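{- Let $\mathbb F_q$ be a finite field with $q$ elements whose characteristic is strictly greater than two. There is a sufficiently large constant $C>0$ such that the following hold, where $X\gtrsim Y$ means $X\ge c'Y$ for a constant $c'>0$ independent of $q$ and of the sets involved. (1) If $d=4$ or $d=6$, and $E_1,E_2,E_3\subset \mathbb F_q^d$ satisfy $\prod_{j=1}^3 |E_j| \ge C q^{3\left(\frac{d+1}{2}-\frac{1}{6d+2}\right)}$, then $|\Delta_3(E_1,E_2,E_3)|\gtrsim q$. (2) If $d\ge 8$ is even and $E_1,E_2,E_3,E_4\subset\mathbb F_q^d$ satisfy $\prod_{j=1}^4 |E_j| \ge C q^{4\left(\frac{d+1}{2}-\frac{1}{6d+2}\right)}$, then $|\Delta_4(E_1,E_2,E_3,E_4)|\gtrsim q$. (3) If $d\ge 8$ is even and $E_1,E_2,E_3\subset\mathbb F_q^d$ satisfy $\prod_{j=1}^3 |E_j| \ge C q^{3\left(\frac{d+1}{2}-\frac{1}{9d-18}\right)}$, then $|\Delta_3(E_1,E_2,E_3)|\gtrsim q$.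
   Context: For $\mathbf y=(\mathbf y_1,\ldots,\mathbf y_d)\in\mathbb F_q^d$, write $\|\mathbf y\|=\mathbf y_1^2+\cdots+\mathbf y_d^2\in\mathbb F_q$. For sets $E_1,\ldots,E_k\subset\mathbb F_q^d$, the generalized $k$-resultant modulus set is $\Delta_k(E_1,\ldots,E_k)=\{\|\mathbf x^1+\cdots+\mathbf x^k\|\in\mathbb F_q:\ \mathbf x^j\in E_j,\ j=1,\ldots,k\}$. -}

module Defs where

open import Data.Nat as ℕ using (ℕ; zero; suc)
open import Data.Fin as Fin using (Fin)
open import Data.List as L using (List; []; _∷_; concatMap; map; allFin)
open import Data.Vec as V using (Vec; []; _∷_)
open import Data.Bool using (Bool; true; false; if_then_else_)
open import Data.Bool.ListAction using (any)
open import Data.Product using (Σ)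
open import Relation.Binary.PropositionalEquality using (_≡_; _≢_; cong; trans; sym)
open import Relation.Nullary using (does)
open import Relation.Nullary.Decidable using (map′)
open import Relation.Binary.Definitions using (DecidableEquality)
open import Algebra.Structures using (IsCommutativeRing)
open import Function.Bundles using (_↔_; Inverse)

record FiniteField (q : ℕ) : Set₁ where
  infixl 6 _+_
  infixl 7 _*_
  field
    Carrier : Set
    _+_ _*_ : Carrier → Carrier → Carrier
    -_      : Carrier → Carrier
    0# 1#   : Carrier
    isCommutativeRing : IsCommutativeRing _≡_ _+_ _*_ -_ 0# 1#
    0≢1     : 0# ≢ 1#
    inverse : (x : Carrier) → x ≢ 0# → Σ Carrier (λ y → x * y ≡ 1#)
    enum    : Carrier ↔ Fin q

  elements : List Carrier
  elements = map (Inverse.from enum) (allFin q)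

  _≟_ : DecidableEquality Carrier
  x ≟ y = map′
    (λ e → trans (sym (Inverse.strictlyInverseʳ enum x))
                 (trans (cong (Inverse.from enum) e) (Inverse.strictlyInverseʳ enum y)))
    (cong (Inverse.to enum))
    (Inverse.to enum x Fin.≟ Inverse.to enum y)

  -- characteristic strictly greater than two (the characteristic is a prime,
  -- so this is the same as: the characteristic is not 2, i.e. 1 + 1 ≠ 0)
  CharGt2 : Set
  CharGt2 = 1# + 1# ≢ 0#

  _+ᵛ_ : ∀ {d} → Vec Carrier d → Vec Carrier d → Vec Carrier d
  _+ᵛ_ = V.zipWith _+_

  0ᵛ : ∀ {d} → Vec Carrier d
  0ᵛ = V.replicate _ 0#

  ‖_‖ : ∀ {d} → Vec Carrier d → Carrier
  ‖ y ‖ = V.foldr _ (λ a s → a * a + s) 0# y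

  allVecs : (d : ℕ) → List (Vec Carrier d)
  allVecs zero    = [] ∷ []
  allVecs (suc d) = concatMap (λ a → map (a ∷_) (allVecs d)) elements

  Subset : ℕ → Set
  Subset d = Vec Carrier d → Bool

  count : {A : Set} → (A → Bool) → List A → ℕ
  count p []       = 0
  count p (x ∷ xs) = if p x then suc (count p xs) else count p xs

  ∣_∣ : ∀ {d} → Subset d → ℕ
  ∣_∣ {d} E = count E (allVecs d)

  members : ∀ {d} → Subset d → List (Vec Carrier d)
  members {d} E = L.filterᵇ E (allVecs d)

  sums : ∀ {d k} → Vec (Subset d) k → List (Vec Carrier d)
  sums []       = 0ᵛ ∷ []
  sums (E ∷ Es) = concatMap (λ x → map (x +ᵛ_) (sums Es)) (members E)

  inΔ : ∀ {d k} → Vec (Subset d) k → Carrier → Bool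
  inΔ Es t = any (λ s → does (‖ s ‖ ≟ t)) (sums Es)

  ∣Δ∣ : ∀ {d k} → Vec (Subset d) k → ℕ
  ∣Δ∣ Es = count (inΔ Es) elements

  ∏∣_∣ : ∀ {d k} → Vec (Subset d) k → ℕ
  ∏∣ Es ∣ = V.foldr _ (λ E p → ∣ E ∣ ℕ.* p) 1 Es

-- The size hypothesis  P ≥ C · q^(k((d+1)/2 − 1/den)), with the rational
-- exponent cleared: (d+1)/2 − 1/den = ((d+1)·den − 2)/(2·den), so it is
-- equivalent (all quantities being ≥ 0) to
--   C^(2·den) · q^(k((d+1)·den − 2)) ≤ P^(2·den).
SizeHyp : (k d den C q P : ℕ) → Set
SizeHyp k d den C q P =
  C ℕ.^ (2 ℕ.* den) ℕ.* q ℕ.^ (k ℕ.* ((suc d) ℕ.* den ℕ.∸ 2)) ℕ.≤ P ℕ.^ (2 ℕ.* den)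

{-# OPTIONS --safe #-}
-- Let N(t) count the triples with ‖x + y + z‖ = t.  For even d the Gauss sum of ‖·‖ does not depend on the
-- character, so up to an additive constant N(t) is, for t ≠ 0, governed only by the frequencies ξ with ‖ξ‖ ≠ 0:
-- its variance is at most a constant times q^{-d} ∑_{a≠0} |∑_{‖ξ‖=a} Ê₁Ê₂Ê₃(ξ)|².  By Cauchy–Schwarz this reduces to the
-- mixed moment M = ∑_{‖ξ‖=a} |Ê₁|²|Ê₂|², and expanding twice gives M⁴ ≤ |E₁|⁷ q^d · (additive energy of |Ê₂|² on the
-- sphere).  A parallelogram inscribed in a sphere is a rectangle, so this energy counts orthogonal pairs; two second
-- moment bounds (one for isotropic sides, on the quadric ‖y‖ = aζ², one for the others) bound it, without Kloosterman
-- sums.  The resulting threshold (d+1)/2 − 1/14 is below all three thresholds claimed.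
--
-- Characters take values in the group ring ℤ[F] instead of ℂ.  An inequality "at every nontrivial character" is an
-- inequality for the order generated by the norms z z̄, and summing over the characters is the functional
-- [c] ↦ ψ(c) = q·1_{c=0} − 1.
module Submission where

open import Defs
open import Level using (0ℓ)
open import Algebra.Bundles using (CommutativeRing)
import Algebra.Properties.Ring as RingProps
import Algebra.Properties.Semiring.Mult.TCOptimised as SMult
import Algebra.Solver.Ring as RingSolver
open import Algebra.Solver.Ring.AlmostCommutativeRing using (fromCommutativeRing; _-Raw-AlmostCommutative⟶_)
open import Data.Bool using (Bool; true; false; if_then_else_; not; _∧_; _∨_)
open import Data.Bool.ListAction using (any)
open import Data.Empty using (⊥-elim)
open import Data.Fin as Fin using (Fin)
import Data.Fin.Properties as FinP
open import Data.Integer as ℤ using (ℤ; +_; -[1+_]; +≤+)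
import Data.Integer.Properties as ℤP
import Data.Integer.Solver as ℤSolver
open import Data.List as L using (List; []; _∷_; _++_; filterᵇ; concatMap)
open import Data.List.Membership.Propositional using (_∈_)
open import Data.List.Membership.Propositional.Properties using (∈-map⁺; ∈-map⁻; ∈-++⁺ˡ; ∈-++⁺ʳ)
import Data.List.Properties as LP
open import Data.List.Relation.Unary.All as All using (All; []; _∷_)
import Data.List.Relation.Unary.All.Properties as AllP
open import Data.List.Relation.Unary.Any using (here; there)
open import Data.Maybe using (Maybe; just; nothing)
open import Data.Nat as ℕ using (ℕ; zero; suc)
open import Data.Nat.Divisibility using (_∣_; divides)
import Data.Nat.Properties as ℕP
open import Data.Nat.Solver using (module +-*-Solver)
open import Data.Product using (_×_; _,_; proj₁; proj₂; ∃; ∃₂)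
open import Data.Sum using (_⊎_; inj₁; inj₂)
open import Data.Vec as V using (Vec; []; _∷_)
import Data.Vec.Properties as VP
open import Function using (_∘_)
open import Function.Bundles using (Inverse)
open import Relation.Binary.Bundles using (Preorder)
open import Relation.Binary.Definitions using (DecidableEquality)
open import Relation.Binary.PropositionalEquality as ≡ using (_≡_; _≢_; refl; cong; cong₂; sym; trans; module ≡-Reasoning)
import Relation.Binary.Reasoning.Setoid as SetoidReasoning
open import Relation.Nullary using (¬_; Dec; does; yes; no)
open import Relation.Nullary.Decidable using (dec-true; dec-false)

-- The weakest place is the second term of `bound`, the square-root error of the incidence estimate:
-- it asks for N₁N₂²N₃⁴ ≥ 6 q^(7d/2 + 3) when N₁ ≤ N₂ ≤ N₃, which is where the exponent (d+1)/2 -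
-- 1/14 comes from. The other size requirements hold already for smaller exponents. The isotropic
-- frequencies add one and the same unknown constant to N(t) for all t ≠ 0. It is eliminated by
-- comparing t with a value t₀ that is not attained. If z nonzero values are missing and D are
-- attained, the comparison yields z M₂ ≤ 8 P², where M₂ is the sum of N(t)² over t ≠ 0 and P is the
-- number of triples, while Cauchy-Schwarz yields P² ≤ 4 D M₂. Hence z ≤ 32 D and q = z + D + 1 ≤ 34
-- D. The value t = 0 is set apart: it takes at most half of the triples. The order on the group
-- ring is partial and offers no roots, so every square or fourth root is replaced by an explicit
-- sum of squares. Dilating a frequency mixes the characters, so the estimate of the dilations is
-- proved only after summing over the characters.

-- Finite sums and polynomial identities in an arbitrary commutative ring.

module RingTools (R : CommutativeRing 0ℓ 0ℓ) where
  open CommutativeRing R hiding (zero) renaming (refl to ≈-refl; sym to ≈-sym; trans to ≈-trans)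
  open SMult semiring using (1+×; ×-homo-+; ×1-homo-*) renaming (_×_ to _×ⁿ_)
  open RingProps ring using (-‿involutive; -‿+-comm; -0#≈0#; -‿distribˡ-*; -‿distribʳ-*)
  open import Relation.Binary.Reasoning.Setoid setoid

  -- The optimised multiple satisfies `1 ×ⁿ x = x` by reduction, so the solver constants `con (+ 1)`
  -- and `con (+ 2)` reduce to `1#` and `1# + 1#`, the form in which 2 occurs in the field.
  ι : ℤ → Carrier
  ι (+ n)      = n ×ⁿ 1#
  ι (-[1+ n ]) = - (suc n ×ⁿ 1#)

  ι-⊖ : ∀ m n → ι (m ℤ.⊖ n) ≈ m ×ⁿ 1# - n ×ⁿ 1#
  ι-⊖ zero    zero    = ≈-sym (-‿inverseʳ 0#)
  ι-⊖ zero    (suc n) = ≈-sym (+-identityˡ _)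
  ι-⊖ (suc m) zero    = ≈-sym (≈-trans (+-congˡ -0#≈0#) (+-identityʳ _))
  ι-⊖ (suc m) (suc n) = begin
    ι (suc m ℤ.⊖ suc n)                     ≡⟨ ≡.cong ι (ℤP.[1+m]⊖[1+n]≡m⊖n m n) ⟩
    ι (m ℤ.⊖ n)                             ≈⟨ ι-⊖ m n ⟩
    a - b                                   ≈⟨ +-congʳ (≈-sym (+-identityˡ a)) ⟩
    0# + a - b                              ≈⟨ +-congʳ (+-congʳ (≈-sym (-‿inverseʳ 1#))) ⟩
    1# - 1# + a - b                         ≈⟨ +-congʳ (+-assoc 1# (- 1#) a) ⟩
    1# + (- 1# + a) - b                     ≈⟨ +-congʳ (+-congˡ (+-comm (- 1#) a)) ⟩
    1# + (a - 1#) - b                       ≈⟨ +-congʳ (≈-sym (+-assoc 1# a (- 1#))) ⟩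
    1# + a - 1# - b                         ≈⟨ +-assoc (1# + a) (- 1#) (- b) ⟩
    1# + a + (- 1# - b)                     ≈⟨ +-congˡ (-‿+-comm 1# b) ⟩
    1# + a - (1# + b)                       ≈⟨ +-cong (≈-sym (1+× m 1#)) (-‿cong (≈-sym (1+× n 1#))) ⟩
    suc m ×ⁿ 1# - suc n ×ⁿ 1#                 ∎
    where
    a = m ×ⁿ 1#
    b = n ×ⁿ 1#

  ι-+ : ∀ m n → ι (m ℤ.+ n) ≈ ι m + ι n
  ι-+ (+ m)      (+ n)      = ×-homo-+ 1# m n
  ι-+ (+ m)      (-[1+ n ]) = ι-⊖ m (suc n)
  ι-+ (-[1+ m ]) (+ n)      = ≈-trans (ι-⊖ n (suc m)) (+-comm _ _)
  ι-+ (-[1+ m ]) (-[1+ n ]) = begin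
    - (suc (suc (m ℕ.+ n)) ×ⁿ 1#)            ≡⟨ ≡.cong (λ k → - (suc k ×ⁿ 1#)) (≡.sym (ℕP.+-suc m n)) ⟩
    - ((suc m ℕ.+ suc n) ×ⁿ 1#)              ≈⟨ -‿cong (×-homo-+ 1# (suc m) (suc n)) ⟩
    - (suc m ×ⁿ 1# + suc n ×ⁿ 1#)             ≈⟨ ≈-sym (-‿+-comm _ _) ⟩
    - (suc m ×ⁿ 1#) - suc n ×ⁿ 1#             ∎

  ι-neg : ∀ m → ι (ℤ.- m) ≈ - ι m
  ι-neg (+ zero)   = ≈-sym -0#≈0#
  ι-neg (+ suc n)  = ≈-refl
  ι-neg (-[1+ n ]) = ≈-sym (-‿involutive _)

  ι-*⁺ : ∀ m n → ι (+ m ℤ.* + n) ≈ ι (+ m) * ι (+ n)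
  ι-*⁺ m n = ≈-trans (reflexive (≡.cong ι (≡.sym (ℤP.pos-* m n)))) (×1-homo-* m n)

  ι-* : ∀ m n → ι (m ℤ.* n) ≈ ι m * ι n
  ι-* (+ m)      (+ n)      = ι-*⁺ m n
  ι-* (+ m)      (-[1+ n ]) = begin
    ι (+ m ℤ.* -[1+ n ])          ≡⟨ ≡.cong ι (≡.sym (ℤP.neg-distribʳ-* (+ m) (+ suc n))) ⟩
    ι (ℤ.- (+ m ℤ.* + suc n))     ≈⟨ ι-neg (+ m ℤ.* + suc n) ⟩
    - ι (+ m ℤ.* + suc n)         ≈⟨ -‿cong (ι-*⁺ m (suc n)) ⟩
    - (ι (+ m) * ι (+ suc n))     ≈⟨ -‿distribʳ-* _ _ ⟩
    ι (+ m) * - ι (+ suc n)       ∎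
  ι-* (-[1+ m ]) (+ n)      = begin
    ι (-[1+ m ] ℤ.* + n)          ≡⟨ ≡.cong ι (≡.sym (ℤP.neg-distribˡ-* (+ suc m) (+ n))) ⟩
    ι (ℤ.- (+ suc m ℤ.* + n))     ≈⟨ ι-neg (+ suc m ℤ.* + n) ⟩
    - ι (+ suc m ℤ.* + n)         ≈⟨ -‿cong (ι-*⁺ (suc m) n) ⟩
    - (ι (+ suc m) * ι (+ n))     ≈⟨ -‿distribˡ-* _ _ ⟩
    (- ι (+ suc m)) * ι (+ n)     ∎
  ι-* (-[1+ m ]) (-[1+ n ]) = begin
    ι (+ suc m ℤ.* + suc n)               ≈⟨ ι-*⁺ (suc m) (suc n) ⟩
    ι (+ suc m) * ι (+ suc n)             ≈⟨ ≈-sym (-‿involutive _) ⟩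
    - - (ι (+ suc m) * ι (+ suc n))       ≈⟨ -‿cong (-‿distribʳ-* _ _) ⟩
    - (ι (+ suc m) * - ι (+ suc n))       ≈⟨ -‿distribˡ-* _ _ ⟩
    (- ι (+ suc m)) * (- ι (+ suc n))     ∎

  ι-1 : ι (+ 1) ≈ 1#
  ι-1 = ≈-refl

  ι-suc : ∀ n → ι (+ suc n) ≈ 1# + ι (+ n)
  ι-suc n = 1+× n 1#

  ι-≟ : ∀ m n → Maybe (ι m ≈ ι n)
  ι-≟ m n with m ℤ.≟ n
  ... | yes e = just (reflexive (≡.cong ι e))
  ... | no _  = nothing

  ι-morphism : CommutativeRing.rawRing ℤP.+-*-commutativeRing -Raw-AlmostCommutative⟶ fromCommutativeRing R
  ι-morphism = record { ⟦_⟧ = ι ; +-homo = ι-+ ; *-homo = ι-* ; -‿homo = ι-neg ; 0-homo = ≈-refl ; 1-homo = ι-1 }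

  module Solver = RingSolver
    (CommutativeRing.rawRing ℤP.+-*-commutativeRing)
    (fromCommutativeRing R)
    ι-morphism
    ι-≟
  open Solver using (solve; _:=_; _:+_; _:*_; _:-_; :-_; con)

  ⟦_⟧ : Bool → Carrier
  ⟦ b ⟧ = if b then 1# else 0#

  ∑ : {A : Set} → List A → (A → Carrier) → Carrier
  ∑ []       f = 0#
  ∑ (x ∷ xs) f = f x + ∑ xs f

  module _ {A : Set} where
    ∑-cong : ∀ (xs : List A) {f g : A → Carrier} → (∀ x → f x ≈ g x) → ∑ xs f ≈ ∑ xs g
    ∑-cong []       e = ≈-refl
    ∑-cong (x ∷ xs) e = +-cong (e x) (∑-cong xs e)

    ∑-0 : ∀ (xs : List A) → ∑ xs (λ _ → 0#) ≈ 0#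
    ∑-0 []       = ≈-refl
    ∑-0 (x ∷ xs) = ≈-trans (+-identityˡ _) (∑-0 xs)

    ∑-+ : ∀ (xs : List A) (f g : A → Carrier) → ∑ xs (λ x → f x + g x) ≈ ∑ xs f + ∑ xs g
    ∑-+ []       f g = ≈-sym (+-identityˡ _)
    ∑-+ (x ∷ xs) f g = ≈-trans (+-congˡ (∑-+ xs f g))
      (solve 4 (λ a b c d → a :+ b :+ (c :+ d) := a :+ c :+ (b :+ d)) ≈-refl _ _ _ _)

    ∑-neg : ∀ (xs : List A) (f : A → Carrier) → ∑ xs (λ x → - f x) ≈ - ∑ xs f
    ∑-neg []       f = ≈-sym -0#≈0#
    ∑-neg (x ∷ xs) f = ≈-trans (+-congˡ (∑-neg xs f)) (-‿+-comm _ _)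

    ∑-- : ∀ (xs : List A) (f g : A → Carrier) → ∑ xs (λ x → f x - g x) ≈ ∑ xs f - ∑ xs g
    ∑-- xs f g = ≈-trans (∑-+ xs f (λ x → - g x)) (+-congˡ (∑-neg xs g))

    ∑-*ˡ : ∀ (xs : List A) (c : Carrier) (f : A → Carrier) → ∑ xs (λ x → c * f x) ≈ c * ∑ xs f
    ∑-*ˡ []       c f = ≈-sym (zeroʳ c)
    ∑-*ˡ (x ∷ xs) c f = ≈-trans (+-congˡ (∑-*ˡ xs c f)) (≈-sym (distribˡ c _ _))

    ∑-*ʳ : ∀ (xs : List A) (f : A → Carrier) (c : Carrier) → ∑ xs (λ x → f x * c) ≈ ∑ xs f * c
    ∑-*ʳ xs f c = ≈-trans (∑-cong xs (λ x → *-comm (f x) c)) (≈-trans (∑-*ˡ xs c f) (*-comm c _))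

    ∑-++ : ∀ (xs ys : List A) (f : A → Carrier) → ∑ (xs ++ ys) f ≈ ∑ xs f + ∑ ys f
    ∑-++ []       ys f = ≈-sym (+-identityˡ _)
    ∑-++ (x ∷ xs) ys f = ≈-trans (+-congˡ (∑-++ xs ys f)) (≈-sym (+-assoc _ _ _))

    ∑-const : ∀ (xs : List A) (c : Carrier) → ∑ xs (λ _ → c) ≈ ι (+ L.length xs) * c
    ∑-const []       c = ≈-sym (zeroˡ c)
    ∑-const (x ∷ xs) c = ≈-trans (+-congˡ (∑-const xs c))
      (≈-trans (+-congʳ (≈-sym (*-identityˡ c))) (≈-trans (≈-sym (distribʳ c _ _)) (*-congʳ (≈-sym (1+× (L.length xs) 1#)))))

    ∑-filter : ∀ (p : A → Bool) (xs : List A) (f : A → Carrier) →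
               ∑ (filterᵇ p xs) f ≈ ∑ xs (λ x → ⟦ p x ⟧ * f x)
    ∑-filter p []       f = ≈-refl
    ∑-filter p (x ∷ xs) f with p x
    ... | true  = +-cong (≈-sym (*-identityˡ _)) (∑-filter p xs f)
    ... | false = ≈-trans (∑-filter p xs f) (≈-sym (≈-trans (+-congʳ (zeroˡ _)) (+-identityˡ _)))

    ∑-cong-filter : ∀ (p : A → Bool) (xs : List A) {f g : A → Carrier} →
                    (∀ x → p x ≡ true → f x ≈ g x) → ∑ (filterᵇ p xs) f ≈ ∑ (filterᵇ p xs) g
    ∑-cong-filter p []       e = ≈-refl
    ∑-cong-filter p (x ∷ xs) e with p x in eq
    ... | true  = +-cong (e x eq) (∑-cong-filter p xs e)
    ... | false = ∑-cong-filter p xs e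

  module _ {A B : Set} where
    ∑-swap : ∀ (xs : List A) (ys : List B) (f : A → B → Carrier) →
             ∑ xs (λ x → ∑ ys (f x)) ≈ ∑ ys (λ y → ∑ xs (λ x → f x y))
    ∑-swap []       ys f = ≈-sym (∑-0 ys)
    ∑-swap (x ∷ xs) ys f = ≈-trans (+-congˡ (∑-swap xs ys f)) (≈-sym (∑-+ ys (f x) _))

    ∑-map : ∀ (g : A → B) (xs : List A) (f : B → Carrier) → ∑ (L.map g xs) f ≈ ∑ xs (λ x → f (g x))
    ∑-map g []       f = ≈-refl
    ∑-map g (x ∷ xs) f = +-congˡ (∑-map g xs f)

    ∑-concatMap : ∀ (g : A → List B) (xs : List A) (f : B → Carrier) →
                  ∑ (concatMap g xs) f ≈ ∑ xs (λ x → ∑ (g x) f)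
    ∑-concatMap g []       f = ≈-refl
    ∑-concatMap g (x ∷ xs) f = ≈-trans (∑-++ (g x) _ f) (+-congˡ (∑-concatMap g xs f))

    ∑-*-∑ : ∀ (xs : List A) (ys : List B) (f : A → Carrier) (g : B → Carrier) →
            ∑ xs f * ∑ ys g ≈ ∑ xs (λ x → ∑ ys (λ y → f x * g y))
    ∑-*-∑ xs ys f g = ≈-trans (≈-sym (∑-*ʳ xs f _)) (∑-cong xs (λ x → ≈-sym (∑-*ˡ ys (f x) g)))

-- Ordered rings with an involution.

-- The model is a ring of complex functions with conjugation, where `NN` means nonnegative at every
-- point. The only division is by positive integers (`NN-cancel`). The two instances are ℤ and the
-- group ring of the field.
record StarOrderedRing : Set₁ where
  field
    commutativeRing : CommutativeRing 0ℓ 0ℓ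
  open CommutativeRing commutativeRing public hiding (zero) renaming (refl to ≈-refl; sym to ≈-sym; trans to ≈-trans)
  open RingTools commutativeRing public
  infix 9 _⋆
  field
    _⋆      : Carrier → Carrier
    ⋆-cong  : ∀ {x y} → x ≈ y → x ⋆ ≈ y ⋆
    ⋆-+     : ∀ x y → (x + y) ⋆ ≈ x ⋆ + y ⋆
    ⋆-*     : ∀ x y → (x * y) ⋆ ≈ x ⋆ * y ⋆
    ⋆-neg   : ∀ x → (- x) ⋆ ≈ - (x ⋆)
    ⋆-0     : 0# ⋆ ≈ 0#
    ⋆-1     : 1# ⋆ ≈ 1#
    ⋆-⋆     : ∀ x → (x ⋆) ⋆ ≈ x
    NN        : Carrier → Set
    NN-resp   : ∀ {x y} → x ≈ y → NN x → NN y
    NN-+      : ∀ {x y} → NN x → NN y → NN (x + y)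
    NN-*      : ∀ {x y} → NN x → NN y → NN (x * y)
    NN-sq     : ∀ x → NN (x * x ⋆)
    NN-cancel : ∀ k {x} → NN (ι (+ suc k) * x) → NN x

ι⁺-id : ∀ n → RingTools.ι ℤP.+-*-commutativeRing (+ n) ≡ + n
ι⁺-id zero    = refl
ι⁺-id (suc n) = ≡.trans (RingTools.ι-suc ℤP.+-*-commutativeRing n) (≡.cong ℤ.suc (ι⁺-id n))

module StarOrdered (𝓡 : StarOrderedRing) where
  open StarOrderedRing 𝓡 public
  open Solver public using (solve; _:=_; _:+_; _:*_; _:-_; :-_; con)

  infix 4 _≤_
  _≤_ : Carrier → Carrier → Set
  x ≤ y = NN (y - x)

  NN-1 : NN 1#
  NN-1 = NN-resp (≈-trans (*-congˡ ⋆-1) (*-identityˡ 1#)) (NN-sq 1#)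

  NN-0 : NN 0#
  NN-0 = NN-resp (≈-trans (*-congˡ ⋆-0) (zeroˡ _)) (NN-sq 0#)

  NN-ι : ∀ n → NN (ι (+ n))
  NN-ι zero    = NN-0
  NN-ι (suc n) = NN-resp (≈-sym (ι-suc n)) (NN-+ NN-1 (NN-ι n))

  NN-⟦⟧ : ∀ b → NN ⟦ b ⟧
  NN-⟦⟧ true  = NN-1
  NN-⟦⟧ false = NN-0

  ι-mono : ∀ {m n} → m ℤ.≤ n → ι m ≤ ι n
  ι-mono {m} {n} m≤n = NN-resp (≈-trans (ι-+ n (ℤ.- m)) (+-congˡ (ι-neg m))) (aux (ℤP.i≤j⇒0≤j-i m≤n))
    where
    aux : ∀ {k} → + 0 ℤ.≤ k → NN (ι k)
    aux {+ k} _ = NN-ι k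

  NN⇒≤ : ∀ {x} → NN x → 0# ≤ x
  NN⇒≤ = NN-resp (solve 1 (λ x → x := x :- con (+ 0)) ≈-refl _)

  ≤-reflexive : ∀ {x y} → x ≈ y → x ≤ y
  ≤-reflexive {x} {y} e = NN-resp (≈-trans (≈-sym (-‿inverseʳ y)) (+-congˡ (-‿cong (≈-sym e)))) NN-0

  ≤-refl : ∀ {x} → x ≤ x
  ≤-refl = ≤-reflexive ≈-refl

  ≤-trans : ∀ {x y z} → x ≤ y → y ≤ z → x ≤ z
  ≤-trans {x} {y} {z} p r = NN-resp (solve 3 (λ x y z → y :- x :+ (z :- y) := z :- x) ≈-refl x y z) (NN-+ p r)

  ≤-resp : ∀ {x y x' y'} → x ≈ x' → y ≈ y' → x ≤ y → x' ≤ y'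
  ≤-resp e e' = NN-resp (+-cong e' (-‿cong e))

  +-mono : ∀ {x y x' y'} → x ≤ y → x' ≤ y' → x + x' ≤ y + y'
  +-mono {x} {y} {x'} {y'} p r =
    NN-resp (solve 4 (λ x y x' y' → y :- x :+ (y' :- x') := y :+ y' :- (x :+ x')) ≈-refl x y x' y') (NN-+ p r)

  *-monoˡ : ∀ {c x y} → NN c → x ≤ y → c * x ≤ c * y
  *-monoˡ {c} {x} {y} p r = NN-resp (solve 3 (λ c x y → c :* (y :- x) := c :* y :- c :* x) ≈-refl c x y) (NN-* p r)

  *-monoʳ : ∀ {c x y} → NN c → x ≤ y → x * c ≤ y * c
  *-monoʳ p r = ≤-resp (*-comm _ _) (*-comm _ _) (*-monoˡ p r)

  *-mono : ∀ {x y x' y'} → NN x → NN y' → x ≤ y → x' ≤ y' → x * x' ≤ y * y'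
  *-mono p r l m = ≤-trans (*-monoˡ p m) (*-monoʳ r l)

  ≤-cancel : ∀ k {x y} → ι (+ suc k) * x ≤ ι (+ suc k) * y → x ≤ y
  ≤-cancel k {x} {y} p =
    NN-cancel k (NN-resp (solve 3 (λ c x y → c :* y :- c :* x := c :* (y :- x)) ≈-refl (ι (+ suc k)) x y) p)

  NN-sq-self : ∀ {x} → x ⋆ ≈ x → NN (x * x)
  NN-sq-self {x} e = NN-resp (*-congˡ e) (NN-sq x)

  ⋆-ι : ∀ n → ι n ⋆ ≈ ι n
  ⋆-ι (+ n)      = aux n
    where
    aux : ∀ n → ι (+ n) ⋆ ≈ ι (+ n)
    aux zero    = ⋆-0
    aux (suc n) = ≈-trans (⋆-cong (ι-suc n)) (≈-trans (⋆-+ _ _) (≈-trans (+-cong ⋆-1 (aux n)) (≈-sym (ι-suc n))))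
  ⋆-ι (-[1+ n ]) = ≈-trans (⋆-neg _) (-‿cong (⋆-ι (+ suc n)))

  ⋆-norm : ∀ x → (x * x ⋆) ⋆ ≈ x * x ⋆
  ⋆-norm x = ≈-trans (⋆-* x (x ⋆)) (≈-trans (*-congˡ (⋆-⋆ x)) (*-comm _ _))

  ≤-preorder : Preorder 0ℓ 0ℓ 0ℓ
  ≤-preorder = record { isPreorder = record { isEquivalence = isEquivalence ; reflexive = ≤-reflexive ; trans = ≤-trans } }

  ≤-cancel-nat : ∀ m .{{_ : ℕ.NonZero m}} {x y} → ι (+ m) * x ≤ ι (+ m) * y → x ≤ y
  ≤-cancel-nat (suc k) = ≤-cancel k

  module _ {A : Set} where
    NN-∑ : ∀ (xs : List A) {f : A → Carrier} → (∀ x → NN (f x)) → NN (∑ xs f)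
    NN-∑ []       p = NN-0
    NN-∑ (x ∷ xs) p = NN-+ (p x) (NN-∑ xs p)

    ∑-mono : ∀ (xs : List A) {f g : A → Carrier} → (∀ x → f x ≤ g x) → ∑ xs f ≤ ∑ xs g
    ∑-mono []       p = ≤-refl
    ∑-mono (x ∷ xs) p = +-mono (p x) (∑-mono xs p)

    ∑-mono-filter : ∀ (p : A → Bool) (xs : List A) {f g : A → Carrier} →
                    (∀ x → p x ≡ true → f x ≤ g x) → ∑ (filterᵇ p xs) f ≤ ∑ (filterᵇ p xs) g
    ∑-mono-filter p []       e = ≤-refl
    ∑-mono-filter p (x ∷ xs) e with p x in eq
    ... | true  = +-mono (e x eq) (∑-mono-filter p xs e)
    ... | false = ∑-mono-filter p xs e

    ∑-filter-≤ : ∀ (p : A → Bool) (xs : List A) {f : A → Carrier} → (∀ x → NN (f x)) → ∑ (filterᵇ p xs) f ≤ ∑ xs f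
    ∑-filter-≤ p []       e = ≤-refl
    ∑-filter-≤ p (x ∷ xs) e with p x
    ... | true  = +-mono ≤-refl (∑-filter-≤ p xs e)
    ... | false = ≤-resp (+-identityˡ _) ≈-refl (+-mono (NN⇒≤ (e x)) (∑-filter-≤ p xs e))

    ∑-⋆ : ∀ (xs : List A) (f : A → Carrier) → (∑ xs f) ⋆ ≈ ∑ xs (λ x → f x ⋆)
    ∑-⋆ []       f = ⋆-0
    ∑-⋆ (x ∷ xs) f = ≈-trans (⋆-+ _ _) (+-congˡ (∑-⋆ xs f))

    -- Lagrange's identity: the norms of `a i * b j ⋆ - a j * b i ⋆`, summed over all i and j, give
    -- twice the difference of the two sides.
    cauchy-schwarz : ∀ (xs : List A) (a b : A → Carrier) →
      ∑ xs (λ i → a i * b i) * (∑ xs (λ i → a i * b i)) ⋆ ≤ ∑ xs (λ i → a i * a i ⋆) * ∑ xs (λ i → b i * b i ⋆)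
    cauchy-schwarz xs a b = ≤-cancel 1 (NN-resp eq (NN-∑ xs (λ i → NN-∑ xs (λ j → NN-sq (z i j)))))
      where
      open SetoidReasoning setoid
      z : A → A → Carrier
      z i j = a i * b j ⋆ - a j * b i ⋆
      α β γ γ' : A → Carrier
      α i = a i * a i ⋆
      β i = b i * b i ⋆
      γ i = a i * b i
      γ' i = a i ⋆ * b i ⋆
      z⋆ : ∀ i j → z i j ⋆ ≈ a i ⋆ * b j - a j ⋆ * b i
      z⋆ i j = begin
        z i j ⋆                              ≈⟨ ⋆-+ _ _ ⟩
        (a i * b j ⋆) ⋆ + (- (a j * b i ⋆)) ⋆ ≈⟨ +-cong (⋆-* _ _) (≈-trans (⋆-neg _) (-‿cong (⋆-* _ _))) ⟩
        a i ⋆ * b j ⋆ ⋆ - a j ⋆ * b i ⋆ ⋆     ≈⟨ +-cong (*-congˡ (⋆-⋆ _)) (-‿cong (*-congˡ (⋆-⋆ _))) ⟩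
        a i ⋆ * b j - a j ⋆ * b i            ∎
      expand : ∀ i j → z i j * z i j ⋆ ≈ (α i * β j + β i * α j) - (γ i * γ' j + γ' i * γ j)
      expand i j = ≈-trans (*-congˡ (z⋆ i j))
        (solve 8 (λ x x' y y' u u' v v' →
            (x :* v' :- u :* y') :* (x' :* v :- u' :* y)
            := (x :* x' :* (v :* v') :+ y :* y' :* (u :* u')) :- (x :* y :* (u' :* v') :+ x' :* y' :* (u :* v)))
          ≈-refl (a i) (a i ⋆) (b i) (b i ⋆) (a j) (a j ⋆) (b j) (b j ⋆))
      eq : ∑ xs (λ i → ∑ xs (λ j → z i j * z i j ⋆))
           ≈ ι (+ 2) * (∑ xs α * ∑ xs β) - ι (+ 2) * (∑ xs γ * (∑ xs γ) ⋆)
      eq = begin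
        ∑ xs (λ i → ∑ xs (λ j → z i j * z i j ⋆))
          ≈⟨ ∑-cong xs (λ i → ≈-trans (∑-cong xs (expand i)) (≈-trans (∑-- xs _ _) (+-cong (∑-+ xs _ _) (-‿cong (∑-+ xs _ _))))) ⟩
        ∑ xs (λ i → (∑ xs (λ j → α i * β j) + ∑ xs (λ j → β i * α j)) - (∑ xs (λ j → γ i * γ' j) + ∑ xs (λ j → γ' i * γ j)))
          ≈⟨ ≈-trans (∑-- xs _ _) (+-cong (∑-+ xs _ _) (-‿cong (∑-+ xs _ _))) ⟩
        _ ≈⟨ +-cong (+-cong (≈-sym (∑-*-∑ xs xs α β)) (≈-sym (∑-*-∑ xs xs β α)))
                    (-‿cong (+-cong (≈-sym (∑-*-∑ xs xs γ γ')) (≈-sym (∑-*-∑ xs xs γ' γ)))) ⟩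
        (∑ xs α * ∑ xs β + ∑ xs β * ∑ xs α) - (∑ xs γ * ∑ xs γ' + ∑ xs γ' * ∑ xs γ)
          ≈⟨ solve 4 (λ A B C D → (A :* B :+ B :* A) :- (C :* D :+ D :* C)
                        := con (+ 2) :* (A :* B) :- con (+ 2) :* (C :* D)) ≈-refl (∑ xs α) (∑ xs β) (∑ xs γ) (∑ xs γ') ⟩
        ι (+ 2) * (∑ xs α * ∑ xs β) - ι (+ 2) * (∑ xs γ * ∑ xs γ')
          ≈⟨ +-congˡ (-‿cong (*-congˡ (*-congˡ (≈-sym (≈-trans (∑-⋆ xs γ) (∑-cong xs (λ i → ⋆-* _ _))))))) ⟩
        ι (+ 2) * (∑ xs α * ∑ xs β) - ι (+ 2) * (∑ xs γ * (∑ xs γ) ⋆) ∎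

  nat : ℕ → Carrier
  nat n = ι (+ n)

  nat-* : ∀ m n → nat (m ℕ.* n) ≈ nat m * nat n
  nat-* m n = ≈-trans (reflexive (≡.cong ι (ℤP.pos-* m n))) (ι-* (+ m) (+ n))

  nat-+ : ∀ m n → nat (m ℕ.+ n) ≈ nat m + nat n
  nat-+ m n = ι-+ (+ m) (+ n)

  nat-mono : ∀ {m n} → m ℕ.≤ n → nat m ≤ nat n
  nat-mono p = ι-mono (+≤+ p)

  -- M⁴ − 4c³M + 3c⁴ = (M − c)² (M² + 2cM + 3c²).
  fourth-root-≤ : ∀ k {M} → NN M → M ⋆ ≈ M →
    M * M * (M * M) ≤ nat (suc k ℕ.* suc k ℕ.* (suc k ℕ.* suc k)) → M ≤ nat (suc k)
  fourth-root-≤ k {M} p e h =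
    ≤-cancel 3 (≤-cancel k (≤-cancel k (≤-cancel k (NN-resp eq (NN-+ h (NN-* (NN-sq-self sa) pos))))))
    where
    c = nat (suc k)
    sa : (M - c) ⋆ ≈ M - c
    sa = ≈-trans (⋆-+ _ _) (+-cong e (≈-trans (⋆-neg _) (-‿cong (⋆-ι (+ suc k)))))
    pos : NN (M * M + ι (+ 2) * (c * M) + ι (+ 3) * (c * c))
    pos = NN-+ (NN-+ (NN-* p p) (NN-* (NN-ι 2) (NN-* (NN-ι (suc k)) p))) (NN-* (NN-ι 3) (NN-* (NN-ι (suc k)) (NN-ι (suc k))))
    eq : (nat (suc k ℕ.* suc k ℕ.* (suc k ℕ.* suc k)) - M * M * (M * M))
         + (M - c) * (M - c) * (M * M + ι (+ 2) * (c * M) + ι (+ 3) * (c * c))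
         ≈ c * (c * (c * (ι (+ 4) * c))) - c * (c * (c * (ι (+ 4) * M)))
    eq = ≈-trans (+-congʳ (+-congʳ (≈-trans (nat-* (suc k ℕ.* suc k) (suc k ℕ.* suc k)) (*-cong (nat-* (suc k) (suc k)) (nat-* (suc k) (suc k))))))
      (solve 2 (λ c M → (c :* c :* (c :* c) :- M :* M :* (M :* M))
                :+ (M :- c) :* (M :- c) :* (M :* M :+ con (+ 2) :* (c :* M) :+ con (+ 3) :* (c :* c))
                := c :* (c :* (c :* (con (+ 4) :* c))) :- c :* (c :* (c :* (con (+ 4) :* M)))) ≈-refl c M)

module ℤT = RingTools ℤP.+-*-commutativeRing

module ι-Sums (𝓡 : StarOrderedRing) where
  open StarOrdered 𝓡
  module _ {A : Set} where
    ι-∑ : ∀ (xs : List A) (f : A → ℤ) → ι (ℤT.∑ xs f) ≈ ∑ xs (λ x → ι (f x))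
    ι-∑ []       f = ≈-refl
    ι-∑ (x ∷ xs) f = ≈-trans (ι-+ (f x) (ℤT.∑ xs f)) (+-congˡ (ι-∑ xs f))

    ∑-filter-∧ : ∀ (p r : A → Bool) (xs : List A) (f : A → Carrier) →
                 ∑ (filterᵇ (λ x → p x ∧ r x) xs) f ≈ ∑ (filterᵇ p xs) (λ x → ⟦ r x ⟧ * f x)
    ∑-filter-∧ p r xs f =
      ≈-trans (∑-filter (λ x → p x ∧ r x) xs f)
      (≈-trans (∑-cong xs (λ x → ⟦∧⟧ (p x) (r x) (f x))) (≈-sym (∑-filter p xs (λ x → ⟦ r x ⟧ * f x))))
      where
      ⟦∧⟧ : ∀ b c y → ⟦ b ∧ c ⟧ * y ≈ ⟦ b ⟧ * (⟦ c ⟧ * y)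
      ⟦∧⟧ true  c y = ≈-sym (*-identityˡ _)
      ⟦∧⟧ false c y = ≈-trans (zeroˡ y) (≈-sym (zeroˡ _))

  module _ {A Z : Set} where
    -- A sum of squares of linear forms in `v` is the quadratic form of a Gram matrix. The kernel is
    -- integral, so its Gram matrix can be evaluated in ℤ whatever ring the weights `v` live in.
    ∑-gram : ∀ (zs : List Z) (xs : List A) (k : Z → A → ℤ) (v : A → Carrier) →
      ∑ zs (λ z → ∑ xs (λ i → v i * ι (k z i)) * ∑ xs (λ j → v j * ι (k z j)))
      ≈ ∑ xs (λ i → ∑ xs (λ j → v i * v j * ι (ℤT.∑ zs (λ z → k z i ℤ.* k z j))))
    ∑-gram zs xs k v = begin
      ∑ zs (λ z → ∑ xs (λ i → v i * ι (k z i)) * ∑ xs (λ j → v j * ι (k z j)))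
        ≈⟨ ∑-cong zs (λ z → ∑-*-∑ xs xs _ _) ⟩
      ∑ zs (λ z → ∑ xs (λ i → ∑ xs (λ j → v i * ι (k z i) * (v j * ι (k z j)))))
        ≈⟨ ≈-trans (∑-swap zs xs _) (∑-cong xs (λ i → ∑-swap zs xs _)) ⟩
      ∑ xs (λ i → ∑ xs (λ j → ∑ zs (λ z → v i * ι (k z i) * (v j * ι (k z j)))))
        ≈⟨ ∑-cong xs (λ i → ∑-cong xs (λ j → ≈-trans (∑-cong zs (λ z → ≈-trans
             (solve 4 (λ a b c d → a :* b :* (c :* d) := a :* c :* (b :* d)) ≈-refl (v i) (ι (k z i)) (v j) (ι (k z j)))
             (*-congˡ (≈-sym (ι-* (k z i) (k z j)))))) (≈-trans (∑-*ˡ zs _ _) (*-congˡ (≈-sym (ι-∑ zs (λ z → k z i ℤ.* k z j))))))) ⟩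
      ∑ xs (λ i → ∑ xs (λ j → v i * v j * ι (ℤT.∑ zs (λ z → k z i ℤ.* k z j)))) ∎
      where open SetoidReasoning setoid

ℤ-starOrderedRing : StarOrderedRing
ℤ-starOrderedRing = record
  { commutativeRing = ℤP.+-*-commutativeRing
  ; _⋆ = λ x → x
  ; ⋆-cong = λ e → e
  ; ⋆-+ = λ _ _ → refl
  ; ⋆-* = λ _ _ → refl
  ; ⋆-neg = λ _ → refl
  ; ⋆-0 = refl
  ; ⋆-1 = refl
  ; ⋆-⋆ = λ _ → refl
  ; NN = λ x → + 0 ℤ.≤ x
  ; NN-resp = λ { refl p → p }
  ; NN-+ = ℤP.+-mono-≤
  ; NN-* = λ { {+ m} {+ n} _ _ → ≡.subst (+ 0 ℤ.≤_) (ℤP.pos-* m n) (+≤+ ℕ.z≤n) }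
  ; NN-sq = λ x → ≡.subst (+ 0 ℤ.≤_) (≡.sym (sq x)) (+≤+ ℕ.z≤n)
  ; NN-cancel = λ k {x} p → ℤP.*-cancelˡ-≤-pos (+ 0) x (+ suc k) (≡.subst₂ ℤ._≤_ (≡.sym (ℤP.*-zeroʳ (+ suc k))) (≡.cong (ℤ._* x) (ι⁺-id (suc k))) p)
  }
  where
  sq : ∀ x → x ℤ.* x ≡ + (ℤ.∣ x ∣ ℕ.* ℤ.∣ x ∣)
  sq (+ n)    = ≡.sym (ℤP.pos-* n n)
  sq -[1+ n ] = refl

-- Complete enumerations and reindexing of sums.

does⇒ : {P : Set} (p? : Dec P) → does p? ≡ true → P
does⇒ (yes p) _ = p

not-does⇒¬ : {P : Set} (p? : Dec P) → not (does p?) ≡ true → ¬ P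
not-does⇒¬ (no ¬p) _ = ¬p

does-cong : {P Q : Set} (p? : Dec P) (q? : Dec Q) → (P → Q) → (Q → P) → does p? ≡ does q?
does-cong (yes p) q? f g = ≡.sym (dec-true q? (f p))
does-cong (no ¬p) q? f g = ≡.sym (dec-false q? (λ x → ¬p (g x)))

-- Every element occurs exactly once, expressed through sums with values in any commutative ring, so
-- that one proof serves ℤ and the group ring alike.
Enumerates : {A : Set} → List A → Set₁
Enumerates {A} xs = (R : CommutativeRing 0ℓ 0ℓ) → let open CommutativeRing R; open RingTools R in
  (w : A → Carrier) (y : A) → (∀ x → x ≢ y → w x ≈ 0#) → ∑ xs w ≈ w y

enumerates-tabulate : ∀ {n} {A : Set} (f : Fin n → A) (R : CommutativeRing 0ℓ 0ℓ) →
  let open CommutativeRing R; open RingTools R in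
  (w : A → Carrier) (j : Fin n) → (∀ i → i ≢ j → w (f i) ≈ 0#) → ∑ (L.tabulate f) w ≈ w (f j)
enumerates-tabulate {suc n} {A} f R w Fin.zero h =
  ≈-trans (+-congˡ (vanish (f ∘ Fin.suc) (λ i → h (Fin.suc i) λ ()))) (+-identityʳ _)
  where
  open CommutativeRing R renaming (trans to ≈-trans; refl to ≈-refl)
  open RingTools R
  vanish : ∀ {m} (g : Fin m → A) → (∀ i → w (g i) ≈ 0#) → ∑ (L.tabulate g) w ≈ 0#
  vanish {zero}  g k = ≈-refl
  vanish {suc m} g k = ≈-trans (+-cong (k Fin.zero) (vanish (g ∘ Fin.suc) (k ∘ Fin.suc))) (+-identityʳ _)
enumerates-tabulate {suc n} f R w (Fin.suc j) h =
  ≈-trans (+-cong (h Fin.zero λ ()) (enumerates-tabulate (f ∘ Fin.suc) R w j (λ i i≢j → h (Fin.suc i) λ { refl → i≢j refl })))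
          (+-identityˡ _)
  where
  open CommutativeRing R using (+-cong; +-identityˡ) renaming (trans to ≈-trans)

module Reindex {A : Set} (xs : List A) (enum : Enumerates xs) (_≟_ : DecidableEquality A) (R : CommutativeRing 0ℓ 0ℓ) where
  open CommutativeRing R renaming (trans to ≈-trans; sym to ≈-sym; refl to ≈-refl)
  open RingTools R

  ⟦yes⟧ : {P : Set} (p? : Dec P) → P → ∀ c → ⟦ does p? ⟧ * c ≈ c
  ⟦yes⟧ p? p c rewrite dec-true p? p = *-identityˡ c

  ⟦no⟧ : {P : Set} (p? : Dec P) → ¬ P → ∀ c → ⟦ does p? ⟧ * c ≈ 0#
  ⟦no⟧ p? ¬p c rewrite dec-false p? ¬p = zeroˡ c

  select : ∀ (w : A → Carrier) y → ∑ xs (λ x → ⟦ does (x ≟ y) ⟧ * w x) ≈ w y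
  select w y = ≈-trans (enum R _ y (λ x x≢y → ⟦no⟧ (x ≟ y) x≢y _)) (⟦yes⟧ (y ≟ y) refl _)

  reindex : (φ φ⁻¹ : A → A) → (∀ x → φ⁻¹ (φ x) ≡ x) → (∀ y → φ (φ⁻¹ y) ≡ y) →
            (w : A → Carrier) → ∑ xs (λ x → w (φ x)) ≈ ∑ xs w
  reindex φ φ⁻¹ l r w =
    ≈-trans (∑-cong xs (λ x → ≈-sym (select w (φ x))))
    (≈-trans (∑-swap xs xs _)
    (∑-cong xs (λ y → ≈-trans (enum R _ (φ⁻¹ y) (λ x x≢ → ⟦no⟧ (y ≟ φ x) (λ e → x≢ (≡.trans (≡.sym (l x)) (≡.cong φ⁻¹ (≡.sym e)))) _))
                              (⟦yes⟧ (y ≟ φ (φ⁻¹ y)) (≡.sym (r y)) _))))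

module ℤO = StarOrdered ℤ-starOrderedRing

module ℤS = ℤSolver.+-*-Solver

∑-constℤ : {A : Set} (xs : List A) (k : ℤ) → ℤO.∑ xs (λ _ → k) ≡ + L.length xs ℤ.* k
∑-constℤ xs k = trans (ℤO.∑-const xs k) (cong (ℤ._* k) (ι⁺-id (L.length xs)))

-- The field and the sum ψ of its nontrivial characters.

module Field {q : ℕ} (F : FiniteField q) (2≢0 : FiniteField.CharGt2 F) where
  open FiniteField F public
  Fring : CommutativeRing 0ℓ 0ℓ
  Fring = record { isCommutativeRing = isCommutativeRing }
  open CommutativeRing Fring public using (+-assoc; +-comm; +-identityˡ; +-identityʳ; -‿inverseˡ; -‿inverseʳ; *-assoc; *-comm; *-identityˡ; *-identityʳ; zeroˡ; zeroʳ; distribˡ; distribʳ; _-_)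
  module FT = RingTools Fring
  module FS = FT.Solver
  open FS public using (solve; _:=_; _:+_; _:*_; _:-_; :-_; con)

  Vect : ℕ → Set
  Vect = Vec Carrier

  _≟ᵛ_ : ∀ {d} → DecidableEquality (Vect d)
  _≟ᵛ_ = VP.≡-dec _≟_

  enumerates-elements : Enumerates elements
  enumerates-elements R w y h =
    ≈-trans (∑-map from (L.allFin q) w)
    (≈-trans (enumerates-tabulate (λ i → i) R (w ∘ from) (to y)
               (λ i i≢ → h (from i) (λ e → i≢ (≡.trans (≡.sym (strictlyInverseˡ i)) (≡.cong to e)))))
             (reflexive (≡.cong w (strictlyInverseʳ y))))
    where
    open Inverse enum
    open CommutativeRing R renaming (trans to ≈-trans) using (reflexive)
    open RingTools R

  enumerates-allVecs : ∀ d → Enumerates (allVecs d)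
  enumerates-allVecs zero R w [] h = CommutativeRing.+-identityʳ R _
  enumerates-allVecs (suc d) R w (b ∷ y) h =
    ≈-trans (∑-concatMap _ elements w)
    (≈-trans (∑-cong elements (λ a → ∑-map (a ∷_) (allVecs d) w))
    (≈-trans (enumerates-elements R _ b (λ a a≢b → ≈-trans (∑-cong (allVecs d) (λ x → h (a ∷ x) (λ e → a≢b (VP.∷-injectiveˡ e)))) (∑-0 (allVecs d))))
             (enumerates-allVecs d R (λ x → w (b ∷ x)) y (λ x x≢y → h (b ∷ x) (λ e → x≢y (VP.∷-injectiveʳ e))))))
    where
    open CommutativeRing R renaming (trans to ≈-trans) using ()
    open RingTools R

  module RF = Reindex elements enumerates-elements _≟_
  module RV (d : ℕ) = Reindex (allVecs d) (enumerates-allVecs d) _≟ᵛ_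

  length-elements : L.length elements ≡ q
  length-elements = ≡.trans (LP.length-map _ (L.allFin q)) (LP.length-tabulate {n = q} (λ i → i))

  _/_ : Carrier → Carrier → Carrier
  a / b with b ≟ 0#
  ... | yes _   = 0#
  ... | no b≢0 = a * proj₁ (inverse b b≢0)

  *-/ : ∀ a {b} → b ≢ 0# → b * (a / b) ≡ a
  *-/ a {b} b≢0 with b ≟ 0#
  ... | yes b≡0 = ⊥-elim (b≢0 b≡0)
  ... | no b≢0′ = ≡.trans (solve 3 (λ b a i → b :* (a :* i) := a :* (b :* i)) refl b a _)
                          (≡.trans (≡.cong (a *_) (proj₂ (inverse b b≢0′))) (*-identityʳ a))

  *-cancelˡ : ∀ {b x y} → b ≢ 0# → b * x ≡ b * y → x ≡ y
  *-cancelˡ {b} {x} {y} b≢0 e with inverse b b≢0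
  ... | (i , bi) = ≡.trans (≡.sym (lem x)) (≡.trans (≡.cong (i *_) e) (lem y))
    where
    lem : ∀ z → i * (b * z) ≡ z
    lem z = ≡.trans (solve 3 (λ i b z → i :* (b :* z) := b :* i :* z) refl i b z)
                    (≡.trans (≡.cong (_* z) bi) (*-identityˡ z))

  *-≢0 : ∀ {a b} → a ≢ 0# → b ≢ 0# → a * b ≢ 0#
  *-≢0 {a} {b} a≢0 b≢0 e = b≢0 (*-cancelˡ a≢0 (≡.trans e (≡.sym (zeroʳ a))))

  -≢0 : ∀ {a} → a ≢ 0# → - a ≢ 0#
  -≢0 {a} a≢0 e = a≢0 (≡.trans (solve 1 (λ a → a := :- (:- a)) refl a) (≡.trans (≡.cong -_ e) (solve 0 (:- con (+ 0) := con (+ 0)) refl)))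

  -≡0⇒≡ : ∀ {a b} → a - b ≡ 0# → a ≡ b
  -≡0⇒≡ {a} {b} e = ≡.trans (solve 2 (λ a b → a := a :- b :+ b) refl a b) (≡.trans (≡.cong (_+ b) e) (+-identityˡ b))

  nz : Carrier → Bool
  nz c = not (does (c ≟ 0#))

  units : List Carrier
  units = filterᵇ nz elements

  nz⇒≢0 : ∀ {c} → nz c ≡ true → c ≢ 0#
  nz⇒≢0 {c} = not-does⇒¬ (c ≟ 0#)

  module UnitSums (R : CommutativeRing 0ℓ 0ℓ) where
    open CommutativeRing R using (_≈_) renaming (Carrier to C; trans to ≈-trans; sym to ≈-sym; refl to ≈-refl; _+_ to _⊕_; _*_ to _⊗_; -_ to ⊖_; 1# to 𝟙; 0# to 𝟘; +-cong to ⊕-cong; +-congˡ to ⊕-congˡ; *-identityˡ to ⊗-identityˡ)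
    open RingTools R
    module S = Solver
    ∑-units : ∀ (w : Carrier → C) → ∑ units w ≈ ∑ elements w ⊕ (⊖ w 0#)
    ∑-units w =
      ≈-trans (∑-filter nz elements w)
      (≈-trans (∑-cong elements (λ c → complement (does (c ≟ 0#)) (w c)))
      (≈-trans (∑-- elements w _) (⊕-congˡ (CommutativeRing.-‿cong R (RF.select R w 0#)))))
      where
      complement : ∀ b x → ⟦ not b ⟧ ⊗ x ≈ x ⊕ (⊖ (⟦ b ⟧ ⊗ x))
      complement true  x = S.solve 1 (λ x → S.con (+ 0) S.:* x S.:= x S.:- S.con (+ 1) S.:* x) ≈-refl x
      complement false x = S.solve 1 (λ x → S.con (+ 1) S.:* x S.:= x S.:- S.con (+ 0) S.:* x) ≈-refl x

  open ≡-Reasoning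
  open ℤT using (∑; ⟦_⟧; ∑-cong; ∑-swap; ∑-*ˡ; ∑-*ʳ; ∑-+; ∑--; ∑-neg; ∑-0; ∑-map; ∑-concatMap; ∑-++; ∑-filter; ∑-cong-filter; ∑-*-∑)

  module Rℤ = RF ℤP.+-*-commutativeRing
  module Uℤ = UnitSums ℤP.+-*-commutativeRing

  ψ : Carrier → ℤ
  ψ c = + q ℤ.* ⟦ does (c ≟ 0#) ⟧ ℤ.- + 1

  ψ-0 : ψ 0# ≡ + q ℤ.- + 1
  ψ-0 = trans (cong (λ b → + q ℤ.* ⟦ b ⟧ ℤ.- + 1) (dec-true (0# ≟ 0#) refl)) (cong (ℤ._- + 1) (ℤP.*-identityʳ (+ q)))

  ψ-≢0 : ∀ {c} → c ≢ 0# → ψ c ≡ ℤ.- + 1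
  ψ-≢0 {c} h = trans (cong (λ b → + q ℤ.* ⟦ b ⟧ ℤ.- + 1) (dec-false (c ≟ 0#) h)) (cong (ℤ._- + 1) (ℤP.*-zeroʳ (+ q)))

  ψ-iff : ∀ {b c} → (b ≡ 0# → c ≡ 0#) → (c ≡ 0# → b ≡ 0#) → ψ b ≡ ψ c
  ψ-iff {b} {c} f g = cong (λ z → + q ℤ.* ⟦ z ⟧ ℤ.- + 1) (does-cong (b ≟ 0#) (c ≟ 0#) f g)

  -0≡0 : - 0# ≡ 0#
  -0≡0 = solve 0 (:- con (+ 0) := con (+ 0)) refl

  ψ-neg : ∀ c → ψ (- c) ≡ ψ c
  ψ-neg c = ψ-iff (λ e → trans (solve 1 (λ c → c := :- (:- c)) refl c) (trans (cong -_ e) -0≡0))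
                  (λ e → trans (cong -_ e) -0≡0)

  -- `ψ` sees only whether its argument vanishes. This scale invariance is what later spreads a
  -- second moment on a sphere over all dilates of the sphere.
  ψ-*ˡ : ∀ {r} c → r ≢ 0# → ψ (r * c) ≡ ψ c
  ψ-*ˡ {r} c r≢0 = ψ-iff (λ e → *-cancelˡ r≢0 (trans e (sym (zeroʳ r)))) (λ e → trans (cong (r *_) e) (zeroʳ r))

  ∑-elements-const : ∀ k → ∑ elements (λ _ → k) ≡ + q ℤ.* k
  ∑-elements-const k = trans (∑-constℤ elements k) (cong (λ n → + n ℤ.* k) length-elements)

  ∑-units-const : ∀ k → ∑ units (λ _ → k) ≡ (+ q ℤ.- + 1) ℤ.* k
  ∑-units-const k = trans (Uℤ.∑-units (λ _ → k)) (trans (cong (ℤ._- k) (∑-elements-const k))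
    (ℤS.solve 2 (λ q k → q ℤS.:* k ℤS.:- k ℤS.:= (q ℤS.:- ℤS.con (+ 1)) ℤS.:* k) refl (+ q) k))

  ∑ψ : ∑ elements ψ ≡ + 0
  ∑ψ = begin
    ∑ elements ψ                                                  ≡⟨ ∑-- elements (λ c → + q ℤ.* ⟦ does (c ≟ 0#) ⟧) (λ _ → + 1) ⟩
    ∑ elements (λ c → + q ℤ.* ⟦ does (c ≟ 0#) ⟧) ℤ.- ∑ elements (λ _ → + 1)
      ≡⟨ cong₂ ℤ._-_ (trans (∑-*ˡ elements (+ q) (λ c → ⟦ does (c ≟ 0#) ⟧)) (cong (+ q ℤ.*_) sel)) (∑-elements-const (+ 1)) ⟩
    + q ℤ.* + 1 ℤ.- + q ℤ.* + 1                                   ≡⟨ ℤP.+-inverseʳ (+ q ℤ.* + 1) ⟩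
    + 0                                                           ∎
    where
    sel : ∑ elements (λ c → ⟦ does (c ≟ 0#) ⟧) ≡ + 1
    sel = trans (∑-cong elements (λ c → sym (ℤP.*-identityʳ _))) (Rℤ.select (λ _ → + 1) 0#)

  ∑ψ-affine : ∀ {x} t → x ≢ 0# → ∑ elements (λ c → ψ (x * c + t)) ≡ + 0
  ∑ψ-affine {x} t x≢0 = trans (Rℤ.reindex (λ c → x * c + t) (λ c → (c - t) / x) l r ψ) ∑ψ
    where
    l : ∀ c → (x * c + t - t) / x ≡ c
    l c = *-cancelˡ x≢0 (trans (*-/ _ x≢0) (solve 2 (λ y t → y :+ t :- t := y) refl (x * c) t))
    r : ∀ c → x * ((c - t) / x) + t ≡ c
    r c = trans (cong (_+ t) (*-/ _ x≢0)) (solve 2 (λ y t → y :- t :+ t := y) refl c t)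

  ∑ψ-shift : ∀ t → ∑ elements (λ c → ψ (c + t)) ≡ + 0
  ∑ψ-shift t = trans (∑-cong elements (λ c → cong (λ z → ψ (z + t)) (sym (*-identityˡ c)))) (∑ψ-affine t (0≢1 ∘ sym))

  -- Relative to a nontrivial character χ, every nontrivial character is c ↦ χ(l c) for exactly one
  -- unit l. The product of the two character sums is therefore the sum of χ(c + l c′) over χ and l.
  ψ*ψ : ∀ c c' → ψ c ℤ.* ψ c' ≡ ∑ units (λ l → ψ (c + l * c'))
  ψ*ψ c c' with c' ≟ 0#
  ... | yes e = begin
    ψ c ℤ.* ψ c'                  ≡⟨ cong (ψ c ℤ.*_) (trans (cong ψ e) ψ-0) ⟩
    ψ c ℤ.* (+ q ℤ.- + 1)         ≡⟨ ℤP.*-comm (ψ c) _ ⟩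
    (+ q ℤ.- + 1) ℤ.* ψ c         ≡⟨ ∑-units-const (ψ c) ⟨
    ∑ units (λ _ → ψ c)           ≡⟨ ∑-cong units (λ l → cong ψ (trans (solve 2 (λ c l → c := c :+ l :* con (+ 0)) refl c l) (cong (λ z → c + l * z) (sym e)))) ⟩
    ∑ units (λ l → ψ (c + l * c')) ∎
  ... | no c'≢0 = begin
    ψ c ℤ.* ψ c'                  ≡⟨ cong (ψ c ℤ.*_) (ψ-≢0 c'≢0) ⟩
    ψ c ℤ.* (ℤ.- + 1)             ≡⟨ ℤS.solve 1 (λ x → x ℤS.:* (ℤS.:- ℤS.con (+ 1)) ℤS.:= ℤS.con (+ 0) ℤS.:- x) refl (ψ c) ⟩
    + 0 ℤ.- ψ c                   ≡⟨ cong₂ ℤ._-_ (trans (sym (∑ψ-affine c c'≢0)) (∑-cong elements (λ l → cong ψ (solve 3 (λ c l c' → c' :* l :+ c := c :+ l :* c') refl c l c'))))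
                                                 (cong ψ (solve 2 (λ c c' → c := c :+ con (+ 0) :* c') refl c c')) ⟩
    ∑ elements (λ l → ψ (c + l * c')) ℤ.- ψ (c + 0# * c') ≡⟨ Uℤ.∑-units (λ l → ψ (c + l * c')) ⟨
    ∑ units (λ l → ψ (c + l * c')) ∎

  -- Orthogonality of characters: summing over t keeps a pair χ, χ′ only if χ′ is the inverse of χ,
  -- which leaves q χ(c - c′).
  ∑ψ*ψ : ∀ c c' → ∑ elements (λ t → ψ (c + t) ℤ.* ψ (c' + t)) ≡ + q ℤ.* ψ (c - c')
  ∑ψ*ψ c c' = begin
    ∑ elements (λ t → ψ (c + t) ℤ.* ψ (c' + t))
      ≡⟨ ∑-cong elements (λ t → ℤS.solve 3 (λ q d y → (q ℤS.:* d ℤS.:- ℤS.con (+ 1)) ℤS.:* y ℤS.:= q ℤS.:* (d ℤS.:* y) ℤS.:- y) refl (+ q) ⟦ does ((c + t) ≟ 0#) ⟧ (ψ (c' + t))) ⟩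
    ∑ elements (λ t → + q ℤ.* (⟦ does ((c + t) ≟ 0#) ⟧ ℤ.* ψ (c' + t)) ℤ.- ψ (c' + t))
      ≡⟨ ∑-- elements (λ t → + q ℤ.* (⟦ does ((c + t) ≟ 0#) ⟧ ℤ.* ψ (c' + t))) (λ t → ψ (c' + t)) ⟩
    ∑ elements (λ t → + q ℤ.* (⟦ does ((c + t) ≟ 0#) ⟧ ℤ.* ψ (c' + t))) ℤ.- ∑ elements (λ t → ψ (c' + t))
      ≡⟨ cong₂ ℤ._-_ (trans (∑-*ˡ elements (+ q) (λ t → ⟦ does ((c + t) ≟ 0#) ⟧ ℤ.* ψ (c' + t))) (cong (+ q ℤ.*_) sel)) (trans (∑-cong elements (λ t → cong ψ (+-comm c' t))) (∑ψ-shift c')) ⟩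
    + q ℤ.* ψ (c' + - c) ℤ.- + 0
      ≡⟨ ℤP.+-identityʳ _ ⟩
    + q ℤ.* ψ (c' + - c)
      ≡⟨ cong (+ q ℤ.*_) (trans (sym (ψ-neg _)) (cong ψ (solve 2 (λ c c' → :- (c' :- c) := c :- c') refl c c'))) ⟩
    + q ℤ.* ψ (c - c') ∎
    where
    sel : ∑ elements (λ t → ⟦ does ((c + t) ≟ 0#) ⟧ ℤ.* ψ (c' + t)) ≡ ψ (c' + - c)
    sel = trans (∑-cong elements (λ t → cong (λ b → ⟦ b ⟧ ℤ.* ψ (c' + t))
            (does-cong ((c + t) ≟ 0#) (t ≟ (- c))
              (λ e → trans (solve 2 (λ c t → t := c :+ t :- c) refl c t) (trans (cong (_- c) e) (+-identityˡ (- c))))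
              (λ e → trans (cong (λ z → c + z) e) (-‿inverseʳ c)))))
          (Rℤ.select (λ t → ψ (c' + t)) (- c))

  -- The dot product, the norm, and sums over vectors.

  infix 8 _∙_
  _∙_ : ∀ {d} → Vect d → Vect d → Carrier
  [] ∙ []             = 0#
  (a ∷ x) ∙ (b ∷ y)   = a * b + x ∙ y

  infixr 9 _·_
  _·_ : ∀ {d} → Carrier → Vect d → Vect d
  r · x = V.map (r *_) x

  infixl 6 _-ᵛ_
  _-ᵛ_ : ∀ {d} → Vect d → Vect d → Vect d
  _-ᵛ_ = V.zipWith _-_

  ‖‖≡∙ : ∀ {d} (x : Vect d) → ‖ x ‖ ≡ x ∙ x
  ‖‖≡∙ []      = refl
  ‖‖≡∙ (a ∷ x) = cong (λ z → a * a + z) (‖‖≡∙ x)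

  ∙-comm : ∀ {d} (x y : Vect d) → x ∙ y ≡ y ∙ x
  ∙-comm []      []      = refl
  ∙-comm (a ∷ x) (b ∷ y) = cong₂ _+_ (*-comm a b) (∙-comm x y)

  ∙-+ˡ : ∀ {d} (x y z : Vect d) → (x +ᵛ y) ∙ z ≡ x ∙ z + y ∙ z
  ∙-+ˡ []      []      []      = sym (+-identityˡ 0#)
  ∙-+ˡ (a ∷ x) (b ∷ y) (c ∷ z) = trans (cong (λ z → (a + b) * c + z) (∙-+ˡ x y z))
    (solve 5 (λ a b c u v → (a :+ b) :* c :+ (u :+ v) := a :* c :+ u :+ (b :* c :+ v)) refl a b c (x ∙ z) (y ∙ z))

  ∙--ˡ : ∀ {d} (x y z : Vect d) → (x -ᵛ y) ∙ z ≡ x ∙ z - y ∙ z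
  ∙--ˡ []      []      []      = sym (-‿inverseʳ 0#)
  ∙--ˡ (a ∷ x) (b ∷ y) (c ∷ z) = trans (cong (λ z → (a - b) * c + z) (∙--ˡ x y z))
    (solve 5 (λ a b c u v → (a :- b) :* c :+ (u :- v) := a :* c :+ u :- (b :* c :+ v)) refl a b c (x ∙ z) (y ∙ z))

  ∙-·ˡ : ∀ {d} r (x y : Vect d) → (r · x) ∙ y ≡ r * x ∙ y
  ∙-·ˡ r []      []      = sym (zeroʳ r)
  ∙-·ˡ r (a ∷ x) (b ∷ y) = trans (cong (λ z → r * a * b + z) (∙-·ˡ r x y))
    (solve 4 (λ r a b u → r :* a :* b :+ r :* u := r :* (a :* b :+ u)) refl r a b (x ∙ y))

  ∙-+ʳ : ∀ {d} (z x y : Vect d) → z ∙ (x +ᵛ y) ≡ z ∙ x + z ∙ y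
  ∙-+ʳ z x y = trans (∙-comm z _) (trans (∙-+ˡ x y z) (cong₂ _+_ (∙-comm x z) (∙-comm y z)))

  ∙--ʳ : ∀ {d} (z x y : Vect d) → z ∙ (x -ᵛ y) ≡ z ∙ x - z ∙ y
  ∙--ʳ z x y = trans (∙-comm z _) (trans (∙--ˡ x y z) (cong₂ _-_ (∙-comm x z) (∙-comm y z)))

  ∙-·ʳ : ∀ {d} r (x y : Vect d) → x ∙ (r · y) ≡ r * x ∙ y
  ∙-·ʳ r x y = trans (∙-comm x _) (trans (∙-·ˡ r y x) (cong (r *_) (∙-comm y x)))

  ∙-0ʳ : ∀ {d} (x : Vect d) → x ∙ 0ᵛ ≡ 0#
  ∙-0ʳ []      = refl
  ∙-0ʳ (a ∷ x) = trans (cong₂ _+_ (zeroʳ a) (∙-0ʳ x)) (+-identityˡ 0#)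

  ‖-‖ : ∀ {d} (x y : Vect d) → ‖ x -ᵛ y ‖ ≡ ‖ x ‖ - (1# + 1#) * x ∙ y + ‖ y ‖
  ‖-‖ []      []      = solve 0 (con (+ 0) := con (+ 0) :- con (+ 2) :* con (+ 0) :+ con (+ 0)) refl
  ‖-‖ (a ∷ x) (b ∷ y) = trans (cong (λ z → (a - b) * (a - b) + z) (‖-‖ x y))
    (solve 5 (λ a b u v w → (a :- b) :* (a :- b) :+ (u :- con (+ 2) :* v :+ w)
               := a :* a :+ u :- con (+ 2) :* (a :* b :+ v) :+ (b :* b :+ w)) refl a b (‖ x ‖) (x ∙ y) (‖ y ‖))

  ‖·‖ : ∀ {d} r (x : Vect d) → ‖ r · x ‖ ≡ r * r * ‖ x ‖
  ‖·‖ r x = trans (‖‖≡∙ (r · x)) (trans (∙-·ˡ r x (r · x)) (trans (cong (r *_) (∙-·ʳ r x x)) (trans (sym (*-assoc r r _)) (cong (r * r *_) (sym (‖‖≡∙ x))))))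

  +ᵛ-ᵛ : ∀ {d} (x w : Vect d) → x +ᵛ w -ᵛ w ≡ x
  +ᵛ-ᵛ []      []      = refl
  +ᵛ-ᵛ (a ∷ x) (b ∷ w) = cong₂ _∷_ (solve 2 (λ a b → a :+ b :- b := a) refl a b) (+ᵛ-ᵛ x w)

  -ᵛ+ᵛ : ∀ {d} (x w : Vect d) → (x -ᵛ w) +ᵛ w ≡ x
  -ᵛ+ᵛ []      []      = refl
  -ᵛ+ᵛ (a ∷ x) (b ∷ w) = cong₂ _∷_ (solve 2 (λ a b → a :- b :+ b := a) refl a b) (-ᵛ+ᵛ x w)

  ·-inverse : ∀ {d} {r s} (x : Vect d) → r * s ≡ 1# → r · s · x ≡ x
  ·-inverse           []      e = refl
  ·-inverse {r = r} {s} (a ∷ x) e =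
    cong₂ _∷_ (trans (sym (*-assoc r s a)) (trans (cong (_* a) e) (*-identityˡ a))) (·-inverse x e)

  -ᵛ≡0⇒≡ : ∀ {d} (x y : Vect d) → x -ᵛ y ≡ 0ᵛ → x ≡ y
  -ᵛ≡0⇒≡ []      []      e = refl
  -ᵛ≡0⇒≡ (a ∷ x) (b ∷ y) e = cong₂ _∷_ (-≡0⇒≡ (VP.∷-injectiveˡ e)) (-ᵛ≡0⇒≡ x y (VP.∷-injectiveʳ e))

  x-ᵛx≡0 : ∀ {d} (x : Vect d) → x -ᵛ x ≡ 0ᵛ
  x-ᵛx≡0 []      = refl
  x-ᵛx≡0 (a ∷ x) = cong₂ _∷_ (-‿inverseʳ a) (x-ᵛx≡0 x)

  module VecSums (R : CommutativeRing 0ℓ 0ℓ) where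
    open CommutativeRing R using (_≈_) renaming (Carrier to C; trans to ≈-trans)
    module RT = RingTools R

    ∑-translate : ∀ {d} (w : Vect d) (f : Vect d → C) → RT.∑ (allVecs d) (λ y → f (y +ᵛ w)) ≈ RT.∑ (allVecs d) f
    ∑-translate {d} w f = RV.reindex d R (_+ᵛ w) (_-ᵛ w) (λ x → +ᵛ-ᵛ x w) (λ x → -ᵛ+ᵛ x w) f

    ∑-scale : ∀ {d} {r} → r ≢ 0# → (f : Vect d → C) → RT.∑ (allVecs d) (λ y → f (r · y)) ≈ RT.∑ (allVecs d) f
    ∑-scale {d} {r} r≢0 f = RV.reindex d R (r ·_) ((1# / r) ·_)
      (λ x → ·-inverse x (trans (*-comm _ r) (*-/ 1# r≢0))) (λ x → ·-inverse x (*-/ 1# r≢0)) f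

    ∑-allVecs-suc : ∀ {d} (f : Vect (suc d) → C) → RT.∑ (allVecs (suc d)) f ≈ RT.∑ elements (λ a → RT.∑ (allVecs d) (λ x → f (a ∷ x)))
    ∑-allVecs-suc {d} f = ≈-trans (RT.∑-concatMap _ elements f) (RT.∑-cong elements (λ a → RT.∑-map (a ∷_) (allVecs d) f))

  module VZ = VecSums ℤP.+-*-commutativeRing

  ∑-allVecs-const : ∀ d k → ∑ (allVecs d) (λ _ → k) ≡ + (q ℕ.^ d) ℤ.* k
  ∑-allVecs-const zero    k = trans (ℤP.+-identityʳ k) (sym (ℤP.*-identityˡ k))
  ∑-allVecs-const (suc d) k = begin
    ∑ (allVecs (suc d)) (λ _ → k)                        ≡⟨ VZ.∑-allVecs-suc (λ _ → k) ⟩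
    ∑ elements (λ _ → ∑ (allVecs d) (λ _ → k))           ≡⟨ ∑-cong elements (λ _ → ∑-allVecs-const d k) ⟩
    ∑ elements (λ _ → + (q ℕ.^ d) ℤ.* k)                 ≡⟨ ∑-elements-const _ ⟩
    + q ℤ.* (+ (q ℕ.^ d) ℤ.* k)                          ≡⟨ ℤP.*-assoc (+ q) (+ (q ℕ.^ d)) k ⟨
    + q ℤ.* + (q ℕ.^ d) ℤ.* k                            ≡⟨ cong (ℤ._* k) (ℤP.pos-* q (q ℕ.^ d)) ⟨
    + (q ℕ.^ suc d) ℤ.* k                                ∎

  ∑ψ-∙≢0 : ∀ {d} (w : Vect d) t → w ≢ 0ᵛ → ∑ (allVecs d) (λ y → ψ (y ∙ w + t)) ≡ + 0
  ∑ψ-∙≢0 [] t w≢0 = ⊥-elim (w≢0 refl)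
  ∑ψ-∙≢0 {suc d} (b ∷ w) t w≢0 with w ≟ᵛ 0ᵛ
  ... | no w'≢0 = trans (VZ.∑-allVecs-suc (λ y → ψ (y ∙ (b ∷ w) + t))) (trans (∑-cong elements (λ a →
          trans (∑-cong (allVecs d) (λ y → cong ψ (solve 3 (λ u v t → u :+ v :+ t := v :+ (u :+ t)) refl (a * b) (y ∙ w) t)))
                (∑ψ-∙≢0 w (a * b + t) w'≢0))) (∑-0 elements))
  ... | yes w≡0 = trans (VZ.∑-allVecs-suc (λ y → ψ (y ∙ (b ∷ w) + t))) (trans (∑-swap elements (allVecs d) (λ a y → ψ ((a ∷ y) ∙ (b ∷ w) + t)))
          (trans (∑-cong (allVecs d) (λ y →
            trans (∑-cong elements (λ a → cong ψ (solve 4 (λ a b v t → a :* b :+ v :+ t := b :* a :+ (v :+ t)) refl a b (y ∙ w) t)))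
                  (∑ψ-affine (y ∙ w + t) (λ b≡0 → w≢0 (cong₂ _∷_ b≡0 w≡0))))) (∑-0 (allVecs d))))

  ∑ψ-∙ : ∀ {d} (w : Vect d) t → ∑ (allVecs d) (λ y → ψ (y ∙ w + t)) ≡ + (q ℕ.^ d) ℤ.* (⟦ does (w ≟ᵛ 0ᵛ) ⟧ ℤ.* ψ t)
  ∑ψ-∙ {d} w t = aux (w ≟ᵛ 0ᵛ)
    where
    aux : (p : Dec (w ≡ 0ᵛ)) → ∑ (allVecs d) (λ y → ψ (y ∙ w + t)) ≡ + (q ℕ.^ d) ℤ.* (⟦ does p ⟧ ℤ.* ψ t)
    aux (yes e) = trans (∑-cong (allVecs d) (λ y → cong ψ (trans (cong (λ z → y ∙ z + t) e) (trans (cong (_+ t) (∙-0ʳ y)) (+-identityˡ t)))))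
                  (trans (∑-allVecs-const d (ψ t)) (cong (+ (q ℕ.^ d) ℤ.*_) (sym (ℤP.*-identityˡ (ψ t)))))
    aux (no w≢0) = trans (∑ψ-∙≢0 w t w≢0) (sym (trans (cong (+ (q ℕ.^ d) ℤ.*_) (ℤP.*-zeroˡ (ψ t))) (ℤP.*-zeroʳ (+ (q ℕ.^ d)))))

  -- Quadratic Gauss sums in even dimension.

  -- The form b² - a² is a hyperbolic plane: after b = c + a the argument is affine in a with slope
  -- 2c, so only c = 0 contributes.
  ∑ψ-square : ∀ t → ∑ elements (λ a → ∑ elements (λ b → ψ (t - a * a + b * b))) ≡ + q ℤ.* ψ t
  ∑ψ-square t = begin
    ∑ elements (λ a → ∑ elements (λ b → ψ (t - a * a + b * b)))
      ≡⟨ ∑-cong elements (λ a → sym (Rℤ.reindex (λ b → b + a) (λ b → b - a)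
           (λ b → solve 2 (λ a b → b :+ a :- a := b) refl a b) (λ b → solve 2 (λ a b → b :- a :+ a := b) refl a b)
           (λ b → ψ (t - a * a + b * b)))) ⟩
    ∑ elements (λ a → ∑ elements (λ c → ψ (t - a * a + (c + a) * (c + a))))
      ≡⟨ ∑-swap elements elements (λ a c → ψ (t - a * a + (c + a) * (c + a))) ⟩
    ∑ elements (λ c → ∑ elements (λ a → ψ (t - a * a + (c + a) * (c + a))))
      ≡⟨ enumerates-elements ℤP.+-*-commutativeRing (λ c → ∑ elements (λ a → ψ (t - a * a + (c + a) * (c + a)))) 0#
           (λ c c≢0 → trans (∑-cong elements (λ a → cong ψ (solve 3 (λ t a c → t :- a :* a :+ (c :+ a) :* (c :+ a) := con (+ 2) :* c :* a :+ (t :+ c :* c)) refl t a c)))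
                            (∑ψ-affine (t + c * c) (*-≢0 2≢0 c≢0))) ⟩
    ∑ elements (λ a → ψ (t - a * a + (0# + a) * (0# + a)))
      ≡⟨ ∑-cong elements (λ a → cong ψ (solve 2 (λ t a → t :- a :* a :+ (con (+ 0) :+ a) :* (con (+ 0) :+ a) := t) refl t a)) ⟩
    ∑ elements (λ a → ψ t) ≡⟨ ∑-elements-const (ψ t) ⟩
    + q ℤ.* ψ t ∎

  r₁ : Carrier → ℤ
  r₁ t = ∑ elements (λ b → ⟦ does ((b * b) ≟ t) ⟧)

  ∑-monoℤ : {A : Set} (xs : List A) {f g : A → ℤ} → (∀ x → f x ℤ.≤ g x) → ∑ xs f ℤ.≤ ∑ xs g
  ∑-monoℤ []       h = ℤP.≤-refl
  ∑-monoℤ (x ∷ xs) h = ℤP.+-mono-≤ (h x) (∑-monoℤ xs h)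

  ∑-select-1 : ∀ y → ∑ elements (λ b → ⟦ does (b ≟ y) ⟧) ≡ + 1
  ∑-select-1 y = trans (∑-cong elements (λ b → sym (ℤP.*-identityʳ ⟦ does (b ≟ y) ⟧))) (Rℤ.select (λ _ → + 1) y)

  search : {P : Carrier → Set} → (∀ x → Dec (P x)) → Dec (∃ P)
  search {P} P? with FinP.any? (λ i → P? (Inverse.from enum i))
  ... | yes (i , p) = yes (Inverse.from enum i , p)
  ... | no ¬p       = no (λ { (x , p) → ¬p (Inverse.to enum x , ≡.subst P (sym (Inverse.strictlyInverseʳ enum x)) p) })

  term-≤-∑ : (f : Carrier → ℤ) → (∀ x → + 0 ℤ.≤ f x) → ∀ y → f y ℤ.≤ ∑ elements f
  term-≤-∑ f f≥0 y = ≡.subst (ℤ._≤ ∑ elements f) (Rℤ.select f y) (∑-monoℤ elements (λ x → aux (does (x ≟ y)) (f≥0 x)))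
    where
    aux : ∀ b {k} → + 0 ℤ.≤ k → ⟦ b ⟧ ℤ.* k ℤ.≤ k
    aux true  {k} h = ℤP.≤-reflexive (ℤP.*-identityˡ k)
    aux false {k} h = ≡.subst (ℤ._≤ k) (sym (ℤP.*-zeroˡ k)) h

  square-roots : ∀ {b x} → b * b ≡ x * x → b ≡ x ⊎ b ≡ - x
  square-roots {b} {x} e with (b - x) ≟ 0#
  ... | yes e' = inj₁ (-≡0⇒≡ e')
  ... | no b≢x = inj₂ (-≡0⇒≡ (*-cancelˡ b≢x (begin
    (b - x) * (b - (- x))   ≡⟨ solve 2 (λ b x → (b :- x) :* (b :- (:- x)) := b :* b :- x :* x) refl b x ⟩
    b * b - x * x           ≡⟨ cong (_- (x * x)) e ⟩
    x * x - x * x           ≡⟨ solve 2 (λ b x → x :* x :- x :* x := (b :- x) :* con (+ 0)) refl b x ⟩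
    (b - x) * 0#            ∎)))

  r₁≡0 : ∀ t → (∀ x → x * x ≢ t) → r₁ t ≡ + 0
  r₁≡0 t h = trans (∑-cong elements (λ b → cong ⟦_⟧ (dec-false ((b * b) ≟ t) (h b)))) (∑-0 elements)

  r₁≤2 : ∀ t → r₁ t ℤ.≤ + 2
  r₁≤2 t with search (λ x → (x * x) ≟ t)
  ... | no ¬∃        = ℤP.≤-trans (ℤP.≤-reflexive (r₁≡0 t (λ x e → ¬∃ (x , e)))) (+≤+ ℕ.z≤n)
  ... | yes (x , e)  = ℤP.≤-trans (∑-monoℤ elements bound)
        (ℤP.≤-reflexive (trans (∑-+ elements (λ b → ⟦ does (b ≟ x) ⟧) (λ b → ⟦ does (b ≟ (- x)) ⟧)) (cong₂ ℤ._+_ (∑-select-1 x) (∑-select-1 (- x)))))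
    where
    nonneg : ∀ b → + 0 ℤ.≤ ⟦ b ⟧
    nonneg true  = +≤+ ℕ.z≤n
    nonneg false = +≤+ ℕ.z≤n
    bound : ∀ b → ⟦ does ((b * b) ≟ t) ⟧ ℤ.≤ ⟦ does (b ≟ x) ⟧ ℤ.+ ⟦ does (b ≟ (- x)) ⟧
    bound b with (b * b) ≟ t in eq
    ... | no ¬p = ≡.subst₂ ℤ._≤_ (cong ⟦_⟧ (sym (dec-false ((b * b) ≟ t) ¬p))) refl (ℤP.+-mono-≤ (nonneg (does (b ≟ x))) (nonneg (does (b ≟ (- x)))))
    ... | yes p with square-roots (trans p (sym e))
    ...   | inj₁ b≡x = ≡.subst₂ ℤ._≤_ (cong ⟦_⟧ (sym (dec-true ((b * b) ≟ t) p))) (cong (λ z → ⟦ z ⟧ ℤ.+ ⟦ does (b ≟ (- x)) ⟧) (sym (dec-true (b ≟ x) b≡x))) (ℤP.+-mono-≤ (ℤP.≤-refl {+ 1}) (nonneg (does (b ≟ (- x)))))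
    ...   | inj₂ b≡-x = ≡.subst₂ ℤ._≤_ (cong ⟦_⟧ (sym (dec-true ((b * b) ≟ t) p))) (cong (λ z → ⟦ does (b ≟ x) ⟧ ℤ.+ ⟦ z ⟧) (sym (dec-true (b ≟ (- x)) b≡-x))) (ℤP.+-mono-≤ (nonneg (does (b ≟ x))) (ℤP.≤-refl {+ 1}))

  r₁-0 : r₁ 0# ≡ + 1
  r₁-0 = trans (∑-cong elements (λ b → cong ⟦_⟧ (does-cong ((b * b) ≟ 0#) (b ≟ 0#)
           (λ e → square-zero b e) (λ e → trans (cong (_* b) e) (zeroˡ b))))) (∑-select-1 0#)
    where
    square-zero : ∀ b → b * b ≡ 0# → b ≡ 0#
    square-zero b e with b ≟ 0#
    ... | yes p = p
    ... | no b≢0 = ⊥-elim (*-≢0 b≢0 b≢0 e)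

  module _ (nonsquare : ∀ x → x * x ≢ - 1#) where
    r₁-pair-≤ : ∀ t → r₁ t ℤ.+ r₁ (- t) ℤ.≤ + 2
    r₁-pair-≤ t with t ≟ 0#
    ... | yes e = ℤP.≤-reflexive (cong₂ ℤ._+_ (trans (cong r₁ e) r₁-0) (trans (cong r₁ (trans (cong -_ e) -0≡0)) r₁-0))
    ... | no t≢0 with search (λ x → (x * x) ≟ t)
    ...   | no ¬∃ = ≡.subst (ℤ._≤ + 2) (trans (sym (ℤP.+-identityˡ (r₁ (- t)))) (cong (ℤ._+ r₁ (- t)) (sym (r₁≡0 t (λ x e → ¬∃ (x , e)))))) (r₁≤2 (- t))
    ...   | yes (x , e) = ≡.subst (ℤ._≤ + 2) (trans (sym (ℤP.+-identityʳ (r₁ t))) (cong (λ z → r₁ t ℤ.+ z) (sym (r₁≡0 (- t) other)))) (r₁≤2 t)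
      where
      x≢0 : x ≢ 0#
      x≢0 x≡0 = t≢0 (trans (sym e) (trans (cong (_* x) x≡0) (zeroˡ x)))
      other : ∀ b → b * b ≢ - t
      other b e' = nonsquare (b / x) (*-cancelˡ x≢0 (*-cancelˡ x≢0 (begin
        x * (x * (b / x * (b / x)))     ≡⟨ solve 2 (λ x c → x :* (x :* (c :* c)) := x :* c :* (x :* c)) refl x (b / x) ⟩
        x * (b / x) * (x * (b / x))     ≡⟨ cong₂ _*_ (*-/ b x≢0) (*-/ b x≢0) ⟩
        b * b                           ≡⟨ trans e' (cong -_ (sym e)) ⟩
        - (x * x)                       ≡⟨ solve 1 (λ x → :- (x :* x) := x :* (x :* (:- con (+ 1)))) refl x ⟩
        x * (x * (- 1#))                ∎)))

    -- No count of the squares is made. The deficits `2 - (r₁ u + r₁ (- u))` are nonnegative because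
    -- u and -u are not both nonzero squares, and they sum to 0 because `r₁` sums to q. So each of
    -- them is 0.
    r₁-pair : ∀ t → r₁ t ℤ.+ r₁ (- t) ≡ + 2
    r₁-pair t = ℤP.≤-antisym (r₁-pair-≤ t) (ℤP.i-j≤0⇒i≤j (≡.subst (+ 2 ℤ.- (r₁ t ℤ.+ r₁ (- t)) ℤ.≤_) total
                  (term-≤-∑ (λ u → + 2 ℤ.- (r₁ u ℤ.+ r₁ (- u))) (λ u → ℤP.i≤j⇒0≤j-i (r₁-pair-≤ u)) t)))
      where
      ∑r₁ : ∑ elements r₁ ≡ + q ℤ.* + 1
      ∑r₁ = trans (∑-swap elements elements (λ t b → ⟦ does ((b * b) ≟ t) ⟧))
        (trans (∑-cong elements (λ b → trans (∑-cong elements (λ t → cong ⟦_⟧ (does-cong ((b * b) ≟ t) (t ≟ (b * b)) sym sym))) (∑-select-1 (b * b))))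
               (∑-elements-const (+ 1)))
      total : ∑ elements (λ u → + 2 ℤ.- (r₁ u ℤ.+ r₁ (- u))) ≡ + 0
      total = begin
        ∑ elements (λ u → + 2 ℤ.- (r₁ u ℤ.+ r₁ (- u)))                   ≡⟨ ∑-- elements (λ _ → + 2) (λ u → r₁ u ℤ.+ r₁ (- u)) ⟩
        ∑ elements (λ u → + 2) ℤ.- ∑ elements (λ u → r₁ u ℤ.+ r₁ (- u))
          ≡⟨ cong₂ ℤ._-_ (∑-elements-const (+ 2)) (trans (∑-+ elements r₁ (λ u → r₁ (- u)))
               (cong₂ ℤ._+_ ∑r₁ (trans (Rℤ.reindex -_ -_ neg-neg neg-neg r₁) ∑r₁))) ⟩
        + q ℤ.* + 2 ℤ.- (+ q ℤ.* + 1 ℤ.+ + q ℤ.* + 1)                      ≡⟨ ℤS.solve 1 (λ q → q ℤS.:* ℤS.con (+ 2) ℤS.:- (q ℤS.:* ℤS.con (+ 1) ℤS.:+ q ℤS.:* ℤS.con (+ 1)) ℤS.:= ℤS.con (+ 0)) refl (+ q) ⟩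
        + 0                                                              ∎
        where
        neg-neg : ∀ x → - (- x) ≡ x
        neg-neg x = solve 1 (λ x → :- (:- x) := x) refl x

    -- The parameter `s` stands for a sign. The equivalence is passed as an argument so that both
    -- signs are covered by one computation.
    ∑ψ-r₁ : ∀ t s → (∀ b → (t + s * (b * b) ≡ 0# → b * b ≡ - (s * t)) × (b * b ≡ - (s * t) → t + s * (b * b) ≡ 0#)) →
            ∑ elements (λ b → ψ (t + s * (b * b))) ≡ + q ℤ.* r₁ (- (s * t)) ℤ.- + q ℤ.* + 1
    ∑ψ-r₁ t s iff = begin
      ∑ elements (λ b → ψ (t + s * (b * b)))
        ≡⟨ ∑-cong elements (λ b → cong (λ z → + q ℤ.* ⟦ z ⟧ ℤ.- + 1) (does-cong ((t + s * (b * b)) ≟ 0#) ((b * b) ≟ (- (s * t))) (proj₁ (iff b)) (proj₂ (iff b)))) ⟩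
      ∑ elements (λ b → + q ℤ.* ⟦ does ((b * b) ≟ (- (s * t))) ⟧ ℤ.- + 1)
        ≡⟨ ∑-- elements (λ b → + q ℤ.* ⟦ does ((b * b) ≟ (- (s * t))) ⟧) (λ _ → + 1) ⟩
      ∑ elements (λ b → + q ℤ.* ⟦ does ((b * b) ≟ (- (s * t))) ⟧) ℤ.- ∑ elements (λ _ → + 1)
        ≡⟨ cong₂ ℤ._-_ (∑-*ˡ elements (+ q) (λ b → ⟦ does ((b * b) ≟ (- (s * t))) ⟧)) (∑-elements-const (+ 1)) ⟩
      + q ℤ.* r₁ (- (s * t)) ℤ.- + q ℤ.* + 1 ∎

    -- The quadratic character is -1 at -1 here, so passing from b² to -b² changes the sign of the
    -- one-variable Gauss sum. In terms of root counts this is `r₁ t = 2 - r₁ (- t)`.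
    ∑ψ-pair : ∀ t → ∑ elements (λ b → ψ (t - b * b)) ≡ ℤ.- ∑ elements (λ b → ψ (t + b * b))
    ∑ψ-pair t = begin
      ∑ elements (λ b → ψ (t - b * b))
        ≡⟨ ∑-cong elements (λ b → cong ψ (solve 2 (λ t b → t :- b :* b := t :+ (:- con (+ 1)) :* (b :* b)) refl t b)) ⟩
      ∑ elements (λ b → ψ (t + (- 1#) * (b * b)))
        ≡⟨ ∑ψ-r₁ t (- 1#) (λ b → (λ e → trans (solve 2 (λ t c → c := :- ((:- con (+ 1)) :* t) :- (t :+ (:- con (+ 1)) :* c)) refl t (b * b)) (trans (cong (λ z → - ((- 1#) * t) - z) e) (solve 1 (λ t → t :- con (+ 0) := t) refl _)))
                               , (λ e → trans (cong (λ z → t + (- 1#) * z) e) (solve 1 (λ t → t :+ (:- con (+ 1)) :* (:- ((:- con (+ 1)) :* t)) := con (+ 0)) refl t))) ⟩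
      + q ℤ.* r₁ (- ((- 1#) * t)) ℤ.- + q ℤ.* + 1
        ≡⟨ cong (λ z → + q ℤ.* z ℤ.- + q ℤ.* + 1) (trans (cong r₁ (solve 1 (λ t → :- ((:- con (+ 1)) :* t) := t) refl t)) r₁t) ⟩
      + q ℤ.* (+ 2 ℤ.- r₁ (- t)) ℤ.- + q ℤ.* + 1
        ≡⟨ ℤS.solve 2 (λ q r → q ℤS.:* (ℤS.con (+ 2) ℤS.:- r) ℤS.:- q ℤS.:* ℤS.con (+ 1) ℤS.:= ℤS.:- (q ℤS.:* r ℤS.:- q ℤS.:* ℤS.con (+ 1))) refl (+ q) (r₁ (- t)) ⟩
      ℤ.- (+ q ℤ.* r₁ (- t) ℤ.- + q ℤ.* + 1)
        ≡⟨ cong (λ z → ℤ.- (+ q ℤ.* r₁ z ℤ.- + q ℤ.* + 1)) (cong -_ (sym (*-identityˡ t))) ⟩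
      ℤ.- (+ q ℤ.* r₁ (- (1# * t)) ℤ.- + q ℤ.* + 1)
        ≡⟨ cong ℤ.-_ (∑ψ-r₁ t 1# (λ b → (λ e → trans (solve 2 (λ t c → c := t :+ con (+ 1) :* c :- con (+ 1) :* t) refl t (b * b)) (trans (cong (_- (1# * t)) e) (+-identityˡ _)))
                               , (λ e → trans (cong (λ z → t + 1# * z) e) (solve 1 (λ t → t :+ con (+ 1) :* (:- (con (+ 1) :* t)) := con (+ 0)) refl t)))) ⟨
      ℤ.- ∑ elements (λ b → ψ (t + 1# * (b * b)))
        ≡⟨ cong ℤ.-_ (∑-cong elements (λ b → cong (λ z → ψ (t + z)) (*-identityˡ (b * b)))) ⟩
      ℤ.- ∑ elements (λ b → ψ (t + b * b)) ∎
      where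
      r₁t : r₁ t ≡ + 2 ℤ.- r₁ (- t)
      r₁t = trans (ℤS.solve 2 (λ a b → a ℤS.:= a ℤS.:+ b ℤS.:- b) refl (r₁ t) (r₁ (- t))) (cong (ℤ._- r₁ (- t)) (r₁-pair t))

  -- The sign `s` is the quadratic character at -1. If i² = -1, the substitution b ↦ i b turns -a² -
  -- b² into the hyperbolic form -a² + b². Otherwise the change of sign in front of b² costs a
  -- factor -1.
  ∑ψ-two-squares : ∃ λ s → (s ℤ.* s ≡ + 1) × (∀ t → ∑ elements (λ a → ∑ elements (λ b → ψ (t - a * a - b * b))) ≡ s ℤ.* (+ q ℤ.* ψ t))
  ∑ψ-two-squares with search (λ x → (x * x) ≟ (- 1#))
  ... | yes (i , i²) = + 1 , refl , λ t → begin
    ∑ elements (λ a → ∑ elements (λ b → ψ (t - a * a - b * b)))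
      ≡⟨ ∑-cong elements (λ a → trans (sym (Rℤ.reindex (i *_) (_/ i) (λ b → *-cancelˡ i≢0 (*-/ (i * b) i≢0)) (λ b → *-/ b i≢0) (λ b → ψ (t - a * a - b * b))))
           (∑-cong elements (λ b → cong ψ (trans (solve 4 (λ t a i b → t :- a :* a :- i :* b :* (i :* b) := t :- a :* a :- i :* i :* (b :* b)) refl t a i b)
              (trans (cong (λ z → t - a * a - z * (b * b)) i²) (solve 3 (λ t a b → t :- a :* a :- (:- con (+ 1)) :* (b :* b) := t :- a :* a :+ b :* b) refl t a b)))))) ⟩
    ∑ elements (λ a → ∑ elements (λ b → ψ (t - a * a + b * b))) ≡⟨ ∑ψ-square t ⟩
    + q ℤ.* ψ t                                                ≡⟨ ℤP.*-identityˡ (+ q ℤ.* ψ t) ⟨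
    + 1 ℤ.* (+ q ℤ.* ψ t) ∎
    where
    i≢0 : i ≢ 0#
    i≢0 e = -≢0 (0≢1 ∘ sym) (trans (sym i²) (trans (cong (_* i) e) (zeroˡ i)))
  ... | no ¬∃ = ℤ.- + 1 , refl , λ t → begin
    ∑ elements (λ a → ∑ elements (λ b → ψ (t - a * a - b * b)))  ≡⟨ ∑-cong elements (λ a → ∑ψ-pair (λ x e → ¬∃ (x , e)) (t - a * a)) ⟩
    ∑ elements (λ a → ℤ.- ∑ elements (λ b → ψ (t - a * a + b * b))) ≡⟨ ∑-neg elements (λ a → ∑ elements (λ b → ψ (t - a * a + b * b))) ⟩
    ℤ.- ∑ elements (λ a → ∑ elements (λ b → ψ (t - a * a + b * b))) ≡⟨ cong ℤ.-_ (∑ψ-square t) ⟩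
    ℤ.- (+ q ℤ.* ψ t)                                          ≡⟨ ℤP.-1*i≡-i (+ q ℤ.* ψ t) ⟨
    ℤ.- + 1 ℤ.* (+ q ℤ.* ψ t) ∎

  -- For even d the Gauss sum ∑ χ(−s‖η‖) does not depend on s ≠ 0.
  gauss : ∀ n → ∃ λ γ → (γ ℤ.* γ ≡ + (q ℕ.^ (n ℕ.* 2))) × (∀ t → ∑ (allVecs (n ℕ.* 2)) (λ y → ψ (t - ‖ y ‖)) ≡ γ ℤ.* ψ t)
  gauss zero = + 1 , refl , λ t → trans (ℤP.+-identityʳ _) (trans (cong ψ (solve 1 (λ t → t :- con (+ 0) := t) refl t)) (sym (ℤP.*-identityˡ (ψ t))))
  gauss (suc n) with gauss n | ∑ψ-two-squares
  ... | γ , γ² , hγ | s , s² , hs = γ ℤ.* (s ℤ.* + q) , eq , λ t → begin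
    ∑ (allVecs (2 ℕ.+ n ℕ.* 2)) (λ y → ψ (t - ‖ y ‖))
      ≡⟨ trans (VZ.∑-allVecs-suc (λ y → ψ (t - ‖ y ‖))) (∑-cong elements (λ a → VZ.∑-allVecs-suc (λ y → ψ (t - ‖ a ∷ y ‖)))) ⟩
    ∑ elements (λ a → ∑ elements (λ b → ∑ (allVecs (n ℕ.* 2)) (λ y → ψ (t - (a * a + (b * b + ‖ y ‖))))))
      ≡⟨ ∑-cong elements (λ a → ∑-cong elements (λ b → trans (∑-cong (allVecs (n ℕ.* 2)) (λ y → cong ψ (solve 4 (λ t a b y → t :- (a :* a :+ (b :* b :+ y)) := t :- a :* a :- b :* b :- y) refl t a b (‖ y ‖)))) (hγ (t - a * a - b * b)))) ⟩
    ∑ elements (λ a → ∑ elements (λ b → γ ℤ.* ψ (t - a * a - b * b)))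
      ≡⟨ trans (∑-cong elements (λ a → ∑-*ˡ elements γ (λ b → ψ (t - a * a - b * b)))) (∑-*ˡ elements γ (λ a → ∑ elements (λ b → ψ (t - a * a - b * b)))) ⟩
    γ ℤ.* ∑ elements (λ a → ∑ elements (λ b → ψ (t - a * a - b * b)))   ≡⟨ cong (γ ℤ.*_) (hs t) ⟩
    γ ℤ.* (s ℤ.* (+ q ℤ.* ψ t))   ≡⟨ ℤS.solve 4 (λ g s q p → g ℤS.:* (s ℤS.:* (q ℤS.:* p)) ℤS.:= g ℤS.:* (s ℤS.:* q) ℤS.:* p) refl γ s (+ q) (ψ t) ⟩
    γ ℤ.* (s ℤ.* + q) ℤ.* ψ t ∎
    where
    eq : γ ℤ.* (s ℤ.* + q) ℤ.* (γ ℤ.* (s ℤ.* + q)) ≡ + (q ℕ.^ (2 ℕ.+ n ℕ.* 2))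
    eq = begin
      γ ℤ.* (s ℤ.* + q) ℤ.* (γ ℤ.* (s ℤ.* + q))   ≡⟨ ℤS.solve 3 (λ g s q → g ℤS.:* (s ℤS.:* q) ℤS.:* (g ℤS.:* (s ℤS.:* q)) ℤS.:= s ℤS.:* s ℤS.:* (q ℤS.:* (q ℤS.:* (g ℤS.:* g)))) refl γ s (+ q) ⟩
      s ℤ.* s ℤ.* (+ q ℤ.* (+ q ℤ.* (γ ℤ.* γ)))   ≡⟨ cong₂ (λ x y → x ℤ.* (+ q ℤ.* (+ q ℤ.* y))) s² γ² ⟩
      + 1 ℤ.* (+ q ℤ.* (+ q ℤ.* + (q ℕ.^ (n ℕ.* 2)))) ≡⟨ ℤP.*-identityˡ _ ⟩
      + q ℤ.* (+ q ℤ.* + (q ℕ.^ (n ℕ.* 2)))       ≡⟨ cong (+ q ℤ.*_) (ℤP.pos-* q (q ℕ.^ (n ℕ.* 2))) ⟨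
      + q ℤ.* + (q ℕ.* q ℕ.^ (n ℕ.* 2))           ≡⟨ ℤP.pos-* q (q ℕ.* q ℕ.^ (n ℕ.* 2)) ⟨
      + (q ℕ.^ (2 ℕ.+ n ℕ.* 2)) ∎

  -- Orthogonality of the kernels attached to a sphere.

  half : Carrier
  half = 1# / (1# + 1#)

  2half : (1# + 1#) * half ≡ 1#
  2half = *-/ 1# 2≢0

  ≢0⇒nz : ∀ {c} → c ≢ 0# → nz c ≡ true
  ≢0⇒nz {c} h = cong not (dec-false (c ≟ 0#) h)

  +·≡0⇒∙ : ∀ {d} l (u u' : Vect d) → u +ᵛ (l · u') ≡ 0ᵛ → ∀ z → z ∙ u ≡ - (l * z ∙ u')
  +·≡0⇒∙ l u u' e z = -≡0⇒≡ (begin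
    z ∙ u - (- (l * z ∙ u'))   ≡⟨ solve 2 (λ a b → a :- (:- b) := a :+ b) refl (z ∙ u) (l * z ∙ u') ⟩
    z ∙ u + l * z ∙ u'         ≡⟨ cong (λ t → z ∙ u + t) (∙-·ʳ l z u') ⟨
    z ∙ u + z ∙ (l · u')       ≡⟨ ∙-+ʳ z u (l · u') ⟨
    z ∙ (u +ᵛ (l · u'))          ≡⟨ cong (z ∙_) e ⟩
    z ∙ 0ᵛ                     ≡⟨ ∙-0ʳ z ⟩
    0#                         ∎)

  +-1·≡0⇒≡ : ∀ {d} (u u' : Vect d) → u +ᵛ ((- 1#) · u') ≡ 0ᵛ → u ≡ u'
  +-1·≡0⇒≡ []      []       e = refl
  +-1·≡0⇒≡ (a ∷ u) (b ∷ u') e = cong₂ _∷_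
    (-≡0⇒≡ (trans (solve 2 (λ a b → a :- b := a :+ (:- con (+ 1)) :* b) refl a b) (VP.∷-injectiveˡ e))) (+-1·≡0⇒≡ u u' (VP.∷-injectiveʳ e))

  ≡⇒+-1·≡0 : ∀ {d} (u : Vect d) → u +ᵛ ((- 1#) · u) ≡ 0ᵛ
  ≡⇒+-1·≡0 []      = refl
  ≡⇒+-1·≡0 (a ∷ u) = cong₂ _∷_ (solve 1 (λ a → a :+ (:- con (+ 1)) :* a := con (+ 0)) refl a) (≡⇒+-1·≡0 u)

  -ᵛ-cancelʳ : ∀ {d} (u u' x : Vect d) → u -ᵛ x ≡ u' -ᵛ x → u ≡ u'
  -ᵛ-cancelʳ u u' x e = trans (sym (-ᵛ+ᵛ u x)) (trans (cong (_+ᵛ x) e) (-ᵛ+ᵛ u' x))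

  ∑-units-single : ∀ (w : Carrier → ℤ) {y} → y ≢ 0# → (∀ l → l ≢ 0# → l ≢ y → w l ≡ + 0) → ∑ units w ≡ w y
  ∑-units-single w {y} y≢0 h = begin
    ∑ units w                            ≡⟨ ∑-filter nz elements w ⟩
    ∑ elements (λ l → ⟦ nz l ⟧ ℤ.* w l)   ≡⟨ enumerates-elements ℤP.+-*-commutativeRing (λ l → ⟦ nz l ⟧ ℤ.* w l) y vanish ⟩
    ⟦ nz y ⟧ ℤ.* w y                     ≡⟨ trans (cong (λ b → ⟦ b ⟧ ℤ.* w y) (≢0⇒nz y≢0)) (ℤP.*-identityˡ (w y)) ⟩
    w y                                  ∎
    where
    vanish : ∀ l → l ≢ y → ⟦ nz l ⟧ ℤ.* w l ≡ + 0
    vanish l l≢y with l ≟ 0#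
    ... | yes e = trans (cong (λ b → ⟦ not b ⟧ ℤ.* w l) (dec-true (l ≟ 0#) e)) (ℤP.*-zeroˡ (w l))
    ... | no l≢0 = trans (cong (⟦ nz l ⟧ ℤ.*_) (h l l≢0 l≢y)) (ℤP.*-zeroʳ ⟦ nz l ⟧)

  -1≢0 : - 1# ≢ 0#
  -1≢0 = -≢0 (0≢1 ∘ sym)

  -- With u = `η -ᵛ x`, the equality of the norms of x and x + u says that ‖u‖ + 2 x·u = 0.
  tangent : ∀ {d} {a} (x η : Vect d) → ‖ x ‖ ≡ a → ‖ η ‖ ≡ a → ‖ η -ᵛ x ‖ ≡ - ((1# + 1#) * x ∙ (η -ᵛ x))
  tangent x η hx h = begin
    ‖ η -ᵛ x ‖                                   ≡⟨ ‖-‖ η x ⟩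
    ‖ η ‖ - (1# + 1#) * η ∙ x + ‖ x ‖            ≡⟨ cong₂ (λ p r → p - (1# + 1#) * r + ‖ x ‖) (trans h (trans (sym hx) (‖‖≡∙ x))) (∙-comm η x) ⟩
    x ∙ x - (1# + 1#) * x ∙ η + ‖ x ‖            ≡⟨ cong (λ p → x ∙ x - (1# + 1#) * x ∙ η + p) (‖‖≡∙ x) ⟩
    x ∙ x - (1# + 1#) * x ∙ η + x ∙ x            ≡⟨ solve 2 (λ p r → p :- con (+ 2) :* r :+ p := :- (con (+ 2) :* (r :- p))) refl (x ∙ x) (x ∙ η) ⟩
    - ((1# + 1#) * (x ∙ η - x ∙ x))              ≡⟨ cong (λ z → - ((1# + 1#) * z)) (∙--ʳ x η x) ⟨
    - ((1# + 1#) * x ∙ (η -ᵛ x))                 ∎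

  -- If u + l u′ = 0 with ‖u‖ = −2u·x and ‖u′‖ = −2u′·x ≠ 0, then l² ‖u′‖ = −l ‖u′‖.
  unique-on-line : ∀ {d} {a} (x ξ ξ' : Vect d) → ‖ x ‖ ≡ a → ‖ ξ ‖ ≡ a → ‖ ξ' ‖ ≡ a → ‖ ξ' -ᵛ x ‖ ≢ 0# →
                   ∀ l → l ≢ 0# → (ξ -ᵛ x) +ᵛ (l · (ξ' -ᵛ x)) ≡ 0ᵛ → l ≡ - 1#
  unique-on-line {a = a} x ξ ξ' hx hξ hξ' n≢0 l l≢0 e = *-cancelˡ l≢0 (*-cancelˡ n≢0 (begin
    ‖ u' ‖ * (l * l)                          ≡⟨ solve 2 (λ n l → n :* (l :* l) := :- (l :* (:- (l :* n)))) refl (‖ u' ‖) l ⟩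
    - (l * (- (l * ‖ u' ‖)))                  ≡⟨ cong (λ z → - (l * (- (l * z)))) (‖‖≡∙ u') ⟩
    - (l * (- (l * u' ∙ u')))                 ≡⟨ cong (λ z → - (l * z)) (sym (trans (∙-comm u u') (+·≡0⇒∙ l u u' e u'))) ⟩
    - (l * u ∙ u')                            ≡⟨ +·≡0⇒∙ l u u' e u ⟨
    u ∙ u                                     ≡⟨ ‖‖≡∙ u ⟨
    ‖ u ‖                                     ≡⟨ tangent x ξ hx hξ ⟩
    - ((1# + 1#) * x ∙ u)                     ≡⟨ cong (λ z → - ((1# + 1#) * z)) (+·≡0⇒∙ l u u' e x) ⟩
    - ((1# + 1#) * (- (l * x ∙ u')))          ≡⟨ solve 2 (λ l z → :- (con (+ 2) :* (:- (l :* z))) := (:- (con (+ 2) :* z)) :* (l :* (:- con (+ 1)))) refl l (x ∙ u') ⟩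
    (- ((1# + 1#) * x ∙ u')) * (l * (- 1#))   ≡⟨ cong (_* (l * (- 1#))) (tangent x ξ' hx hξ') ⟨
    ‖ u' ‖ * (l * (- 1#))                     ∎))
    where
    u = ξ -ᵛ x
    u' = ξ' -ᵛ x

  -- By `ψ*ψ` the product is a sum over l of characters that are linear in y with frequency u + l
  -- u′. Only a vanishing frequency survives the sum over y.
  ∑ψψ-∙ : ∀ {d} (u u' : Vect d) → ∑ (allVecs d) (λ y → ψ (y ∙ u) ℤ.* ψ (y ∙ u'))
          ≡ ∑ units (λ l → + (q ℕ.^ d) ℤ.* (⟦ does ((u +ᵛ (l · u')) ≟ᵛ 0ᵛ) ⟧ ℤ.* ψ 0#))
  ∑ψψ-∙ {d} u u' = begin
    ∑ (allVecs d) (λ y → ψ (y ∙ u) ℤ.* ψ (y ∙ u'))                    ≡⟨ ∑-cong (allVecs d) (λ y → ψ*ψ (y ∙ u) (y ∙ u')) ⟩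
    ∑ (allVecs d) (λ y → ∑ units (λ l → ψ (y ∙ u + l * y ∙ u')))       ≡⟨ ∑-swap (allVecs d) units (λ y l → ψ (y ∙ u + l * y ∙ u')) ⟩
    ∑ units (λ l → ∑ (allVecs d) (λ y → ψ (y ∙ u + l * y ∙ u')))
      ≡⟨ ∑-cong units (λ l → trans (∑-cong (allVecs d) (λ y → cong ψ (trans (cong (λ z → y ∙ u + z) (sym (∙-·ʳ l y u')))
           (trans (sym (∙-+ʳ y u (l · u'))) (sym (+-identityʳ _)))))) (∑ψ-∙ (u +ᵛ (l · u')) 0#)) ⟩
    ∑ units (λ l → + (q ℕ.^ d) ℤ.* (⟦ does ((u +ᵛ (l · u')) ≟ᵛ 0ᵛ) ⟧ ℤ.* ψ 0#)) ∎

  qq : ℕ → ℤ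
  qq d = + (q ℕ.^ d) ℤ.* (+ q ℤ.- + 1)

  -- A nonisotropic line through x meets the sphere in at most one further point. Hence
  -- proportionality of the two difference vectors forces the factor `l = - 1#`, that is, ξ = ξ′.
  orthogonal-at : ∀ {d} {a} (x ξ ξ' : Vect d) → ‖ x ‖ ≡ a → ‖ ξ ‖ ≡ a → ‖ ξ' ‖ ≡ a → ‖ ξ' -ᵛ x ‖ ≢ 0# →
    ∑ (allVecs d) (λ y → ψ (y ∙ (ξ -ᵛ x)) ℤ.* ψ (y ∙ (ξ' -ᵛ x))) ≡ qq d ℤ.* ⟦ does (ξ ≟ᵛ ξ') ⟧
  orthogonal-at {d} x ξ ξ' hx hξ hξ' n≢0 = begin
    ∑ (allVecs d) (λ y → ψ (y ∙ (ξ -ᵛ x)) ℤ.* ψ (y ∙ (ξ' -ᵛ x)))   ≡⟨ ∑ψψ-∙ (ξ -ᵛ x) (ξ' -ᵛ x) ⟩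
    ∑ units W                                                    ≡⟨ ∑-units-single W -1≢0 vanish ⟩
    + (q ℕ.^ d) ℤ.* (⟦ does (((ξ -ᵛ x) +ᵛ ((- 1#) · (ξ' -ᵛ x))) ≟ᵛ 0ᵛ) ⟧ ℤ.* ψ 0#)
      ≡⟨ cong₂ (λ b p → + (q ℕ.^ d) ℤ.* (⟦ b ⟧ ℤ.* p))
           (does-cong (((ξ -ᵛ x) +ᵛ ((- 1#) · (ξ' -ᵛ x))) ≟ᵛ 0ᵛ) (ξ ≟ᵛ ξ') (λ e → -ᵛ-cancelʳ ξ ξ' x (+-1·≡0⇒≡ _ _ e)) (λ { refl → ≡⇒+-1·≡0 (ξ -ᵛ x) })) ψ-0 ⟩
    + (q ℕ.^ d) ℤ.* (⟦ does (ξ ≟ᵛ ξ') ⟧ ℤ.* (+ q ℤ.- + 1))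
      ≡⟨ ℤS.solve 3 (λ a b c → a ℤS.:* (b ℤS.:* c) ℤS.:= a ℤS.:* c ℤS.:* b) refl (+ (q ℕ.^ d)) ⟦ does (ξ ≟ᵛ ξ') ⟧ (+ q ℤ.- + 1) ⟩
    qq d ℤ.* ⟦ does (ξ ≟ᵛ ξ') ⟧ ∎
    where
    W : Carrier → ℤ
    W l = + (q ℕ.^ d) ℤ.* (⟦ does (((ξ -ᵛ x) +ᵛ (l · (ξ' -ᵛ x))) ≟ᵛ 0ᵛ) ⟧ ℤ.* ψ 0#)
    vanish : ∀ l → l ≢ 0# → l ≢ - 1# → W l ≡ + 0
    vanish l l≢0 l≢-1 = trans (cong (λ b → + (q ℕ.^ d) ℤ.* (⟦ b ⟧ ℤ.* ψ 0#)) (dec-false (((ξ -ᵛ x) +ᵛ (l · (ξ' -ᵛ x))) ≟ᵛ 0ᵛ) (λ e → l≢-1 (unique-on-line x ξ ξ' hx hξ hξ' n≢0 l l≢0 e))))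
      (trans (cong (+ (q ℕ.^ d) ℤ.*_) (ℤP.*-zeroˡ (ψ 0#))) (ℤP.*-zeroʳ (+ (q ℕ.^ d))))

  -- As ζ² vanishes exactly when ζ does, `ψ (a * (ζ * ζ))` equals `ψ ζ`. This replaces the
  -- evaluation of a one-variable Gauss sum.
  ∑ψ-aζ² : ∀ {a} → a ≢ 0# → ∑ elements (λ ζ → ψ (a * (ζ * ζ))) ≡ + 0
  ∑ψ-aζ² {a} a≢0 = trans (∑-cong elements (λ ζ → trans (ψ-*ˡ (ζ * ζ) a≢0) (ψ-square ζ))) ∑ψ
    where
    ψ-square : ∀ ζ → ψ (ζ * ζ) ≡ ψ ζ
    ψ-square ζ with ζ ≟ 0#
    ... | yes e = cong ψ (trans (cong (_* ζ) e) (trans (zeroˡ ζ) (sym e)))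
    ... | no ζ≢0 = ψ-*ˡ ζ ζ≢0

  quadric : ∀ {d} → Carrier → Carrier → Vect d → Bool
  quadric a ζ y = does (‖ y ‖ ≟ (a * (ζ * ζ)))

  module _ {n : ℕ} {a : Carrier} (a≢0 : a ≢ 0#) (ξ ξ' : Vect (n ℕ.* 2)) (hξ : ‖ ξ ‖ ≡ a) (hξ' : ‖ ξ' ‖ ≡ a) where
    private
      d = n ℕ.* 2
      γ = proj₁ (gauss n)
      s = ξ ∙ ξ'
      k : Vect d → Carrier → Vect d → Carrier
      k y ζ η = y ∙ η - a * ζ

    -- For the form Q(y, ζ) = ‖y‖ - aζ² the points (ξ, 1) and (ξ′, 1) are isotropic. Translating by
    -- half of their combination with coefficients l and m therefore leaves only the cross term l m
    -- (a - s)/2, where s = ξ·ξ′.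
    complete-square : ∀ l m y ζ → let w = half · ((l · ξ) +ᵛ (m · ξ')) ; η = half * (l + m) in
      ‖ y -ᵛ w ‖ - a * ((ζ - η) * (ζ - η)) + l * k (y -ᵛ w) (ζ - η) ξ + m * k (y -ᵛ w) (ζ - η) ξ'
      ≡ - ((a * (ζ * ζ) - l * (m * (half * (a - s)))) - ‖ y ‖)
    complete-square l m y ζ = begin
      ‖ y -ᵛ w ‖ - a * ((ζ - η) * (ζ - η)) + l * (((y -ᵛ w) ∙ ξ) - a * (ζ - η)) + m * (((y -ᵛ w) ∙ ξ') - a * (ζ - η))
        ≡⟨ cong₂ (λ u v → u - a * ((ζ - η) * (ζ - η)) + l * (v - a * (ζ - η)) + m * (((y -ᵛ w) ∙ ξ') - a * (ζ - η))) norm (inner ξ) ⟩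
      _ ≡⟨ cong₂ (λ u v → N₀ - a * ((ζ - η) * (ζ - η)) + l * (y ∙ ξ - half * (l * u + m * (ξ' ∙ ξ)) - a * (ζ - η)) + m * (v - a * (ζ - η))) (trans (sym (‖‖≡∙ ξ)) hξ) (inner ξ') ⟩
      _ ≡⟨ cong₂ (λ u v → N₀ - a * ((ζ - η) * (ζ - η)) + l * (y ∙ ξ - half * (l * a + m * u) - a * (ζ - η)) + m * (y ∙ ξ' - half * (l * s + m * v) - a * (ζ - η))) (∙-comm ξ' ξ) (trans (sym (‖‖≡∙ ξ')) hξ') ⟩
      N₀ - a * ((ζ - η) * (ζ - η)) + l * (y ∙ ξ - half * (l * a + m * s) - a * (ζ - η)) + m * (y ∙ ξ' - half * (l * s + m * a) - a * (ζ - η))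
        -- The solver treats `half` as a variable, so the identity holds only up to a multiple of
        -- 2·`half` - 1. The cofactor is `E`.
        ≡⟨ solve 9 (λ h Y p p' l m a s ζ →
             (Y :- con (+ 2) :* (h :* (l :* p :+ m :* p')) :+ h :* (h :* (l :* (l :* a :+ m :* s) :+ m :* (l :* s :+ m :* a))))
             :- a :* ((ζ :- h :* (l :+ m)) :* (ζ :- h :* (l :+ m)))
             :+ l :* (p :- h :* (l :* a :+ m :* s) :- a :* (ζ :- h :* (l :+ m)))
             :+ m :* (p' :- h :* (l :* s :+ m :* a) :- a :* (ζ :- h :* (l :+ m)))
             := :- ((a :* (ζ :* ζ) :- l :* (m :* (h :* (a :- s)))) :- Y)
                :+ (con (+ 2) :* h :- con (+ 1)) :* (:- (l :* p :+ m :* p') :+ a :* (ζ :* (l :+ m)) :- h :* (l :* (m :* (a :- s)))))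
             refl half (‖ y ‖) (y ∙ ξ) (y ∙ ξ') l m a s ζ ⟩
      T + ((1# + 1#) * half - 1#) * E     ≡⟨ cong (λ z → T + (z - 1#) * E) 2half ⟩
      T + (1# - 1#) * E                   ≡⟨ solve 2 (λ T E → T :+ (con (+ 1) :- con (+ 1)) :* E := T) refl T E ⟩
      T ∎
      where
      v = (l · ξ) +ᵛ (m · ξ')
      w = half · v
      η = half * (l + m)
      T = - ((a * (ζ * ζ) - l * (m * (half * (a - s)))) - ‖ y ‖)
      E = - (l * y ∙ ξ + m * y ∙ ξ') + a * (ζ * (l + m)) - half * (l * (m * (a - s)))
      N₀ = ‖ y ‖ - (1# + 1#) * (half * (l * y ∙ ξ + m * y ∙ ξ')) + half * (half * (l * (l * a + m * s) + m * (l * s + m * a)))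
      v∙ : ∀ z → v ∙ z ≡ l * ξ ∙ z + m * ξ' ∙ z
      v∙ z = trans (∙-+ˡ (l · ξ) (m · ξ') z) (cong₂ _+_ (∙-·ˡ l ξ z) (∙-·ˡ m ξ' z))
      inner : ∀ z → (y -ᵛ w) ∙ z ≡ y ∙ z - half * (l * ξ ∙ z + m * ξ' ∙ z)
      inner z = trans (∙--ˡ y w z) (cong (λ t → y ∙ z - t) (trans (∙-·ˡ half v z) (cong (half *_) (v∙ z))))
      y∙v : y ∙ v ≡ l * y ∙ ξ + m * y ∙ ξ'
      y∙v = trans (∙-+ʳ y (l · ξ) (m · ξ')) (cong₂ _+_ (∙-·ʳ l y ξ) (∙-·ʳ m y ξ'))
      v∙v : v ∙ v ≡ l * (l * a + m * s) + m * (l * s + m * a)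
      v∙v = trans (v∙ v) (cong₂ (λ t u → l * t + m * u)
        (trans (∙-comm ξ v) (trans (v∙ ξ) (cong₂ (λ t u → l * t + m * u) (trans (sym (‖‖≡∙ ξ)) hξ) (∙-comm ξ' ξ))))
        (trans (∙-comm ξ' v) (trans (v∙ ξ') (cong (λ u → l * s + m * u) (trans (sym (‖‖≡∙ ξ')) hξ')))))
      norm : ‖ y -ᵛ w ‖ ≡ N₀
      norm = trans (‖-‖ y w) (cong₂ (λ t u → ‖ y ‖ - (1# + 1#) * t + u)
        (trans (∙-·ʳ half y v) (cong (half *_) y∙v))
        (trans (‖‖≡∙ w) (trans (∙-·ˡ half v w) (cong (half *_) (trans (∙-·ʳ half v v) (cong (half *_) v∙v))))))

    private
      c = half * (a - s)

      -- After the square is completed, the sum over y is γ ψ(aζ² - l m c). For c = 0 the sum over ζ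
      -- vanishes by `∑ψ-aζ²`. For c ≠ 0 the sum over all m vanishes, and the excluded term m = 0 is
      -- again the sum of `∑ψ-aζ²`.
      twisted : ∑ elements (λ ζ → ∑ (allVecs d) (λ y → ψ (‖ y ‖ - a * (ζ * ζ)) ℤ.* ψ (k y ζ ξ) ℤ.* ψ (k y ζ ξ'))) ≡ + 0
      twisted = begin
        ∑ elements (λ ζ → ∑ (allVecs d) (λ y → ψ (‖ y ‖ - a * (ζ * ζ)) ℤ.* ψ (k y ζ ξ) ℤ.* ψ (k y ζ ξ')))
          ≡⟨ ∑-cong elements (λ ζ → ∑-cong (allVecs d) (λ y → triple (‖ y ‖ - a * (ζ * ζ)) (k y ζ ξ) (k y ζ ξ'))) ⟩
        ∑ elements (λ ζ → ∑ (allVecs d) (λ y → ∑ units (λ l → ∑ units (λ m → G l m y ζ))))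
          ≡⟨ ∑-cong elements (λ ζ → ∑-swap (allVecs d) units (λ y l → ∑ units (λ m → G l m y ζ))) ⟩
        ∑ elements (λ ζ → ∑ units (λ l → ∑ (allVecs d) (λ y → ∑ units (λ m → G l m y ζ))))
          ≡⟨ ∑-swap elements units (λ ζ l → ∑ (allVecs d) (λ y → ∑ units (λ m → G l m y ζ))) ⟩
        ∑ units (λ l → ∑ elements (λ ζ → ∑ (allVecs d) (λ y → ∑ units (λ m → G l m y ζ))))
          ≡⟨ ∑-cong units (λ l → trans (∑-cong elements (λ ζ → ∑-swap (allVecs d) units (λ y m → G l m y ζ))) (∑-swap elements units (λ ζ m → ∑ (allVecs d) (λ y → G l m y ζ)))) ⟩
        ∑ units (λ l → ∑ units (λ m → ∑ elements (λ ζ → ∑ (allVecs d) (λ y → G l m y ζ))))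
          ≡⟨ ∑-cong units (λ l → ∑-cong units (λ m → evaluate l m)) ⟩
        ∑ units (λ l → ∑ units (λ m → γ ℤ.* ∑ elements (λ ζ → ψ (a * (ζ * ζ) - l * (m * c)))))
          ≡⟨ ∑-cong-filter nz elements (λ l hl → trans (∑-*ˡ units γ (λ m → ∑ elements (λ ζ → ψ (a * (ζ * ζ) - l * (m * c))))) (trans (cong (γ ℤ.*_) (cancel l (nz⇒≢0 hl))) (ℤP.*-zeroʳ γ))) ⟩
        ∑ units (λ l → + 0)   ≡⟨ ∑-0 units ⟩
        + 0                   ∎
        where
        G : Carrier → Carrier → Vect d → Carrier → ℤ
        G l m y ζ = ψ (‖ y ‖ - a * (ζ * ζ) + l * k y ζ ξ + m * k y ζ ξ')
        triple : ∀ A B C → ψ A ℤ.* ψ B ℤ.* ψ C ≡ ∑ units (λ l → ∑ units (λ m → ψ (A + l * B + m * C)))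
        triple A B C = trans (cong (ℤ._* ψ C) (ψ*ψ A B)) (trans (sym (∑-*ʳ units (λ l → ψ (A + l * B)) (ψ C))) (∑-cong units (λ l → ψ*ψ (A + l * B) C)))
        evaluate : ∀ l m → ∑ elements (λ ζ → ∑ (allVecs d) (λ y → G l m y ζ)) ≡ γ ℤ.* ∑ elements (λ ζ → ψ (a * (ζ * ζ) - l * (m * c)))
        evaluate l m = begin
          ∑ elements (λ ζ → ∑ (allVecs d) (λ y → G l m y ζ))
            ≡⟨ Rℤ.reindex (λ ζ → ζ - η) (λ ζ → ζ + η) (λ ζ → solve 2 (λ ζ η → ζ :- η :+ η := ζ) refl ζ η) (λ ζ → solve 2 (λ ζ η → ζ :+ η :- η := ζ) refl ζ η) (λ ζ → ∑ (allVecs d) (λ y → G l m y ζ)) ⟨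
          ∑ elements (λ ζ → ∑ (allVecs d) (λ y → G l m y (ζ - η)))
            ≡⟨ ∑-cong elements (λ ζ → RV.reindex d ℤP.+-*-commutativeRing (_-ᵛ w) (_+ᵛ w) (λ y → -ᵛ+ᵛ y w) (λ y → +ᵛ-ᵛ y w) (λ y → G l m y (ζ - η))) ⟨
          ∑ elements (λ ζ → ∑ (allVecs d) (λ y → G l m (y -ᵛ w) (ζ - η)))
            ≡⟨ ∑-cong elements (λ ζ → ∑-cong (allVecs d) (λ y → trans (cong ψ (complete-square l m y ζ)) (ψ-neg (a * (ζ * ζ) - l * (m * c) - ‖ y ‖)))) ⟩
          ∑ elements (λ ζ → ∑ (allVecs d) (λ y → ψ (a * (ζ * ζ) - l * (m * c) - ‖ y ‖)))
            ≡⟨ ∑-cong elements (λ ζ → proj₂ (proj₂ (gauss n)) (a * (ζ * ζ) - l * (m * c))) ⟩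
          ∑ elements (λ ζ → γ ℤ.* ψ (a * (ζ * ζ) - l * (m * c)))
            ≡⟨ ∑-*ˡ elements γ (λ ζ → ψ (a * (ζ * ζ) - l * (m * c))) ⟩
          γ ℤ.* ∑ elements (λ ζ → ψ (a * (ζ * ζ) - l * (m * c))) ∎
          where
          w = half · ((l · ξ) +ᵛ (m · ξ'))
          η = half * (l + m)
        cancel : ∀ l → l ≢ 0# → ∑ units (λ m → ∑ elements (λ ζ → ψ (a * (ζ * ζ) - l * (m * c)))) ≡ + 0
        cancel l l≢0 with c ≟ 0#
        ... | yes c≡0 = trans (∑-cong units (λ m → trans (∑-cong elements (λ ζ → cong ψ (trans (cong (λ z → a * (ζ * ζ) - l * (m * z)) c≡0)
                (solve 3 (λ A l m → A :- l :* (m :* con (+ 0)) := A) refl (a * (ζ * ζ)) l m)))) (∑ψ-aζ² a≢0))) (∑-0 units)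
        ... | no c≢0 = begin
          ∑ units (λ m → ∑ elements (λ ζ → ψ (a * (ζ * ζ) - l * (m * c))))   ≡⟨ ∑-swap units elements (λ m ζ → ψ (a * (ζ * ζ) - l * (m * c))) ⟩
          ∑ elements (λ ζ → ∑ units (λ m → ψ (a * (ζ * ζ) - l * (m * c))))
            ≡⟨ ∑-cong elements (λ ζ → trans (Uℤ.∑-units (λ m → ψ (a * (ζ * ζ) - l * (m * c)))) (cong₂ ℤ._-_
                 (trans (∑-cong elements (λ m → cong ψ (solve 4 (λ A l m c → A :- l :* (m :* c) := (:- (l :* c)) :* m :+ A) refl (a * (ζ * ζ)) l m c))) (∑ψ-affine (a * (ζ * ζ)) (-≢0 (*-≢0 l≢0 c≢0))))
                 (cong ψ (solve 3 (λ A l c → A :- l :* (con (+ 0) :* c) := A) refl (a * (ζ * ζ)) l c)))) ⟩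
          ∑ elements (λ ζ → + 0 ℤ.- ψ (a * (ζ * ζ)))    ≡⟨ ∑-- elements (λ _ → + 0) (λ ζ → ψ (a * (ζ * ζ))) ⟩
          ∑ elements (λ ζ → + 0) ℤ.- ∑ elements (λ ζ → ψ (a * (ζ * ζ))) ≡⟨ cong₂ ℤ._-_ (∑-0 elements) (∑ψ-aζ² a≢0) ⟩
          + 0 ∎

      -- The coefficient of ζ is -a(1 + l), so the sum over ζ kills every l except -1. For l = -1
      -- the sum over y leaves the diagonal.
      untwisted : ∑ elements (λ ζ → ∑ (allVecs d) (λ y → ψ (k y ζ ξ) ℤ.* ψ (k y ζ ξ'))) ≡ + q ℤ.* (qq d ℤ.* ⟦ does (ξ ≟ᵛ ξ') ⟧)
      untwisted = begin
        ∑ elements (λ ζ → ∑ (allVecs d) (λ y → ψ (k y ζ ξ) ℤ.* ψ (k y ζ ξ')))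
          ≡⟨ ∑-cong elements (λ ζ → trans (∑-cong (allVecs d) (λ y → ψ*ψ (k y ζ ξ) (k y ζ ξ'))) (∑-swap (allVecs d) units (λ y l → ψ (k y ζ ξ + l * k y ζ ξ')))) ⟩
        ∑ elements (λ ζ → ∑ units (λ l → ∑ (allVecs d) (λ y → ψ (k y ζ ξ + l * k y ζ ξ'))))
          ≡⟨ ∑-cong elements (λ ζ → ∑-cong units (λ l → trans (∑-cong (allVecs d) (λ y → cong ψ (linear l y ζ))) (∑ψ-∙ (ξ +ᵛ (l · ξ')) (((- a) * (1# + l)) * ζ + 0#)))) ⟩
        ∑ elements (λ ζ → ∑ units (λ l → + (q ℕ.^ d) ℤ.* (D l ℤ.* ψ (((- a) * (1# + l)) * ζ + 0#))))
          ≡⟨ ∑-swap elements units (λ ζ l → + (q ℕ.^ d) ℤ.* (D l ℤ.* ψ (((- a) * (1# + l)) * ζ + 0#))) ⟩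
        ∑ units W
          ≡⟨ ∑-units-single W -1≢0 vanish ⟩
        W (- 1#)
          ≡⟨ ∑-cong elements (λ ζ → cong₂ (λ b z → + (q ℕ.^ d) ℤ.* (⟦ b ⟧ ℤ.* z))
               (does-cong ((ξ +ᵛ ((- 1#) · ξ')) ≟ᵛ 0ᵛ) (ξ ≟ᵛ ξ') (+-1·≡0⇒≡ ξ ξ') (λ { refl → ≡⇒+-1·≡0 ξ }))
               (trans (cong ψ (solve 2 (λ a ζ → ((:- a) :* (con (+ 1) :+ (:- con (+ 1)))) :* ζ :+ con (+ 0) := con (+ 0)) refl a ζ)) ψ-0)) ⟩
        ∑ elements (λ ζ → + (q ℕ.^ d) ℤ.* (⟦ does (ξ ≟ᵛ ξ') ⟧ ℤ.* (+ q ℤ.- + 1)))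
          ≡⟨ ∑-elements-const _ ⟩
        + q ℤ.* (+ (q ℕ.^ d) ℤ.* (⟦ does (ξ ≟ᵛ ξ') ⟧ ℤ.* (+ q ℤ.- + 1)))
          ≡⟨ cong (+ q ℤ.*_) (ℤS.solve 3 (λ a b c → a ℤS.:* (b ℤS.:* c) ℤS.:= a ℤS.:* c ℤS.:* b) refl (+ (q ℕ.^ d)) ⟦ does (ξ ≟ᵛ ξ') ⟧ (+ q ℤ.- + 1)) ⟩
        + q ℤ.* (qq d ℤ.* ⟦ does (ξ ≟ᵛ ξ') ⟧) ∎
        where
        D : Carrier → ℤ
        D l = ⟦ does ((ξ +ᵛ (l · ξ')) ≟ᵛ 0ᵛ) ⟧
        W : Carrier → ℤ
        W l = ∑ elements (λ ζ → + (q ℕ.^ d) ℤ.* (D l ℤ.* ψ (((- a) * (1# + l)) * ζ + 0#)))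
        linear : ∀ l y ζ → k y ζ ξ + l * k y ζ ξ' ≡ y ∙ (ξ +ᵛ (l · ξ')) + (((- a) * (1# + l)) * ζ + 0#)
        linear l y ζ = trans (solve 5 (λ p p' l a ζ → p :- a :* ζ :+ l :* (p' :- a :* ζ) := p :+ l :* p' :+ (((:- a) :* (con (+ 1) :+ l)) :* ζ :+ con (+ 0))) refl (y ∙ ξ) (y ∙ ξ') l a ζ)
          (cong (_+ (((- a) * (1# + l)) * ζ + 0#)) (sym (trans (∙-+ʳ y ξ (l · ξ')) (cong (λ z → y ∙ ξ + z) (∙-·ʳ l y ξ')))))
        vanish : ∀ l → l ≢ 0# → l ≢ - 1# → W l ≡ + 0
        vanish l _ l≢-1 = trans (∑-*ˡ elements (+ (q ℕ.^ d)) (λ ζ → D l ℤ.* ψ (((- a) * (1# + l)) * ζ + 0#)))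
          (trans (cong (+ (q ℕ.^ d) ℤ.*_) (trans (∑-*ˡ elements (D l) (λ ζ → ψ (((- a) * (1# + l)) * ζ + 0#)))
             (trans (cong (D l ℤ.*_) (∑ψ-affine 0# (*-≢0 (-≢0 a≢0) (λ e → l≢-1 (trans (solve 1 (λ l → l := con (+ 1) :+ l :- con (+ 1)) refl l) (trans (cong (_- 1#) e) (+-identityˡ (- 1#)))))))) (ℤP.*-zeroʳ (D l)))))
             (ℤP.*-zeroʳ (+ (q ℕ.^ d))))

    -- The points (y , ζ) form the quadric ‖y‖ = aζ², on which ξ and ξ′ sit at ζ = 1.
    orthogonal-on-quadric : ∑ elements (λ ζ → ∑ (filterᵇ (quadric a ζ) (allVecs d)) (λ y → ψ (k y ζ ξ) ℤ.* ψ (k y ζ ξ')))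
                            ≡ qq d ℤ.* ⟦ does (ξ ≟ᵛ ξ') ⟧
    orthogonal-on-quadric = ℤP.*-cancelˡ-≡ (+ q) _ _ {{q≢0}} (begin
      + q ℤ.* ∑ elements (λ ζ → ∑ (filterᵇ (quadric a ζ) (allVecs d)) (λ y → K ζ y))
        ≡⟨ sym (∑-*ˡ elements (+ q) (λ ζ → ∑ (filterᵇ (quadric a ζ) (allVecs d)) (K ζ))) ⟩
      ∑ elements (λ ζ → + q ℤ.* ∑ (filterᵇ (quadric a ζ) (allVecs d)) (K ζ))
        ≡⟨ ∑-cong elements (λ ζ → trans (cong (+ q ℤ.*_) (∑-filter (quadric a ζ) (allVecs d) (K ζ)))
             (trans (sym (∑-*ˡ (allVecs d) (+ q) (λ y → ⟦ quadric a ζ y ⟧ ℤ.* K ζ y)))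
             (trans (∑-cong (allVecs d) (λ y → split ζ y)) (∑-+ (allVecs d) (λ y → ψ (‖ y ‖ - a * (ζ * ζ)) ℤ.* ψ (k y ζ ξ) ℤ.* ψ (k y ζ ξ')) (K ζ))))) ⟩
      ∑ elements (λ ζ → ∑ (allVecs d) (λ y → ψ (‖ y ‖ - a * (ζ * ζ)) ℤ.* ψ (k y ζ ξ) ℤ.* ψ (k y ζ ξ')) ℤ.+ ∑ (allVecs d) (K ζ))
        ≡⟨ ∑-+ elements (λ ζ → ∑ (allVecs d) (λ y → ψ (‖ y ‖ - a * (ζ * ζ)) ℤ.* ψ (k y ζ ξ) ℤ.* ψ (k y ζ ξ'))) (λ ζ → ∑ (allVecs d) (K ζ)) ⟩
      _ ≡⟨ cong₂ ℤ._+_ twisted untwisted ⟩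
      + 0 ℤ.+ + q ℤ.* (qq d ℤ.* ⟦ does (ξ ≟ᵛ ξ') ⟧)  ≡⟨ ℤP.+-identityˡ _ ⟩
      + q ℤ.* (qq d ℤ.* ⟦ does (ξ ≟ᵛ ξ') ⟧) ∎)
      where
      K : Carrier → Vect d → ℤ
      K ζ y = ψ (k y ζ ξ) ℤ.* ψ (k y ζ ξ')
      split : ∀ ζ y → + q ℤ.* (⟦ quadric a ζ y ⟧ ℤ.* K ζ y) ≡ ψ (‖ y ‖ - a * (ζ * ζ)) ℤ.* ψ (k y ζ ξ) ℤ.* ψ (k y ζ ξ') ℤ.+ K ζ y
      split ζ y = trans (cong (λ b → + q ℤ.* (⟦ b ⟧ ℤ.* K ζ y)) (does-cong (‖ y ‖ ≟ (a * (ζ * ζ))) ((‖ y ‖ - a * (ζ * ζ)) ≟ 0#)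
            (λ e → trans (cong (_- (a * (ζ * ζ))) e) (-‿inverseʳ _)) -≡0⇒≡))
          (ℤS.solve 4 (λ q b u v → q ℤS.:* (b ℤS.:* (u ℤS.:* v)) ℤS.:= (q ℤS.:* b ℤS.:- ℤS.con (+ 1)) ℤS.:* u ℤS.:* v ℤS.:+ u ℤS.:* v) refl
             (+ q) ⟦ does ((‖ y ‖ - a * (ζ * ζ)) ≟ 0#) ⟧ (ψ (k y ζ ξ)) (ψ (k y ζ ξ')))
      q≢0 : ℤ.NonZero (+ q)
      q≢0 = nonempty (Inverse.to enum 0#)
        where
        nonempty : ∀ {m} → Fin.Fin m → ℤ.NonZero (+ m)
        nonempty {suc m} _ = _

-- Additive energy of a weight on a sphere.

∧-split : ∀ b c → b ∧ c ≡ true → b ≡ true × c ≡ true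
∧-split true true _ = refl , refl

-- Distinctness of the entries in the form of a bounded multiplicity, which is the inequality that
-- second moments consume.
NoDup : ∀ {q} (F : FiniteField q) {d} → List (Vec (FiniteField.Carrier F) d) → Set
NoDup F {d} xs = ∀ y → ℤT.∑ xs (λ x → ℤT.⟦ does (VP.≡-dec (FiniteField._≟_ F) x y) ⟧) ℤ.≤ + 1

module Spheres {q : ℕ} (F : FiniteField q) (2≢0 : FiniteField.CharGt2 F) (𝓡 : StarOrderedRing) where
  module 𝔽 = Field F 2≢0
  open 𝔽 using (Vect; allVecs; elements; units; nz; ψ; ‖_‖; _∙_; _·_; _+ᵛ_; _-ᵛ_; 0ᵛ; _≟_; _≟ᵛ_; qq; quadric; nz⇒≢0)
  open StarOrdered 𝓡 public
  open ι-Sums 𝓡 public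
  open import Relation.Binary.Reasoning.Preorder ≤-preorder

  ⟦⟧-≤ : ∀ b {P : Set} (p? : Dec P) → (b ≡ true → P) → ⟦ b ⟧ ≤ ⟦ does p? ⟧
  ⟦⟧-≤ true  p? f = ≤-reflexive (reflexive (cong ⟦_⟧ (sym (dec-true p? (f refl)))))
  ⟦⟧-≤ false p? f = NN⇒≤ (NN-⟦⟧ (does p?))

  ⟦⟧≤1 : ∀ b → ι ℤT.⟦ b ⟧ ≤ 1#
  ⟦⟧≤1 true  = ≤-refl
  ⟦⟧≤1 false = NN⇒≤ NN-1

  NN-ι⟦⟧ : ∀ b → NN (ι ℤT.⟦ b ⟧)
  NN-ι⟦⟧ true  = NN-1
  NN-ι⟦⟧ false = NN-0

  q≥2 : ∃ λ k → q ≡ suc (suc k)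
  q≥2 = aux (Inverse.to 𝔽.enum 𝔽.0#) (Inverse.to 𝔽.enum 𝔽.1#) (λ e → 𝔽.0≢1 (to-injective e))
    where
    to-injective : Inverse.to 𝔽.enum 𝔽.0# ≡ Inverse.to 𝔽.enum 𝔽.1# → 𝔽.0# ≡ 𝔽.1#
    to-injective e = trans (sym (Inverse.strictlyInverseʳ 𝔽.enum 𝔽.0#)) (trans (cong (Inverse.from 𝔽.enum) e) (Inverse.strictlyInverseʳ 𝔽.enum 𝔽.1#))
    aux : ∀ {m} (i j : Fin.Fin m) → i ≢ j → ∃ λ k → m ≡ suc (suc k)
    aux {suc zero}    Fin.zero Fin.zero i≢j = ⊥-elim (i≢j refl)
    aux {suc (suc k)} _        _        _   = k , refl

  q-1 : Carrier
  q-1 = ι (+ q ℤ.- + 1)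

  NN-q-1 : NN q-1
  NN-q-1 with q≥2
  ... | k , e = ≡.subst (λ m → NN (ι (+ m ℤ.- + 1))) (sym e) (NN-ι (suc k))

  cancel-q-1 : ∀ {x y} → q-1 * x ≤ q-1 * y → x ≤ y
  cancel-q-1 {x} {y} h with q≥2
  ... | k , e = ≤-cancel k (≡.subst (λ m → ι (+ m ℤ.- + 1) * x ≤ ι (+ m ℤ.- + 1) * y) e h)

  q-nonZero : ℕ.NonZero q
  q-nonZero with q≥2
  ... | k , e = ≡.subst ℕ.NonZero (sym e) _

  q^-nonZero : ∀ n → ℕ.NonZero (q ℕ.^ n)
  q^-nonZero n = ℕP.m^n≢0 q n {{q-nonZero}}

  ∑-units-constᴿ : ∀ c → ∑ units (λ _ → c) ≈ q-1 * c
  ∑-units-constᴿ c = ≈-trans (∑-const units c) (*-congʳ (reflexive (cong ι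
    (trans (sym (ℤP.*-identityʳ (+ L.length units))) (trans (sym (∑-constℤ units (+ 1))) (trans (𝔽.∑-units-const (+ 1)) (ℤP.*-identityʳ (+ q ℤ.- + 1))))))))

  onSphere : ∀ {d} → 𝔽.Carrier → Vect d → Bool
  onSphere a ξ = does (‖ ξ ‖ ≟ a)

  sphere : ∀ d → 𝔽.Carrier → List (Vect d)
  sphere d a = filterᵇ (onSphere a) (allVecs d)

  onSphere⇒ : ∀ {d a} (ξ : Vect d) → onSphere a ξ ≡ true → ‖ ξ ‖ ≡ a
  onSphere⇒ {a = a} ξ = does⇒ (‖ ξ ‖ ≟ a)

  ∑-filter-diagonal : ∀ {d} (p : Vect d → Bool) (v : Vect d → Carrier) c →
    ∑ (filterᵇ p (allVecs d)) (λ ξ → ∑ (filterᵇ p (allVecs d)) (λ ξ' → v ξ * v ξ' * ι (c ℤ.* ℤT.⟦ does (ξ ≟ᵛ ξ') ⟧)))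
    ≈ ι c * ∑ (filterᵇ p (allVecs d)) (λ ξ → v ξ * v ξ)
  ∑-filter-diagonal {d} p v c = ≈-trans (∑-cong-filter p (allVecs d) (λ ξ pξ →
      ≈-trans (∑-filter p (allVecs d) _)
      (≈-trans (𝔽.enumerates-allVecs d commutativeRing _ ξ (λ ξ' ξ'≢ξ → ≈-trans (*-congˡ (≈-trans (*-congˡ (reflexive (cong ι
                  (trans (cong (λ b → c ℤ.* ℤT.⟦ b ⟧) (dec-false (ξ ≟ᵛ ξ') (λ e → ξ'≢ξ (sym e)))) (ℤP.*-zeroʳ c))))) (zeroʳ _))) (zeroʳ _)))
      (≈-trans (*-cong (reflexive (cong ⟦_⟧ pξ)) (*-congˡ (reflexive (cong ι (trans (cong (λ b → c ℤ.* ℤT.⟦ b ⟧) (dec-true (ξ ≟ᵛ ξ) refl)) (ℤP.*-identityʳ c))))))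
               (≈-trans (*-identityˡ _) (*-comm _ _))))))
    (∑-*ˡ (filterᵇ p (allVecs d)) (ι c) _)

  module _ {n : ℕ} where
    private
      d = n ℕ.* 2
      κ = q ℕ.^ n

    nat-κ² : nat (κ ℕ.* κ) ≈ nat (q ℕ.^ d)
    nat-κ² = reflexive (cong nat (trans (sym (ℕP.^-distribˡ-+-* q n n)) (cong (q ℕ.^_) (trans (cong (n ℕ.+_) (sym (ℕP.+-identityʳ n))) (ℕP.*-comm 2 n)))))

    -- Termwise 2κ v b ≤ κ² v² + b² with κ² = q^d. This stands in for Cauchy-Schwarz followed by a
    -- square root. The hypothesis is ∑ b² ≤ q^d ∑ v² with both sides multiplied by q - 1, the form
    -- in which it is proved.
    form-≤ : ∀ {A : Set} (xs : List A) (v b : A → Carrier) → (∀ ξ → v ξ ⋆ ≈ v ξ) → (∀ ξ → b ξ ⋆ ≈ b ξ) →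
      q-1 * ∑ xs (λ ξ → b ξ * b ξ) ≤ ι (qq d) * ∑ xs (λ ξ → v ξ * v ξ) →
      ∑ xs (λ ξ → v ξ * b ξ) ≤ nat κ * ∑ xs (λ ξ → v ξ * v ξ)
    form-≤ xs v b v⋆ b⋆ h = ≤-cancel-nat κ {{q^-nonZero n}} (≤-cancel 1 (cancel-q-1 (begin
      q-1 * (ι (+ 2) * (nat κ * ∑ xs (λ ξ → v ξ * b ξ)))
        ≈⟨ *-congˡ (≈-trans (≈-sym (*-assoc _ _ _)) (≈-sym (∑-*ˡ xs _ _))) ⟩
      q-1 * ∑ xs (λ ξ → ι (+ 2) * nat κ * (v ξ * b ξ))
        ≲⟨ *-monoˡ NN-q-1 (∑-mono xs (λ ξ → NN-resp
             (solve 3 (λ k v b → (k :* v :- b) :* (k :* v :- b) := (k :* k :* (v :* v) :+ b :* b) :- con (+ 2) :* k :* (v :* b)) ≈-refl (nat κ) (v ξ) (b ξ))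
             (NN-sq-self (≈-trans (⋆-+ _ _) (+-cong (≈-trans (⋆-* _ _) (*-cong (⋆-ι (+ κ)) (v⋆ ξ))) (≈-trans (⋆-neg _) (-‿cong (b⋆ ξ)))))))) ⟩
      q-1 * ∑ xs (λ ξ → nat κ * nat κ * (v ξ * v ξ) + b ξ * b ξ)
        ≈⟨ *-congˡ (≈-trans (∑-+ xs _ _) (+-congʳ (∑-*ˡ xs _ _))) ⟩
      q-1 * (nat κ * nat κ * V₂ + ∑ xs (λ ξ → b ξ * b ξ))
        ≈⟨ distribˡ _ _ _ ⟩
      q-1 * (nat κ * nat κ * V₂) + q-1 * ∑ xs (λ ξ → b ξ * b ξ)
        ≲⟨ +-mono ≤-refl h ⟩
      q-1 * (nat κ * nat κ * V₂) + ι (qq d) * V₂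
        ≈⟨ +-congˡ (*-congʳ (≈-trans (ι-* (+ (q ℕ.^ d)) (+ q ℤ.- + 1)) (*-congʳ (≈-trans (≈-sym nat-κ²) (nat-* κ κ))))) ⟩
      q-1 * (nat κ * nat κ * V₂) + nat κ * nat κ * q-1 * V₂
        ≈⟨ solve 3 (λ r k V → r :* (k :* k :* V) :+ k :* k :* r :* V := r :* (con (+ 2) :* (k :* (k :* V)))) ≈-refl q-1 (nat κ) V₂ ⟩
      q-1 * (ι (+ 2) * (nat κ * (nat κ * V₂))) ∎)))
      where
      V₂ = ∑ xs (λ ξ → v ξ * v ξ)

    module Weights (v : Vect d → Carrier) (v≥0 : ∀ ξ → NN (v ξ)) (v⋆ : ∀ ξ → v ξ ⋆ ≈ v ξ) (h : ℕ) (v≤h : ∀ ξ → v ξ ≤ nat h) where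

      -- Since q times the indicator of t = 0 is 1 + ψ(t), the constant 1 gives the expected count
      -- (∑ v)², and ψ gives a bilinear form bounded by `form-≤`. There ∑ v² is at most h ∑ v.
      incidences-≤ : ∀ (xs : List (Vect d)) (t : Vect d → Vect d → 𝔽.Carrier) →
        q-1 * ∑ xs (λ ξ → ∑ xs (λ ξ' → v ξ' * ι (ψ (t ξ ξ'))) * ∑ xs (λ ξ' → v ξ' * ι (ψ (t ξ ξ'))))
          ≤ ι (qq d) * ∑ xs (λ ξ → v ξ * v ξ) →
        nat q * ∑ xs (λ ξ → ∑ xs (λ ξ' → v ξ * v ξ' * ι ℤT.⟦ does (t ξ ξ' ≟ 𝔽.0#) ⟧))
          ≤ ∑ xs v * ∑ xs v + nat (κ ℕ.* h) * ∑ xs v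
      incidences-≤ xs t hyp = begin
        nat q * ∑ xs (λ ξ → ∑ xs (λ ξ' → v ξ * v ξ' * ι (δ ξ ξ')))
          ≈⟨ ≈-trans (≈-sym (∑-*ˡ xs _ _)) (∑-cong xs (λ ξ → ≈-sym (∑-*ˡ xs _ _))) ⟩
        ∑ xs (λ ξ → ∑ xs (λ ξ' → nat q * (v ξ * v ξ' * ι (δ ξ ξ'))))
          ≈⟨ ∑-cong xs (λ ξ → ≈-trans (∑-cong xs (λ ξ' → expand ξ ξ')) (∑-+ xs _ _)) ⟩
        ∑ xs (λ ξ → ∑ xs (λ ξ' → v ξ * v ξ') + ∑ xs (λ ξ' → v ξ * (v ξ' * ι (ψ (t ξ ξ')))))
          ≈⟨ ≈-trans (∑-+ xs _ _) (+-cong (≈-sym (∑-*-∑ xs xs v v)) (∑-cong xs (λ ξ → ∑-*ˡ xs _ _))) ⟩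
        ∑ xs v * ∑ xs v + ∑ xs (λ ξ → v ξ * b ξ)
          ≲⟨ +-mono ≤-refl (form-≤ xs v b v⋆ (λ ξ → ≈-trans (∑-⋆ xs _) (∑-cong xs (λ ξ' → ≈-trans (⋆-* _ _) (*-cong (v⋆ ξ') (⋆-ι (ψ (t ξ ξ'))))))) hyp) ⟩
        ∑ xs v * ∑ xs v + nat κ * ∑ xs (λ ξ → v ξ * v ξ)
          ≲⟨ +-mono ≤-refl (*-monoˡ (NN-ι κ) (∑-mono xs (λ ξ → *-monoʳ (v≥0 ξ) (v≤h ξ)))) ⟩
        ∑ xs v * ∑ xs v + nat κ * ∑ xs (λ ξ → nat h * v ξ)
          ≈⟨ +-congˡ (≈-trans (*-congˡ (∑-*ˡ xs _ _)) (≈-trans (≈-sym (*-assoc _ _ _)) (*-congʳ (≈-sym (nat-* κ h))))) ⟩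
        ∑ xs v * ∑ xs v + nat (κ ℕ.* h) * ∑ xs v ∎
        where
        δ : Vect d → Vect d → ℤ
        δ ξ ξ' = ℤT.⟦ does (t ξ ξ' ≟ 𝔽.0#) ⟧
        b : Vect d → Carrier
        b ξ = ∑ xs (λ ξ' → v ξ' * ι (ψ (t ξ ξ')))
        expand : ∀ ξ ξ' → nat q * (v ξ * v ξ' * ι (δ ξ ξ')) ≈ v ξ * v ξ' + v ξ * (v ξ' * ι (ψ (t ξ ξ')))
        expand ξ ξ' = ≈-trans
          (solve 4 (λ q a b e → q :* (a :* b :* e) := a :* b :+ a :* (b :* (q :* e :+ (:- con (+ 1))))) ≈-refl (nat q) (v ξ) (v ξ') (ι (δ ξ ξ')))
          (+-congˡ (*-congˡ (*-congˡ (≈-sym (≈-trans (ι-+ (+ q ℤ.* δ ξ ξ') (ℤ.- + 1)) (+-congʳ (ι-* (+ q) (δ ξ ξ'))))))))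

      module OnSphere {a : 𝔽.Carrier} (a≢0 : a ≢ 𝔽.0#) where
        private
          S = sphere d a

        -- By scale invariance of `ψ`, the inner sum at ξ equals the sum β at every point (ζξ, ζ)
        -- with ζ ≠ 0, and ζ times the sphere is the slice ζ of the quadric. So q - 1 copies of the
        -- second moment fit into the one over the whole quadric, where the kernel is orthogonal;
        -- the slice ζ = 0 adds something nonnegative.
        tangent-pairs-≤ : nat q * ∑ S (λ ξ → ∑ S (λ ξ' → v ξ * v ξ' * ι ℤT.⟦ does ((ξ ∙ ξ' 𝔽.- a) ≟ 𝔽.0#) ⟧))
                          ≤ ∑ S v * ∑ S v + nat (κ ℕ.* h) * ∑ S v
        tangent-pairs-≤ = incidences-≤ S (λ ξ ξ' → ξ ∙ ξ' 𝔽.- a) (begin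
          q-1 * ∑ S (λ ξ → b ξ * b ξ)                 ≈⟨ ∑-units-constᴿ _ ⟨
          ∑ units (λ ζ → ∑ S (λ ξ → b ξ * b ξ))        ≈⟨ ∑-cong-filter nz elements (λ ζ hζ → rescale ζ (nz⇒≢0 hζ)) ⟩
          ∑ units (λ ζ → ∑ (Q ζ) (λ y → β ζ y * β ζ y)) ≲⟨ ∑-filter-≤ nz elements (λ ζ → NN-∑ (Q ζ) (λ y → NN-sq-self (β⋆ ζ y))) ⟩
          ∑ elements (λ ζ → ∑ (Q ζ) (λ y → β ζ y * β ζ y)) ≈⟨ ∑-cong elements (λ ζ → ∑-gram (Q ζ) S (λ y ξ' → ψ (k y ζ ξ')) v) ⟩
          ∑ elements (λ ζ → ∑ S (λ ξ → ∑ S (λ ξ' → v ξ * v ξ' * ι (A ζ ξ ξ'))))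
            ≈⟨ ≈-trans (∑-swap elements S _) (∑-cong S (λ ξ → ≈-trans (∑-swap elements S _) (∑-cong S (λ ξ' → ≈-trans (∑-*ˡ elements _ _) (*-congˡ (≈-sym (ι-∑ elements (λ ζ → A ζ ξ ξ')))))))) ⟩
          ∑ S (λ ξ → ∑ S (λ ξ' → v ξ * v ξ' * ι (ℤT.∑ elements (λ ζ → A ζ ξ ξ'))))
            ≈⟨ ∑-cong-filter (onSphere a) (allVecs d) (λ ξ hξ → ∑-cong-filter (onSphere a) (allVecs d) (λ ξ' hξ' → *-congˡ (reflexive (cong ι
                 (𝔽.orthogonal-on-quadric {n} a≢0 ξ ξ' (onSphere⇒ ξ hξ) (onSphere⇒ ξ' hξ')))))) ⟩
          ∑ S (λ ξ → ∑ S (λ ξ' → v ξ * v ξ' * ι (qq d ℤ.* ℤT.⟦ does (ξ ≟ᵛ ξ') ⟧)))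
            ≈⟨ ∑-filter-diagonal (onSphere a) v (qq d) ⟩
          ι (qq d) * ∑ S (λ ξ → v ξ * v ξ) ∎)
          where
          k : Vect d → 𝔽.Carrier → Vect d → 𝔽.Carrier
          k y ζ ξ' = y ∙ ξ' 𝔽.- a 𝔽.* ζ
          Q : 𝔽.Carrier → List (Vect d)
          Q ζ = filterᵇ (quadric a ζ) (allVecs d)
          A : 𝔽.Carrier → Vect d → Vect d → ℤ
          A ζ ξ ξ' = ℤT.∑ (Q ζ) (λ y → ψ (k y ζ ξ) ℤ.* ψ (k y ζ ξ'))
          b : Vect d → Carrier
          b ξ = ∑ S (λ ξ' → v ξ' * ι (ψ (ξ ∙ ξ' 𝔽.- a)))
          β : 𝔽.Carrier → Vect d → Carrier
          β ζ y = ∑ S (λ ξ' → v ξ' * ι (ψ (k y ζ ξ')))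
          β⋆ : ∀ ζ y → β ζ y ⋆ ≈ β ζ y
          β⋆ ζ y = ≈-trans (∑-⋆ S _) (∑-cong S (λ ξ' → ≈-trans (⋆-* _ _) (*-cong (v⋆ ξ') (⋆-ι (ψ (k y ζ ξ'))))))
          β-scale : ∀ ζ ξ → ζ ≢ 𝔽.0# → b ξ ≈ β ζ (ζ · ξ)
          β-scale ζ ξ ζ≢0 = ∑-cong S (λ ξ' → *-congˡ (reflexive (cong ι (trans (sym (𝔽.ψ-*ˡ (ξ ∙ ξ' 𝔽.- a) ζ≢0)) (cong ψ
            (trans (𝔽.solve 3 (λ ζ p a → ζ 𝔽.:* (p 𝔽.:- a) 𝔽.:= ζ 𝔽.:* p 𝔽.:- a 𝔽.:* ζ) refl ζ (ξ ∙ ξ') a) (cong (𝔽._- (a 𝔽.* ζ)) (sym (𝔽.∙-·ˡ ζ ξ ξ')))))))))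
          rescale : ∀ ζ → ζ ≢ 𝔽.0# → ∑ S (λ ξ → b ξ * b ξ) ≈ ∑ (Q ζ) (λ y → β ζ y * β ζ y)
          rescale ζ ζ≢0 =
            ≈-trans (∑-filter (onSphere a) (allVecs d) _)
            (≈-trans (∑-cong (allVecs d) (λ ξ → *-cong (reflexive (cong ⟦_⟧ (does-cong (‖ ξ ‖ ≟ a) (‖ ζ · ξ ‖ ≟ (a 𝔽.* (ζ 𝔽.* ζ))) (to ξ) (from ξ)))) (*-cong (β-scale ζ ξ ζ≢0) (β-scale ζ ξ ζ≢0))))
            (≈-trans (𝔽.VecSums.∑-scale commutativeRing ζ≢0 (λ y → ⟦ quadric a ζ y ⟧ * (β ζ y * β ζ y)))
                     (≈-sym (∑-filter (quadric a ζ) (allVecs d) _))))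
            where
            to : ∀ ξ → ‖ ξ ‖ ≡ a → ‖ ζ · ξ ‖ ≡ a 𝔽.* (ζ 𝔽.* ζ)
            to ξ e = trans (𝔽.‖·‖ ζ ξ) (trans (cong (ζ 𝔽.* ζ 𝔽.*_) e) (𝔽.*-comm _ a))
            from : ∀ ξ → ‖ ζ · ξ ‖ ≡ a 𝔽.* (ζ 𝔽.* ζ) → ‖ ξ ‖ ≡ a
            from ξ e = 𝔽.*-cancelˡ (𝔽.*-≢0 ζ≢0 ζ≢0) (trans (sym (𝔽.‖·‖ ζ ξ)) (trans e (𝔽.*-comm a _)))

        nonisotropicFrom : Vect d → Vect d → Bool
        nonisotropicFrom x ξ = nz (‖ ξ -ᵛ x ‖)

        N : Vect d → List (Vect d)
        N x = filterᵇ (λ ξ → onSphere a ξ ∧ nonisotropicFrom x ξ) (allVecs d)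

        bound : Carrier
        bound = ∑ S v * ∑ S v + nat (κ ℕ.* h) * ∑ S v

        -- The inner sum depends only on the line spanned by ξ - x. The q - 1 dilates of the set of
        -- these differences cover each vector at most once, so q - 1 copies of the second moment
        -- are at most the sum over all of F^d, which `orthogonal-at` makes diagonal.
        nonisotropic-pairs-≤ : ∀ x → ‖ x ‖ ≡ a →
          nat q * ∑ (N x) (λ ξ → ∑ (N x) (λ ξ' → v ξ * v ξ' * ι ℤT.⟦ does (((ξ -ᵛ x) ∙ (ξ' -ᵛ x)) ≟ 𝔽.0#) ⟧)) ≤ bound
        nonisotropic-pairs-≤ x hx = ≤-trans (incidences-≤ (N x) (λ ξ ξ' → (ξ -ᵛ x) ∙ (ξ' -ᵛ x)) (begin
          q-1 * ∑ (N x) (λ ξ → g (ξ -ᵛ x))               ≈⟨ ∑-units-constᴿ _ ⟨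
          ∑ units (λ r → ∑ (N x) (λ ξ → g (ξ -ᵛ x)))      ≈⟨ ∑-cong-filter nz elements (λ r hr → rescale r (nz⇒≢0 hr)) ⟩
          ∑ units (λ r → ∑ (allVecs d) (λ y → ⟦ p ((r · y) +ᵛ x) ⟧ * g y))   ≈⟨ ∑-swap units (allVecs d) _ ⟩
          ∑ (allVecs d) (λ y → ∑ units (λ r → ⟦ p ((r · y) +ᵛ x) ⟧ * g y))   ≈⟨ ∑-cong (allVecs d) (λ y → ∑-*ʳ units _ (g y)) ⟩
          ∑ (allVecs d) (λ y → ∑ units (λ r → ⟦ p ((r · y) +ᵛ x) ⟧) * g y)   ≲⟨ ∑-mono (allVecs d) (λ y → *-monoʳ (NN-sq-self (β⋆ y)) (count y)) ⟩
          ∑ (allVecs d) (λ y → 1# * g y)                 ≈⟨ ∑-cong (allVecs d) (λ y → *-identityˡ _) ⟩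
          ∑ (allVecs d) g                                ≈⟨ ∑-gram (allVecs d) (N x) (λ y ξ' → ψ (y ∙ (ξ' -ᵛ x))) v ⟩
          ∑ (N x) (λ ξ → ∑ (N x) (λ ξ' → v ξ * v ξ' * ι (ℤT.∑ (allVecs d) (λ y → ψ (y ∙ (ξ -ᵛ x)) ℤ.* ψ (y ∙ (ξ' -ᵛ x))))))
            ≈⟨ ∑-cong-filter p (allVecs d) (λ ξ pξ → ∑-cong-filter p (allVecs d) (λ ξ' pξ' → *-congˡ (reflexive (cong ι
                 (𝔽.orthogonal-at x ξ ξ' hx (onSphere⇒ ξ (proj₁ (∧-split _ _ pξ))) (onSphere⇒ ξ' (proj₁ (∧-split _ _ pξ'))) (nz⇒≢0 (proj₂ (∧-split (onSphere a ξ') _ pξ')))))))) ⟩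
          ∑ (N x) (λ ξ → ∑ (N x) (λ ξ' → v ξ * v ξ' * ι (qq d ℤ.* ℤT.⟦ does (ξ ≟ᵛ ξ') ⟧)))
            ≈⟨ ∑-filter-diagonal p v (qq d) ⟩
          ι (qq d) * ∑ (N x) (λ ξ → v ξ * v ξ) ∎))
          (+-mono (*-mono (NN-∑ (N x) v≥0) (NN-∑ S v≥0) N≤S N≤S) (*-monoˡ (NN-ι (κ ℕ.* h)) N≤S))
          where
          p : Vect d → Bool
          p ξ = onSphere a ξ ∧ nonisotropicFrom x ξ
          β : Vect d → Carrier
          β y = ∑ (N x) (λ ξ' → v ξ' * ι (ψ (y ∙ (ξ' -ᵛ x))))
          g : Vect d → Carrier
          g y = β y * β y
          β⋆ : ∀ y → β y ⋆ ≈ β y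
          β⋆ y = ≈-trans (∑-⋆ (N x) _) (∑-cong (N x) (λ ξ' → ≈-trans (⋆-* _ _) (*-cong (v⋆ ξ') (⋆-ι (ψ (y ∙ (ξ' -ᵛ x)))))))
          N≤S : ∑ (N x) v ≤ ∑ S v
          N≤S = begin
            ∑ (N x) v                                     ≈⟨ ∑-filter-∧ (onSphere a) (nonisotropicFrom x) (allVecs d) v ⟩
            ∑ S (λ ξ → ⟦ nonisotropicFrom x ξ ⟧ * v ξ)     ≲⟨ ∑-mono S (λ ξ → *-monoʳ (v≥0 ξ) (⟦⟧-≤1 (nonisotropicFrom x ξ))) ⟩
            ∑ S (λ ξ → 1# * v ξ)                          ≈⟨ ∑-cong S (λ ξ → *-identityˡ (v ξ)) ⟩
            ∑ S v                                         ∎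
            where
            ⟦⟧-≤1 : ∀ b → ⟦ b ⟧ ≤ 1#
            ⟦⟧-≤1 true  = ≤-refl
            ⟦⟧-≤1 false = NN⇒≤ NN-1
          g-scale : ∀ r y → r ≢ 𝔽.0# → g (r · y) ≈ g y
          g-scale r y r≢0 = *-cong β-scale β-scale
            where
            β-scale : β (r · y) ≈ β y
            β-scale = ∑-cong (N x) (λ ξ' → *-congˡ (reflexive (cong ι (trans (cong ψ (𝔽.∙-·ˡ r y (ξ' -ᵛ x))) (𝔽.ψ-*ˡ (y ∙ (ξ' -ᵛ x)) r≢0)))))
          rescale : ∀ r → r ≢ 𝔽.0# → ∑ (N x) (λ ξ → g (ξ -ᵛ x)) ≈ ∑ (allVecs d) (λ y → ⟦ p ((r · y) +ᵛ x) ⟧ * g y)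
          rescale r r≢0 =
            ≈-trans (∑-filter p (allVecs d) _)
            (≈-trans (≈-sym (𝔽.VecSums.∑-translate commutativeRing x (λ ξ → ⟦ p ξ ⟧ * g (ξ -ᵛ x))))
            (≈-trans (∑-cong (allVecs d) (λ u → *-congˡ (reflexive (cong g (𝔽.+ᵛ-ᵛ u x)))))
            (≈-trans (≈-sym (𝔽.VecSums.∑-scale commutativeRing r≢0 (λ u → ⟦ p (u +ᵛ x) ⟧ * g u)))
                     (∑-cong (allVecs d) (λ y → *-congˡ (g-scale r y r≢0))))))
          -- If x and x + r y are on the sphere, then r² ‖y‖ = -2 r x·y. With r and ‖y‖ nonzero this
          -- determines r as `r₀`.
          count : ∀ y → ∑ units (λ r → ⟦ p ((r · y) +ᵛ x) ⟧) ≤ 1#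
          count y = begin
            ∑ units (λ r → ⟦ p ((r · y) +ᵛ x) ⟧)        ≲⟨ ∑-mono-filter nz elements (λ r hr → ⟦⟧-≤ (p ((r · y) +ᵛ x)) (r ≟ r₀) (solution r (nz⇒≢0 hr))) ⟩
            ∑ units (λ r → ⟦ does (r ≟ r₀) ⟧)            ≲⟨ ∑-filter-≤ nz elements (λ r → NN-⟦⟧ (does (r ≟ r₀))) ⟩
            ∑ elements (λ r → ⟦ does (r ≟ r₀) ⟧)         ≈⟨ ∑-cong elements (λ r → ≈-sym (*-identityʳ _)) ⟩
            ∑ elements (λ r → ⟦ does (r ≟ r₀) ⟧ * 1#)    ≈⟨ 𝔽.RF.select commutativeRing (λ _ → 1#) r₀ ⟩
            1# ∎
            where
            two = 𝔽.1# 𝔽.+ 𝔽.1#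
            r₀ = (𝔽.- (two 𝔽.* x ∙ y)) 𝔽./ (‖ y ‖)
            solution : ∀ r → r ≢ 𝔽.0# → p ((r · y) +ᵛ x) ≡ true → r ≡ r₀
            solution r r≢0 e with ∧-split (onSphere a ((r · y) +ᵛ x)) _ e
            ... | e₁ , e₂ = 𝔽.*-cancelˡ y≢0 (trans (𝔽.*-cancelˡ r≢0 eq) (sym (𝔽.*-/ _ y≢0)))
              where
              u≡ : ((r · y) +ᵛ x) -ᵛ x ≡ r · y
              u≡ = 𝔽.+ᵛ-ᵛ (r · y) x
              norm-u : ‖ ((r · y) +ᵛ x) -ᵛ x ‖ ≡ r 𝔽.* r 𝔽.* ‖ y ‖
              norm-u = trans (cong ‖_‖ u≡) (𝔽.‖·‖ r y)
              y≢0 : ‖ y ‖ ≢ 𝔽.0#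
              y≢0 y≡0 = nz⇒≢0 e₂ (trans norm-u (trans (cong (r 𝔽.* r 𝔽.*_) y≡0) (𝔽.zeroʳ _)))
              eq : r 𝔽.* (‖ y ‖ 𝔽.* r) ≡ r 𝔽.* (𝔽.- (two 𝔽.* x ∙ y))
              eq = trans (𝔽.solve 2 (λ r n → r 𝔽.:* (n 𝔽.:* r) 𝔽.:= r 𝔽.:* r 𝔽.:* n) refl r (‖ y ‖))
                   (trans (sym norm-u)
                   (trans (𝔽.tangent x ((r · y) +ᵛ x) hx (onSphere⇒ ((r · y) +ᵛ x) e₁))
                   (trans (cong (λ z → 𝔽.- (two 𝔽.* x ∙ z)) u≡)
                   (trans (cong (λ z → 𝔽.- (two 𝔽.* z)) (𝔽.∙-·ʳ r x y))
                          (𝔽.solve 2 (λ r z → 𝔽.:- (𝔽.con (+ 2) 𝔽.:* (r 𝔽.:* z)) 𝔽.:= r 𝔽.:* (𝔽.:- (𝔽.con (+ 2) 𝔽.:* z))) refl r (x ∙ y))))))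

        right-angle : Vect d → Vect d → Vect d → Carrier
        right-angle x ξ ξ' = ι ℤT.⟦ does (((ξ -ᵛ x) ∙ (ξ' -ᵛ x)) ≟ 𝔽.0#) ⟧

        isotropic : Vect d → Vect d → Carrier
        isotropic x ξ = ι ℤT.⟦ does (‖ ξ -ᵛ x ‖ ≟ 𝔽.0#) ⟧

        -- Either both legs are nonisotropic, or one of them is isotropic. In the second case the
        -- right angle is forgotten and the end of the other leg runs over the whole sphere. The
        -- factor 2 counts the choice of the isotropic leg.
        right-angles-at-≤ : ∀ x → ‖ x ‖ ≡ a →
          nat q * ∑ S (λ ξ → ∑ S (λ ξ' → v ξ * v ξ' * right-angle x ξ ξ'))
          ≤ bound + ι (+ 2) * (nat q * (∑ S (λ ξ → v ξ * isotropic x ξ) * ∑ S v))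
        right-angles-at-≤ x hx = begin
          nat q * ∑ S (λ ξ → ∑ S (λ ξ' → v ξ * v ξ' * G ξ ξ'))
            ≲⟨ *-monoˡ (NN-ι q) (∑-mono S (λ ξ → ∑-mono S (λ ξ' → *-monoˡ (NN-* (v≥0 ξ) (v≥0 ξ'))
                 (split (does (‖ ξ -ᵛ x ‖ ≟ 𝔽.0#)) (does (‖ ξ' -ᵛ x ‖ ≟ 𝔽.0#)) (does (((ξ -ᵛ x) ∙ (ξ' -ᵛ x)) ≟ 𝔽.0#)))))) ⟩
          nat q * ∑ S (λ ξ → ∑ S (λ ξ' → v ξ * v ξ' * (c ξ * (c ξ' * G ξ ξ') + (i ξ + i ξ'))))
            ≈⟨ *-congˡ (∑-cong S (λ ξ → ≈-trans (∑-cong S (λ ξ' → solve 7 (λ a b c c' g i i' →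
                  a :* b :* (c :* (c' :* g) :+ (i :+ i')) := c :* (c' :* (a :* b :* g)) :+ (a :* i :* b :+ a :* (b :* i')))
                  ≈-refl (v ξ) (v ξ') (c ξ) (c ξ') (G ξ ξ') (i ξ) (i ξ'))) (∑-+ S _ _))) ⟩
          nat q * ∑ S (λ ξ → ∑ S (λ ξ' → c ξ * (c ξ' * (v ξ * v ξ' * G ξ ξ'))) + ∑ S (λ ξ' → v ξ * i ξ * v ξ' + v ξ * (v ξ' * i ξ')))
            ≈⟨ *-congˡ (≈-trans (∑-+ S _ _) (+-cong nn iso)) ⟩
          nat q * (∑ (N x) (λ ξ → ∑ (N x) (λ ξ' → v ξ * v ξ' * G ξ ξ')) + ι (+ 2) * (I * ∑ S v))
            ≈⟨ solve 4 (λ q A I X → q :* (A :+ con (+ 2) :* (I :* X)) := q :* A :+ con (+ 2) :* (q :* (I :* X))) ≈-refl (nat q) _ I (∑ S v) ⟩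
          nat q * ∑ (N x) (λ ξ → ∑ (N x) (λ ξ' → v ξ * v ξ' * G ξ ξ')) + ι (+ 2) * (nat q * (I * ∑ S v))
            ≲⟨ +-mono (nonisotropic-pairs-≤ x hx) ≤-refl ⟩
          bound + ι (+ 2) * (nat q * (I * ∑ S v)) ∎
          where
          G = right-angle x
          i = isotropic x
          I = ∑ S (λ ξ → v ξ * i ξ)
          c : Vect d → Carrier
          c ξ = ⟦ nonisotropicFrom x ξ ⟧
          split : ∀ i i' g → ι ℤT.⟦ g ⟧ ≤ ⟦ not i ⟧ * (⟦ not i' ⟧ * ι ℤT.⟦ g ⟧) + (ι ℤT.⟦ i ⟧ + ι ℤT.⟦ i' ⟧)
          split false false g = ≤-reflexive (solve 1 (λ g → g := con (+ 1) :* (con (+ 1) :* g) :+ (con (+ 0) :+ con (+ 0))) ≈-refl (ι ℤT.⟦ g ⟧))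
          split false true g = ≤-trans (⟦⟧≤1 g) (≤-reflexive (solve 1 (λ g → con (+ 1) := con (+ 1) :* (con (+ 0) :* g) :+ (con (+ 0) :+ con (+ 1))) ≈-refl (ι ℤT.⟦ g ⟧)))
          split true i' g = ≤-trans (⟦⟧≤1 g) (NN-resp (solve 3 (λ c g i → i := con (+ 0) :* (c :* g) :+ (con (+ 1) :+ i) :- con (+ 1)) ≈-refl ⟦ not i' ⟧ (ι ℤT.⟦ g ⟧) (ι ℤT.⟦ i' ⟧)) (NN-ι⟦⟧ i'))
          nn : ∑ S (λ ξ → ∑ S (λ ξ' → c ξ * (c ξ' * (v ξ * v ξ' * G ξ ξ')))) ≈ ∑ (N x) (λ ξ → ∑ (N x) (λ ξ' → v ξ * v ξ' * G ξ ξ'))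
          nn = ≈-trans (∑-cong S (λ ξ → ≈-trans (∑-*ˡ S (c ξ) _) (*-congˡ (≈-sym (∑-filter-∧ (onSphere a) (nonisotropicFrom x) (allVecs d) _)))))
                       (≈-sym (∑-filter-∧ (onSphere a) (nonisotropicFrom x) (allVecs d) _))
          iso : ∑ S (λ ξ → ∑ S (λ ξ' → v ξ * i ξ * v ξ' + v ξ * (v ξ' * i ξ'))) ≈ ι (+ 2) * (I * ∑ S v)
          iso = ≈-trans (∑-cong S (λ ξ → ∑-+ S _ _)) (≈-trans (∑-+ S _ _)
                (≈-trans (+-cong (≈-sym (∑-*-∑ S S (λ ξ → v ξ * i ξ) v)) (≈-sym (∑-*-∑ S S v (λ ξ → v ξ * i ξ))))
                         (solve 2 (λ I X → I :* X :+ X :* I := con (+ 2) :* (I :* X)) ≈-refl I (∑ S v))))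

        -- On the sphere ‖ξ - x‖ = -2(x·ξ - a), so summing the isotropic legs over the vertex gives
        -- the pairs of `tangent-pairs-≤`. The constant 3 is one contribution of nonisotropic legs
        -- plus two of isotropic ones.
        right-angles-≤ : nat q * ∑ S (λ x → v x * ∑ S (λ ξ → ∑ S (λ ξ' → v ξ * v ξ' * right-angle x ξ ξ'))) ≤ ι (+ 3) * (∑ S v * bound)
        right-angles-≤ = begin
          nat q * ∑ S (λ x → v x * Θ x)                 ≈⟨ ≈-trans (≈-sym (∑-*ˡ S _ _)) (∑-cong S (λ x → solve 3 (λ a b c → a :* (b :* c) := b :* (a :* c)) ≈-refl (nat q) (v x) (Θ x))) ⟩
          ∑ S (λ x → v x * (nat q * Θ x))               ≲⟨ ∑-mono-filter (onSphere a) (allVecs d) (λ x hx → *-monoˡ (v≥0 x) (right-angles-at-≤ x (onSphere⇒ x hx))) ⟩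
          ∑ S (λ x → v x * (bound + ι (+ 2) * (nat q * (I x * ∑ S v))))
            ≈⟨ ≈-trans (∑-cong S (λ x → solve 5 (λ v B q I X → v :* (B :+ con (+ 2) :* (q :* (I :* X))) := v :* B :+ con (+ 2) :* (q :* X) :* (v :* I)) ≈-refl (v x) bound (nat q) (I x) (∑ S v)))
                 (≈-trans (∑-+ S _ _) (+-cong (∑-*ʳ S v bound) (∑-*ˡ S _ _))) ⟩
          ∑ S v * bound + ι (+ 2) * (nat q * ∑ S v) * ∑ S (λ x → v x * I x)
            ≈⟨ +-congˡ (solve 3 (λ q X Y → con (+ 2) :* (q :* X) :* Y := con (+ 2) :* X :* (q :* Y)) ≈-refl (nat q) (∑ S v) _) ⟩
          ∑ S v * bound + ι (+ 2) * ∑ S v * (nat q * ∑ S (λ x → v x * I x))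
            ≈⟨ +-congˡ (*-congˡ (*-congˡ (∑-cong-filter (onSphere a) (allVecs d) (λ x hx → ≈-trans (≈-sym (∑-*ˡ S (v x) _))
                 (∑-cong-filter (onSphere a) (allVecs d) (λ ξ hξ → ≈-trans (≈-sym (*-assoc _ _ _)) (*-congˡ (reflexive (cong (λ b → ι ℤT.⟦ b ⟧) (iff x ξ (onSphere⇒ x hx) (onSphere⇒ ξ hξ))))))))))) ⟩
          ∑ S v * bound + ι (+ 2) * ∑ S v * (nat q * ∑ S (λ x → ∑ S (λ ξ → v x * v ξ * ι ℤT.⟦ does ((x ∙ ξ 𝔽.- a) ≟ 𝔽.0#) ⟧)))
            ≲⟨ +-mono ≤-refl (*-monoˡ (NN-* (NN-ι 2) (NN-∑ S v≥0)) tangent-pairs-≤) ⟩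
          ∑ S v * bound + ι (+ 2) * ∑ S v * bound
            ≈⟨ solve 2 (λ X B → X :* B :+ con (+ 2) :* X :* B := con (+ 3) :* (X :* B)) ≈-refl (∑ S v) bound ⟩
          ι (+ 3) * (∑ S v * bound) ∎
          where
          Θ : Vect d → Carrier
          Θ x = ∑ S (λ ξ → ∑ S (λ ξ' → v ξ * v ξ' * right-angle x ξ ξ'))
          I : Vect d → Carrier
          I x = ∑ S (λ ξ → v ξ * isotropic x ξ)
          iff : ∀ x ξ → ‖ x ‖ ≡ a → ‖ ξ ‖ ≡ a → does (‖ ξ -ᵛ x ‖ ≟ 𝔽.0#) ≡ does ((x ∙ ξ 𝔽.- a) ≟ 𝔽.0#)
          iff x ξ hx hξ = does-cong (‖ ξ -ᵛ x ‖ ≟ 𝔽.0#) ((x ∙ ξ 𝔽.- a) ≟ 𝔽.0#)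
            (λ e → 𝔽.*-cancelˡ (𝔽.-≢0 2≢0) (trans (sym eq) (trans e (sym (𝔽.zeroʳ _)))))
            (λ e → trans eq (trans (cong ((𝔽.- (𝔽.1# 𝔽.+ 𝔽.1#)) 𝔽.*_) e) (𝔽.zeroʳ _)))
            where
            eq : ‖ ξ -ᵛ x ‖ ≡ (𝔽.- (𝔽.1# 𝔽.+ 𝔽.1#)) 𝔽.* (x ∙ ξ 𝔽.- a)
            eq = trans (𝔽.‖-‖ ξ x) (trans (cong₂ (λ p r → p 𝔽.- (𝔽.1# 𝔽.+ 𝔽.1#) 𝔽.* ξ ∙ x 𝔽.+ r) hξ hx)
                 (trans (cong (λ z → a 𝔽.- (𝔽.1# 𝔽.+ 𝔽.1#) 𝔽.* z 𝔽.+ a) (𝔽.∙-comm ξ x))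
                        (𝔽.solve 2 (λ a p → a 𝔽.:- 𝔽.con (+ 2) 𝔽.:* p 𝔽.:+ a 𝔽.:= (𝔽.:- 𝔽.con (+ 2)) 𝔽.:* (p 𝔽.:- a)) refl a (x ∙ ξ))))

        parallelogram : Vect d → Vect d → Vect d → Vect d → Carrier
        parallelogram ξ₁ ξ₂ ξ₃ ξ₄ = ι ℤT.⟦ does ((ξ₁ -ᵛ ξ₂) ≟ᵛ (ξ₃ -ᵛ ξ₄)) ⟧

        -- A parallelogram inscribed in a sphere is a rectangle.
        energy-≤ : nat q * ∑ S (λ ξ₁ → v ξ₁ * ∑ S (λ ξ₂ → ∑ S (λ ξ₃ → v ξ₂ * v ξ₃ * ∑ S (λ ξ₄ → v ξ₄ * parallelogram ξ₁ ξ₂ ξ₃ ξ₄))))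
                   ≤ ι (+ 3) * (nat h * (∑ S v * bound))
        energy-≤ = begin
          nat q * ∑ S (λ ξ₁ → v ξ₁ * ∑ S (λ ξ₂ → ∑ S (λ ξ₃ → v ξ₂ * v ξ₃ * ∑ S (λ ξ₄ → v ξ₄ * parallelogram ξ₁ ξ₂ ξ₃ ξ₄))))
            ≲⟨ *-monoˡ (NN-ι q) (∑-mono-filter (onSphere a) (allVecs d) (λ ξ₁ h₁ → *-monoˡ (v≥0 ξ₁) (∑-mono-filter (onSphere a) (allVecs d) (λ ξ₂ h₂ →
                 ∑-mono-filter (onSphere a) (allVecs d) (λ ξ₃ h₃ → *-monoˡ (NN-* (v≥0 ξ₂) (v≥0 ξ₃)) (fourth ξ₁ ξ₂ ξ₃ (onSphere⇒ ξ₁ h₁) (onSphere⇒ ξ₂ h₂) (onSphere⇒ ξ₃ h₃))))))) ⟩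
          nat q * ∑ S (λ ξ₁ → v ξ₁ * ∑ S (λ ξ₂ → ∑ S (λ ξ₃ → v ξ₂ * v ξ₃ * (nat h * right-angle ξ₁ ξ₂ ξ₃))))
            ≈⟨ *-congˡ (≈-trans (∑-cong S (λ ξ₁ → ≈-trans (*-congˡ (≈-trans (∑-cong S (λ ξ₂ → ≈-trans (∑-cong S (λ ξ₃ →
                 swap (v ξ₂ * v ξ₃) (nat h) _)) (∑-*ˡ S (nat h) _))) (∑-*ˡ S (nat h) _))) (swap (v ξ₁) (nat h) _))) (∑-*ˡ S (nat h) _)) ⟩
          nat q * (nat h * ∑ S (λ x → v x * ∑ S (λ ξ → ∑ S (λ ξ' → v ξ * v ξ' * right-angle x ξ ξ'))))
            ≈⟨ swap (nat q) (nat h) _ ⟩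
          nat h * (nat q * ∑ S (λ x → v x * ∑ S (λ ξ → ∑ S (λ ξ' → v ξ * v ξ' * right-angle x ξ ξ'))))
            ≲⟨ *-monoˡ (NN-ι h) right-angles-≤ ⟩
          nat h * (ι (+ 3) * (∑ S v * bound))
            ≈⟨ swap (nat h) (ι (+ 3)) _ ⟩
          ι (+ 3) * (nat h * (∑ S v * bound)) ∎
          where
          swap : ∀ x y z → x * (y * z) ≈ y * (x * z)
          swap x y z = solve 3 (λ x y z → x :* (y :* z) := y :* (x :* z)) ≈-refl x y z
          cancel : ∀ {m} (x y z : Vect m) → x ≡ y -ᵛ z → z ≡ y -ᵛ x
          cancel [] [] [] _ = refl
          cancel (a ∷ x) (b ∷ y) (c ∷ z) e = cong₂ _∷_
            (trans (𝔽.solve 2 (λ b c → c 𝔽.:= b 𝔽.:- (b 𝔽.:- c)) refl b c) (cong (λ z → b 𝔽.- z) (sym (VP.∷-injectiveˡ e)))) (cancel x y z (VP.∷-injectiveʳ e))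
          -- The fourth vertex is forced to be `w`, so a single term is left, and its weight is at
          -- most `h`.
          fourth : ∀ ξ₁ ξ₂ ξ₃ → ‖ ξ₁ ‖ ≡ a → ‖ ξ₂ ‖ ≡ a → ‖ ξ₃ ‖ ≡ a →
            ∑ S (λ ξ₄ → v ξ₄ * parallelogram ξ₁ ξ₂ ξ₃ ξ₄) ≤ nat h * right-angle ξ₁ ξ₂ ξ₃
          fourth ξ₁ ξ₂ ξ₃ h₁ h₂ h₃ = begin
            ∑ S (λ ξ₄ → v ξ₄ * parallelogram ξ₁ ξ₂ ξ₃ ξ₄)     ≈⟨ ∑-filter (onSphere a) (allVecs d) _ ⟩
            ∑ (allVecs d) (λ ξ₄ → ⟦ onSphere a ξ₄ ⟧ * (v ξ₄ * parallelogram ξ₁ ξ₂ ξ₃ ξ₄))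
              ≈⟨ 𝔽.enumerates-allVecs d commutativeRing _ w (λ ξ₄ ξ₄≢w → ≈-trans (*-congˡ (≈-trans (*-congˡ (reflexive (cong (λ b → ι ℤT.⟦ b ⟧)
                   (dec-false ((ξ₁ -ᵛ ξ₂) ≟ᵛ (ξ₃ -ᵛ ξ₄)) (λ e → ξ₄≢w (cancel (ξ₁ -ᵛ ξ₂) ξ₃ ξ₄ e)))))) (zeroʳ _))) (zeroʳ _)) ⟩
            ⟦ onSphere a w ⟧ * (v w * parallelogram ξ₁ ξ₂ ξ₃ w)
              ≲⟨ *-monoˡ (NN-⟦⟧ (onSphere a w)) (*-mono (v≥0 w) NN-1 (v≤h w) (⟦⟧≤1 (does ((ξ₁ -ᵛ ξ₂) ≟ᵛ (ξ₃ -ᵛ w))))) ⟩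
            ⟦ onSphere a w ⟧ * (nat h * 1#)      ≈⟨ ≈-trans (*-congˡ (*-identityʳ _)) (*-comm _ _) ⟩
            nat h * ⟦ onSphere a w ⟧             ≲⟨ *-monoˡ (NN-ι h) (≤-trans (⟦⟧-≤ (onSphere a w) (((ξ₂ -ᵛ ξ₁) ∙ (ξ₃ -ᵛ ξ₁)) ≟ 𝔽.0#) (λ e → rectangle (onSphere⇒ w e))) (≤-reflexive (⟦⟧-ι _))) ⟩
            nat h * right-angle ξ₁ ξ₂ ξ₃ ∎
            where
            w = ξ₃ -ᵛ (ξ₁ -ᵛ ξ₂)
            ⟦⟧-ι : ∀ b → ⟦ b ⟧ ≈ ι ℤT.⟦ b ⟧
            ⟦⟧-ι true  = ≈-refl
            ⟦⟧-ι false = ≈-refl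
            two = 𝔽.1# 𝔽.+ 𝔽.1#
            -- Expanding the norms, ‖w‖ - a is twice the dot product of the two sides that meet at
            -- ξ₁.
            rectangle : ‖ w ‖ ≡ a → (ξ₂ -ᵛ ξ₁) ∙ (ξ₃ -ᵛ ξ₁) ≡ 𝔽.0#
            rectangle hw = 𝔽.*-cancelˡ 2≢0 (trans (sym expand) (trans (cong (𝔽._- a) hw) (trans (𝔽.-‿inverseʳ a) (sym (𝔽.zeroʳ two)))))
              where
              p = ξ₁ ∙ ξ₂
              r = ξ₁ ∙ ξ₃
              s = ξ₂ ∙ ξ₃
              ‖w‖ : ‖ w ‖ ≡ a 𝔽.- two 𝔽.* (r 𝔽.- s) 𝔽.+ (a 𝔽.- two 𝔽.* p 𝔽.+ a)
              ‖w‖ = trans (𝔽.‖-‖ ξ₃ (ξ₁ -ᵛ ξ₂)) (trans (cong₂ (λ u t → u 𝔽.- two 𝔽.* t 𝔽.+ ‖ ξ₁ -ᵛ ξ₂ ‖) h₃ (trans (𝔽.∙-comm ξ₃ (ξ₁ -ᵛ ξ₂)) (𝔽.∙--ˡ ξ₁ ξ₂ ξ₃)))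
                    (cong (λ z → a 𝔽.- two 𝔽.* (r 𝔽.- s) 𝔽.+ z) (trans (𝔽.‖-‖ ξ₁ ξ₂) (cong₂ (λ u t → u 𝔽.- two 𝔽.* p 𝔽.+ t) h₁ h₂))))
              dot : (ξ₂ -ᵛ ξ₁) ∙ (ξ₃ -ᵛ ξ₁) ≡ (s 𝔽.- p) 𝔽.- (r 𝔽.- a)
              dot = trans (𝔽.∙--ˡ ξ₂ ξ₁ (ξ₃ -ᵛ ξ₁)) (cong₂ 𝔽._-_ (trans (𝔽.∙--ʳ ξ₂ ξ₃ ξ₁) (cong (λ z → s 𝔽.- z) (𝔽.∙-comm ξ₂ ξ₁)))
                    (trans (𝔽.∙--ʳ ξ₁ ξ₃ ξ₁) (cong (λ z → r 𝔽.- z) (trans (sym (𝔽.‖‖≡∙ ξ₁)) h₁))))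
              expand : ‖ w ‖ 𝔽.- a ≡ two 𝔽.* (ξ₂ -ᵛ ξ₁) ∙ (ξ₃ -ᵛ ξ₁)
              expand = trans (cong (𝔽._- a) ‖w‖) (trans (𝔽.solve 4 (λ a p r s → a 𝔽.:- 𝔽.con (+ 2) 𝔽.:* (r 𝔽.:- s) 𝔽.:+ (a 𝔽.:- 𝔽.con (+ 2) 𝔽.:* p 𝔽.:+ a) 𝔽.:- a
                         𝔽.:= 𝔽.con (+ 2) 𝔽.:* ((s 𝔽.:- p) 𝔽.:- (r 𝔽.:- a))) refl a p r s) (cong (two 𝔽.*_) (sym dot)))

  -- Fourier transforms and the mixed moment.

  -- These laws are all that the moment estimates use of an additive character; `∑e` expresses
  -- nontriviality.
  record Character : Set where
    field
      e   : 𝔽.Carrier → Carrier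
      e-+ : ∀ a b → e (a 𝔽.+ b) ≈ e a * e b
      e-0 : e 𝔽.0# ≈ 1#
      e-⋆ : ∀ a → e a ⋆ ≈ e (𝔽.- a)
      ∑e  : ∀ {x} → x ≢ 𝔽.0# → ∑ 𝔽.elements (λ c → e (x 𝔽.* c)) ≈ 0#

  module Moments (χ : Character) where
    open Character χ

    e-- : ∀ a b → e a * e b ⋆ ≈ e (a 𝔽.- b)
    e-- a b = ≈-trans (*-congˡ (e-⋆ b)) (≈-sym (e-+ a (𝔽.- b)))

    e-unit : ∀ a → e a * e a ⋆ ≈ 1#
    e-unit a = ≈-trans (e-- a a) (≈-trans (reflexive (cong e (𝔽.-‿inverseʳ a))) e-0)

    ∑e-∙≢0 : ∀ {d} (w : Vect d) → w ≢ 0ᵛ → ∑ (allVecs d) (λ y → e (y ∙ w)) ≈ 0#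
    ∑e-∙≢0 []                w≢0 = ⊥-elim (w≢0 refl)
    ∑e-∙≢0 {suc d} (b ∷ w) w≢0 = ≈-trans factor (vanish (w ≟ᵛ 0ᵛ))
      where
      factor : ∑ (allVecs (suc d)) (λ y → e (y ∙ (b ∷ w))) ≈ ∑ elements (λ a → e (b 𝔽.* a)) * ∑ (allVecs d) (λ y → e (y ∙ w))
      factor = ≈-trans (𝔽.VecSums.∑-allVecs-suc commutativeRing (λ y → e (y ∙ (b ∷ w))))
        (≈-trans (∑-cong elements (λ a → ∑-cong (allVecs d) (λ y → ≈-trans (e-+ _ _) (*-congʳ (reflexive (cong e (𝔽.*-comm a b)))))))
                 (≈-sym (∑-*-∑ elements (allVecs d) _ _)))
      vanish : Dec (w ≡ 0ᵛ) → ∑ elements (λ a → e (b 𝔽.* a)) * ∑ (allVecs d) (λ y → e (y ∙ w)) ≈ 0#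
      vanish (yes w≡0) = ≈-trans (*-congʳ (∑e (λ b≡0 → w≢0 (cong₂ _∷_ b≡0 w≡0)))) (zeroˡ _)
      vanish (no w≢0′) = ≈-trans (*-congˡ (∑e-∙≢0 w w≢0′)) (zeroʳ _)

    length-allVecs : ∀ d → L.length (allVecs d) ≡ q ℕ.^ d
    length-allVecs d = ℤP.+-injective (trans (sym (ℤP.*-identityʳ (+ L.length (allVecs d)))) (trans (sym (∑-constℤ (allVecs d) (+ 1)))
      (trans (𝔽.∑-allVecs-const d (+ 1)) (ℤP.*-identityʳ (+ (q ℕ.^ d))))))

    ∑e-∙ : ∀ {d} (w : Vect d) → ∑ (allVecs d) (λ y → e (y ∙ w)) ≈ nat (q ℕ.^ d) * ι ℤT.⟦ does (w ≟ᵛ 0ᵛ) ⟧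
    ∑e-∙ {d} w = aux (w ≟ᵛ 0ᵛ)
      where
      aux : (p : Dec (w ≡ 0ᵛ)) → ∑ (allVecs d) (λ y → e (y ∙ w)) ≈ nat (q ℕ.^ d) * ι ℤT.⟦ does p ⟧
      aux (no w≢0)  = ≈-trans (∑e-∙≢0 w w≢0) (≈-sym (zeroʳ _))
      aux (yes w≡0) = ≈-trans (∑-cong (allVecs d) (λ y → ≈-trans (reflexive (cong e (trans (cong (y ∙_) w≡0) (𝔽.∙-0ʳ y)))) e-0))
        (≈-trans (∑-const (allVecs d) 1#) (*-congʳ (reflexive (cong nat (length-allVecs d)))))

    hat : ∀ {d} → List (Vect d) → Vect d → Carrier
    hat L ξ = ∑ L (λ x → e (x ∙ ξ))

    ∣hat∣² : ∀ {d} → List (Vect d) → Vect d → Carrier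
    ∣hat∣² L ξ = hat L ξ * hat L ξ ⋆

    ∣hat∣²≤ : ∀ {d} (L : List (Vect d)) ξ → ∣hat∣² L ξ ≤ nat (L.length L ℕ.* L.length L)
    ∣hat∣²≤ L ξ = begin
      hat L ξ * hat L ξ ⋆                                        ≈⟨ *-cong one* (⋆-cong one*) ⟩
      ∑ L (λ x → 1# * e (x ∙ ξ)) * (∑ L (λ x → 1# * e (x ∙ ξ))) ⋆ ≲⟨ cauchy-schwarz L (λ _ → 1#) (λ x → e (x ∙ ξ)) ⟩
      ∑ L (λ x → 1# * 1# ⋆) * ∑ L (λ x → e (x ∙ ξ) * e (x ∙ ξ) ⋆)
        ≈⟨ *-cong (∑-cong L (λ x → ≈-trans (*-identityˡ _) ⋆-1)) (∑-cong L (λ x → e-unit (x ∙ ξ))) ⟩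
      ∑ L (λ x → 1#) * ∑ L (λ x → 1#)                            ≈⟨ *-cong count count ⟩
      nat (L.length L) * nat (L.length L)                        ≈⟨ nat-* (L.length L) (L.length L) ⟨
      nat (L.length L ℕ.* L.length L)                            ∎
      where
      one* : hat L ξ ≈ ∑ L (λ x → 1# * e (x ∙ ξ))
      one* = ∑-cong L (λ x → ≈-sym (*-identityˡ _))
      count : ∑ L (λ x → 1#) ≈ nat (L.length L)
      count = ≈-trans (∑-const L 1#) (*-identityʳ _)

    ∣hat∣²-∑ : ∀ {d} (L : List (Vect d)) ξ → ∣hat∣² L ξ ≈ ∑ L (λ x → ∑ L (λ y → e (ξ ∙ (x -ᵛ y))))
    ∣hat∣²-∑ L ξ = ≈-trans (*-congˡ (∑-⋆ L _)) (≈-trans (∑-*-∑ L L _ _) (∑-cong L (λ x → ∑-cong L (λ y →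
      ≈-trans (e-- (x ∙ ξ) (y ∙ ξ)) (reflexive (cong e (trans (sym (𝔽.∙--ˡ x y ξ)) (𝔽.∙-comm (x -ᵛ y) ξ))))))))

    NN-∣hat∣² : ∀ {d} (L : List (Vect d)) ξ → NN (∣hat∣² L ξ)
    NN-∣hat∣² L ξ = NN-sq (hat L ξ)

    plancherel-≤ : ∀ {d} (L : List (Vect d)) → NoDup F L → ∑ (allVecs d) (∣hat∣² L) ≤ nat (q ℕ.^ d ℕ.* L.length L)
    plancherel-≤ {d} L nodup = begin
      ∑ (allVecs d) (∣hat∣² L)                                                ≈⟨ ∑-cong (allVecs d) (∣hat∣²-∑ L) ⟩
      ∑ (allVecs d) (λ ξ → ∑ L (λ x → ∑ L (λ y → e (ξ ∙ (x -ᵛ y)))))          ≈⟨ ≈-trans (∑-swap (allVecs d) L _) (∑-cong L (λ x → ∑-swap (allVecs d) L _)) ⟩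
      ∑ L (λ x → ∑ L (λ y → ∑ (allVecs d) (λ ξ → e (ξ ∙ (x -ᵛ y)))))          ≈⟨ ∑-cong L (λ x → ≈-trans (∑-cong L (λ y → ≈-trans (∑e-∙ (x -ᵛ y)) (*-congˡ (reflexive (cong (λ b → ι ℤT.⟦ b ⟧)
                                                                                    (does-cong ((x -ᵛ y) ≟ᵛ 0ᵛ) (y ≟ᵛ x) (λ e → sym (𝔽.-ᵛ≡0⇒≡ x y e)) (λ { refl → 𝔽.x-ᵛx≡0 x })))))))
                                                                                    (≈-trans (∑-*ˡ L _ _) (*-congˡ (≈-sym (ι-∑ L _))))) ⟩
      ∑ L (λ x → nat (q ℕ.^ d) * ι (ℤT.∑ L (λ y → ℤT.⟦ does (y ≟ᵛ x) ⟧)))     ≲⟨ ∑-mono L (λ x → *-monoˡ (NN-ι (q ℕ.^ d)) (ι-mono (nodup x))) ⟩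
      ∑ L (λ x → nat (q ℕ.^ d) * 1#)                                          ≈⟨ ≈-trans (∑-const L _) (≈-trans (*-congˡ (*-identityʳ _)) (*-comm _ _)) ⟩
      nat (q ℕ.^ d) * nat (L.length L)                                        ≈⟨ nat-* (q ℕ.^ d) (L.length L) ⟨
      nat (q ℕ.^ d ℕ.* L.length L)                                            ∎

    ⋆-∣hat∣² : ∀ {d} (L : List (Vect d)) ξ → ∣hat∣² L ξ ⋆ ≈ ∣hat∣² L ξ
    ⋆-∣hat∣² L ξ = ⋆-norm (hat L ξ)

    pairs : {A : Set} → List A → List (A × A)
    pairs xs = concatMap (λ x → L.map (x ,_) xs) xs

    ∑-pairs : {A : Set} (xs : List A) (f : A × A → Carrier) → ∑ (pairs xs) f ≈ ∑ xs (λ x → ∑ xs (λ y → f (x , y)))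
    ∑-pairs xs f = ≈-trans (∑-concatMap _ xs f) (∑-cong xs (λ x → ∑-map (x ,_) xs f))

    module MomentSteps {n : ℕ} (L₁ : List (Vect (n ℕ.* 2))) (nodup₁ : NoDup F L₁)
             (v : Vect (n ℕ.* 2) → Carrier) (v≥0 : ∀ ξ → NN (v ξ)) (v⋆ : ∀ ξ → v ξ ⋆ ≈ v ξ) (a : 𝔽.Carrier) where
      private
        d = n ℕ.* 2
        N₁ = L.length L₁
        S = sphere d a

      M Y : Carrier
      M = ∑ S (λ ξ → ∣hat∣² L₁ ξ * v ξ)
      Y = ∑ S (λ ξ → ∑ S (λ ξ' → v ξ * v ξ' * ∣hat∣² L₁ (ξ -ᵛ ξ')))

      Λ : Carrier
      Λ = ∑ S (λ ξ₁ → v ξ₁ * ∑ S (λ ξ₂ → ∑ S (λ ξ₃ → v ξ₂ * v ξ₃ * ∑ S (λ ξ₄ → v ξ₄ * ι ℤT.⟦ does ((ξ₁ -ᵛ ξ₂) ≟ᵛ (ξ₃ -ᵛ ξ₄)) ⟧))))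

      ⋆-M : M ⋆ ≈ M
      ⋆-M = ≈-trans (∑-⋆ S _) (∑-cong S (λ ξ → ≈-trans (⋆-* _ _) (*-cong (⋆-∣hat∣² L₁ ξ) (v⋆ ξ))))

      NN-M : NN M
      NN-M = NN-∑ S (λ ξ → NN-* (NN-∣hat∣² L₁ ξ) (v≥0 ξ))

      NN-Y : NN Y
      NN-Y = NN-∑ S (λ ξ → NN-∑ S (λ ξ' → NN-* (NN-* (v≥0 ξ) (v≥0 ξ')) (NN-∣hat∣² L₁ (ξ -ᵛ ξ'))))

      -- Opening only the factor |Ê₁|² writes M as a sum over pairs (x, y) of `L₁`. After
      -- Cauchy-Schwarz over the N₁² pairs, the sums over x and y close up again to |Ê₁(ξ - ξ′)|².
      M²-≤ : M * M ≤ nat (N₁ ℕ.* N₁) * Y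
      M²-≤ = begin
        M * M                                              ≈⟨ *-cong M≈ (≈-trans (≈-sym ⋆-M) (⋆-cong M≈)) ⟩
        ∑ P (λ i → 1# * V i) * (∑ P (λ i → 1# * V i)) ⋆    ≲⟨ cauchy-schwarz P (λ _ → 1#) V ⟩
        ∑ P (λ i → 1# * 1# ⋆) * ∑ P (λ i → V i * V i ⋆)    ≈⟨ *-cong count gram ⟩
        nat (N₁ ℕ.* N₁) * Y                                ∎
        where
        P = pairs L₁
        V : Vect d × Vect d → Carrier
        V (x , y) = ∑ S (λ ξ → v ξ * (e (x ∙ ξ) * e (y ∙ ξ) ⋆))
        count : ∑ P (λ i → 1# * 1# ⋆) ≈ nat (N₁ ℕ.* N₁)
        count = ≈-trans (∑-cong P (λ _ → ≈-trans (*-identityˡ _) ⋆-1)) (≈-trans (∑-pairs L₁ _)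
                (≈-trans (∑-cong L₁ (λ _ → ≈-trans (∑-const L₁ 1#) (*-identityʳ _))) (≈-trans (∑-const L₁ _) (≈-sym (nat-* N₁ N₁)))))
        M≈ : M ≈ ∑ P (λ i → 1# * V i)
        M≈ = ≈-sym (≈-trans (∑-cong P (λ _ → *-identityˡ _)) (≈-trans (∑-pairs L₁ V)
               (≈-trans (∑-cong L₁ (λ x → ∑-swap L₁ S _)) (≈-trans (∑-swap L₁ S _)
               (∑-cong S (λ ξ → ≈-trans (∑-cong L₁ (λ x → ∑-*ˡ L₁ (v ξ) _)) (≈-trans (∑-*ˡ L₁ (v ξ) _)
                 (≈-trans (*-congˡ (≈-trans (≈-sym (∑-*-∑ L₁ L₁ _ _)) (*-congˡ (≈-sym (∑-⋆ L₁ _))))) (*-comm _ _)))))))))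
        shift : ∀ x ξ ξ' → e (x ∙ ξ) * e (x ∙ ξ') ⋆ ≈ e (x ∙ (ξ -ᵛ ξ'))
        shift x ξ ξ' = ≈-trans (e-- (x ∙ ξ) (x ∙ ξ')) (reflexive (cong e (sym (𝔽.∙--ʳ x ξ ξ'))))
        term : ∀ x y ξ ξ' → v ξ * (e (x ∙ ξ) * e (y ∙ ξ) ⋆) * (v ξ' * (e (x ∙ ξ') * e (y ∙ ξ') ⋆)) ⋆
                            ≈ v ξ * v ξ' * (e (x ∙ (ξ -ᵛ ξ')) * e (y ∙ (ξ -ᵛ ξ')) ⋆)
        term x y ξ ξ' = begin-equality
          v ξ * (e (x ∙ ξ) * e (y ∙ ξ) ⋆) * (v ξ' * (e (x ∙ ξ') * e (y ∙ ξ') ⋆)) ⋆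
            ≈⟨ *-congˡ (≈-trans (⋆-* _ _) (*-cong (v⋆ ξ') (≈-trans (⋆-* _ _) (*-congˡ (⋆-⋆ _))))) ⟩
          v ξ * (e (x ∙ ξ) * e (y ∙ ξ) ⋆) * (v ξ' * (e (x ∙ ξ') ⋆ * e (y ∙ ξ')))
            ≈⟨ solve 6 (λ a b c d e f → a :* (b :* c) :* (d :* (e :* f)) := a :* d :* (b :* e :* (c :* f))) ≈-refl (v ξ) (e (x ∙ ξ)) (e (y ∙ ξ) ⋆) (v ξ') (e (x ∙ ξ') ⋆) (e (y ∙ ξ')) ⟩
          v ξ * v ξ' * (e (x ∙ ξ) * e (x ∙ ξ') ⋆ * (e (y ∙ ξ) ⋆ * e (y ∙ ξ')))
            ≈⟨ *-congˡ (*-cong (shift x ξ ξ') (≈-trans (*-congˡ (≈-sym (⋆-⋆ _))) (≈-trans (≈-sym (⋆-* _ _)) (⋆-cong (shift y ξ ξ'))))) ⟩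
          v ξ * v ξ' * (e (x ∙ (ξ -ᵛ ξ')) * e (y ∙ (ξ -ᵛ ξ')) ⋆) ∎
        gram : ∑ P (λ i → V i * V i ⋆) ≈ Y
        gram = begin-equality
          ∑ P (λ i → V i * V i ⋆)                            ≈⟨ ∑-pairs L₁ _ ⟩
          ∑ L₁ (λ x → ∑ L₁ (λ y → V (x , y) * V (x , y) ⋆))
            ≈⟨ ∑-cong L₁ (λ x → ∑-cong L₁ (λ y → ≈-trans (*-congˡ (∑-⋆ S _)) (≈-trans (∑-*-∑ S S _ _) (∑-cong S (λ ξ → ∑-cong S (λ ξ' → term x y ξ ξ')))))) ⟩
          ∑ L₁ (λ x → ∑ L₁ (λ y → ∑ S (λ ξ → ∑ S (λ ξ' → T ξ ξ' x y))))
            ≈⟨ ≈-trans (∑-cong L₁ (λ x → ≈-trans (∑-swap L₁ S _) (∑-cong S (λ ξ → ∑-swap L₁ S _)))) (≈-trans (∑-swap L₁ S _) (∑-cong S (λ ξ → ∑-swap L₁ S _))) ⟩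
          ∑ S (λ ξ → ∑ S (λ ξ' → ∑ L₁ (λ x → ∑ L₁ (λ y → T ξ ξ' x y))))
            ≈⟨ ∑-cong S (λ ξ → ∑-cong S (λ ξ' → ≈-trans (∑-cong L₁ (λ x → ∑-*ˡ L₁ _ _)) (≈-trans (∑-*ˡ L₁ _ _)
                 (*-congˡ (≈-trans (≈-sym (∑-*-∑ L₁ L₁ _ _)) (*-congˡ (≈-sym (∑-⋆ L₁ _)))))))) ⟩
          Y ∎
          where
          T : Vect d → Vect d → Vect d → Vect d → Carrier
          T ξ ξ' x y = v ξ * v ξ' * (e (x ∙ (ξ -ᵛ ξ')) * e (y ∙ (ξ -ᵛ ξ')) ⋆)

      -- Pairs are collected by their difference η: `C η` is the weighted number of representations
      -- of η, and ∑ C² is the energy Λ. The other factor of Cauchy-Schwarz is ∑ |Ê₁|⁴, at most the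
      -- maximum N₁² of |Ê₁|² times the Plancherel bound q^d N₁.
      Y²-≤ : Y * Y ≤ nat (N₁ ℕ.* N₁ ℕ.* (q ℕ.^ d ℕ.* N₁)) * Λ
      Y²-≤ = begin
        Y * Y                                                     ≈⟨ *-cong Y≈ (≈-trans (≈-sym ⋆-Y) (⋆-cong Y≈)) ⟩
        ∑ V (λ η → A η * C η) * (∑ V (λ η → A η * C η)) ⋆          ≲⟨ cauchy-schwarz V A C ⟩
        ∑ V (λ η → A η * A η ⋆) * ∑ V (λ η → C η * C η ⋆)          ≈⟨ *-congˡ C²≈ ⟩
        ∑ V (λ η → A η * A η ⋆) * Λ                               ≲⟨ *-monoʳ NN-Λ A²≤ ⟩
        nat (N₁ ℕ.* N₁ ℕ.* (q ℕ.^ d ℕ.* N₁)) * Λ                   ∎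
        where
        V = allVecs d
        A C : Vect d → Carrier
        A = ∣hat∣² L₁
        C η = ∑ S (λ ξ → ∑ S (λ ξ' → v ξ * v ξ' * ι ℤT.⟦ does (η ≟ᵛ (ξ -ᵛ ξ')) ⟧))
        NN-Λ : NN Λ
        NN-Λ = NN-∑ S (λ ξ₁ → NN-* (v≥0 ξ₁) (NN-∑ S (λ ξ₂ → NN-∑ S (λ ξ₃ → NN-* (NN-* (v≥0 ξ₂) (v≥0 ξ₃)) (NN-∑ S (λ ξ₄ → NN-* (v≥0 ξ₄) (NN-ι⟦⟧ (does ((ξ₁ -ᵛ ξ₂) ≟ᵛ (ξ₃ -ᵛ ξ₄))))))))))
        A²≤ : ∑ V (λ η → A η * A η ⋆) ≤ nat (N₁ ℕ.* N₁ ℕ.* (q ℕ.^ d ℕ.* N₁))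
        A²≤ = begin
          ∑ V (λ η → A η * A η ⋆)                  ≈⟨ ∑-cong V (λ η → *-congˡ (⋆-∣hat∣² L₁ η)) ⟩
          ∑ V (λ η → A η * A η)                    ≲⟨ ∑-mono V (λ η → *-monoʳ (NN-∣hat∣² L₁ η) (∣hat∣²≤ L₁ η)) ⟩
          ∑ V (λ η → nat (N₁ ℕ.* N₁) * A η)        ≈⟨ ∑-*ˡ V _ _ ⟩
          nat (N₁ ℕ.* N₁) * ∑ V A                  ≲⟨ *-monoˡ (NN-ι (N₁ ℕ.* N₁)) (plancherel-≤ L₁ nodup₁) ⟩
          nat (N₁ ℕ.* N₁) * nat (q ℕ.^ d ℕ.* N₁)   ≈⟨ nat-* (N₁ ℕ.* N₁) (q ℕ.^ d ℕ.* N₁) ⟨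
          nat (N₁ ℕ.* N₁ ℕ.* (q ℕ.^ d ℕ.* N₁))     ∎
        ⟦⟧-ι : ∀ b → ⟦ b ⟧ ≈ ι ℤT.⟦ b ⟧
        ⟦⟧-ι true  = ≈-refl
        ⟦⟧-ι false = ≈-refl
        pick : ∀ (g : Vect d → Carrier) w → ∑ V (λ η → ι ℤT.⟦ does (η ≟ᵛ w) ⟧ * g η) ≈ g w
        pick g w = ≈-trans (∑-cong V (λ η → *-congʳ (≈-sym (⟦⟧-ι (does (η ≟ᵛ w)))))) (𝔽.RV.select d commutativeRing g w)
        Y≈ : Y ≈ ∑ V (λ η → A η * C η)
        Y≈ = ≈-sym (begin-equality
          ∑ V (λ η → A η * C η)
            ≈⟨ ∑-cong V (λ η → ≈-trans (≈-sym (∑-*ˡ S _ _)) (∑-cong S (λ ξ → ≈-sym (∑-*ˡ S _ _)))) ⟩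
          ∑ V (λ η → ∑ S (λ ξ → ∑ S (λ ξ' → A η * (v ξ * v ξ' * ι ℤT.⟦ does (η ≟ᵛ (ξ -ᵛ ξ')) ⟧))))
            ≈⟨ ≈-trans (∑-swap V S _) (∑-cong S (λ ξ → ∑-swap V S _)) ⟩
          ∑ S (λ ξ → ∑ S (λ ξ' → ∑ V (λ η → A η * (v ξ * v ξ' * ι ℤT.⟦ does (η ≟ᵛ (ξ -ᵛ ξ')) ⟧))))
            ≈⟨ ∑-cong S (λ ξ → ∑-cong S (λ ξ' → ≈-trans (∑-cong V (λ η → solve 3 (λ a b c → a :* (b :* c) := b :* (c :* a)) ≈-refl (A η) (v ξ * v ξ') (ι ℤT.⟦ does (η ≟ᵛ (ξ -ᵛ ξ')) ⟧)))
                 (≈-trans (∑-*ˡ V _ _) (*-congˡ (pick A (ξ -ᵛ ξ')))))) ⟩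
          Y ∎)
        ⋆-Y : Y ⋆ ≈ Y
        ⋆-Y = ≈-trans (∑-⋆ S _) (∑-cong S (λ ξ → ≈-trans (∑-⋆ S _) (∑-cong S (λ ξ' → ≈-trans (⋆-* _ _)
                (*-cong (≈-trans (⋆-* _ _) (*-cong (v⋆ ξ) (v⋆ ξ'))) (⋆-∣hat∣² L₁ (ξ -ᵛ ξ')))))))
        ⋆-C : ∀ η → C η ⋆ ≈ C η
        ⋆-C η = ≈-trans (∑-⋆ S _) (∑-cong S (λ ξ → ≈-trans (∑-⋆ S _) (∑-cong S (λ ξ' → ≈-trans (⋆-* _ _)
                (*-cong (≈-trans (⋆-* _ _) (*-cong (v⋆ ξ) (v⋆ ξ'))) (⋆-ι ℤT.⟦ does (η ≟ᵛ (ξ -ᵛ ξ')) ⟧))))))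
        C²≈ : ∑ V (λ η → C η * C η ⋆) ≈ Λ
        C²≈ = begin-equality
          ∑ V (λ η → C η * C η ⋆)
            ≈⟨ ∑-cong V (λ η → ≈-trans (*-congˡ (⋆-C η)) (≈-trans (≈-sym (∑-*ʳ S _ (C η))) (∑-cong S (λ ξ₁ → ≈-trans (≈-sym (∑-*ʳ S _ (C η))) (∑-cong S (λ ξ₂ →
                 solve 4 (λ a b c d → a :* b :* c :* d := a :* (b :* (c :* d))) ≈-refl (v ξ₁) (v ξ₂) (δ η ξ₁ ξ₂) (C η))))))) ⟩
          ∑ V (λ η → ∑ S (λ ξ₁ → ∑ S (λ ξ₂ → v ξ₁ * (v ξ₂ * (δ η ξ₁ ξ₂ * C η)))))
            ≈⟨ ≈-trans (∑-swap V S _) (∑-cong S (λ ξ₁ → ∑-swap V S _)) ⟩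
          ∑ S (λ ξ₁ → ∑ S (λ ξ₂ → ∑ V (λ η → v ξ₁ * (v ξ₂ * (δ η ξ₁ ξ₂ * C η)))))
            ≈⟨ ∑-cong S (λ ξ₁ → ≈-trans (∑-cong S (λ ξ₂ → ≈-trans (∑-*ˡ V _ _) (*-congˡ (≈-trans (∑-*ˡ V _ _) (*-congˡ (pick C (ξ₁ -ᵛ ξ₂))))))) (∑-*ˡ S _ _)) ⟩
          ∑ S (λ ξ₁ → v ξ₁ * ∑ S (λ ξ₂ → v ξ₂ * C (ξ₁ -ᵛ ξ₂)))
            ≈⟨ ∑-cong S (λ ξ₁ → *-congˡ (∑-cong S (λ ξ₂ → ≈-trans (≈-sym (∑-*ˡ S _ _)) (∑-cong S (λ ξ₃ →
                 ≈-trans (*-congˡ (≈-trans (∑-cong S (λ ξ₄ → *-assoc _ _ _)) (∑-*ˡ S _ _))) (≈-sym (*-assoc _ _ _))))))) ⟩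
          Λ ∎
          where
          δ : Vect d → Vect d → Vect d → Carrier
          δ η ξ ξ' = ι ℤT.⟦ does (η ≟ᵛ (ξ -ᵛ ξ')) ⟧

    -- Bounds q M⁴ for the moment M = ∑_{‖ξ‖=a} |Ê₁(ξ)|² |Ê₂(ξ)|².
    momentBound : (n N₁ N₂ : ℕ) → ℕ
    momentBound n N₁ N₂ = N₁ ℕ.* N₁ ℕ.* (N₁ ℕ.* N₁) ℕ.* (N₁ ℕ.* N₁ ℕ.* (D ℕ.* N₁)) ℕ.* (3 ℕ.* (h ℕ.* (X ℕ.* (X ℕ.* X ℕ.+ q ℕ.^ n ℕ.* h ℕ.* X))))
      where
      D = q ℕ.^ (n ℕ.* 2)
      h = N₂ ℕ.* N₂
      X = D ℕ.* N₂

    module _ {n : ℕ} (L₁ L₂ : List (Vect (n ℕ.* 2))) (nodup₁ : NoDup F L₁) (nodup₂ : NoDup F L₂)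
             {a : 𝔽.Carrier} (a≢0 : a ≢ 𝔽.0#) where
      private
        d = n ℕ.* 2
        S = sphere d a
        N₁ = L.length L₁
        N₂ = L.length L₂
        v = ∣hat∣² L₂
        h = N₂ ℕ.* N₂
        κ = q ℕ.^ n
        X = q ℕ.^ d ℕ.* N₂
        open MomentSteps {n} L₁ nodup₁ v (NN-∣hat∣² L₂) (⋆-∣hat∣² L₂) a using (NN-M; ⋆-M; NN-Y; M²-≤; Y²-≤) renaming (M to M₁; Y to Y₁; Λ to Λ₁)
        open Weights {n} v (NN-∣hat∣² L₂) (⋆-∣hat∣² L₂) h (∣hat∣²≤ L₂)
        open OnSphere a≢0 using (bound; energy-≤)

      ∑v≤X : ∑ S v ≤ nat X
      ∑v≤X = ≤-trans (∑-filter-≤ (onSphere a) (allVecs d) (NN-∣hat∣² L₂)) (plancherel-≤ L₂ nodup₂)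

      qΛ-≤ : nat q * Λ₁ ≤ nat (3 ℕ.* (h ℕ.* (X ℕ.* (X ℕ.* X ℕ.+ κ ℕ.* h ℕ.* X))))
      qΛ-≤ = begin
        nat q * Λ₁                                   ≲⟨ energy-≤ ⟩
        nat 3 * (nat h * (∑ S v * bound))            ≲⟨ *-monoˡ (NN-ι 3) (*-monoˡ (NN-ι h) (*-mono (NN-∑ S (NN-∣hat∣² L₂)) NN-B ∑v≤X bound≤)) ⟩
        nat 3 * (nat h * (nat X * (nat X * nat X + nat (κ ℕ.* h) * nat X)))
          ≈⟨ *-congˡ (*-congˡ (*-congˡ (+-cong (≈-sym (nat-* X X)) (≈-sym (nat-* (κ ℕ.* h) X))))) ⟩
        nat 3 * (nat h * (nat X * (nat (X ℕ.* X) + nat (κ ℕ.* h ℕ.* X))))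
          ≈⟨ *-congˡ (*-congˡ (≈-trans (*-congˡ (≈-sym (nat-+ (X ℕ.* X) (κ ℕ.* h ℕ.* X)))) (≈-sym (nat-* X (X ℕ.* X ℕ.+ κ ℕ.* h ℕ.* X))))) ⟩
        nat 3 * (nat h * nat (X ℕ.* (X ℕ.* X ℕ.+ κ ℕ.* h ℕ.* X)))
          ≈⟨ ≈-trans (*-congˡ (≈-sym (nat-* h (X ℕ.* (X ℕ.* X ℕ.+ κ ℕ.* h ℕ.* X))))) (≈-sym (nat-* 3 (h ℕ.* (X ℕ.* (X ℕ.* X ℕ.+ κ ℕ.* h ℕ.* X))))) ⟩
        nat (3 ℕ.* (h ℕ.* (X ℕ.* (X ℕ.* X ℕ.+ κ ℕ.* h ℕ.* X)))) ∎
        where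
        NN-B : NN (nat X * nat X + nat (κ ℕ.* h) * nat X)
        NN-B = NN-+ (NN-* (NN-ι X) (NN-ι X)) (NN-* (NN-ι (κ ℕ.* h)) (NN-ι X))
        bound≤ : bound ≤ nat X * nat X + nat (κ ℕ.* h) * nat X
        bound≤ = +-mono (*-mono (NN-∑ S (NN-∣hat∣² L₂)) (NN-ι X) ∑v≤X ∑v≤X) (*-monoˡ (NN-ι (κ ℕ.* h)) ∑v≤X)

      qM⁴-≤ : nat q * (M₁ * M₁ * (M₁ * M₁)) ≤ nat (momentBound n N₁ N₂)
      qM⁴-≤ = begin
        nat q * (M₁ * M₁ * (M₁ * M₁))
          ≲⟨ *-monoˡ (NN-ι q) (*-mono (NN-* NN-M NN-M) (NN-* (NN-ι (N₁ ℕ.* N₁)) NN-Y) M²-≤ M²-≤) ⟩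
        nat q * (nat (N₁ ℕ.* N₁) * Y₁ * (nat (N₁ ℕ.* N₁) * Y₁))
          ≈⟨ solve 3 (λ q a y → q :* (a :* y :* (a :* y)) := q :* (a :* a :* (y :* y))) ≈-refl (nat q) (nat (N₁ ℕ.* N₁)) Y₁ ⟩
        nat q * (nat (N₁ ℕ.* N₁) * nat (N₁ ℕ.* N₁) * (Y₁ * Y₁))
          ≲⟨ *-monoˡ (NN-ι q) (*-monoˡ (NN-* (NN-ι (N₁ ℕ.* N₁)) (NN-ι (N₁ ℕ.* N₁))) Y²-≤) ⟩
        nat q * (nat (N₁ ℕ.* N₁) * nat (N₁ ℕ.* N₁) * (nat (N₁ ℕ.* N₁ ℕ.* (q ℕ.^ d ℕ.* N₁)) * Λ₁))
          ≈⟨ solve 4 (λ q a b l → q :* (a :* (b :* l)) := a :* b :* (q :* l)) ≈-refl (nat q) (nat (N₁ ℕ.* N₁) * nat (N₁ ℕ.* N₁)) (nat (N₁ ℕ.* N₁ ℕ.* (q ℕ.^ d ℕ.* N₁))) Λ₁ ⟩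
        nat (N₁ ℕ.* N₁) * nat (N₁ ℕ.* N₁) * nat (N₁ ℕ.* N₁ ℕ.* (q ℕ.^ d ℕ.* N₁)) * (nat q * Λ₁)
          ≈⟨ *-congʳ (≈-trans (*-congʳ (≈-sym (nat-* (N₁ ℕ.* N₁) (N₁ ℕ.* N₁)))) (≈-sym (nat-* (N₁ ℕ.* N₁ ℕ.* (N₁ ℕ.* N₁)) (N₁ ℕ.* N₁ ℕ.* (q ℕ.^ d ℕ.* N₁))))) ⟩
        nat A * (nat q * Λ₁)
          ≲⟨ *-monoˡ (NN-ι A) qΛ-≤ ⟩
        nat A * nat (3 ℕ.* (h ℕ.* (X ℕ.* (X ℕ.* X ℕ.+ κ ℕ.* h ℕ.* X))))
          ≈⟨ nat-* A (3 ℕ.* (h ℕ.* (X ℕ.* (X ℕ.* X ℕ.+ κ ℕ.* h ℕ.* X)))) ⟨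
        nat (momentBound n N₁ N₂) ∎
        where
        A = N₁ ℕ.* N₁ ℕ.* (N₁ ℕ.* N₁) ℕ.* (N₁ ℕ.* N₁ ℕ.* (q ℕ.^ d ℕ.* N₁))

      -- The bound on q M⁴ is multiplied by q³, which makes it one on (q M)⁴ to which
      -- `fourth-root-≤` applies. The integer `suc k` plays the part of the fourth root.
      moment-≤ : ∀ k → q ℕ.* q ℕ.* q ℕ.* momentBound n N₁ N₂ ℕ.≤ suc k ℕ.* suc k ℕ.* (suc k ℕ.* suc k) →
                 nat q * ∑ S (λ ξ → ∣hat∣² L₁ ξ * ∣hat∣² L₂ ξ) ≤ nat (suc k)
      moment-≤ k hyp = fourth-root-≤ k (NN-* (NN-ι q) NN-M)
        (≈-trans (⋆-* _ _) (*-cong (⋆-ι (+ q)) ⋆-M)) (begin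
        nat q * M₁ * (nat q * M₁) * (nat q * M₁ * (nat q * M₁))
          ≈⟨ solve 2 (λ q m → q :* m :* (q :* m) :* (q :* m :* (q :* m)) := q :* q :* q :* (q :* (m :* m :* (m :* m)))) ≈-refl (nat q) M₁ ⟩
        nat q * nat q * nat q * (nat q * (M₁ * M₁ * (M₁ * M₁)))
          ≲⟨ *-monoˡ (NN-* (NN-* (NN-ι q) (NN-ι q)) (NN-ι q)) qM⁴-≤ ⟩
        nat q * nat q * nat q * nat (momentBound n N₁ N₂)
          ≈⟨ ≈-trans (*-congʳ (≈-trans (*-congʳ (≈-sym (nat-* q q))) (≈-sym (nat-* (q ℕ.* q) q)))) (≈-sym (nat-* (q ℕ.* q ℕ.* q) (momentBound n N₁ N₂))) ⟩
        nat (q ℕ.* q ℕ.* q ℕ.* momentBound n N₁ N₂)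
          ≲⟨ nat-mono hyp ⟩
        nat (suc k ℕ.* suc k ℕ.* (suc k ℕ.* suc k)) ∎)

      module _ (L₃ : List (Vect d)) where
        hat³ : Vect d → Carrier
        hat³ ξ = hat L₁ ξ * hat L₂ ξ * hat L₃ ξ

        -- Cauchy-Schwarz separates the third set from the other two. It is left as ∑ |Ê₃|² over one
        -- sphere, which can afterwards be summed over all radii by Plancherel.
        restriction-≤ : ∀ k → q ℕ.* q ℕ.* q ℕ.* momentBound n N₁ N₂ ℕ.≤ suc k ℕ.* suc k ℕ.* (suc k ℕ.* suc k) →
          nat q * (∑ S hat³ * (∑ S hat³) ⋆) ≤ nat (suc k) * ∑ S (∣hat∣² L₃)
        restriction-≤ k hyp = begin
          nat q * (∑ S hat³ * (∑ S hat³) ⋆)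
            ≲⟨ *-monoˡ (NN-ι q) (cauchy-schwarz S (λ ξ → hat L₁ ξ * hat L₂ ξ) (hat L₃)) ⟩
          nat q * (∑ S (λ ξ → hat L₁ ξ * hat L₂ ξ * (hat L₁ ξ * hat L₂ ξ) ⋆) * ∑ S (∣hat∣² L₃))
            ≈⟨ ≈-sym (*-assoc _ _ _) ⟩
          nat q * ∑ S (λ ξ → hat L₁ ξ * hat L₂ ξ * (hat L₁ ξ * hat L₂ ξ) ⋆) * ∑ S (∣hat∣² L₃)
            ≈⟨ *-congʳ (*-congˡ (∑-cong S (λ ξ → ≈-trans (*-congˡ (⋆-* _ _))
                 (solve 4 (λ a b c d → a :* b :* (c :* d) := a :* c :* (b :* d)) ≈-refl (hat L₁ ξ) (hat L₂ ξ) (hat L₁ ξ ⋆) (hat L₂ ξ ⋆))))) ⟩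
          nat q * ∑ S (λ ξ → ∣hat∣² L₁ ξ * ∣hat∣² L₂ ξ) * ∑ S (∣hat∣² L₃)
            ≲⟨ *-monoʳ (NN-∑ S (NN-∣hat∣² L₃)) (moment-≤ k hyp) ⟩
          nat (suc k) * ∑ S (∣hat∣² L₃) ∎

-- Sealed, since multiplication by a numeral unfolds to a sum of that many terms.
abstract
  C₃ C₄ : ℕ
  C₃ = 216
  C₄ = 46656

  C₃≢0 : ℕ.NonZero C₃
  C₃≢0 = _

  C₄≢0 : ℕ.NonZero C₄
  C₄≢0 = _

  6³≤C₃⁸ : 6 ℕ.^ 3 ℕ.≤ C₃ ℕ.^ 8
  6³≤C₃⁸ = ℕP.≤ᵇ⇒≤ (6 ℕ.^ 3) (C₃ ℕ.^ 8) _

  6³≤C₃⁷ : 6 ℕ.^ 3 ℕ.≤ C₃ ℕ.^ 7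
  6³≤C₃⁷ = ℕP.≤ᵇ⇒≤ (6 ℕ.^ 3) (C₃ ℕ.^ 7) _

  36³≤C₃² : 36 ℕ.^ 3 ℕ.≤ C₃ ℕ.^ 2
  36³≤C₃² = ℕP.≤ᵇ⇒≤ (36 ℕ.^ 3) (C₃ ℕ.^ 2) _

  C₃⁴≤C₄³ : C₃ ℕ.^ 4 ℕ.≤ C₄ ℕ.^ 3
  C₃⁴≤C₄³ = ℕP.≤ᵇ⇒≤ (C₃ ℕ.^ 4) (C₄ ℕ.^ 3) _

-- Arithmetic of the exponents.

module Exponents where
  open import Data.Nat using (_*_; _+_; _^_; _≤_; _∸_; NonZero)
  open +-*-Solver

  ^-distribʳ-* : ∀ x y m → (x * y) ^ m ≡ x ^ m * y ^ m
  ^-distribʳ-* x y zero    = refl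
  ^-distribʳ-* x y (suc m) = trans (cong (x * y *_) (^-distribʳ-* x y m))
    (solve 4 (λ x y a b → x :* y :* (a :* b) := x :* a :* (y :* b)) refl x y (x ^ m) (y ^ m))

  ^-cancelˡ-≤ : ∀ m .{{_ : NonZero m}} {x y} → x ^ m ≤ y ^ m → x ≤ y
  ^-cancelˡ-≤ m {x} {y} h with x ℕ.≤? y
  ... | yes p = p
  ... | no ¬p = ⊥-elim (ℕP.<⇒≱ (ℕP.^-monoˡ-< m (ℕP.≰⇒> ¬p)) h)

  ^-swap : ∀ x i j → (x ^ i) ^ j ≡ (x ^ j) ^ i
  ^-swap x i j = trans (ℕP.^-*-assoc x i j) (trans (cong (x ^_) (ℕP.*-comm i j)) (sym (ℕP.^-*-assoc x j i)))

  -- Comparing 3S-th powers: (c q^w)³ ≤ C^j q^{3ej/S} ≤ P^j ≤ A³.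
  root-≤ : ∀ {q S e C P c w j A} .{{_ : NonZero q}} .{{_ : NonZero S}} →
    C ^ S * q ^ (3 * e) ≤ P ^ S → P ^ j ≤ A ^ 3 → c ^ 3 ≤ C ^ j → w * S ≤ e * j → c * q ^ w ≤ A
  root-≤ {q} {S} {e} {C} {P} {c} {w} {j} {A} hyp PA cC ws = ^-cancelˡ-≤ 3 (^-cancelˡ-≤ S (begin
    ((c * q ^ w) ^ 3) ^ S            ≡⟨ trans (cong (_^ S) (^-distribʳ-* c (q ^ w) 3)) (^-distribʳ-* (c ^ 3) ((q ^ w) ^ 3) S) ⟩
    (c ^ 3) ^ S * ((q ^ w) ^ 3) ^ S  ≤⟨ ℕP.*-mono-≤ (ℕP.^-monoˡ-≤ S cC) (ℕP.≤-trans (ℕP.≤-reflexive qw) (ℕP.^-monoʳ-≤ q (ℕP.*-monoʳ-≤ 3 ws))) ⟩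
    (C ^ j) ^ S * q ^ (3 * (e * j))  ≡⟨ cong₂ _*_ (^-swap C j S) (trans (cong (q ^_) (sym (ℕP.*-assoc 3 e j))) (sym (ℕP.^-*-assoc q (3 * e) j))) ⟩
    (C ^ S) ^ j * (q ^ (3 * e)) ^ j  ≡⟨ sym (^-distribʳ-* (C ^ S) (q ^ (3 * e)) j) ⟩
    (C ^ S * q ^ (3 * e)) ^ j        ≤⟨ ℕP.^-monoˡ-≤ j hyp ⟩
    (P ^ S) ^ j                      ≡⟨ ^-swap P S j ⟩
    (P ^ j) ^ S                      ≤⟨ ℕP.^-monoˡ-≤ S PA ⟩
    (A ^ 3) ^ S                      ∎))
    where
    open ℕP.≤-Reasoning
    qw : ((q ^ w) ^ 3) ^ S ≡ q ^ (3 * (w * S))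
    qw = trans (cong (_^ S) (ℕP.^-*-assoc q w 3)) (trans (ℕP.^-*-assoc q (w * 3) S) (cong (q ^_) (solve 2 (λ w S → w :* con 3 :* S := con 3 :* (w :* S)) refl w S)))

  exponent-≤ : ∀ {E w S j} → 2 ≤ E → w * S + 2 * j ≤ E * j → w * S ≤ (E ∸ 2) * j
  exponent-≤ {E} {w} {S} {j} 2≤E h = ℕP.+-cancelʳ-≤ (2 * j) (w * S) ((E ∸ 2) * j)
    (ℕP.≤-trans h (ℕP.≤-reflexive (trans (cong (_* j) (sym (ℕP.m∸n+n≡m 2≤E))) (ℕP.*-distribʳ-+ j (E ∸ 2) 2))))

  size⇒≢0 : ∀ {m d den C q P} .{{_ : NonZero C}} .{{_ : NonZero q}} .{{_ : NonZero den}} → SizeHyp m d den C q P → NonZero P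
  size⇒≢0 {P = suc _} _ = _
  size⇒≢0 {m} {d} {den@(suc _)} {C} {q} {zero} size =
    ⊥-elim (ℕ.≢-nonZero⁻¹ _ {{ℕP.m*n≢0 _ _ {{ℕP.m^n≢0 C (2 * den)}} {{ℕP.m^n≢0 q (m * (suc d * den ∸ 2))}}}} (ℕP.n≤0⇒n≡0 size))

  module _ {n k q N₁ N₂ N₃ : ℕ} .{{_ : NonZero q}} (le₁₂ : N₁ ≤ N₂) (le₂₃ : N₂ ≤ N₃)
           (size : SizeHyp 3 (n * 2) (14 + k) C₃ q (N₁ * (N₂ * N₃))) where
    private
      den = 14 + k
      d = n * 2
      P = N₁ * (N₂ * N₃)
      E = suc d * den
      le₁₃ : N₁ ≤ N₃
      le₁₃ = ℕP.≤-trans le₁₂ le₂₃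
      2≤E : 2 ≤ E
      2≤E = ℕ.s≤s (ℕ.s≤s ℕ.z≤n)
      larger : ∀ {x y} r → y ≡ x + r → x ≤ y
      larger {x} r e = ℕP.≤-trans (ℕP.m≤m+n x r) (ℕP.≤-reflexive (sym e))

    -- This is for the term of the moment bound with D⁴. As N₁ ≤ N₂ ≤ N₃, the cube of the right side
    -- is at least P⁸, and 8((d+1)/2 - 1/den) ≥ 4d + 3 once den ≥ 8.
    size-a : 6 * q ^ (3 + (d + (d + (d + d)))) ≤ N₁ * (N₂ * N₂ * N₂) * (N₃ * N₃ * N₃ * N₃)
    size-a = root-≤ {q} {2 * den} {E ∸ 2} {C₃} {P} {6} {3 + (d + (d + (d + d)))} {8} size
      (ℕP.≤-trans (ℕP.≤-reflexive (solve 3 (λ a b c → (a :* (b :* c)) :^ 8 := a :^ 3 :* b :^ 8 :* c :^ 8 :* (a :* (a :* a :* a :* a))) refl N₁ N₂ N₃))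
        (ℕP.≤-trans (ℕP.*-monoʳ-≤ (N₁ ^ 3 * N₂ ^ 8 * N₃ ^ 8) (ℕP.*-mono-≤ le₁₂ (ℕP.*-mono-≤ (ℕP.*-mono-≤ (ℕP.*-mono-≤ le₁₃ le₁₃) le₁₃) le₁₃)))
          (ℕP.≤-reflexive (solve 3 (λ a b c → a :^ 3 :* b :^ 8 :* c :^ 8 :* (b :* (c :* c :* c :* c)) := (a :* (b :* b :* b) :* (c :* c :* c :* c)) :^ 3) refl N₁ N₂ N₃))))
      6³≤C₃⁸
      (exponent-≤ {E} {3 + (d + (d + (d + d)))} {2 * den} {8} 2≤E (larger (12 + 2 * k) (solve 2 (λ d k → (con 1 :+ d) :* (con 14 :+ k) :* con 8 := (con 3 :+ (d :+ (d :+ (d :+ d)))) :* (con 2 :* (con 14 :+ k)) :+ con 16 :+ (con 12 :+ con 2 :* k)) refl d k)))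

    -- This is for the term with D³κ, where κ = q^(d/2). The cube of the right side is at least P⁷,
    -- and 7((d+1)/2 - 1/den) ≥ 7d/2 + 3 holds exactly when den ≥ 14. This is the origin of 14, and
    -- the slack in the exponents is exactly `k`.
    size-b : 6 * q ^ (3 + (d + (d + (d + n)))) ≤ N₁ * (N₂ * N₂) * (N₃ * N₃ * N₃ * N₃)
    size-b = root-≤ {q} {2 * den} {E ∸ 2} {C₃} {P} {6} {3 + (d + (d + (d + n)))} {7} size
      (ℕP.≤-trans (ℕP.≤-reflexive (solve 3 (λ a b c → (a :* (b :* c)) :^ 7 := a :^ 3 :* b :^ 6 :* c :^ 7 :* (b :* (a :* a :* a :* a))) refl N₁ N₂ N₃))
        (ℕP.≤-trans (ℕP.*-monoʳ-≤ (N₁ ^ 3 * N₂ ^ 6 * N₃ ^ 7) (ℕP.*-mono-≤ le₂₃ (ℕP.*-mono-≤ (ℕP.*-mono-≤ (ℕP.*-mono-≤ le₁₃ le₁₃) le₁₃) le₁₃)))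
          (ℕP.≤-reflexive (solve 3 (λ a b c → a :^ 3 :* b :^ 6 :* c :^ 7 :* (c :* (c :* c :* c :* c)) := (a :* (b :* b) :* (c :* c :* c :* c)) :^ 3) refl N₁ N₂ N₃))))
      6³≤C₃⁷
      (exponent-≤ {E} {3 + (d + (d + (d + n)))} {2 * den} {7} 2≤E (larger k (solve 2 (λ n k → (con 1 :+ n :* con 2) :* (con 14 :+ k) :* con 7 := (con 3 :+ (n :* con 2 :+ (n :* con 2 :+ (n :* con 2 :+ n)))) :* (con 2 :* (con 14 :+ k)) :+ con 14 :+ k) refl n k)))

    -- This serves the bound on triples whose sum is isotropic. Since 36³ = 6⁶, it also makes 6³ =
    -- 216 the least constant `C₃` that passes.
    size-c : 36 * q ^ d ≤ N₂ * N₃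
    size-c = root-≤ {q} {2 * den} {E ∸ 2} {C₃} {P} {36} {d} {2} size
      (ℕP.≤-trans (ℕP.≤-reflexive (solve 3 (λ a b c → (a :* (b :* c)) :^ 2 := b :^ 2 :* c :^ 2 :* (a :* a)) refl N₁ N₂ N₃))
        (ℕP.≤-trans (ℕP.*-monoʳ-≤ (N₂ ^ 2 * N₃ ^ 2) (ℕP.*-mono-≤ le₁₂ le₁₃))
          (ℕP.≤-reflexive (solve 2 (λ b c → b :^ 2 :* c :^ 2 :* (b :* c) := (b :* c) :^ 3) refl N₂ N₃))))
      36³≤C₃²
      (exponent-≤ {E} {d} {2 * den} {2} 2≤E (larger (24 + 2 * k) (solve 2 (λ d k → (con 1 :+ d) :* (con 14 :+ k) :* con 2 := d :* (con 2 :* (con 14 :+ k)) :+ con 4 :+ (con 24 :+ con 2 :* k)) refl d k)))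

    private
      W = N₁ * N₁ * (N₂ * N₂) * N₃
      D = q ^ d
      κ = q ^ n
      h = N₂ * N₂
      X = D * N₂

    -- `W` is chosen so that W N₃ = P². The moment bound has two terms with coefficient 3, each of
    -- which must be at most W⁴/2; this explains the factor 6 in `size-a` and `size-b`.
    moment-size : q * q * q * (N₁ * N₁ * (N₁ * N₁) * (N₁ * N₁ * (D * N₁)) * (3 * (h * (X * (X * X + κ * h * X))))) ≤ W * W * (W * W)
    moment-size = ℕP.*-cancelˡ-≤ 2 (begin
      2 * (q * q * q * (N₁ * N₁ * (N₁ * N₁) * (N₁ * N₁ * (D * N₁)) * (3 * (h * (X * (X * X + κ * h * X))))))
        ≡⟨ solve 5 (λ q a b D κ → con 2 :* (q :* q :* q :* (a :* a :* (a :* a) :* (a :* a :* (D :* a)) :* (con 3 :* (b :* b :* (D :* b :* (D :* b :* (D :* b) :+ κ :* (b :* b) :* (D :* b)))))))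
             := a :^ 7 :* b :^ 5 :* (con 6 :* (q :^ 3 :* (D :* (D :* (D :* D))))) :+ a :^ 7 :* b :^ 6 :* (con 6 :* (q :^ 3 :* (D :* (D :* (D :* κ)))))) refl q N₁ N₂ D κ ⟩
      N₁ ^ 7 * N₂ ^ 5 * (6 * (q ^ 3 * (D * (D * (D * D))))) + N₁ ^ 7 * N₂ ^ 6 * (6 * (q ^ 3 * (D * (D * (D * κ)))))
        ≤⟨ ℕP.+-mono-≤ (ℕP.*-monoʳ-≤ (N₁ ^ 7 * N₂ ^ 5) (ℕP.≤-trans (ℕP.≤-reflexive (cong (6 *_) (sym (split d)))) size-a)) (ℕP.*-monoʳ-≤ (N₁ ^ 7 * N₂ ^ 6) (ℕP.≤-trans (ℕP.≤-reflexive (cong (6 *_) (sym (split n)))) size-b)) ⟩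
      N₁ ^ 7 * N₂ ^ 5 * (N₁ * (N₂ * N₂ * N₂) * (N₃ * N₃ * N₃ * N₃)) + N₁ ^ 7 * N₂ ^ 6 * (N₁ * (N₂ * N₂) * (N₃ * N₃ * N₃ * N₃))
        ≡⟨ solve 3 (λ a b c → a :^ 7 :* b :^ 5 :* (a :* (b :* b :* b) :* (c :* c :* c :* c)) :+ a :^ 7 :* b :^ 6 :* (a :* (b :* b) :* (c :* c :* c :* c))
             := con 2 :* (a :* a :* (b :* b) :* c :* (a :* a :* (b :* b) :* c) :* (a :* a :* (b :* b) :* c :* (a :* a :* (b :* b) :* c)))) refl N₁ N₂ N₃ ⟩
      2 * (W * W * (W * W)) ∎)
      where
      open ℕP.≤-Reasoning
      split : ∀ m → q ^ (3 + (d + (d + (d + m)))) ≡ q ^ 3 * (D * (D * (D * q ^ m)))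
      split m = trans (ℕP.^-distribˡ-+-* q 3 (d + (d + (d + m)))) (cong (q ^ 3 *_) (trans (ℕP.^-distribˡ-+-* q d (d + (d + m))) (cong (D *_) (trans (ℕP.^-distribˡ-+-* q d (d + m)) (cong (D *_) (ℕP.^-distribˡ-+-* q d m))))))

  -- When N is at most each of the three remaining sizes, P₄³ = N³P₃³ ≤ P₃⁴. Discarding the smallest
  -- of four sets thus preserves the exponent `e` per set, and C₃⁴ ≤ C₄³ takes care of the
  -- constants.
  drop-one : ∀ {q den e P₃ P₄ N} .{{_ : NonZero den}} → N ^ 3 ≤ P₃ → P₄ ≡ N * P₃ → C₄ ^ (2 * den) * q ^ (4 * e) ≤ P₄ ^ (2 * den) → C₃ ^ (2 * den) * q ^ (3 * e) ≤ P₃ ^ (2 * den)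
  drop-one {q} {den@(suc _)} {e} {P₃} {P₄} {N} N³≤P₃ P₄≡ hyp = ^-cancelˡ-≤ 4 (begin
    (C₃ ^ S * q ^ (3 * e)) ^ 4           ≡⟨ ^-distribʳ-* (C₃ ^ S) (q ^ (3 * e)) 4 ⟩
    (C₃ ^ S) ^ 4 * (q ^ (3 * e)) ^ 4     ≤⟨ ℕP.*-mono-≤ (ℕP.≤-trans (ℕP.≤-reflexive (^-swap C₃ S 4)) (ℕP.≤-trans (ℕP.^-monoˡ-≤ S C₃⁴≤C₄³) (ℕP.≤-reflexive (^-swap C₄ 3 S))))
                                              (ℕP.≤-reflexive (trans (ℕP.^-*-assoc q (3 * e) 4) (trans (cong (q ^_) (solve 1 (λ e → con 3 :* e :* con 4 := con 4 :* e :* con 3) refl e)) (sym (ℕP.^-*-assoc q (4 * e) 3))))) ⟩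
    (C₄ ^ S) ^ 3 * (q ^ (4 * e)) ^ 3   ≡⟨ sym (^-distribʳ-* (C₄ ^ S) (q ^ (4 * e)) 3) ⟩
    (C₄ ^ S * q ^ (4 * e)) ^ 3         ≤⟨ ℕP.^-monoˡ-≤ 3 hyp ⟩
    (P₄ ^ S) ^ 3                          ≡⟨ ^-swap P₄ S 3 ⟩
    (P₄ ^ 3) ^ S                          ≤⟨ ℕP.^-monoˡ-≤ S (ℕP.≤-trans (ℕP.≤-reflexive (trans (cong (_^ 3) P₄≡) (^-distribʳ-* N P₃ 3))) (ℕP.*-monoˡ-≤ (P₃ ^ 3) N³≤P₃)) ⟩
    (P₃ ^ 4) ^ S                          ≡⟨ ^-swap P₃ 4 S ⟩
    (P₃ ^ S) ^ 4                          ∎)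
    where
    open ℕP.≤-Reasoning
    S = 2 * den

∈-concatMap : {A B : Set} (f : A → List B) {x : A} {y : B} {xs : List A} → x ∈ xs → y ∈ f x → y ∈ concatMap f xs
∈-concatMap f {xs = x ∷ xs} (here refl) h = ∈-++⁺ˡ h
∈-concatMap f {xs = x ∷ xs} (there p)   h = ∈-++⁺ʳ (f x) (∈-concatMap f p h)

all-concatMap : {A B : Set} {Q : B → Set} (f : A → List B) (xs : List A) → (∀ {x} → x ∈ xs → All Q (f x)) → All Q (concatMap f xs)
all-concatMap f []       h = []
all-concatMap f (x ∷ xs) h = AllP.++⁺ (h (here refl)) (all-concatMap f xs (h ∘ there))

any-∈ : {A : Set} (f : A → Bool) {x : A} {xs : List A} → x ∈ xs → f x ≡ true → any f xs ≡ true
any-∈ f {xs = x ∷ xs} (here refl) e = cong (λ b → b Data.Bool.∨ any f xs) e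
any-∈ f {xs = y ∷ xs} (there p)   e with f y
... | true  = refl
... | false = any-∈ f p e

-- The group ring of the field and its order.

module Modulus {q : ℕ} (F : FiniteField q) (2≢0 : FiniteField.CharGt2 F) where
  open Field F 2≢0
  open ≡-Reasoning
  open ℤT using (∑; ⟦_⟧; ∑-cong; ∑-swap; ∑-*ˡ; ∑-*ʳ; ∑-+; ∑--; ∑-neg; ∑-0; ∑-map; ∑-concatMap; ∑-++; ∑-filter; ∑-cong-filter; ∑-*-∑)

  -- The group ring ℤ[F] modulo ∑_c [c]: equality is tested against the translates of ψ, that is,
  -- against the nontrivial additive characters of F only.
  FormalSum : Set
  FormalSum = List (ℤ × Carrier)

  ⟪_⟫ : FormalSum → (Carrier → ℤ) → ℤ
  ⟪ u ⟫ φ = ∑ u (λ p → proj₁ p ℤ.* φ (proj₂ p))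

  ev : Carrier → FormalSum → ℤ
  ev t u = ⟪ u ⟫ (λ c → ψ (c + t))

  infix 4 _≃_
  record _≃_ (u v : FormalSum) : Set where
    constructor mk≃
    field at : ∀ t → ev t u ≡ ev t v
  open _≃_ public

  infixl 7 _⊗_
  _⊗_ : FormalSum → FormalSum → FormalSum
  u ⊗ v = concatMap (λ p → L.map (λ p' → proj₁ p ℤ.* proj₁ p' , proj₂ p + proj₂ p') v) u

  neg : FormalSum → FormalSum
  neg = L.map (λ p → ℤ.- proj₁ p , proj₂ p)

  star : FormalSum → FormalSum
  star = L.map (λ p → proj₁ p , - proj₂ p)

  [_] : Carrier → FormalSum
  [ c ] = (+ 1 , c) ∷ []

  ⟪⟫-cong : ∀ u {φ φ' : Carrier → ℤ} → (∀ c → φ c ≡ φ' c) → ⟪ u ⟫ φ ≡ ⟪ u ⟫ φ'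
  ⟪⟫-cong u h = ∑-cong u (λ p → cong (proj₁ p ℤ.*_) (h (proj₂ p)))

  ⟪⟫-+ : ∀ u (φ φ' : Carrier → ℤ) → ⟪ u ⟫ (λ c → φ c ℤ.+ φ' c) ≡ ⟪ u ⟫ φ ℤ.+ ⟪ u ⟫ φ'
  ⟪⟫-+ u φ φ' = trans (∑-cong u (λ p → ℤP.*-distribˡ-+ (proj₁ p) (φ (proj₂ p)) (φ' (proj₂ p)))) (∑-+ u _ _)

  ⟪⟫-*ˡ : ∀ u k (φ : Carrier → ℤ) → ⟪ u ⟫ (λ c → k ℤ.* φ c) ≡ k ℤ.* ⟪ u ⟫ φ
  ⟪⟫-*ˡ u k φ = trans (∑-cong u (λ p → ℤS.solve 3 (λ a b c → a ℤS.:* (b ℤS.:* c) ℤS.:= b ℤS.:* (a ℤS.:* c)) refl (proj₁ p) k (φ (proj₂ p)))) (∑-*ˡ u k _)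

  ⟪⟫-∑ : ∀ {A : Set} u (xs : List A) (φ : A → Carrier → ℤ) → ⟪ u ⟫ (λ c → ∑ xs (λ x → φ x c)) ≡ ∑ xs (λ x → ⟪ u ⟫ (φ x))
  ⟪⟫-∑ u xs φ = trans (∑-cong u (λ p → sym (∑-*ˡ xs (proj₁ p) (λ x → φ x (proj₂ p))))) (∑-swap u xs (λ p x → proj₁ p ℤ.* φ x (proj₂ p)))

  ⟪⟫-swap : ∀ u v (G : Carrier → Carrier → ℤ) → ⟪ u ⟫ (λ c → ⟪ v ⟫ (G c)) ≡ ⟪ v ⟫ (λ c' → ⟪ u ⟫ (λ c → G c c'))
  ⟪⟫-swap u v G = trans (⟪⟫-∑ u v (λ p c → proj₁ p ℤ.* G c (proj₂ p))) (∑-cong v (λ p → ⟪⟫-*ˡ u (proj₁ p) (λ c → G c (proj₂ p))))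

  ⟪⊗⟫ : ∀ u v φ → ⟪ u ⊗ v ⟫ φ ≡ ⟪ u ⟫ (λ c → ⟪ v ⟫ (λ c' → φ (c + c')))
  ⟪⊗⟫ u v φ = trans (∑-concatMap _ u _) (∑-cong u (λ p → trans (∑-map _ v _)
    (trans (∑-cong v (λ p' → ℤP.*-assoc (proj₁ p) (proj₁ p') (φ (proj₂ p + proj₂ p')))) (∑-*ˡ v (proj₁ p) (λ p' → proj₁ p' ℤ.* φ (proj₂ p + proj₂ p'))))))

  -- Testing a product amounts to testing `v` against further translates of ψ. This is why equality
  -- against all translates, and not against ψ alone, is compatible with multiplication.
  ev-⊗ : ∀ t u v → ev t (u ⊗ v) ≡ ⟪ u ⟫ (λ c → ev (c + t) v)
  ev-⊗ t u v = trans (⟪⊗⟫ u v (λ c → ψ (c + t))) (⟪⟫-cong u (λ c → ⟪⟫-cong v (λ c' → cong ψ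
    (solve 3 (λ c c' t → c :+ c' :+ t := c' :+ (c :+ t)) refl c c' t))))

  ev-++ : ∀ t u v → ev t (u ++ v) ≡ ev t u ℤ.+ ev t v
  ev-++ t u v = ∑-++ u v _

  ev-neg : ∀ t u → ev t (neg u) ≡ ℤ.- ev t u
  ev-neg t u = trans (∑-map _ u _) (trans (∑-cong u (λ p → sym (ℤP.neg-distribˡ-* (proj₁ p) (ψ (proj₂ p + t))))) (∑-neg u _))

  ev-star : ∀ t u → ev t (star u) ≡ ev (- t) u
  ev-star t u = trans (∑-map _ u _) (⟪⟫-cong u (λ c → trans (sym (ψ-neg (- c + t))) (cong ψ (solve 2 (λ c t → :- (:- c :+ t) := c :+ (:- t)) refl c t))))

  ev-[] : ∀ t c → ev t [ c ] ≡ ψ (c + t)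
  ev-[] t c = trans (ℤP.+-identityʳ _) (ℤP.*-identityˡ (ψ (c + t)))

  ⊗-comm : ∀ u v → u ⊗ v ≃ v ⊗ u
  ⊗-comm u v .at t = begin
    ev t (u ⊗ v)                                    ≡⟨ ⟪⊗⟫ u v _ ⟩
    ⟪ u ⟫ (λ c → ⟪ v ⟫ (λ c' → ψ (c + c' + t)))      ≡⟨ ⟪⟫-swap u v _ ⟩
    ⟪ v ⟫ (λ c' → ⟪ u ⟫ (λ c → ψ (c + c' + t)))      ≡⟨ ⟪⟫-cong v (λ c' → ⟪⟫-cong u (λ c → cong (λ z → ψ (z + t)) (+-comm c c'))) ⟩
    ⟪ v ⟫ (λ c' → ⟪ u ⟫ (λ c → ψ (c' + c + t)))      ≡⟨ ⟪⊗⟫ v u _ ⟨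
    ev t (v ⊗ u)                                    ∎

  ⊗-congˡ : ∀ u {v v'} → v ≃ v' → u ⊗ v ≃ u ⊗ v'
  ⊗-congˡ u {v} {v'} e .at t = trans (ev-⊗ t u v) (trans (⟪⟫-cong u (λ c → e .at (c + t))) (sym (ev-⊗ t u v')))

  ≃-refl : ∀ {u} → u ≃ u
  ≃-refl .at t = refl

  ≃-sym : ∀ {u v} → u ≃ v → v ≃ u
  ≃-sym e .at t = sym (e .at t)

  ≃-trans : ∀ {u v w} → u ≃ v → v ≃ w → u ≃ w
  ≃-trans e e' .at t = trans (e .at t) (e' .at t)

  ⊗-cong : ∀ {u u' v v'} → u ≃ u' → v ≃ v' → u ⊗ v ≃ u' ⊗ v'
  ⊗-cong {u} {u'} {v} {v'} e e' = ≃-trans (⊗-congˡ u e') (≃-trans (⊗-comm u v') (≃-trans (⊗-congˡ v' e) (⊗-comm v' u')))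

  ⊗-assoc : ∀ u v w → u ⊗ v ⊗ w ≃ u ⊗ (v ⊗ w)
  ⊗-assoc u v w .at t = begin
    ev t (u ⊗ v ⊗ w)                                        ≡⟨ ev-⊗ t (u ⊗ v) w ⟩
    ⟪ u ⊗ v ⟫ (λ c → ev (c + t) w)                          ≡⟨ ⟪⊗⟫ u v _ ⟩
    ⟪ u ⟫ (λ a → ⟪ v ⟫ (λ b → ev (a + b + t) w))             ≡⟨ ⟪⟫-cong u (λ a → ⟪⟫-cong v (λ b → cong (λ z → ev z w) (solve 3 (λ a b t → a :+ b :+ t := b :+ (a :+ t)) refl a b t))) ⟩
    ⟪ u ⟫ (λ a → ⟪ v ⟫ (λ b → ev (b + (a + t)) w))           ≡⟨ ⟪⟫-cong u (λ a → ev-⊗ (a + t) v w) ⟨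
    ⟪ u ⟫ (λ a → ev (a + t) (v ⊗ w))                        ≡⟨ ev-⊗ t u (v ⊗ w) ⟨
    ev t (u ⊗ (v ⊗ w))                                      ∎

  ⊗-identityˡ : ∀ u → [ 0# ] ⊗ u ≃ u
  ⊗-identityˡ u .at t = trans (ev-⊗ t [ 0# ] u) (trans (ℤP.+-identityʳ _) (trans (ℤP.*-identityˡ _) (cong (λ z → ev z u) (+-identityˡ t))))

  ⊗-distribˡ : ∀ u v w → u ⊗ (v ++ w) ≃ u ⊗ v ++ u ⊗ w
  ⊗-distribˡ u v w .at t = begin
    ev t (u ⊗ (v ++ w))                                          ≡⟨ ev-⊗ t u (v ++ w) ⟩
    ⟪ u ⟫ (λ c → ev (c + t) (v ++ w))                            ≡⟨ ⟪⟫-cong u (λ c → ev-++ (c + t) v w) ⟩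
    ⟪ u ⟫ (λ c → ev (c + t) v ℤ.+ ev (c + t) w)                  ≡⟨ ⟪⟫-+ u _ _ ⟩
    ⟪ u ⟫ (λ c → ev (c + t) v) ℤ.+ ⟪ u ⟫ (λ c → ev (c + t) w)     ≡⟨ cong₂ ℤ._+_ (ev-⊗ t u v) (ev-⊗ t u w) ⟨
    ev t (u ⊗ v) ℤ.+ ev t (u ⊗ w)                                ≡⟨ ev-++ t (u ⊗ v) (u ⊗ w) ⟨
    ev t (u ⊗ v ++ u ⊗ w)                                        ∎

  ++-cong : ∀ {u u' v v'} → u ≃ u' → v ≃ v' → u ++ v ≃ u' ++ v'
  ++-cong {u} {u'} {v} {v'} e e' .at t = trans (ev-++ t u v) (trans (cong₂ ℤ._+_ (e .at t) (e' .at t)) (sym (ev-++ t u' v')))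

  ++-comm : ∀ u v → u ++ v ≃ v ++ u
  ++-comm u v .at t = trans (ev-++ t u v) (trans (ℤP.+-comm (ev t u) (ev t v)) (sym (ev-++ t v u)))

  neg-cong : ∀ {u v} → u ≃ v → neg u ≃ neg v
  neg-cong {u} {v} e .at t = trans (ev-neg t u) (trans (cong ℤ.-_ (e .at t)) (sym (ev-neg t v)))

  ++-inverseʳ : ∀ u → u ++ neg u ≃ []
  ++-inverseʳ u .at t = trans (ev-++ t u (neg u)) (trans (cong (λ z → ev t u ℤ.+ z) (ev-neg t u)) (ℤP.+-inverseʳ (ev t u)))

  groupRing : CommutativeRing 0ℓ 0ℓ
  groupRing = record
    { Carrier = FormalSum
    ; _≈_ = _≃_
    ; _+_ = _++_
    ; _*_ = _⊗_
    ; -_ = neg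
    ; 0# = []
    ; 1# = [ 0# ]
    ; isCommutativeRing = record
      { isRing = record
        { +-isAbelianGroup = record
          { isGroup = record
            { isMonoid = record
              { isSemigroup = record
                { isMagma = record { isEquivalence = record { refl = ≃-refl ; sym = ≃-sym ; trans = ≃-trans } ; ∙-cong = ++-cong }
                ; assoc = λ u v w → mk≃ (λ t → cong (ev t) (LP.++-assoc u v w)) }
              ; identity = (λ _ → ≃-refl) , (λ u → mk≃ (λ t → cong (ev t) (LP.++-identityʳ u))) }
            ; inverse = (λ u → ≃-trans (++-comm (neg u) u) (++-inverseʳ u)) , ++-inverseʳ
            ; ⁻¹-cong = neg-cong }
          ; comm = ++-comm }
        ; *-cong = ⊗-cong
        ; *-assoc = ⊗-assoc
        ; *-identity = ⊗-identityˡ , (λ u → ≃-trans (⊗-comm u [ 0# ]) (⊗-identityˡ u))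
        ; distrib = ⊗-distribˡ , (λ u v w → ≃-trans (⊗-comm (v ++ w) u) (≃-trans (⊗-distribˡ u v w) (++-cong (⊗-comm u v) (⊗-comm u w)))) }
      ; *-comm = ⊗-comm } }

  module GT = RingTools groupRing
  module GS = GT.Solver

  ev-∑ : ∀ {A : Set} t (xs : List A) (f : A → FormalSum) → ev t (GT.∑ xs f) ≡ ∑ xs (λ x → ev t (f x))
  ev-∑ t []       f = refl
  ev-∑ t (x ∷ xs) f = trans (ev-++ t (f x) (GT.∑ xs f)) (cong (λ z → ev t (f x) ℤ.+ z) (ev-∑ t xs f))

  ev-ι⁺ : ∀ t n u → ev t (GT.ι (+ n) ⊗ u) ≡ + n ℤ.* ev t u
  ev-ι⁺ t zero    u = refl
  ev-ι⁺ t (suc n) u = begin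
    ev t (GT.ι (+ suc n) ⊗ u)                       ≡⟨ ⊗-cong (GT.ι-suc n) (≃-refl {u}) .at t ⟩
    ev t (([ 0# ] ++ GT.ι (+ n)) ⊗ u)               ≡⟨ GS.solve 2 (λ i u → (GS.con (+ 1) GS.:+ i) GS.:* u GS.:= u GS.:+ i GS.:* u) ≃-refl (GT.ι (+ n)) u .at t ⟩
    ev t (u ++ GT.ι (+ n) ⊗ u)                      ≡⟨ ev-++ t u _ ⟩
    ev t u ℤ.+ ev t (GT.ι (+ n) ⊗ u)                ≡⟨ cong (λ z → ev t u ℤ.+ z) (ev-ι⁺ t n u) ⟩
    ev t u ℤ.+ + n ℤ.* ev t u                       ≡⟨ ℤP.suc-* (+ n) (ev t u) ⟨
    + suc n ℤ.* ev t u                              ∎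

  ev-norm : ∀ z → ∑ elements (λ t → ev t z ℤ.* ev t z) ≡ + q ℤ.* ev 0# (z ⊗ star z)
  ev-norm z = begin
    ∑ elements (λ t → ev t z ℤ.* ev t z)
      ≡⟨ ∑-cong elements (λ t → trans (ℤP.*-comm (ev t z) (ev t z)) (trans (sym (⟪⟫-*ˡ z (ev t z) (λ c → ψ (c + t)))) (⟪⟫-cong z (λ c → trans (ℤP.*-comm (ev t z) (ψ (c + t))) (sym (⟪⟫-*ˡ z (ψ (c + t)) (λ c' → ψ (c' + t)))))))) ⟩
    ∑ elements (λ t → ⟪ z ⟫ (λ c → ⟪ z ⟫ (λ c' → ψ (c + t) ℤ.* ψ (c' + t))))
      ≡⟨ trans (sym (⟪⟫-∑ z elements (λ t c → ⟪ z ⟫ (λ c' → ψ (c + t) ℤ.* ψ (c' + t))))) (⟪⟫-cong z (λ c → sym (⟪⟫-∑ z elements (λ t c' → ψ (c + t) ℤ.* ψ (c' + t))))) ⟩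
    ⟪ z ⟫ (λ c → ⟪ z ⟫ (λ c' → ∑ elements (λ t → ψ (c + t) ℤ.* ψ (c' + t))))
      ≡⟨ ⟪⟫-cong z (λ c → ⟪⟫-cong z (λ c' → ∑ψ*ψ c c')) ⟩
    ⟪ z ⟫ (λ c → ⟪ z ⟫ (λ c' → + q ℤ.* ψ (c - c')))
      ≡⟨ trans (⟪⟫-cong z (λ c → ⟪⟫-*ˡ z (+ q) (λ c' → ψ (c - c')))) (⟪⟫-*ˡ z (+ q) (λ c → ⟪ z ⟫ (λ c' → ψ (c - c')))) ⟩
    + q ℤ.* ⟪ z ⟫ (λ c → ⟪ z ⟫ (λ c' → ψ (c - c')))
      ≡⟨ cong (+ q ℤ.*_) (⟪⟫-cong z (λ c → ⟪⟫-cong z (λ c' → trans (sym (ψ-neg (c - c'))) (cong ψ (solve 2 (λ c c' → :- (c :- c') := c' :+ (:- (c :+ con (+ 0)))) refl c c'))))) ⟩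
    + q ℤ.* ⟪ z ⟫ (λ c → ev (- (c + 0#)) z)
      ≡⟨ cong (+ q ℤ.*_) (trans (ev-⊗ 0# z (star z)) (⟪⟫-cong z (λ c → ev-star (c + 0#) z))) ⟨
    + q ℤ.* ev 0# (z ⊗ star z) ∎

  ev-norm-≥0 : ∀ z → + 0 ℤ.≤ ev 0# (z ⊗ star z)
  ev-norm-≥0 z = ℤO.NN-cancel (ℕ.pred q) (≡.subst (+ 0 ℤ.≤_) (trans (ev-norm z) (cong (ℤ._* ev 0# (z ⊗ star z))
    (trans (cong +_ (sym (ℕP.suc-pred q {{q≢0}}))) (sym (ι⁺-id (suc (ℕ.pred q))))))) (ℤO.NN-∑ elements (λ t → ℤO.NN-sq (ev t z))))
    where
    q≢0 : ℕ.NonZero q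
    q≢0 = nonempty (Inverse.to enum 0#)
      where
      nonempty : ∀ {m} → Fin.Fin m → ℕ.NonZero m
      nonempty {suc m} _ = _

  -- With integer coefficients a norm takes equal values at χ and at its conjugate, so this test
  -- controls only the real part of u at each nontrivial character. Such a condition does not pass
  -- to products, hence the multiplier form of `Nonneg`.
  record Pos (u : FormalSum) : Set where
    constructor mkPos
    field pos : ∀ z → + 0 ℤ.≤ ev 0# (u ⊗ (z ⊗ star z))
  open Pos public

  -- Being nonnegative at every nontrivial character, in a form closed under products.
  record Nonneg (u : FormalSum) : Set where
    constructor mkNonneg
    field times : ∀ {w} → Pos w → Pos (w ⊗ u)
  open Nonneg public

  Pos-resp : ∀ {u v} → u ≃ v → Pos u → Pos v
  Pos-resp {u} {v} e p .pos z = ≡.subst (+ 0 ℤ.≤_) (⊗-cong e (≃-refl {z ⊗ star z}) .at 0#) (p .pos z)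

  star-++ : ∀ u v → star (u ++ v) ≃ star u ++ star v
  star-++ u v .at t = cong (ev t) (LP.map-++ _ u v)

  star-cong : ∀ {u v} → u ≃ v → star u ≃ star v
  star-cong {u} {v} e .at t = trans (ev-star t u) (trans (e .at (- t)) (sym (ev-star t v)))

  star-⊗ : ∀ u v → star (u ⊗ v) ≃ star u ⊗ star v
  star-⊗ u v .at t = begin
    ev t (star (u ⊗ v))                    ≡⟨ ev-star t (u ⊗ v) ⟩
    ev (- t) (u ⊗ v)                       ≡⟨ ev-⊗ (- t) u v ⟩
    ⟪ u ⟫ (λ c → ev (c + - t) v)           ≡⟨ ⟪⟫-cong u (λ c → trans (cong (λ z → ev z v) (solve 2 (λ c t → c :+ (:- t) := :- (:- c :+ t)) refl c t)) (sym (ev-star (- c + t) v))) ⟩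
    ⟪ u ⟫ (λ c → ev (- c + t) (star v))    ≡⟨ ∑-map _ u _ ⟨
    ⟪ star u ⟫ (λ c → ev (c + t) (star v)) ≡⟨ ev-⊗ t (star u) (star v) ⟨
    ev t (star u ⊗ star v)                 ∎

  star-neg : ∀ u → star (neg u) ≃ neg (star u)
  star-neg u .at t = trans (ev-star t (neg u)) (trans (ev-neg (- t) u) (sym (trans (ev-neg t (star u)) (cong ℤ.-_ (ev-star t u)))))

  star-1 : star [ 0# ] ≃ [ 0# ]
  star-1 .at t = cong (λ z → ev t [ z ]) -0≡0

  star-star : ∀ u → star (star u) ≃ u
  star-star u .at t = trans (ev-star t (star u)) (trans (ev-star (- t) u) (cong (λ z → ev z u) (solve 1 (λ t → :- (:- t) := t) refl t)))

  -- The norm moves into the test element: testing w z z⋆ at y is testing w at `z ⊗ y`.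
  Nonneg-norm : ∀ z → Nonneg (z ⊗ star z)
  Nonneg-norm z .times {w} p .pos y = ≡.subst (+ 0 ℤ.≤_) (≃-trans (⊗-congˡ w (⊗-congˡ (z ⊗ y) (star-⊗ z y)))
    (GS.solve 5 (λ w z z' y y' → w GS.:* (z GS.:* y GS.:* (z' GS.:* y')) GS.:= w GS.:* (z GS.:* z') GS.:* (y GS.:* y')) ≃-refl w z (star z) y (star y)) .at 0#) (p .pos (z ⊗ y))

  Nonneg-cancel : ∀ k {x} → Nonneg (GT.ι (+ suc k) ⊗ x) → Nonneg x
  Nonneg-cancel k {x} p .times {w} h .pos z = ℤO.NN-cancel k (≡.subst (+ 0 ℤ.≤_) eq (p .times h .pos z))
    where
    eq : ev 0# (w ⊗ (GT.ι (+ suc k) ⊗ x) ⊗ (z ⊗ star z)) ≡ ℤT.ι (+ suc k) ℤ.* ev 0# (w ⊗ x ⊗ (z ⊗ star z))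
    eq = trans (GS.solve 4 (λ w i x s → w GS.:* (i GS.:* x) GS.:* s GS.:= i GS.:* (w GS.:* x GS.:* s)) ≃-refl w (GT.ι (+ suc k)) x (z ⊗ star z) .at 0#)
         (trans (ev-ι⁺ 0# (suc k) (w ⊗ x ⊗ (z ⊗ star z))) (cong (ℤ._* ev 0# (w ⊗ x ⊗ (z ⊗ star z))) (sym (ι⁺-id (suc k)))))

  𝔸 : StarOrderedRing
  𝔸 = record
    { commutativeRing = groupRing
    ; _⋆ = star
    ; ⋆-cong = star-cong
    ; ⋆-+ = star-++
    ; ⋆-* = star-⊗
    ; ⋆-neg = star-neg
    ; ⋆-0 = ≃-refl
    ; ⋆-1 = star-1
    ; ⋆-⋆ = star-star
    ; NN = Nonneg
    ; NN-resp = λ e p → mkNonneg (λ {w} h → Pos-resp (⊗-congˡ w e) (p .times h))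
    ; NN-+ = λ {x} {y} p r → mkNonneg (λ {w} h → Pos-resp (≃-sym (⊗-distribˡ w x y)) (mkPos (λ z →
        ≡.subst (+ 0 ℤ.≤_) (trans (sym (ev-++ 0# (w ⊗ x ⊗ (z ⊗ star z)) (w ⊗ y ⊗ (z ⊗ star z))))
          (GS.solve 3 (λ a b s → a GS.:* s GS.:+ b GS.:* s GS.:= (a GS.:+ b) GS.:* s) ≃-refl (w ⊗ x) (w ⊗ y) (z ⊗ star z) .at 0#))
          (ℤP.+-mono-≤ (p .times h .pos z) (r .times h .pos z)))))
    ; NN-* = λ {x} {y} p r → mkNonneg (λ {w} h → Pos-resp (⊗-assoc w x y) (r .times (p .times h)))
    ; NN-sq = Nonneg-norm
    ; NN-cancel = Nonneg-cancel
    }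

  τ : FormalSum → ℤ
  τ = ev 0#

  τ-Nonneg : ∀ {u} → Nonneg u → + 0 ℤ.≤ τ u
  τ-Nonneg {u} p = ≡.subst (+ 0 ℤ.≤_) (≃-trans (⊗-congˡ ([ 0# ] ⊗ u) (⊗-congˡ [ 0# ] star-1))
    (GS.solve 1 (λ u → GS.con (+ 1) GS.:* u GS.:* (GS.con (+ 1) GS.:* GS.con (+ 1)) GS.:= u) ≃-refl u) .at 0#)
    (p .times {[ 0# ]} (mkPos (λ z → ≡.subst (+ 0 ℤ.≤_) (sym (⊗-identityˡ (z ⊗ star z) .at 0#)) (ev-norm-≥0 z))) .pos [ 0# ])

  -- The tautological map c ↦ [c] is every nontrivial character at once. The sum of all [x c] is
  -- zero because the trivial character is invisible to `_≃_`.
  universal : Spheres.Character F 2≢0 𝔸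
  universal = record
    { e = [_]
    ; e-+ = λ a b → ≃-refl
    ; e-0 = ≃-refl
    ; e-⋆ = λ a → ≃-refl
    ; ∑e = λ {x} x≢0 → mk≃ (λ t → trans (ev-∑ t elements (λ c → [ x * c ])) (trans (∑-cong elements (λ c → ev-[] t (x * c))) (∑ψ-affine t x≢0)))
    }

  module A where
    open Spheres F 2≢0 𝔸 public
    open Moments universal public

  -- Chirp sums along a line of frequencies.

  -- The affine substitution r = r′ + m makes the exponent linear in r′.
  ∑-chirp : ∀ {a} → a ≢ 0# → ∀ c c' → ∑ elements (λ r' → ∑ elements (λ r → ψ (r * c - r * r * a - (r' * c' - r' * r' * a)))) ≡ + q ℤ.* ψ ((c - c') * (c + c'))
  ∑-chirp {a} a≢0 c c' = begin
    ∑ elements (λ r' → ∑ elements (λ r → f r r'))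
      ≡⟨ ∑-cong elements (λ r' → sym (Rℤ.reindex (λ m → m + r') (λ m → m - r') (λ m → solve 2 (λ m r → m :+ r :- r := m) refl m r') (λ m → solve 2 (λ m r → m :- r :+ r := m) refl m r') (λ r → f r r'))) ⟩
    ∑ elements (λ r' → ∑ elements (λ m → f (m + r') r'))
      ≡⟨ ∑-swap elements elements (λ r' m → f (m + r') r') ⟩
    ∑ elements (λ m → ∑ elements (λ r' → f (m + r') r'))
      ≡⟨ ∑-cong elements (λ m → ∑-cong elements (λ r' → cong ψ (solve 5 (λ m r c c' a → (m :+ r) :* c :- (m :+ r) :* (m :+ r) :* a :- (r :* c' :- r :* r :* a)
           := (c :- c' :- con (+ 2) :* a :* m) :* r :+ (m :* c :- m :* m :* a)) refl m r' c c' a))) ⟩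
    ∑ elements (λ m → ∑ elements (λ r' → ψ ((c - c' - (1# + 1#) * a * m) * r' + (m * c - m * m * a))))
      ≡⟨ enumerates-elements ℤP.+-*-commutativeRing (λ m → ∑ elements (λ r' → ψ ((c - c' - (1# + 1#) * a * m) * r' + (m * c - m * m * a)))) m₀
           (λ m m≢m₀ → ∑ψ-affine (m * c - m * m * a) (λ e → m≢m₀ (*-cancelˡ 2a≢0 (trans (sym (-≡0⇒≡ e)) (sym 2am₀))))) ⟩
    ∑ elements (λ r' → ψ ((c - c' - (1# + 1#) * a * m₀) * r' + (m₀ * c - m₀ * m₀ * a)))
      ≡⟨ ∑-cong elements (λ r' → trans (cong (λ z → ψ ((c - c' - z) * r' + (m₀ * c - m₀ * m₀ * a))) 2am₀)
           (cong ψ (solve 3 (λ x r y → (x :- x) :* r :+ y := y) refl (c - c') r' (m₀ * c - m₀ * m₀ * a)))) ⟩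
    ∑ elements (λ r' → ψ (m₀ * c - m₀ * m₀ * a))   ≡⟨ ∑-elements-const (ψ (m₀ * c - m₀ * m₀ * a)) ⟩
    + q ℤ.* ψ (m₀ * c - m₀ * m₀ * a)               ≡⟨ cong (+ q ℤ.*_) (trans (sym (ψ-*ˡ (m₀ * c - m₀ * m₀ * a) 4a≢0)) (cong ψ value)) ⟩
    + q ℤ.* ψ ((c - c') * (c + c'))                ∎
    where
    f : Carrier → Carrier → ℤ
    f r r' = ψ (r * c - r * r * a - (r' * c' - r' * r' * a))
    2a≢0 : (1# + 1#) * a ≢ 0#
    2a≢0 = *-≢0 2≢0 a≢0
    4a≢0 : (1# + 1#) * ((1# + 1#) * a) ≢ 0#
    4a≢0 = *-≢0 2≢0 2a≢0
    m₀ = (c - c') / ((1# + 1#) * a)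
    2am₀ : (1# + 1#) * a * m₀ ≡ c - c'
    2am₀ = *-/ (c - c') 2a≢0
    value : (1# + 1#) * ((1# + 1#) * a) * (m₀ * c - m₀ * m₀ * a) ≡ (c - c') * (c + c')
    value = trans (solve 3 (λ a m c → con (+ 2) :* (con (+ 2) :* a) :* (m :* c :- m :* m :* a) := con (+ 2) :* a :* m :* (con (+ 2) :* c :- con (+ 2) :* a :* m)) refl a m₀ c)
            (trans (cong (λ z → z * ((1# + 1#) * c - z)) 2am₀) (solve 2 (λ c c' → (c :- c') :* (con (+ 2) :* c :- (c :- c')) := (c :- c') :* (c :+ c')) refl c c'))

  -- For r ≠ 0 the factor r of the argument r(c - a r) can be cancelled inside `ψ`, which leaves an
  -- affine sum over the units; r = 0 contributes q - 1.
  ∑-chirp₁ : ∀ {a} → a ≢ 0# → ∀ c → ∑ elements (λ r → ψ (r * c - r * r * a)) ≡ + q ℤ.- + 1 ℤ.- ψ c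
  ∑-chirp₁ {a} a≢0 c = begin
    ∑ elements (λ r → ψ (r * c - r * r * a))
      ≡⟨ ∑-cong elements (λ r → cong ψ (solve 3 (λ r c a → r :* c :- r :* r :* a := r :* (c :- a :* r)) refl r c a)) ⟩
    ∑ elements (λ r → ψ (r * (c - a * r)))     ≡⟨ split ⟩
    ∑ units (λ r → ψ (r * (c - a * r))) ℤ.+ ψ (0# * (c - a * 0#))
      ≡⟨ cong₂ ℤ._+_ (∑-cong-filter nz elements (λ r hr → trans (ψ-*ˡ (c - a * r) (nz⇒≢0 hr)) (cong ψ (solve 3 (λ r c a → c :- a :* r := (:- a) :* r :+ c) refl r c a))))
                     (trans (cong ψ (zeroˡ (c - a * 0#))) ψ-0) ⟩
    ∑ units (λ r → ψ ((- a) * r + c)) ℤ.+ (+ q ℤ.- + 1)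
      ≡⟨ cong (ℤ._+ (+ q ℤ.- + 1)) (trans (Uℤ.∑-units (λ r → ψ ((- a) * r + c))) (cong₂ ℤ._-_ (∑ψ-affine c (-≢0 a≢0)) (cong ψ (solve 2 (λ a c → (:- a) :* con (+ 0) :+ c := c) refl a c)))) ⟩
    (+ 0 ℤ.- ψ c) ℤ.+ (+ q ℤ.- + 1)            ≡⟨ ℤS.solve 2 (λ q p → (ℤS.con (+ 0) ℤS.:- p) ℤS.:+ (q ℤS.:- ℤS.con (+ 1)) ℤS.:= q ℤS.:- ℤS.con (+ 1) ℤS.:- p) refl (+ q) (ψ c) ⟩
    + q ℤ.- + 1 ℤ.- ψ c ∎
    where
    split : ∑ elements (λ r → ψ (r * (c - a * r))) ≡ ∑ units (λ r → ψ (r * (c - a * r))) ℤ.+ ψ (0# * (c - a * 0#))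
    split = trans (ℤS.solve 2 (λ x y → x ℤS.:= x ℤS.:- y ℤS.:+ y) refl (∑ elements (λ r → ψ (r * (c - a * r)))) (ψ (0# * (c - a * 0#))))
                  (cong (ℤ._+ ψ (0# * (c - a * 0#))) (sym (Uℤ.∑-units (λ r → ψ (r * (c - a * r))))))

  chirp-kernel : Carrier → Carrier → Carrier → ℤ
  chirp-kernel a c c' = ∑ units (λ r → ∑ units (λ r' → ψ (r * c - r * r * a - (r' * c' - r' * r' * a))))

  -- Inclusion-exclusion over r = 0 and r′ = 0 reduces to the complete sums: `∑-chirp` for the
  -- double sum and `∑-chirp₁` for the two edges.
  chirp-kernel≡ : ∀ {a} → a ≢ 0# → ∀ c c' → chirp-kernel a c c' ≡ + q ℤ.* ψ ((c - c') * (c + c')) ℤ.+ ψ c ℤ.+ ψ c' ℤ.- (+ q ℤ.- + 1)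
  chirp-kernel≡ {a} a≢0 c c' = begin
    ∑ units (λ r → ∑ units (f r))                       ≡⟨ ∑-cong units (λ r → Uℤ.∑-units (f r)) ⟩
    ∑ units (λ r → ∑ elements (f r) ℤ.- f r 0#)         ≡⟨ ∑-- units (λ r → ∑ elements (f r)) (λ r → f r 0#) ⟩
    ∑ units (λ r → ∑ elements (f r)) ℤ.- ∑ units (λ r → f r 0#)
      ≡⟨ cong₂ ℤ._-_ (Uℤ.∑-units (λ r → ∑ elements (f r))) (Uℤ.∑-units (λ r → f r 0#)) ⟩
    (∑ elements (λ r → ∑ elements (f r)) ℤ.- ∑ elements (f 0#)) ℤ.- (∑ elements (λ r → f r 0#) ℤ.- f 0# 0#)
      ≡⟨ cong₂ ℤ._-_ (cong₂ ℤ._-_ (trans (∑-swap elements elements f) (∑-chirp a≢0 c c')) left) (cong₂ ℤ._-_ right corner) ⟩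
    (+ q ℤ.* ψ ((c - c') * (c + c')) ℤ.- (+ q ℤ.- + 1 ℤ.- ψ c')) ℤ.- ((+ q ℤ.- + 1 ℤ.- ψ c) ℤ.- (+ q ℤ.- + 1))
      ≡⟨ ℤS.solve 4 (λ X q p p' → (X ℤS.:- (q ℤS.:- ℤS.con (+ 1) ℤS.:- p')) ℤS.:- ((q ℤS.:- ℤS.con (+ 1) ℤS.:- p) ℤS.:- (q ℤS.:- ℤS.con (+ 1))) ℤS.:= X ℤS.:+ p ℤS.:+ p' ℤS.:- (q ℤS.:- ℤS.con (+ 1)))
           refl (+ q ℤ.* ψ ((c - c') * (c + c'))) (+ q) (ψ c) (ψ c') ⟩
    + q ℤ.* ψ ((c - c') * (c + c')) ℤ.+ ψ c ℤ.+ ψ c' ℤ.- (+ q ℤ.- + 1) ∎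
    where
    f : Carrier → Carrier → ℤ
    f r r' = ψ (r * c - r * r * a - (r' * c' - r' * r' * a))
    left : ∑ elements (f 0#) ≡ + q ℤ.- + 1 ℤ.- ψ c'
    left = trans (∑-cong elements (λ r → trans (sym (ψ-neg (0# * c - 0# * 0# * a - (r * c' - r * r * a)))) (cong ψ (solve 4 (λ r c c' a → :- (con (+ 0) :* c :- con (+ 0) :* con (+ 0) :* a :- (r :* c' :- r :* r :* a)) := r :* c' :- r :* r :* a) refl r c c' a)))) (∑-chirp₁ a≢0 c')
    right : ∑ elements (λ r → f r 0#) ≡ + q ℤ.- + 1 ℤ.- ψ c
    right = trans (∑-cong elements (λ r → cong ψ (solve 4 (λ r c c' a → r :* c :- r :* r :* a :- (con (+ 0) :* c' :- con (+ 0) :* con (+ 0) :* a) := r :* c :- r :* r :* a) refl r c c' a))) (∑-chirp₁ a≢0 c)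
    corner : f 0# 0# ≡ + q ℤ.- + 1
    corner = trans (cong ψ (solve 3 (λ c c' a → con (+ 0) :* c :- con (+ 0) :* con (+ 0) :* a :- (con (+ 0) :* c' :- con (+ 0) :* con (+ 0) :* a) := con (+ 0)) refl c c' a)) ψ-0

  -- All values of `ψ` are q - 1 or -1, so the cases c = c′, c = -c′, c = 0 and c′ = 0 decide. The
  -- right side is arranged as a sum of two positive semidefinite kernels: the first comes from an
  -- odd part, the second has rank one.
  ψ-relation : ∀ c c' → + 2 ℤ.* (+ q ℤ.* ψ (c - c')) ℤ.- (+ q ℤ.* ψ ((c - c') * (c + c')) ℤ.+ ψ c ℤ.+ ψ c' ℤ.- (+ q ℤ.- + 1))
                        ≡ + q ℤ.* (ψ (c - c') ℤ.- ψ (c + c')) ℤ.+ ψ c ℤ.* ψ c'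
  ψ-relation c c' = cases ((c - c') ≟ 0#) ((c + c') ≟ 0#)
    where
    Goal : ℤ → ℤ → ℤ → ℤ → ℤ → Set
    Goal x y z u w = + 2 ℤ.* (+ q ℤ.* x) ℤ.- (+ q ℤ.* y ℤ.+ z ℤ.+ u ℤ.- (+ q ℤ.- + 1)) ≡ + q ℤ.* (x ℤ.- w) ℤ.+ z ℤ.* u
    go : ∀ {x y z u w} → ψ (c - c') ≡ x → ψ ((c - c') * (c + c')) ≡ y → ψ c ≡ z → ψ c' ≡ u → ψ (c + c') ≡ w → Goal x y z u w →
         Goal (ψ (c - c')) (ψ ((c - c') * (c + c'))) (ψ c) (ψ c') (ψ (c + c'))
    go refl refl refl refl refl g = g
    Q : ∀ {m} → ℤS.Polynomial m → ℤS.Polynomial m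
    Q k = k ℤS.:- ℤS.con (+ 1)
    o : ∀ {m} → ℤS.Polynomial m
    o = ℤS.:- ℤS.con (+ 1)
    poly : ∀ {m} → (q x y z u w : ℤS.Polynomial m) → ℤS.Polynomial m × ℤS.Polynomial m
    poly q x y z u w = ℤS.con (+ 2) ℤS.:* (q ℤS.:* x) ℤS.:- (q ℤS.:* y ℤS.:+ z ℤS.:+ u ℤS.:- (q ℤS.:- ℤS.con (+ 1))) ℤS.:= q ℤS.:* (x ℤS.:- w) ℤS.:+ z ℤS.:* u
    product-0ˡ : c - c' ≡ 0# → (c - c') * (c + c') ≡ 0#
    product-0ˡ e = trans (cong (_* (c + c')) e) (zeroˡ _)
    product-0ʳ : c + c' ≡ 0# → (c - c') * (c + c') ≡ 0#
    product-0ʳ e = trans (cong ((c - c') *_) e) (zeroʳ _)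
    ψ0 : ∀ {x} → x ≡ 0# → ψ x ≡ + q ℤ.- + 1
    ψ0 e = trans (cong ψ e) ψ-0
    cases : Dec (c - c' ≡ 0#) → Dec (c + c' ≡ 0#) → Goal (ψ (c - c')) (ψ ((c - c') * (c + c'))) (ψ c) (ψ c') (ψ (c + c'))
    cases (yes e) (yes e') = go (ψ0 e) (ψ0 (product-0ˡ e)) (ψ0 c≡0) (ψ0 c'≡0) (ψ0 e') (ℤS.solve 1 (λ q → poly q (Q q) (Q q) (Q q) (Q q) (Q q)) refl (+ q))
      where
      c≡0 : c ≡ 0#
      c≡0 = *-cancelˡ 2≢0 (trans (solve 2 (λ c c' → con (+ 2) :* c := c :- c' :+ (c :+ c')) refl c c') (trans (cong₂ _+_ e e') (solve 0 (con (+ 0) :+ con (+ 0) := con (+ 2) :* con (+ 0)) refl)))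
      c'≡0 : c' ≡ 0#
      c'≡0 = trans (sym (-≡0⇒≡ e)) c≡0
    cases (yes e) (no e') = go (ψ0 e) (ψ0 (product-0ˡ e)) (ψ-≢0 c≢0) (ψ-≢0 c'≢0) (ψ-≢0 e') (ℤS.solve 1 (λ q → poly q (Q q) (Q q) o o o) refl (+ q))
      where
      c'≢0 : c' ≢ 0#
      c'≢0 z = e' (trans (cong₂ _+_ (trans (-≡0⇒≡ e) z) z) (+-identityˡ 0#))
      c≢0 : c ≢ 0#
      c≢0 z = c'≢0 (trans (sym (-≡0⇒≡ e)) z)
    cases (no e) (yes e') = go (ψ-≢0 e) (ψ0 (product-0ʳ e')) (ψ-≢0 c≢0) (ψ-≢0 c'≢0) (ψ0 e') (ℤS.solve 1 (λ q → poly q o (Q q) o o (Q q)) refl (+ q))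
      where
      c≡-c' : c ≡ - c'
      c≡-c' = trans (solve 2 (λ c c' → c := c :+ c' :- c') refl c c') (trans (cong (_- c') e') (+-identityˡ (- c')))
      c'≢0 : c' ≢ 0#
      c'≢0 z = e (trans (cong₂ _-_ (trans c≡-c' (trans (cong -_ z) -0≡0)) z) (-‿inverseʳ 0#))
      c≢0 : c ≢ 0#
      c≢0 z = c'≢0 (trans (solve 2 (λ c c' → c' := c :+ c' :- c) refl c c') (trans (cong₂ _-_ e' z) (-‿inverseʳ 0#)))
    cases (no e) (no e') with c ≟ 0# | c' ≟ 0#
    ... | yes z | yes z' = ⊥-elim (e (trans (cong₂ _-_ z z') (-‿inverseʳ 0#)))
    ... | yes z | no z'  = go (ψ-≢0 e) (ψ-≢0 (*-≢0 e e')) (ψ0 z) (ψ-≢0 z') (ψ-≢0 e') (ℤS.solve 1 (λ q → poly q o o (Q q) o o) refl (+ q))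
    ... | no z  | yes z' = go (ψ-≢0 e) (ψ-≢0 (*-≢0 e e')) (ψ-≢0 z) (ψ0 z') (ψ-≢0 e') (ℤS.solve 1 (λ q → poly q o o o (Q q) o) refl (+ q))
    ... | no z  | no z'  = go (ψ-≢0 e) (ψ-≢0 (*-≢0 e e')) (ψ-≢0 z) (ψ-≢0 z') (ψ-≢0 e') (ℤS.solve 1 (λ q → poly q o o o o o) refl (+ q))

  delta : List Carrier → FormalSum
  delta C = GT.∑ C [_]

  τ-deltas : ∀ C C' → τ (delta C ⊗ star (delta C')) ≡ ∑ C (λ c → ∑ C' (λ c' → ψ (c - c')))
  τ-deltas C C' = begin
    τ (delta C ⊗ star (delta C'))                   ≡⟨ ⊗-congˡ (delta C) (A.∑-⋆ C' [_]) .at 0# ⟩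
    τ (delta C ⊗ GT.∑ C' (λ c' → [ - c' ]))         ≡⟨ GT.∑-*-∑ C C' [_] (λ c' → [ - c' ]) .at 0# ⟩
    τ (GT.∑ C (λ c → GT.∑ C' (λ c' → [ c + - c' ]))) ≡⟨ trans (ev-∑ 0# C _) (∑-cong C (λ c → ev-∑ 0# C' _)) ⟩
    ∑ C (λ c → ∑ C' (λ c' → ev 0# [ c + - c' ]))    ≡⟨ ∑-cong C (λ c → ∑-cong C' (λ c' → trans (ev-[] 0# (c - c')) (cong ψ (+-identityʳ (c - c'))))) ⟩
    ∑ C (λ c → ∑ C' (λ c' → ψ (c - c')))            ∎

  -- The entry r c - r² a is the phase s·η - ‖η‖/4 at the dilate η = r ξ, where c = s·ξ and ‖ξ‖ =
  -- 4a.
  chirp : Carrier → List Carrier → FormalSum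
  chirp a C = GT.∑ units (λ r → GT.∑ C (λ c → [ r * c - r * r * a ]))

  -- By `ψ-relation` the difference of the two sides is q/2 times τ of the norm of H - H⋆, plus the
  -- square of the sum of `ψ` over `C`. The estimate concerns the sum over all nontrivial
  -- characters, not the order of the group ring.
  τ-chirp-≤ : ∀ {a} → a ≢ 0# → ∀ C → τ (chirp a C ⊗ star (chirp a C)) ℤ.≤ + 2 ℤ.* (+ q ℤ.* τ (delta C ⊗ star (delta C)))
  τ-chirp-≤ {a} a≢0 C = ℤP.0≤i-j⇒j≤i (≡.subst (+ 0 ℤ.≤_) (sym difference) (ℤP.+-mono-≤ (nonneg-q odd-part) (ℤO.NN-sq (∑ C ψ))))
    where
    values : List Carrier
    values = concatMap (λ r → L.map (λ c → r * c - r * r * a) C) units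
    ∑-values : ∀ (f : Carrier → ℤ) → ∑ values f ≡ ∑ units (λ r → ∑ C (λ c → f (r * c - r * r * a)))
    ∑-values f = trans (∑-concatMap _ units f) (∑-cong units (λ r → ∑-map _ C f))
    chirp≃ : chirp a C ≃ delta values
    chirp≃ = ≃-sym (≃-trans (GT.∑-concatMap _ units [_]) (GT.∑-cong units (λ r → GT.∑-map _ C [_])))
    τ-chirp : τ (chirp a C ⊗ star (chirp a C)) ≡ ∑ C (λ c → ∑ C (λ c' → chirp-kernel a c c'))
    τ-chirp = begin
      τ (chirp a C ⊗ star (chirp a C))       ≡⟨ ⊗-cong chirp≃ (star-cong chirp≃) .at 0# ⟩
      τ (delta values ⊗ star (delta values)) ≡⟨ τ-deltas values values ⟩
      ∑ values (λ x → ∑ values (λ y → ψ (x - y)))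
        ≡⟨ trans (∑-values _) (∑-cong units (λ r → ∑-cong C (λ c → ∑-values _))) ⟩
      ∑ units (λ r → ∑ C (λ c → ∑ units (λ r' → ∑ C (λ c' → f r c r' c'))))
        ≡⟨ trans (∑-swap units C _) (∑-cong C (λ c → trans (∑-cong units (λ r → ∑-swap units C _)) (∑-swap units C _))) ⟩
      ∑ C (λ c → ∑ C (λ c' → chirp-kernel a c c')) ∎
      where
      f : Carrier → Carrier → Carrier → Carrier → ℤ
      f r c r' c' = ψ (r * c - r * r * a - (r' * c' - r' * r' * a))
    H = delta C
    τ-HH : τ (H ⊗ H) ≡ ∑ C (λ c → ∑ C (λ c' → ψ (c + c')))
    τ-HH = trans (GT.∑-*-∑ C C [_] [_] .at 0#) (trans (trans (ev-∑ 0# C _) (∑-cong C (λ c → ev-∑ 0# C _))) (∑-cong C (λ c → ∑-cong C (λ c' → trans (ev-[] 0# (c + c')) (cong ψ (+-identityʳ (c + c')))))))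
    τ-star : ∀ u → τ (star u) ≡ τ u
    τ-star u = trans (ev-star 0# u) (cong (λ z → ev z u) -0≡0)
    difference : + 2 ℤ.* (+ q ℤ.* τ (H ⊗ star H)) ℤ.- τ (chirp a C ⊗ star (chirp a C)) ≡ + q ℤ.* (τ (H ⊗ star H) ℤ.- τ (H ⊗ H)) ℤ.+ ∑ C ψ ℤ.* ∑ C ψ
    difference = begin
      + 2 ℤ.* (+ q ℤ.* τ (H ⊗ star H)) ℤ.- τ (chirp a C ⊗ star (chirp a C))
        ≡⟨ cong₂ ℤ._-_ (cong (λ z → + 2 ℤ.* (+ q ℤ.* z)) (τ-deltas C C)) τ-chirp ⟩
      + 2 ℤ.* (+ q ℤ.* ∑∑ (λ c c' → ψ (c - c'))) ℤ.- ∑∑ (chirp-kernel a)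
        ≡⟨ cong₂ ℤ._-_ (trans (cong (+ 2 ℤ.*_) (∑∑-*ˡ (+ q) (λ c c' → ψ (c - c')))) (∑∑-*ˡ (+ 2) (λ c c' → + q ℤ.* ψ (c - c')))) (∑-cong C (λ c → ∑-cong C (λ c' → chirp-kernel≡ a≢0 c c'))) ⟩
      _ ≡⟨ sym (trans (∑-cong C (λ c → ∑-- C _ _)) (∑-- C _ _)) ⟩
      ∑∑ (λ c c' → + 2 ℤ.* (+ q ℤ.* ψ (c - c')) ℤ.- (+ q ℤ.* ψ ((c - c') * (c + c')) ℤ.+ ψ c ℤ.+ ψ c' ℤ.- (+ q ℤ.- + 1)))
        ≡⟨ ∑-cong C (λ c → ∑-cong C (λ c' → ψ-relation c c')) ⟩
      ∑∑ (λ c c' → + q ℤ.* (ψ (c - c') ℤ.- ψ (c + c')) ℤ.+ ψ c ℤ.* ψ c')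
        ≡⟨ trans (∑-cong C (λ c → ∑-+ C _ _)) (∑-+ C _ _) ⟩
      ∑∑ (λ c c' → + q ℤ.* (ψ (c - c') ℤ.- ψ (c + c'))) ℤ.+ ∑∑ (λ c c' → ψ c ℤ.* ψ c')
        ≡⟨ cong₂ ℤ._+_ (sym (∑∑-*ˡ (+ q) (λ c c' → ψ (c - c') ℤ.- ψ (c + c')))) (sym (∑-*-∑ C C ψ ψ)) ⟩
      + q ℤ.* ∑∑ (λ c c' → ψ (c - c') ℤ.- ψ (c + c')) ℤ.+ ∑ C ψ ℤ.* ∑ C ψ
        ≡⟨ cong (λ z → + q ℤ.* z ℤ.+ ∑ C ψ ℤ.* ∑ C ψ) (trans (trans (∑-cong C (λ c → ∑-- C _ _)) (∑-- C _ _)) (cong₂ ℤ._-_ (sym (τ-deltas C C)) (sym τ-HH))) ⟩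
      + q ℤ.* (τ (H ⊗ star H) ℤ.- τ (H ⊗ H)) ℤ.+ ∑ C ψ ℤ.* ∑ C ψ ∎
      where
      ∑∑ : (Carrier → Carrier → ℤ) → ℤ
      ∑∑ f = ∑ C (λ c → ∑ C (f c))
      ∑∑-*ˡ : ∀ k f → k ℤ.* ∑∑ f ≡ ∑∑ (λ c c' → k ℤ.* f c c')
      ∑∑-*ˡ k f = sym (trans (∑-cong C (λ c → ∑-*ˡ C k (f c))) (∑-*ˡ C k _))
    -- |H − H̄|² = 2|H|² − H² − H̄².
    odd-part : + 0 ℤ.≤ τ (H ⊗ star H) ℤ.- τ (H ⊗ H)
    odd-part = ℤO.NN-cancel 1 (≡.subst (+ 0 ℤ.≤_) eq (ev-norm-≥0 (H ++ neg (star H))))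
      where
      eq : τ ((H ++ neg (star H)) ⊗ star (H ++ neg (star H))) ≡ + 2 ℤ.* (τ (H ⊗ star H) ℤ.- τ (H ⊗ H))
      eq = begin
        τ ((H ++ neg (star H)) ⊗ star (H ++ neg (star H)))
          ≡⟨ ⊗-congˡ (H ++ neg (star H)) (≃-trans (star-++ H (neg (star H))) (++-cong (≃-refl {star H}) (≃-trans (star-neg (star H)) (neg-cong (star-star H))))) .at 0# ⟩
        τ ((H ++ neg (star H)) ⊗ (star H ++ neg H))
          ≡⟨ GS.solve 2 (λ h h' → (h GS.:- h') GS.:* (h' GS.:- h) GS.:= (h GS.:* h' GS.:+ h GS.:* h') GS.:+ GS.:- (h GS.:* h GS.:+ h' GS.:* h')) ≃-refl H (star H) .at 0# ⟩
        τ ((H ⊗ star H ++ H ⊗ star H) ++ neg (H ⊗ H ++ star H ⊗ star H))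
          ≡⟨ trans (ev-++ 0# (H ⊗ star H ++ H ⊗ star H) _) (cong₂ ℤ._+_ (ev-++ 0# (H ⊗ star H) (H ⊗ star H)) (trans (ev-neg 0# (H ⊗ H ++ star H ⊗ star H)) (cong ℤ.-_ (trans (ev-++ 0# (H ⊗ H) _) (cong (λ z → τ (H ⊗ H) ℤ.+ z) (trans (sym (star-⊗ H H .at 0#)) (τ-star (H ⊗ H)))))))) ⟩
        (τ (H ⊗ star H) ℤ.+ τ (H ⊗ star H)) ℤ.+ ℤ.- (τ (H ⊗ H) ℤ.+ τ (H ⊗ H))
          ≡⟨ ℤS.solve 2 (λ x y → (x ℤS.:+ x) ℤS.:+ (ℤS.:- (y ℤS.:+ y)) ℤS.:= ℤS.con (+ 2) ℤS.:* (x ℤS.:- y)) refl (τ (H ⊗ star H)) (τ (H ⊗ H)) ⟩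
        + 2 ℤ.* (τ (H ⊗ star H) ℤ.- τ (H ⊗ H)) ∎
    nonneg-q : ∀ {k} → + 0 ℤ.≤ k → + 0 ℤ.≤ + q ℤ.* k
    nonneg-q {k} h = ℤO.NN-* {+ q} {k} (+≤+ ℕ.z≤n) h

  -- At most half of the sums are isotropic.

  ‖+‖ : ∀ {d} (x y : Vect d) → ‖ x +ᵛ y ‖ ≡ ‖ x ‖ + (1# + 1#) * x ∙ y + ‖ y ‖
  ‖+‖ []      []      = solve 0 (con (+ 0) := con (+ 0) :+ con (+ 2) :* con (+ 0) :+ con (+ 0)) refl
  ‖+‖ (a ∷ x) (b ∷ y) = trans (cong (λ z → (a + b) * (a + b) + z) (‖+‖ x y))
    (solve 5 (λ a b u v w → (a :+ b) :* (a :+ b) :+ (u :+ con (+ 2) :* v :+ w) := a :* a :+ u :+ con (+ 2) :* (a :* b :+ v) :+ (b :* b :+ w)) refl a b (‖ x ‖) (x ∙ y) (‖ y ‖))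

  +ᵛ-assoc : ∀ {d} (x y z : Vect d) → (x +ᵛ y) +ᵛ z ≡ x +ᵛ (y +ᵛ z)
  +ᵛ-assoc []      []      []      = refl
  +ᵛ-assoc (a ∷ x) (b ∷ y) (c ∷ z) = cong₂ _∷_ (+-assoc a b c) (+ᵛ-assoc x y z)

  +ᵛ-comm : ∀ {d} (x y : Vect d) → x +ᵛ y ≡ y +ᵛ x
  +ᵛ-comm []      []      = refl
  +ᵛ-comm (a ∷ x) (b ∷ y) = cong₂ _∷_ (+-comm a b) (+ᵛ-comm x y)

  ·-≡0 : ∀ {d} {r} → r ≢ 0# → (x : Vect d) → r · x ≡ 0ᵛ → x ≡ 0ᵛ
  ·-≡0 r≢0 []      e = refl
  ·-≡0 {r = r} r≢0 (a ∷ x) e = cong₂ _∷_ (*-cancelˡ r≢0 (trans (VP.∷-injectiveˡ e) (sym (zeroʳ r)))) (·-≡0 r≢0 x (VP.∷-injectiveʳ e))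

  ·-0ᵛ : ∀ {d} r → r · 0ᵛ {d} ≡ 0ᵛ
  ·-0ᵛ {zero}  r = refl
  ·-0ᵛ {suc d} r = cong₂ _∷_ (zeroʳ r) (·-0ᵛ r)

  -- The difference of the two norms is affine in w with slope 2(z - z′), so its character sum
  -- vanishes off the diagonal.
  ∑ψ-difference : ∀ {d} (z z' : Vect d) → ∑ (allVecs d) (λ w → ψ (‖ w +ᵛ z ‖ - ‖ w +ᵛ z' ‖)) ≡ qq d ℤ.* ⟦ does (z' ≟ᵛ z) ⟧
  ∑ψ-difference {d} z z' = begin
    ∑ (allVecs d) (λ w → ψ (‖ w +ᵛ z ‖ - ‖ w +ᵛ z' ‖))
      ≡⟨ ∑-cong (allVecs d) (λ w → cong ψ (trans (cong₂ _-_ (‖+‖ w z) (‖+‖ w z'))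
           (trans (solve 5 (λ n p p' u u' → n :+ con (+ 2) :* p :+ u :- (n :+ con (+ 2) :* p' :+ u') := con (+ 2) :* (p :- p') :+ (u :- u')) refl (‖ w ‖) (w ∙ z) (w ∙ z') (‖ z ‖) (‖ z' ‖))
                  (cong (_+ (‖ z ‖ - ‖ z' ‖)) (trans (cong ((1# + 1#) *_) (sym (∙--ʳ w z z'))) (sym (∙-·ʳ (1# + 1#) w (z -ᵛ z')))))))) ⟩
    ∑ (allVecs d) (λ w → ψ (w ∙ ((1# + 1#) · (z -ᵛ z')) + (‖ z ‖ - ‖ z' ‖)))
      ≡⟨ ∑ψ-∙ ((1# + 1#) · (z -ᵛ z')) (‖ z ‖ - ‖ z' ‖) ⟩
    + (q ℕ.^ d) ℤ.* (⟦ does (((1# + 1#) · (z -ᵛ z')) ≟ᵛ 0ᵛ) ⟧ ℤ.* ψ (‖ z ‖ - ‖ z' ‖))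
      ≡⟨ cong (λ b → + (q ℕ.^ d) ℤ.* (⟦ b ⟧ ℤ.* ψ (‖ z ‖ - ‖ z' ‖))) (does-cong (((1# + 1#) · (z -ᵛ z')) ≟ᵛ 0ᵛ) (z' ≟ᵛ z)
           (λ e → sym (-ᵛ≡0⇒≡ z z' (·-≡0 2≢0 (z -ᵛ z') e))) (λ { refl → trans (cong ((1# + 1#) ·_) (x-ᵛx≡0 z)) (·-0ᵛ (1# + 1#)) })) ⟩
    + (q ℕ.^ d) ℤ.* (⟦ does (z' ≟ᵛ z) ⟧ ℤ.* ψ (‖ z ‖ - ‖ z' ‖))
      ≡⟨ cong (+ (q ℕ.^ d) ℤ.*_) (at-diagonal (z' ≟ᵛ z)) ⟩
    + (q ℕ.^ d) ℤ.* (⟦ does (z' ≟ᵛ z) ⟧ ℤ.* (+ q ℤ.- + 1))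
      ≡⟨ ℤS.solve 3 (λ a b c → a ℤS.:* (b ℤS.:* c) ℤS.:= a ℤS.:* c ℤS.:* b) refl (+ (q ℕ.^ d)) ⟦ does (z' ≟ᵛ z) ⟧ (+ q ℤ.- + 1) ⟩
    qq d ℤ.* ⟦ does (z' ≟ᵛ z) ⟧ ∎
    where
    at-diagonal : (p : Dec (z' ≡ z)) → ⟦ does p ⟧ ℤ.* ψ (‖ z ‖ - ‖ z' ‖) ≡ ⟦ does p ⟧ ℤ.* (+ q ℤ.- + 1)
    at-diagonal (yes refl) = cong (+ 1 ℤ.*_) (trans (cong ψ (-‿inverseʳ (‖ z ‖))) ψ-0)
    at-diagonal (no _)     = refl

  module _ {d : ℕ} (L₂ L₃ : List (Vect d)) (nodup₂ : NoDup F L₂) (nodup₃ : NoDup F L₃) where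
    private
      N₂ = L.length L₂
      N₃ = L.length L₃
      σ : Vect d → Carrier → ℤ
      σ w t = ∑ L₃ (λ z → ψ (‖ w +ᵛ z ‖ + t))

    ∑σ² : ∑ (allVecs d) (λ w → ∑ elements (λ t → σ w t ℤ.* σ w t)) ≡ + q ℤ.* (qq d ℤ.* ∑ L₃ (λ z → ∑ L₃ (λ z' → ⟦ does (z' ≟ᵛ z) ⟧)))
    ∑σ² = begin
      ∑ (allVecs d) (λ w → ∑ elements (λ t → σ w t ℤ.* σ w t))
        ≡⟨ ∑-cong (allVecs d) (λ w → trans (∑-cong elements (λ t → ∑-*-∑ L₃ L₃ _ _)) (trans (∑-swap elements L₃ _) (∑-cong L₃ (λ z → trans (∑-swap elements L₃ _) (∑-cong L₃ (λ z' → ∑ψ*ψ (‖ w +ᵛ z ‖) (‖ w +ᵛ z' ‖))))))) ⟩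
      ∑ (allVecs d) (λ w → ∑ L₃ (λ z → ∑ L₃ (λ z' → + q ℤ.* ψ (‖ w +ᵛ z ‖ - ‖ w +ᵛ z' ‖))))
        ≡⟨ trans (∑-swap (allVecs d) L₃ _) (∑-cong L₃ (λ z → ∑-swap (allVecs d) L₃ _)) ⟩
      ∑ L₃ (λ z → ∑ L₃ (λ z' → ∑ (allVecs d) (λ w → + q ℤ.* ψ (‖ w +ᵛ z ‖ - ‖ w +ᵛ z' ‖))))
        ≡⟨ ∑-cong L₃ (λ z → ∑-cong L₃ (λ z' → trans (∑-*ˡ (allVecs d) (+ q) _) (cong (+ q ℤ.*_) (∑ψ-difference z z')))) ⟩
      ∑ L₃ (λ z → ∑ L₃ (λ z' → + q ℤ.* (qq d ℤ.* ⟦ does (z' ≟ᵛ z) ⟧)))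
        ≡⟨ trans (∑-cong L₃ (λ z → trans (∑-*ˡ L₃ (+ q) _) (cong (+ q ℤ.*_) (∑-*ˡ L₃ (qq d) _)))) (trans (∑-*ˡ L₃ (+ q) _) (cong (+ q ℤ.*_) (∑-*ˡ L₃ (qq d) _))) ⟩
      + q ℤ.* (qq d ℤ.* ∑ L₃ (λ z → ∑ L₃ (λ z' → ⟦ does (z' ≟ᵛ z) ⟧))) ∎

    Qᵈ : ℤ
    Qᵈ = + (q ℕ.^ d)

    -- The second moment becomes diagonal once it is also summed over t. The value t = 0 is a single
    -- nonnegative term of that sum.
    ∑σ²-≤ : ∑ (allVecs d) (λ w → σ w 0# ℤ.* σ w 0#) ℤ.≤ Qᵈ ℤ.* (+ q ℤ.* + q) ℤ.* + N₃
    ∑σ²-≤ = ℤP.≤-trans (∑-monoℤ (allVecs d) (λ w → term-≤-∑ (λ t → σ w t ℤ.* σ w t) (λ t → ℤO.NN-sq (σ w t)) 0#))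
      (ℤP.≤-trans (ℤP.≤-reflexive ∑σ²) (ℤP.≤-trans (ℤP.*-monoˡ-≤-nonNeg (+ q) (ℤP.≤-trans
        (mono (ℤP.≤-trans (∑-monoℤ L₃ (λ z → nodup₃ z)) (ℤP.≤-reflexive (trans (∑-constℤ L₃ (+ 1)) (ℤP.*-identityʳ (+ N₃))))))
        (drop (+ N₃) (+≤+ ℕ.z≤n)))) (ℤP.≤-reflexive (ℤS.solve 3 (λ q Qᵈ N → q ℤS.:* (Qᵈ ℤS.:* q ℤS.:* N) ℤS.:= Qᵈ ℤS.:* (q ℤS.:* q) ℤS.:* N) refl (+ q) Qᵈ (+ N₃)))))
      where
      0≤q-1 : + 0 ℤ.≤ + q ℤ.- + 1
      0≤q-1 = ℤP.i≤j⇒0≤j-i (+≤+ (nonempty (Inverse.to enum 0#)))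
        where
        nonempty : ∀ {m} → Fin.Fin m → 1 ℕ.≤ m
        nonempty {suc m} _ = ℕ.s≤s ℕ.z≤n
      0≤qq : + 0 ℤ.≤ qq d
      0≤qq = ℤO.NN-* {Qᵈ} {+ q ℤ.- + 1} (+≤+ ℕ.z≤n) 0≤q-1
      mono : ∀ {x y} → x ℤ.≤ y → qq d ℤ.* x ℤ.≤ qq d ℤ.* y
      mono {x} {y} h = ℤP.0≤i-j⇒j≤i (ℤO.*-monoˡ {qq d} {x} {y} 0≤qq (ℤP.i≤j⇒0≤j-i h))
      drop : ∀ k → + 0 ℤ.≤ k → qq d ℤ.* k ℤ.≤ Qᵈ ℤ.* + q ℤ.* k
      drop k h = ℤP.0≤i-j⇒j≤i (≡.subst (+ 0 ℤ.≤_) (ℤS.solve 3 (λ Qᵈ q k → Qᵈ ℤS.:* k ℤS.:= Qᵈ ℤS.:* q ℤS.:* k ℤS.:- Qᵈ ℤS.:* (q ℤS.:- ℤS.con (+ 1)) ℤS.:* k) refl Qᵈ (+ q) k) (ℤO.NN-* {Qᵈ} {k} (+≤+ ℕ.z≤n) h))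

    ∑-nodup-≤ : ∀ (x : Vect d) (g : Vect d → ℤ) → (∀ w → + 0 ℤ.≤ g w) → ∑ L₂ (λ y → g (x +ᵛ y)) ℤ.≤ ∑ (allVecs d) g
    ∑-nodup-≤ x g g≥0 = ≡.subst₂ ℤ._≤_ (sym lhs) rhs (∑-monoℤ (allVecs d) (λ w → ℤP.≤-trans
        (ℤP.0≤i-j⇒j≤i (ℤO.*-monoʳ {g (x +ᵛ w)} {∑ L₂ (λ y → ⟦ does (y ≟ᵛ w) ⟧)} {+ 1} (g≥0 (x +ᵛ w)) (ℤP.i≤j⇒0≤j-i (nodup₂ w)))) (ℤP.≤-reflexive (ℤP.*-identityˡ (g (x +ᵛ w))))))
      where
      lhs : ∑ L₂ (λ y → g (x +ᵛ y)) ≡ ∑ (allVecs d) (λ w → ∑ L₂ (λ y → ⟦ does (y ≟ᵛ w) ⟧) ℤ.* g (x +ᵛ w))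
      lhs = trans (∑-cong L₂ (λ y → sym (trans (∑-cong (allVecs d) (λ w → cong (λ b → ⟦ b ⟧ ℤ.* g (x +ᵛ w)) (does-cong (y ≟ᵛ w) (w ≟ᵛ y) sym sym))) (RV.select d ℤP.+-*-commutativeRing (λ w → g (x +ᵛ w)) y))))
        (trans (∑-swap L₂ (allVecs d) (λ y w → ⟦ does (y ≟ᵛ w) ⟧ ℤ.* g (x +ᵛ w))) (∑-cong (allVecs d) (λ w → ∑-*ʳ L₂ (λ y → ⟦ does (y ≟ᵛ w) ⟧) (g (x +ᵛ w)))))
      rhs : ∑ (allVecs d) (λ w → g (x +ᵛ w)) ≡ ∑ (allVecs d) g
      rhs = trans (∑-cong (allVecs d) (λ w → cong g (+ᵛ-comm x w))) (VZ.∑-translate x g)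

    -- With I isotropic pairs among E = N₂N₃, one has q I = E + s. The second moment gives s² ≤ q²
    -- q^d E, so 36 q^d ≤ E yields 6|s| ≤ q E. Then I ≤ E/q + E/6 ≤ E/2, as q ≥ 3. The constant 36
    -- is the square of 6 in 1/3 + 1/6 = 1/2.
    isotropic-pairs-≤ : 3 ℕ.≤ q → 36 ℕ.* q ℕ.^ d ℕ.≤ N₂ ℕ.* N₃ → ∀ x →
      + 2 ℤ.* ∑ L₂ (λ y → ∑ L₃ (λ z → ⟦ does ((‖ x +ᵛ (y +ᵛ z) ‖ + 0#) ≟ 0#) ⟧)) ℤ.≤ + (N₂ ℕ.* N₃)
    isotropic-pairs-≤ 3≤q big x with (+ 2 ℤ.* I) ℤ.≤? E
      where
      I = ∑ L₂ (λ y → ∑ L₃ (λ z → ⟦ does ((‖ x +ᵛ (y +ᵛ z) ‖ + 0#) ≟ 0#) ⟧))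
      E = + (N₂ ℕ.* N₃)
    ... | yes p = p
    ... | no ¬p = ⊥-elim (ℤP.<-irrefl refl (ℤP.<-≤-trans strict (ℤP.≤-trans s²≤ E-large)))
      where
      I = ∑ L₂ (λ y → ∑ L₃ (λ z → ⟦ does ((‖ x +ᵛ (y +ᵛ z) ‖ + 0#) ≟ 0#) ⟧))
      E = + (N₂ ℕ.* N₃)
      Q = + q
      s = ∑ L₂ (λ y → σ (x +ᵛ y) 0#)
      qI : Q ℤ.* I ≡ s ℤ.+ E
      qI = begin
        Q ℤ.* I  ≡⟨ sym (trans (∑-cong L₂ (λ y → ∑-*ˡ L₃ Q _)) (∑-*ˡ L₂ Q _)) ⟩
        ∑ L₂ (λ y → ∑ L₃ (λ z → Q ℤ.* ⟦ does ((‖ x +ᵛ (y +ᵛ z) ‖ + 0#) ≟ 0#) ⟧))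
          ≡⟨ ∑-cong L₂ (λ y → trans (∑-cong L₃ (λ z → trans (cong (λ v → Q ℤ.* ⟦ does ((‖ v ‖ + 0#) ≟ 0#) ⟧) (sym (+ᵛ-assoc x y z)))
               (ℤS.solve 1 (λ u → u ℤS.:= u ℤS.:- ℤS.con (+ 1) ℤS.:+ ℤS.con (+ 1)) refl (Q ℤ.* ⟦ does ((‖ (x +ᵛ y) +ᵛ z ‖ + 0#) ≟ 0#) ⟧)))) (∑-+ L₃ (λ z → ψ (‖ (x +ᵛ y) +ᵛ z ‖ + 0#)) (λ _ → + 1))) ⟩
        ∑ L₂ (λ y → σ (x +ᵛ y) 0# ℤ.+ ∑ L₃ (λ z → + 1))
          ≡⟨ trans (∑-+ L₂ (λ y → σ (x +ᵛ y) 0#) (λ y → ∑ L₃ (λ z → + 1))) (cong (λ u → s ℤ.+ u) (trans (∑-cong L₂ (λ y → trans (∑-constℤ L₃ (+ 1)) (ℤP.*-identityʳ (+ N₃)))) (trans (∑-constℤ L₂ (+ N₃)) (sym (ℤP.pos-* N₂ N₃))))) ⟩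
        s ℤ.+ E ∎
      s²≤ : + 36 ℤ.* (s ℤ.* s) ℤ.≤ + 36 ℤ.* (E ℤ.* (Qᵈ ℤ.* (Q ℤ.* Q)))
      s²≤ = ℤP.*-monoˡ-≤-nonNeg (+ 36) (ℤP.≤-trans cs (ℤP.≤-trans (ℤP.*-monoˡ-≤-nonNeg (+ N₂) (ℤP.≤-trans (∑-nodup-≤ x (λ w → σ w 0# ℤ.* σ w 0#) (λ w → ℤO.NN-sq (σ w 0#))) ∑σ²-≤))
             (ℤP.≤-reflexive (trans (ℤS.solve 3 (λ n m k → n ℤS.:* (k ℤS.:* m) ℤS.:= n ℤS.:* m ℤS.:* k) refl (+ N₂) (+ N₃) (Qᵈ ℤ.* (Q ℤ.* Q))) (cong (ℤ._* (Qᵈ ℤ.* (Q ℤ.* Q))) (sym (ℤP.pos-* N₂ N₃)))))))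
        where
        cs : s ℤ.* s ℤ.≤ + N₂ ℤ.* ∑ L₂ (λ y → σ (x +ᵛ y) 0# ℤ.* σ (x +ᵛ y) 0#)
        cs = ≡.subst₂ ℤ._≤_ (cong₂ ℤ._*_ one one) (cong (ℤ._* ∑ L₂ (λ y → σ (x +ᵛ y) 0# ℤ.* σ (x +ᵛ y) 0#)) (trans (∑-constℤ L₂ (+ 1)) (ℤP.*-identityʳ (+ N₂))))
               (ℤP.0≤i-j⇒j≤i (ℤO.cauchy-schwarz L₂ (λ _ → + 1) (λ y → σ (x +ᵛ y) 0#)))
          where
          one : ∑ L₂ (λ y → + 1 ℤ.* σ (x +ᵛ y) 0#) ≡ s
          one = ∑-cong L₂ (λ y → ℤP.*-identityˡ (σ (x +ᵛ y) 0#))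
      E-large : + 36 ℤ.* (E ℤ.* (Qᵈ ℤ.* (Q ℤ.* Q))) ℤ.≤ (Q ℤ.* E) ℤ.* (Q ℤ.* E)
      E-large = ≡.subst₂ ℤ._≤_
        (trans (cong (λ u → E ℤ.* (Q ℤ.* Q) ℤ.* u) (ℤP.pos-* 36 (q ℕ.^ d))) (ℤS.solve 3 (λ E Q Qᵈ → E ℤS.:* (Q ℤS.:* Q) ℤS.:* (ℤS.con (+ 36) ℤS.:* Qᵈ) ℤS.:= ℤS.con (+ 36) ℤS.:* (E ℤS.:* (Qᵈ ℤS.:* (Q ℤS.:* Q)))) refl E Q Qᵈ))
        (ℤS.solve 2 (λ E Q → E ℤS.:* (Q ℤS.:* Q) ℤS.:* E ℤS.:= (Q ℤS.:* E) ℤS.:* (Q ℤS.:* E)) refl E Q)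
        (ℤP.0≤i-j⇒j≤i (ℤO.*-monoˡ {E ℤ.* (Q ℤ.* Q)} {+ (36 ℕ.* q ℕ.^ d)} {E} (ℤO.NN-* {E} {Q ℤ.* Q} (+≤+ ℕ.z≤n) (ℤO.NN-sq Q)) (ℤP.i≤j⇒0≤j-i (+≤+ big))))
      -- 2I > E forces 6s > qE.
      e : ∃ λ j → + 2 ℤ.* I ≡ E ℤ.+ + suc j
      e = ℤ.∣ gap ∣ , trans (ℤS.solve 2 (λ a b → a ℤS.:= b ℤS.:+ (ℤS.con (+ 1) ℤS.:+ (a ℤS.:- (ℤS.con (+ 1) ℤS.:+ b)))) refl (+ 2 ℤ.* I) E)
                            (cong (λ u → E ℤ.+ (+ 1 ℤ.+ u)) (sym (ℤP.0≤i⇒+∣i∣≡i (ℤP.i≤j⇒0≤j-i (ℤP.i<j⇒suc[i]≤j (ℤP.≰⇒> ¬p))))))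
        where
        gap = + 2 ℤ.* I ℤ.- (+ 1 ℤ.+ E)
      j = proj₁ e
      6s : ∃ λ r → + 6 ℤ.* s ≡ Q ℤ.* E ℤ.+ + suc r
      6s = _ , (begin
        + 6 ℤ.* s                                              ≡⟨ ℤS.solve 2 (λ s E → ℤS.con (+ 6) ℤS.:* s ℤS.:= ℤS.con (+ 6) ℤS.:* (s ℤS.:+ E) ℤS.:- ℤS.con (+ 6) ℤS.:* E) refl s E ⟩
        + 6 ℤ.* (s ℤ.+ E) ℤ.- + 6 ℤ.* E                        ≡⟨ cong (λ u → + 6 ℤ.* u ℤ.- + 6 ℤ.* E) qI ⟨
        + 6 ℤ.* (Q ℤ.* I) ℤ.- + 6 ℤ.* E                        ≡⟨ ℤS.solve 3 (λ Q I E → ℤS.con (+ 6) ℤS.:* (Q ℤS.:* I) ℤS.:- ℤS.con (+ 6) ℤS.:* E ℤS.:= ℤS.con (+ 3) ℤS.:* Q ℤS.:* (ℤS.con (+ 2) ℤS.:* I) ℤS.:- ℤS.con (+ 6) ℤS.:* E) refl Q I E ⟩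
        + 3 ℤ.* Q ℤ.* (+ 2 ℤ.* I) ℤ.- + 6 ℤ.* E                ≡⟨ cong₂ (λ u v → + 3 ℤ.* u ℤ.* v ℤ.- + 6 ℤ.* E) q≡ (proj₂ e) ⟩
        + 3 ℤ.* (+ 3 ℤ.+ + k) ℤ.* (E ℤ.+ + suc j) ℤ.- + 6 ℤ.* E
          ≡⟨ ℤS.solve 3 (λ k E j → ℤS.con (+ 3) ℤS.:* (ℤS.con (+ 3) ℤS.:+ k) ℤS.:* (E ℤS.:+ (ℤS.con (+ 1) ℤS.:+ j)) ℤS.:- ℤS.con (+ 6) ℤS.:* E
               ℤS.:= (ℤS.con (+ 3) ℤS.:+ k) ℤS.:* E ℤS.:+ (ℤS.con (+ 1) ℤS.:+ (ℤS.con (+ 8) ℤS.:+ ℤS.con (+ 3) ℤS.:* k ℤS.:+ (ℤS.con (+ 9) ℤS.:+ ℤS.con (+ 3) ℤS.:* k) ℤS.:* j ℤS.:+ ℤS.con (+ 2) ℤS.:* (k ℤS.:* E)))) refl (+ k) E (+ j) ⟩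
        (+ 3 ℤ.+ + k) ℤ.* E ℤ.+ (+ 1 ℤ.+ (+ 8 ℤ.+ + 3 ℤ.* + k ℤ.+ (+ 9 ℤ.+ + 3 ℤ.* + k) ℤ.* + j ℤ.+ + 2 ℤ.* (+ k ℤ.* E)))
          ≡⟨ cong₂ (λ u v → u ℤ.* E ℤ.+ (+ 1 ℤ.+ v)) (sym q≡) nat-remainder ⟩
        Q ℤ.* E ℤ.+ + suc (8 ℕ.+ 3 ℕ.* k ℕ.+ (9 ℕ.+ 3 ℕ.* k) ℕ.* j ℕ.+ 2 ℕ.* (k ℕ.* (N₂ ℕ.* N₃))) ∎)
        where
        k = q ℕ.∸ 3
        q≡ : Q ≡ + 3 ℤ.+ + k
        q≡ = cong +_ (sym (ℕP.m+[n∸m]≡n 3≤q))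
        nat-remainder : + 8 ℤ.+ + 3 ℤ.* + k ℤ.+ (+ 9 ℤ.+ + 3 ℤ.* + k) ℤ.* + j ℤ.+ + 2 ℤ.* (+ k ℤ.* E) ≡ + (8 ℕ.+ 3 ℕ.* k ℕ.+ (9 ℕ.+ 3 ℕ.* k) ℕ.* j ℕ.+ 2 ℕ.* (k ℕ.* (N₂ ℕ.* N₃)))
        nat-remainder = cong₂ ℤ._+_ (cong₂ ℤ._+_ (cong (λ u → + 8 ℤ.+ u) (sym (ℤP.pos-* 3 k))) (trans (cong (λ u → (+ 9 ℤ.+ u) ℤ.* + j) (sym (ℤP.pos-* 3 k))) (sym (ℤP.pos-* (9 ℕ.+ 3 ℕ.* k) j))))
          (trans (cong (+ 2 ℤ.*_) (sym (ℤP.pos-* k (N₂ ℕ.* N₃)))) (sym (ℤP.pos-* 2 (k ℕ.* (N₂ ℕ.* N₃)))))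
      strict : (Q ℤ.* E) ℤ.* (Q ℤ.* E) ℤ.< + 36 ℤ.* (s ℤ.* s)
      strict = ≡.subst₂ ℤ._<_ (ℤP.+-identityʳ _) (trans (sym eq) (ℤS.solve 1 (λ s → ℤS.con (+ 6) ℤS.:* s ℤS.:* (ℤS.con (+ 6) ℤS.:* s) ℤS.:= ℤS.con (+ 36) ℤS.:* (s ℤS.:* s)) refl s))
          (ℤP.+-monoʳ-< ((Q ℤ.* E) ℤ.* (Q ℤ.* E)) positive)
        where
        r = proj₁ 6s
        R = + suc r ℤ.* + suc r ℤ.+ + 2 ℤ.* (Q ℤ.* E ℤ.* + suc r)
        eq : (+ 6 ℤ.* s) ℤ.* (+ 6 ℤ.* s) ≡ (Q ℤ.* E) ℤ.* (Q ℤ.* E) ℤ.+ R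
        eq = trans (cong (λ u → u ℤ.* u) (proj₂ 6s)) (ℤS.solve 2 (λ a b → (a ℤS.:+ b) ℤS.:* (a ℤS.:+ b) ℤS.:= a ℤS.:* a ℤS.:+ (b ℤS.:* b ℤS.:+ ℤS.con (+ 2) ℤS.:* (a ℤS.:* b))) refl (Q ℤ.* E) (+ suc r))
        positive : + 0 ℤ.< R
        positive = ℤP.<-≤-trans (ℤ.+<+ {0} {suc r ℕ.* suc r} (ℕ.s≤s ℕ.z≤n)) (≡.subst (ℤ._≤ R) (trans (ℤP.+-identityʳ _) (sym (ℤP.pos-* (suc r) (suc r)))) (ℤP.+-monoʳ-≤ (+ suc r ℤ.* + suc r)
          (ℤO.NN-* {+ 2} {Q ℤ.* E ℤ.* + suc r} (+≤+ ℕ.z≤n) (ℤO.NN-* {Q ℤ.* E} {+ suc r} (ℤO.NN-* {Q} {E} (+≤+ ℕ.z≤n) (+≤+ ℕ.z≤n)) (+≤+ ℕ.z≤n)))))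

  -- The distribution of the norms of the sums.

  module SumDistribution (n : ℕ) (L₁ L₂ L₃ : List (Vect (n ℕ.* 2)))
    (nodup₁ : NoDup F L₁) (nodup₂ : NoDup F L₂) (nodup₃ : NoDup F L₃) where

    d N₁ N₂ N₃ : ℕ
    d = n ℕ.* 2
    N₁ = L.length L₁
    N₂ = L.length L₂
    N₃ = L.length L₃

    T : List (Vect d)
    T = concatMap (λ x → concatMap (λ y → L.map (λ z → x +ᵛ (y +ᵛ z)) L₃) L₂) L₁

    module _ (R : CommutativeRing 0ℓ 0ℓ) where
      open CommutativeRing R using (_≈_) renaming (Carrier to C; trans to ≈-trans; sym to ≈-sym; refl to ≈-refl; _+_ to _⊕_; _*_ to _⊛_)
      private module RT = RingTools R

      ∑-T : ∀ (f : Vect d → C) → RT.∑ T f ≈ RT.∑ L₁ (λ x → RT.∑ L₂ (λ y → RT.∑ L₃ (λ z → f (x +ᵛ (y +ᵛ z)))))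
      ∑-T f = ≈-trans (RT.∑-concatMap _ L₁ f) (RT.∑-cong L₁ (λ x → ≈-trans (RT.∑-concatMap _ L₂ f) (RT.∑-cong L₂ (λ y → RT.∑-map _ L₃ f))))

      ∑-by-norm : ∀ (f : Vect d → C) → RT.∑ (filterᵇ (λ η → nz (‖ η ‖)) (allVecs d)) f ≈ RT.∑ units (λ a → RT.∑ (A.sphere d a) f)
      ∑-by-norm f = ≈-sym
        (≈-trans (RT.∑-cong units (λ a → RT.∑-filter (A.onSphere a) (allVecs d) f))
        (≈-trans (RT.∑-swap units (allVecs d) (λ a η → RT.⟦ does (‖ η ‖ ≟ a) ⟧ ⊛ f η))
        (≈-trans (RT.∑-cong (allVecs d) (λ η → ≈-trans (RT.∑-filter nz elements (λ a → RT.⟦ does (‖ η ‖ ≟ a) ⟧ ⊛ f η))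
                    (≈-trans (RT.∑-cong elements (λ a → ≈-trans
                       (RT.Solver.solve 3 (λ x y z → x RT.Solver.:* (y RT.Solver.:* z) RT.Solver.:= y RT.Solver.:* (x RT.Solver.:* z)) ≈-refl RT.⟦ nz a ⟧ RT.⟦ does (‖ η ‖ ≟ a) ⟧ (f η))
                       (CommutativeRing.*-congʳ R (CommutativeRing.reflexive R (cong RT.⟦_⟧ (does-cong (‖ η ‖ ≟ a) (a ≟ (‖ η ‖)) sym sym))))))
                       (RF.select R (λ a → RT.⟦ nz a ⟧ ⊛ f η) (‖ η ‖)))))
                 (≈-sym (RT.∑-filter (λ η → nz (‖ η ‖)) (allVecs d) f)))))

      ∑-partition : ∀ {X : Set} (p : X → Bool) (xs : List X) (f : X → C) → RT.∑ xs f ≈ RT.∑ (filterᵇ p xs) f ⊕ RT.∑ (filterᵇ (λ x → not (p x)) xs) f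
      ∑-partition p xs f = ≈-sym (≈-trans (CommutativeRing.+-cong R (RT.∑-filter p xs f) (RT.∑-filter (λ x → not (p x)) xs f))
        (≈-trans (≈-sym (RT.∑-+ xs _ _)) (RT.∑-cong xs (λ x → either (p x) (f x)))))
        where
        either : ∀ b c → (RT.⟦ b ⟧ ⊛ c) ⊕ (RT.⟦ not b ⟧ ⊛ c) ≈ c
        either true  c = RT.Solver.solve 1 (λ c → RT.Solver.con (+ 1) RT.Solver.:* c RT.Solver.:+ RT.Solver.con (+ 0) RT.Solver.:* c RT.Solver.:= c) ≈-refl c
        either false c = RT.Solver.solve 1 (λ c → RT.Solver.con (+ 0) RT.Solver.:* c RT.Solver.:+ RT.Solver.con (+ 1) RT.Solver.:* c RT.Solver.:= c) ≈-refl c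

      ∑-filter-scale : ∀ (p : Vect d → Bool) {r} → r ≢ 0# → (∀ η → p (r · η) ≡ p η) → (f : Vect d → C) →
                       RT.∑ (filterᵇ p (allVecs d)) (λ η → f (r · η)) ≈ RT.∑ (filterᵇ p (allVecs d)) f
      ∑-filter-scale p {r} r≢0 inv f = ≈-trans (RT.∑-filter p (allVecs d) _)
        (≈-trans (RT.∑-cong (allVecs d) (λ η → CommutativeRing.*-congʳ R (CommutativeRing.reflexive R (cong RT.⟦_⟧ (sym (inv η))))))
        (≈-trans (VecSums.∑-scale R r≢0 (λ η → RT.⟦ p η ⟧ ⊛ f η)) (≈-sym (RT.∑-filter p (allVecs d) f))))

    norm-scale-≡0 : ∀ {r} → r ≢ 0# → ∀ (η : Vect d) → does (‖ r · η ‖ ≟ 0#) ≡ does (‖ η ‖ ≟ 0#)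
    norm-scale-≡0 {r} r≢0 η = does-cong (‖ r · η ‖ ≟ 0#) (‖ η ‖ ≟ 0#)
      (λ e → *-cancelˡ (*-≢0 r≢0 r≢0) (trans (sym (‖·‖ r η)) (trans e (sym (zeroʳ (r * r))))))
      (λ e → trans (‖·‖ r η) (trans (cong (r * r *_) e) (zeroʳ (r * r))))

    ¼ : Carrier
    ¼ = half * half

    half≢0 : half ≢ 0#
    half≢0 e = 0≢1 (trans (sym (zeroʳ (1# + 1#))) (trans (cong ((1# + 1#) *_) (sym e)) 2half))

    NI : List (Vect d)
    NI = filterᵇ (λ η → nz (‖ η ‖)) (allVecs d)

    G : Vect d → FormalSum
    G η = GT.∑ T (λ s → [ s ∙ η - ¼ * ‖ η ‖ ])

    -- The nonisotropic frequencies in the Gauss expansion of the norms of all sums, kept as one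
    -- element of the group ring so that its values at every t are handled together.
    B : FormalSum
    B = GT.∑ NI G

    C : Carrier → List Carrier
    C a = concatMap (λ ξ → L.map (_∙ ξ) T) (A.sphere d a)

    hat³ : Vect d → FormalSum
    hat³ ξ = A.hat L₁ ξ ⊗ A.hat L₂ ξ ⊗ A.hat L₃ ξ

    hat³≃ : ∀ ξ → hat³ ξ ≃ GT.∑ T (λ s → [ s ∙ ξ ])
    hat³≃ ξ = ≃-trans (⊗-cong (GT.∑-*-∑ L₁ L₂ (λ x → [ x ∙ ξ ]) (λ y → [ y ∙ ξ ])) (≃-refl {A.hat L₃ ξ}))
      (≃-trans (≃-sym (GT.∑-*ʳ L₁ (λ x → GT.∑ L₂ (λ y → [ x ∙ ξ ] ⊗ [ y ∙ ξ ])) (A.hat L₃ ξ)))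
      (≃-trans (GT.∑-cong L₁ (λ x → ≃-trans (GT.∑-*-∑ L₂ L₃ (λ y → [ x ∙ ξ ] ⊗ [ y ∙ ξ ]) (λ z → [ z ∙ ξ ]))
                  (GT.∑-cong L₂ (λ y → GT.∑-cong L₃ (λ z → mk≃ (λ t → cong (λ c → ev t [ c ]) (combine x y z)))))))
               (≃-sym (∑-T groupRing (λ s → [ s ∙ ξ ])))))
      where
      combine : ∀ x y z → x ∙ ξ + y ∙ ξ + z ∙ ξ ≡ (x +ᵛ (y +ᵛ z)) ∙ ξ
      combine x y z = trans (+-assoc (x ∙ ξ) (y ∙ ξ) (z ∙ ξ)) (sym (trans (∙-+ˡ x (y +ᵛ z) ξ) (cong (λ w → x ∙ ξ + w) (∙-+ˡ y z ξ))))

    delta-C : ∀ a → delta (C a) ≃ GT.∑ (A.sphere d a) hat³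
    delta-C a = ≃-trans (GT.∑-concatMap _ (A.sphere d a) [_]) (GT.∑-cong (A.sphere d a) (λ ξ → ≃-trans (GT.∑-map (_∙ ξ) T [_]) (≃-sym (hat³≃ ξ))))

    -- Each dilation permutes the nonisotropic vectors. Averaging over the dilations and sorting by
    -- norm turns the quadratic phase into chirps in r, one for each radius a.
    [q-1]B : A.q-1 ⊗ B ≃ GT.∑ units (λ a → chirp (¼ * a) (C a))
    [q-1]B = ≃-trans (≃-sym (A.∑-units-constᴿ B))
      (≃-trans (GT.∑-cong-filter nz elements (λ r hr → ≃-trans (≃-sym (∑-filter-scale groupRing (λ η → nz (‖ η ‖)) (nz⇒≢0 hr) (λ η → cong not (norm-scale-≡0 (nz⇒≢0 hr) η)) G))
                                                          (∑-by-norm groupRing (λ ξ → G (r · ξ)))))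
      (≃-trans (GT.∑-swap units units (λ r a → GT.∑ (A.sphere d a) (λ ξ → G (r · ξ))))
               (GT.∑-cong units (λ a → GT.∑-cong units (λ r → ≃-trans
                 (GT.∑-cong-filter (A.onSphere a) (allVecs d) (λ ξ hξ → ≃-trans (GT.∑-cong T (λ s → mk≃ (λ t → cong (λ c → ev t [ c ]) (scaled r s ξ (A.onSphere⇒ ξ hξ)))))
                                                                              (≃-sym (GT.∑-map (_∙ ξ) T (λ c → [ r * c - r * r * (¼ * a) ])))))
                 (≃-sym (GT.∑-concatMap _ (A.sphere d a) (λ c → [ r * c - r * r * (¼ * a) ]))))))))
      where
      scaled : ∀ {a} r s ξ → ‖ ξ ‖ ≡ a → s ∙ (r · ξ) - ¼ * ‖ r · ξ ‖ ≡ r * s ∙ ξ - r * r * (¼ * a)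
      scaled {a} r s ξ e = cong₂ _-_ (∙-·ʳ r s ξ) (trans (cong (¼ *_) (trans (‖·‖ r ξ) (cong (r * r *_) e))) (solve 3 (λ h r a → h :* (r :* r :* a) := r :* r :* (h :* a)) refl ¼ r a))

    τ-q-1 : ∀ u → τ (A.q-1 ⊗ u) ≡ (+ q ℤ.- + 1) ℤ.* τ u
    τ-q-1 u with A.q≥2
    ... | k , e = ≡.subst (λ m → τ (GT.ι (+ m ℤ.- + 1) ⊗ u) ≡ (+ m ℤ.- + 1) ℤ.* τ u) (sym e) (ev-ι⁺ 0# (suc k) u)

    τ-mono : ∀ {u v} → u A.≤ v → τ u ℤ.≤ τ v
    τ-mono {u} {v} h = ℤP.0≤i-j⇒j≤i (≡.subst (+ 0 ℤ.≤_) (trans (ev-++ 0# v (neg u)) (cong (λ z → τ v ℤ.+ z) (ev-neg 0# u))) (τ-Nonneg h))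

    K : Carrier → FormalSum
    K a = chirp (¼ * a) (C a)

    -- The left side of Cauchy-Schwarz over the radii carries (q - 1)² by `[q-1]B`, and the right
    -- side carries q - 1 for the number of radii. One factor remains.
    τB-≤-chirps : (+ q ℤ.- + 1) ℤ.* τ (B ⊗ star B) ℤ.≤ ∑ units (λ a → τ (K a ⊗ star (K a)))
    τB-≤-chirps = ≡.subst₂ ℤ._≤_ (τ-q-1 (B ⊗ star B)) (ev-∑ 0# units (λ a → K a ⊗ star (K a))) (τ-mono {A.q-1 ⊗ (B ⊗ star B)} {GT.∑ units (λ a → K a ⊗ star (K a))} (A.cancel-q-1 {A.q-1 ⊗ (B ⊗ star B)} {GT.∑ units (λ a → K a ⊗ star (K a))} (A.≤-resp lhs rhs (A.cauchy-schwarz units (λ _ → [ 0# ]) K))))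
      where
      one : GT.∑ units (λ a → [ 0# ] ⊗ K a) ≃ A.q-1 ⊗ B
      one = ≃-trans (GT.∑-cong units (λ a → ⊗-identityˡ (K a))) (≃-sym [q-1]B)
      lhs : GT.∑ units (λ a → [ 0# ] ⊗ K a) ⊗ star (GT.∑ units (λ a → [ 0# ] ⊗ K a)) ≃ A.q-1 ⊗ (A.q-1 ⊗ (B ⊗ star B))
      lhs = ≃-trans (⊗-cong one (≃-trans (star-cong one) (≃-trans (star-⊗ A.q-1 B) (⊗-cong (A.⋆-ι (+ q ℤ.- + 1)) (≃-refl {star B})))))
        (GS.solve 3 (λ c b b' → c GS.:* b GS.:* (c GS.:* b') GS.:= c GS.:* (c GS.:* (b GS.:* b'))) ≃-refl A.q-1 B (star B))
      rhs : GT.∑ units (λ a → [ 0# ] ⊗ star [ 0# ]) ⊗ GT.∑ units (λ a → K a ⊗ star (K a)) ≃ A.q-1 ⊗ GT.∑ units (λ a → K a ⊗ star (K a))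
      rhs = ⊗-cong (≃-trans (GT.∑-cong units (λ _ → ≃-trans (⊗-identityˡ (star [ 0# ])) star-1)) (≃-trans (A.∑-units-constᴿ [ 0# ]) (≃-trans (⊗-comm A.q-1 [ 0# ]) (⊗-identityˡ A.q-1)))) ≃-refl

    ¼≢0 : ¼ ≢ 0#
    ¼≢0 = *-≢0 half≢0 half≢0

    module _ (k : ℕ) (hyp : q ℕ.* q ℕ.* q ℕ.* A.momentBound n N₁ N₂ ℕ.≤ suc k ℕ.* suc k ℕ.* (suc k ℕ.* suc k)) where
      private
        H : Carrier → FormalSum
        H a = GT.∑ (A.sphere d a) hat³

      -- `restriction-≤` holds in the order of the group ring at each radius; Plancherel for `L₃` is
      -- then applied to all radii together, and τ comes last. The factor q - 1 is τ of the unit,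
      -- the number of nontrivial characters.
      ∑τH-≤ : + q ℤ.* ∑ units (λ a → τ (H a ⊗ star (H a))) ℤ.≤ + suc k ℤ.* (+ (q ℕ.^ d ℕ.* N₃) ℤ.* (+ q ℤ.- + 1))
      ∑τH-≤ = ≡.subst₂ ℤ._≤_ lhs rhs (τ-mono {X₀} {A.nat (suc k) ⊗ X₃} total)
        where
        Z : Carrier → FormalSum
        Z a = GT.∑ (A.sphere d a) (A.∣hat∣² L₃)
        X₀ X₁ X₂ X₃ : FormalSum
        X₀ = GT.∑ units (λ a → A.nat q ⊗ (H a ⊗ star (H a)))
        X₁ = GT.∑ units (λ a → A.nat (suc k) ⊗ Z a)
        X₂ = GT.∑ units Z
        X₃ = A.nat (q ℕ.^ d ℕ.* N₃)
        X₂≤X₃ : X₂ A.≤ X₃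
        X₂≤X₃ = A.≤-trans {X₂} {GT.∑ NI (A.∣hat∣² L₃)} {X₃} (A.≤-reflexive (≃-sym (∑-by-norm groupRing (A.∣hat∣² L₃))))
          (A.≤-trans {GT.∑ NI (A.∣hat∣² L₃)} {GT.∑ (allVecs d) (A.∣hat∣² L₃)} {X₃} (A.∑-filter-≤ (λ η → nz (‖ η ‖)) (allVecs d) (A.NN-∣hat∣² L₃)) (A.plancherel-≤ L₃ nodup₃))
        total : X₀ A.≤ A.nat (suc k) ⊗ X₃
        total = A.≤-trans {X₀} {X₁} {A.nat (suc k) ⊗ X₃}
          (A.∑-mono-filter nz elements {λ a → A.nat q ⊗ (H a ⊗ star (H a))} {λ a → A.nat (suc k) ⊗ Z a} (λ a ha → A.restriction-≤ {n} L₁ L₂ nodup₁ nodup₂ {a} (nz⇒≢0 ha) L₃ k hyp))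
          (A.≤-trans {X₁} {A.nat (suc k) ⊗ X₂} {A.nat (suc k) ⊗ X₃} (A.≤-reflexive (GT.∑-*ˡ units (A.nat (suc k)) Z))
            (A.*-monoˡ {A.nat (suc k)} {X₂} {X₃} (A.NN-ι (suc k)) X₂≤X₃))
        lhs : τ (GT.∑ units (λ a → A.nat q ⊗ (H a ⊗ star (H a)))) ≡ + q ℤ.* ∑ units (λ a → τ (H a ⊗ star (H a)))
        lhs = trans (ev-∑ 0# units _) (trans (∑-cong units (λ a → ev-ι⁺ 0# q (H a ⊗ star (H a)))) (∑-*ˡ units (+ q) _))
        rhs : τ (A.nat (suc k) ⊗ A.nat (q ℕ.^ d ℕ.* N₃)) ≡ + suc k ℤ.* (+ (q ℕ.^ d ℕ.* N₃) ℤ.* (+ q ℤ.- + 1))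
        rhs = trans (ev-ι⁺ 0# (suc k) (A.nat (q ℕ.^ d ℕ.* N₃))) (cong (+ suc k ℤ.*_)
          (trans (sym (≃-trans (⊗-comm (A.nat (q ℕ.^ d ℕ.* N₃)) [ 0# ]) (⊗-identityˡ (A.nat (q ℕ.^ d ℕ.* N₃))) .at 0#))
          (trans (ev-ι⁺ 0# (q ℕ.^ d ℕ.* N₃) [ 0# ]) (cong (+ (q ℕ.^ d ℕ.* N₃) ℤ.*_) (trans (ev-[] 0# 0#) (trans (cong ψ (+-identityˡ 0#)) ψ-0))))))

      τB-≤ : τ (B ⊗ star B) ℤ.≤ + 2 ℤ.* (+ suc k ℤ.* + (q ℕ.^ d ℕ.* N₃))
      τB-≤ = cancel (ℤP.≤-trans τB-≤-chirps (ℤP.≤-trans chirps (ℤP.≤-reflexive eq₁ ⟨≤⟩ ℤP.*-monoˡ-≤-nonNeg (+ 2) ∑τH-≤ ⟨≤⟩ ℤP.≤-reflexive eq₂)))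
        where
        infixr 1 _⟨≤⟩_
        _⟨≤⟩_ : ∀ {x y z} → x ℤ.≤ y → y ℤ.≤ z → x ℤ.≤ z
        _⟨≤⟩_ = ℤP.≤-trans
        chirps : ∑ units (λ a → τ (K a ⊗ star (K a))) ℤ.≤ ∑ units (λ a → + 2 ℤ.* (+ q ℤ.* τ (H a ⊗ star (H a))))
        chirps = ℤP.0≤i-j⇒j≤i (ℤO.∑-mono-filter nz elements {f = λ a → τ (K a ⊗ star (K a))} (λ a ha → ℤP.i≤j⇒0≤j-i (≡.subst (λ z → τ (K a ⊗ star (K a)) ℤ.≤ + 2 ℤ.* (+ q ℤ.* z))
          (⊗-cong (delta-C a) (star-cong (delta-C a)) .at 0#) (τ-chirp-≤ (*-≢0 ¼≢0 (nz⇒≢0 ha)) (C a)))))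
        eq₁ : ∑ units (λ a → + 2 ℤ.* (+ q ℤ.* τ (H a ⊗ star (H a)))) ≡ + 2 ℤ.* (+ q ℤ.* ∑ units (λ a → τ (H a ⊗ star (H a))))
        eq₁ = trans (∑-*ˡ units (+ 2) _) (cong (+ 2 ℤ.*_) (∑-*ˡ units (+ q) _))
        eq₂ : + 2 ℤ.* (+ suc k ℤ.* (+ (q ℕ.^ d ℕ.* N₃) ℤ.* (+ q ℤ.- + 1))) ≡ (+ q ℤ.- + 1) ℤ.* (+ 2 ℤ.* (+ suc k ℤ.* + (q ℕ.^ d ℕ.* N₃)))
        eq₂ = ℤS.solve 3 (λ w x r → ℤS.con (+ 2) ℤS.:* (w ℤS.:* (x ℤS.:* r)) ℤS.:= r ℤS.:* (ℤS.con (+ 2) ℤS.:* (w ℤS.:* x))) refl (+ suc k) (+ (q ℕ.^ d ℕ.* N₃)) (+ q ℤ.- + 1)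
        cancel : ∀ {x y} → (+ q ℤ.- + 1) ℤ.* x ℤ.≤ (+ q ℤ.- + 1) ℤ.* y → x ℤ.≤ y
        cancel {x} {y} h with A.q≥2
        ... | j , e = ℤP.*-cancelˡ-≤-pos x y (+ suc j) (≡.subst (λ m → (+ m ℤ.- + 1) ℤ.* x ℤ.≤ (+ m ℤ.- + 1) ℤ.* y) e h)

    P : ℕ
    P = N₁ ℕ.* (N₂ ℕ.* N₃)

    -- The sign is reversed: `m t` counts sums of norm -t, which keeps every test in the form
    -- `ψ (… + t)`.
    m : Carrier → ℤ
    m t = ∑ T (λ s → ⟦ does ((‖ s ‖ + t) ≟ 0#) ⟧)

    b : Carrier → ℤ
    b t = ev t B

    γ : ℤ
    γ = proj₁ (gauss n)

    ∑T1 : ∑ T (λ _ → + 1) ≡ + P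
    ∑T1 = begin
      ∑ T (λ _ → + 1)                                              ≡⟨ ∑-T ℤP.+-*-commutativeRing (λ _ → + 1) ⟩
      ∑ L₁ (λ _ → ∑ L₂ (λ _ → ∑ L₃ (λ _ → + 1)))                   ≡⟨ ∑-cong L₁ (λ _ → ∑-cong L₂ (λ _ → trans (∑-constℤ L₃ (+ 1)) (ℤP.*-identityʳ (+ N₃)))) ⟩
      ∑ L₁ (λ _ → ∑ L₂ (λ _ → + N₃))                               ≡⟨ ∑-cong L₁ (λ _ → trans (∑-constℤ L₂ (+ N₃)) (sym (ℤP.pos-* N₂ N₃))) ⟩
      ∑ L₁ (λ _ → + (N₂ ℕ.* N₃))                                   ≡⟨ trans (∑-constℤ L₁ (+ (N₂ ℕ.* N₃))) (sym (ℤP.pos-* N₁ (N₂ ℕ.* N₃))) ⟩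
      + P                                                          ∎

    ∑Tψ : ∀ t → ∑ T (λ s → ψ (‖ s ‖ + t)) ≡ + q ℤ.* m t ℤ.- + P
    ∑Tψ t = trans (∑-- T (λ s → + q ℤ.* ⟦ does ((‖ s ‖ + t) ≟ 0#) ⟧) (λ _ → + 1)) (cong₂ ℤ._-_ (∑-*ˡ T (+ q) (λ s → ⟦ does ((‖ s ‖ + t) ≟ 0#) ⟧)) ∑T1)

    isotropicPart : Carrier → ℤ
    isotropicPart t = ∑ (A.sphere d 0#) (λ ξ → ∑ T (λ s → ψ (s ∙ ξ - ¼ * ‖ ξ ‖ + t)))

    -- Completing the square in ‖s‖ − ‖½ξ − s‖ = s·ξ − ¼‖ξ‖.
    gauss-expand : ∀ (s : Vect d) t → γ ℤ.* ψ (‖ s ‖ + t) ≡ ∑ (allVecs d) (λ ξ → ψ (s ∙ ξ - ¼ * ‖ ξ ‖ + t))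
    gauss-expand s t = begin
      γ ℤ.* ψ (‖ s ‖ + t)                                             ≡⟨ proj₂ (proj₂ (gauss n)) (‖ s ‖ + t) ⟨
      ∑ (allVecs d) (λ η → ψ (‖ s ‖ + t - ‖ η ‖))                      ≡⟨ RV.reindex d ℤP.+-*-commutativeRing (_-ᵛ s) (_+ᵛ s) (λ y → -ᵛ+ᵛ y s) (λ y → +ᵛ-ᵛ y s) (λ η → ψ (‖ s ‖ + t - ‖ η ‖)) ⟨
      ∑ (allVecs d) (λ η → ψ (‖ s ‖ + t - ‖ η -ᵛ s ‖))                 ≡⟨ VZ.∑-scale half≢0 (λ η → ψ (‖ s ‖ + t - ‖ η -ᵛ s ‖)) ⟨
      ∑ (allVecs d) (λ ξ → ψ (‖ s ‖ + t - ‖ (half · ξ) -ᵛ s ‖))        ≡⟨ ∑-cong (allVecs d) (λ ξ → cong ψ (complete ξ)) ⟩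
      ∑ (allVecs d) (λ ξ → ψ (s ∙ ξ - ¼ * ‖ ξ ‖ + t))                  ∎
      where
      complete : ∀ ξ → ‖ s ‖ + t - ‖ (half · ξ) -ᵛ s ‖ ≡ s ∙ ξ - ¼ * ‖ ξ ‖ + t
      complete ξ = begin
        ‖ s ‖ + t - ‖ (half · ξ) -ᵛ s ‖                                            ≡⟨ cong (λ z → ‖ s ‖ + t - z) (‖-‖ (half · ξ) s) ⟩
        ‖ s ‖ + t - (‖ half · ξ ‖ - (1# + 1#) * (half · ξ) ∙ s + ‖ s ‖)            ≡⟨ cong₂ (λ u v → ‖ s ‖ + t - (u - (1# + 1#) * v + ‖ s ‖)) (‖·‖ half ξ) (trans (∙-·ˡ half ξ s) (cong (half *_) (∙-comm ξ s))) ⟩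
        ‖ s ‖ + t - (¼ * ‖ ξ ‖ - (1# + 1#) * (half * s ∙ ξ) + ‖ s ‖)               ≡⟨ solve 5 (λ n t x h p → n :+ t :- (x :- con (+ 2) :* (h :* p) :+ n) := con (+ 2) :* h :* p :- x :+ t) refl (‖ s ‖) t (¼ * ‖ ξ ‖) half (s ∙ ξ) ⟩
        (1# + 1#) * half * s ∙ ξ - ¼ * ‖ ξ ‖ + t                                   ≡⟨ cong (λ z → z * s ∙ ξ - ¼ * ‖ ξ ‖ + t) 2half ⟩
        1# * s ∙ ξ - ¼ * ‖ ξ ‖ + t                                                 ≡⟨ cong (λ z → z - ¼ * ‖ ξ ‖ + t) (*-identityˡ (s ∙ ξ)) ⟩
        s ∙ ξ - ¼ * ‖ ξ ‖ + t                                                      ∎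

    -- Both the count and its mean are carried through the Gauss expansion of each sum s; the
    -- frequencies are then split by whether their norm vanishes.
    spectral-identity : ∀ t → γ ℤ.* (+ q ℤ.* m t ℤ.- + P) ≡ isotropicPart t ℤ.+ b t
    spectral-identity t = begin
      γ ℤ.* (+ q ℤ.* m t ℤ.- + P)                                      ≡⟨ cong (γ ℤ.*_) (∑Tψ t) ⟨
      γ ℤ.* ∑ T (λ s → ψ (‖ s ‖ + t))                                  ≡⟨ ∑-*ˡ T γ (λ s → ψ (‖ s ‖ + t)) ⟨
      ∑ T (λ s → γ ℤ.* ψ (‖ s ‖ + t))                                  ≡⟨ ∑-cong T (λ s → gauss-expand s t) ⟩
      ∑ T (λ s → ∑ (allVecs d) (λ ξ → f ξ s))                          ≡⟨ ∑-swap T (allVecs d) (λ s ξ → f ξ s) ⟩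
      ∑ (allVecs d) (λ ξ → ∑ T (f ξ))                                  ≡⟨ ∑-partition ℤP.+-*-commutativeRing (λ ξ → does (‖ ξ ‖ ≟ 0#)) (allVecs d) (λ ξ → ∑ T (f ξ)) ⟩
      isotropicPart t ℤ.+ ∑ NI (λ ξ → ∑ T (f ξ))                       ≡⟨ cong (λ z → isotropicPart t ℤ.+ z) (sym (trans (ev-∑ t NI G) (∑-cong NI (λ ξ → trans (ev-∑ t T (λ s → [ s ∙ ξ - ¼ * ‖ ξ ‖ ])) (∑-cong T (λ s → ev-[] t (s ∙ ξ - ¼ * ‖ ξ ‖))))))) ⟩
      isotropicPart t ℤ.+ b t                                          ∎
      where
      f : Vect d → Vect d → ℤ
      f ξ s = ψ (s ∙ ξ - ¼ * ‖ ξ ‖ + t)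

    -- The isotropic cone is invariant under ξ ↦ tξ, and on it the quadratic phase is zero, so the
    -- whole argument is t times its value at 1.
    isotropicPart-const : ∀ {t} → t ≢ 0# → isotropicPart t ≡ isotropicPart 1#
    isotropicPart-const {t} t≢0 = begin
      isotropicPart t
        ≡⟨ ∑-filter-scale ℤP.+-*-commutativeRing (A.onSphere 0#) t≢0 (norm-scale-≡0 t≢0) (λ ξ → ∑ T (λ s → ψ (s ∙ ξ - ¼ * ‖ ξ ‖ + t))) ⟨
      ∑ (A.sphere d 0#) (λ ξ → ∑ T (λ s → ψ (s ∙ (t · ξ) - ¼ * ‖ t · ξ ‖ + t)))
        ≡⟨ ∑-cong-filter (A.onSphere 0#) (allVecs d) (λ ξ hξ → ∑-cong T (λ s → trans (cong ψ (scaled ξ s (A.onSphere⇒ ξ hξ))) (ψ-*ˡ (s ∙ ξ - ¼ * ‖ ξ ‖ + 1#) t≢0))) ⟩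
      isotropicPart 1# ∎
      where
      scaled : ∀ ξ s → ‖ ξ ‖ ≡ 0# → s ∙ (t · ξ) - ¼ * ‖ t · ξ ‖ + t ≡ t * (s ∙ ξ - ¼ * ‖ ξ ‖ + 1#)
      scaled ξ s e = begin
        s ∙ (t · ξ) - ¼ * ‖ t · ξ ‖ + t              ≡⟨ cong₂ (λ u v → u - ¼ * v + t) (∙-·ʳ t s ξ) (trans (‖·‖ t ξ) (cong (t * t *_) e)) ⟩
        t * s ∙ ξ - ¼ * (t * t * 0#) + t             ≡⟨ solve 3 (λ t p h → t :* p :- h :* (t :* t :* con (+ 0)) :+ t := t :* (p :- h :* con (+ 0) :+ con (+ 1))) refl t (s ∙ ξ) ¼ ⟩
        t * (s ∙ ξ - ¼ * 0# + 1#)                    ≡⟨ cong (λ z → t * (s ∙ ξ - ¼ * z + 1#)) e ⟨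
        t * (s ∙ ξ - ¼ * ‖ ξ ‖ + 1#)                 ∎

    -- Subtracting the spectral identity at a missing value t₀ eliminates both the mean P and the
    -- constant isotropic part.
    jump : ∀ {t t₀} → t ≢ 0# → t₀ ≢ 0# → m t₀ ≡ + 0 → γ ℤ.* (+ q ℤ.* m t) ≡ b t ℤ.- b t₀
    jump {t} {t₀} t≢0 t₀≢0 m₀ = begin
      γ ℤ.* (+ q ℤ.* m t)
        ≡⟨ ℤS.solve 4 (λ g q x p → g ℤS.:* (q ℤS.:* x) ℤS.:= g ℤS.:* (q ℤS.:* x ℤS.:- p) ℤS.:- g ℤS.:* (q ℤS.:* ℤS.con (+ 0) ℤS.:- p)) refl γ (+ q) (m t) (+ P) ⟩
      γ ℤ.* (+ q ℤ.* m t ℤ.- + P) ℤ.- γ ℤ.* (+ q ℤ.* + 0 ℤ.- + P)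
        ≡⟨ cong (λ z → γ ℤ.* (+ q ℤ.* m t ℤ.- + P) ℤ.- γ ℤ.* (+ q ℤ.* z ℤ.- + P)) (sym m₀) ⟩
      γ ℤ.* (+ q ℤ.* m t ℤ.- + P) ℤ.- γ ℤ.* (+ q ℤ.* m t₀ ℤ.- + P)
        ≡⟨ cong₂ ℤ._-_ (trans (spectral-identity t) (cong (ℤ._+ b t) (isotropicPart-const t≢0))) (trans (spectral-identity t₀) (cong (ℤ._+ b t₀) (isotropicPart-const t₀≢0))) ⟩
      (isotropicPart 1# ℤ.+ b t) ℤ.- (isotropicPart 1# ℤ.+ b t₀)
        ≡⟨ ℤS.solve 3 (λ i x y → (i ℤS.:+ x) ℤS.:- (i ℤS.:+ y) ℤS.:= x ℤS.:- y) refl (isotropicPart 1#) (b t) (b t₀) ⟩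
      b t ℤ.- b t₀ ∎

    Σb² M₂ : ℤ
    Σb² = ∑ elements (λ t → b t ℤ.* b t)
    M₂  = ∑ units (λ t → m t ℤ.* m t)

    isZero : Carrier → Bool
    isZero t = does (m t ℤ.≟ + 0)

    z D : ℤ
    z = ∑ units (λ t → ⟦ isZero t ⟧)
    D = ∑ units (λ t → ⟦ not (isZero t) ⟧)

    qᵈ : ℤ
    qᵈ = + (q ℕ.^ d)

    z+D : z ℤ.+ D ≡ + q ℤ.- + 1
    z+D = trans (sym (∑-+ units (λ t → ⟦ isZero t ⟧) (λ t → ⟦ not (isZero t) ⟧))) (trans (∑-cong units (λ t → either (isZero t))) (trans (∑-units-const (+ 1)) (ℤP.*-identityʳ (+ q ℤ.- + 1))))
      where
      either : ∀ c → ⟦ c ⟧ ℤ.+ ⟦ not c ⟧ ≡ + 1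
      either true  = refl
      either false = refl

    0≤⟦⟧ : ∀ c → + 0 ℤ.≤ ⟦ c ⟧
    0≤⟦⟧ true  = +≤+ ℕ.z≤n
    0≤⟦⟧ false = +≤+ ℕ.z≤n

    ℤ≤ : ∀ {x y} → x ℤO.≤ y → x ℤ.≤ y
    ℤ≤ = ℤP.0≤i-j⇒j≤i

    ≤ℤ : ∀ {x y} → x ℤ.≤ y → x ℤO.≤ y
    ≤ℤ = ℤP.i≤j⇒0≤j-i

    -- This is (x - y)² ≤ 2x² + 2y² for the difference in `jump`, with γ² = q^d. The indicator is
    -- kept on the first square and dropped from the second, so that summing over both variables
    -- gives z copies of one and q - 1 copies of the other.
    pair-≤ : ∀ t t₀ → t ≢ 0# → t₀ ≢ 0# → ⟦ isZero t₀ ⟧ ℤ.* (qᵈ ℤ.* (+ q ℤ.* + q) ℤ.* (m t ℤ.* m t)) ℤ.≤ + 2 ℤ.* (⟦ isZero t₀ ⟧ ℤ.* (b t ℤ.* b t)) ℤ.+ + 2 ℤ.* (b t₀ ℤ.* b t₀)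
    pair-≤ t t₀ t≢0 t₀≢0 = aux (m t₀ ℤ.≟ + 0)
      where
      aux : (p : Dec (m t₀ ≡ + 0)) → ⟦ does p ⟧ ℤ.* (qᵈ ℤ.* (+ q ℤ.* + q) ℤ.* (m t ℤ.* m t)) ℤ.≤ + 2 ℤ.* (⟦ does p ⟧ ℤ.* (b t ℤ.* b t)) ℤ.+ + 2 ℤ.* (b t₀ ℤ.* b t₀)
      aux (yes e) = ℤ≤ (≡.subst (+ 0 ℤ.≤_) eq (ℤO.NN-sq (b t ℤ.+ b t₀)))
        where
        eq : (b t ℤ.+ b t₀) ℤ.* (b t ℤ.+ b t₀) ≡ + 2 ℤ.* (+ 1 ℤ.* (b t ℤ.* b t)) ℤ.+ + 2 ℤ.* (b t₀ ℤ.* b t₀) ℤ.- + 1 ℤ.* (qᵈ ℤ.* (+ q ℤ.* + q) ℤ.* (m t ℤ.* m t))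
        eq = trans (ℤS.solve 2 (λ x y → (x ℤS.:+ y) ℤS.:* (x ℤS.:+ y) ℤS.:= ℤS.con (+ 2) ℤS.:* (ℤS.con (+ 1) ℤS.:* (x ℤS.:* x)) ℤS.:+ ℤS.con (+ 2) ℤS.:* (y ℤS.:* y) ℤS.:- (x ℤS.:- y) ℤS.:* (x ℤS.:- y)) refl (b t) (b t₀))
          (cong (λ w → + 2 ℤ.* (+ 1 ℤ.* (b t ℤ.* b t)) ℤ.+ + 2 ℤ.* (b t₀ ℤ.* b t₀) ℤ.- w)
            (trans (cong (λ w → w ℤ.* w) (sym (jump t≢0 t₀≢0 e)))
            (trans (ℤS.solve 3 (λ g q x → g ℤS.:* (q ℤS.:* x) ℤS.:* (g ℤS.:* (q ℤS.:* x)) ℤS.:= ℤS.con (+ 1) ℤS.:* (g ℤS.:* g ℤS.:* (q ℤS.:* q) ℤS.:* (x ℤS.:* x))) refl γ (+ q) (m t))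
                   (cong (λ w → + 1 ℤ.* (w ℤ.* (+ q ℤ.* + q) ℤ.* (m t ℤ.* m t))) (proj₁ (proj₂ (gauss n)))))))
      aux (no _) = ℤ≤ (≡.subst (+ 0 ℤ.≤_) (ℤS.solve 3 (λ x y w → ℤS.con (+ 2) ℤS.:* (y ℤS.:* y) ℤS.:= ℤS.con (+ 2) ℤS.:* (ℤS.con (+ 0) ℤS.:* x) ℤS.:+ ℤS.con (+ 2) ℤS.:* (y ℤS.:* y) ℤS.:- ℤS.con (+ 0) ℤS.:* w) refl (b t ℤ.* b t) (b t₀) (qᵈ ℤ.* (+ q ℤ.* + q) ℤ.* (m t ℤ.* m t)))
                     (ℤO.NN-* {+ 2} {b t₀ ℤ.* b t₀} (+≤+ ℕ.z≤n) (ℤO.NN-sq (b t₀))))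

    -- Summing `pair-≤` over t and t₀ produces 2z + 2(q - 1) ≤ 4q copies of the sum of squares of
    -- `b`.
    zM₂-≤ : z ℤ.* (qᵈ ℤ.* (+ q ℤ.* + q) ℤ.* M₂) ℤ.≤ + 4 ℤ.* (+ q ℤ.* Σb²)
    zM₂-≤ = ℤP.≤-trans (ℤP.≤-reflexive (sym lhs)) (ℤP.≤-trans (ℤ≤ (ℤO.∑-mono-filter nz elements {λ t₀ → ∑ units (l t₀)} (λ t₀ h₀ → ℤO.∑-mono-filter nz elements {l t₀} (λ t h → ≤ℤ (pair-≤ t t₀ (nz⇒≢0 h) (nz⇒≢0 h₀))))))
              (ℤP.≤-trans (ℤP.≤-reflexive rhs) bound))
      where
      l : Carrier → Carrier → ℤ
      l t₀ t = ⟦ isZero t₀ ⟧ ℤ.* (qᵈ ℤ.* (+ q ℤ.* + q) ℤ.* (m t ℤ.* m t))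
      Σᵤ = ∑ units (λ t → b t ℤ.* b t)
      lhs : ∑ units (λ t₀ → ∑ units (l t₀)) ≡ z ℤ.* (qᵈ ℤ.* (+ q ℤ.* + q) ℤ.* M₂)
      lhs = trans (∑-cong units (λ t₀ → trans (∑-*ˡ units ⟦ isZero t₀ ⟧ (λ t → qᵈ ℤ.* (+ q ℤ.* + q) ℤ.* (m t ℤ.* m t))) (cong (⟦ isZero t₀ ⟧ ℤ.*_) (∑-*ˡ units (qᵈ ℤ.* (+ q ℤ.* + q)) (λ t → m t ℤ.* m t))))) (∑-*ʳ units (λ t → ⟦ isZero t ⟧) (qᵈ ℤ.* (+ q ℤ.* + q) ℤ.* M₂))
      rhs : ∑ units (λ t₀ → ∑ units (λ t → + 2 ℤ.* (⟦ isZero t₀ ⟧ ℤ.* (b t ℤ.* b t)) ℤ.+ + 2 ℤ.* (b t₀ ℤ.* b t₀))) ≡ + 2 ℤ.* (z ℤ.* Σᵤ) ℤ.+ (+ q ℤ.- + 1) ℤ.* (+ 2 ℤ.* Σᵤ)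
      rhs = trans (∑-cong units (λ t₀ → trans (∑-+ units (λ t → + 2 ℤ.* (⟦ isZero t₀ ⟧ ℤ.* (b t ℤ.* b t))) (λ t → + 2 ℤ.* (b t₀ ℤ.* b t₀)))
               (cong₂ ℤ._+_ (trans (∑-*ˡ units (+ 2) (λ t → ⟦ isZero t₀ ⟧ ℤ.* (b t ℤ.* b t))) (cong (+ 2 ℤ.*_) (∑-*ˡ units ⟦ isZero t₀ ⟧ (λ t → b t ℤ.* b t)))) (∑-units-const (+ 2 ℤ.* (b t₀ ℤ.* b t₀))))))
             (trans (∑-+ units (λ t₀ → + 2 ℤ.* (⟦ isZero t₀ ⟧ ℤ.* Σᵤ)) (λ t₀ → (+ q ℤ.- + 1) ℤ.* (+ 2 ℤ.* (b t₀ ℤ.* b t₀))))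
               (cong₂ ℤ._+_ (trans (∑-*ˡ units (+ 2) (λ t₀ → ⟦ isZero t₀ ⟧ ℤ.* Σᵤ)) (cong (+ 2 ℤ.*_) (∑-*ʳ units (λ t → ⟦ isZero t ⟧) Σᵤ)))
                            (trans (∑-*ˡ units (+ q ℤ.- + 1) (λ t₀ → + 2 ℤ.* (b t₀ ℤ.* b t₀))) (cong ((+ q ℤ.- + 1) ℤ.*_) (∑-*ˡ units (+ 2) (λ t₀ → b t₀ ℤ.* b t₀))))))
      0≤D : + 0 ℤ.≤ D
      0≤D = ℤO.NN-∑ units (λ t → 0≤⟦⟧ (not (isZero t)))
      bound : + 2 ℤ.* (z ℤ.* Σᵤ) ℤ.+ (+ q ℤ.- + 1) ℤ.* (+ 2 ℤ.* Σᵤ) ℤ.≤ + 4 ℤ.* (+ q ℤ.* Σb²)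
      bound = ℤP.≤-trans (ℤ≤ (≡.subst (+ 0 ℤ.≤_)
          (trans (ℤS.solve 3 (λ D z S → ℤS.con (+ 2) ℤS.:* (D ℤS.:* S) ℤS.:+ ℤS.con (+ 4) ℤS.:* S ℤS.:= ℤS.con (+ 4) ℤS.:* ((z ℤS.:+ D ℤS.:+ ℤS.con (+ 1)) ℤS.:* S) ℤS.:- (ℤS.con (+ 2) ℤS.:* (z ℤS.:* S) ℤS.:+ (z ℤS.:+ D) ℤS.:* (ℤS.con (+ 2) ℤS.:* S))) refl D z Σᵤ)
                 (cong₂ (λ u v → + 4 ℤ.* (u ℤ.* Σᵤ) ℤ.- (+ 2 ℤ.* (z ℤ.* Σᵤ) ℤ.+ v ℤ.* (+ 2 ℤ.* Σᵤ))) (trans (cong (ℤ._+ + 1) z+D) (ℤS.solve 1 (λ q → q ℤS.:- ℤS.con (+ 1) ℤS.:+ ℤS.con (+ 1) ℤS.:= q) refl (+ q))) z+D))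
          (ℤO.NN-+ {+ 2 ℤ.* (D ℤ.* Σᵤ)} {+ 4 ℤ.* Σᵤ} (ℤO.NN-* {+ 2} {D ℤ.* Σᵤ} (+≤+ ℕ.z≤n) (ℤO.NN-* {D} {Σᵤ} 0≤D 0≤Σᵤ)) (ℤO.NN-* {+ 4} {Σᵤ} (+≤+ ℕ.z≤n) 0≤Σᵤ))))
        (ℤP.*-monoˡ-≤-nonNeg (+ 4) (ℤP.*-monoˡ-≤-nonNeg (+ q) (ℤ≤ (ℤO.∑-filter-≤ nz elements (λ t → ℤO.NN-sq (b t))))))
        where
        0≤Σᵤ : + 0 ℤ.≤ Σᵤ
        0≤Σᵤ = ℤO.NN-∑ units (λ t → ℤO.NN-sq (b t))

    ∑m : ∑ elements m ≡ + P
    ∑m = trans (∑-swap elements T (λ t s → ⟦ does ((‖ s ‖ + t) ≟ 0#) ⟧)) (trans (∑-cong T (λ s → trans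
           (∑-cong elements (λ t → cong ⟦_⟧ (does-cong ((‖ s ‖ + t) ≟ 0#) (t ≟ (- ‖ s ‖))
              (λ e → trans (solve 2 (λ n t → t := n :+ t :- n) refl (‖ s ‖) t) (trans (cong (_- ‖ s ‖) e) (+-identityˡ (- ‖ s ‖)))) (λ e → trans (cong (λ u → ‖ s ‖ + u) e) (-‿inverseʳ (‖ s ‖))))))
           (∑-select-1 (- ‖ s ‖)))) ∑T1)

    -- Cauchy-Schwarz on the nonzero part of the support of `m`, which has D elements.
    [∑m]²-≤ : (+ P ℤ.- m 0#) ℤ.* (+ P ℤ.- m 0#) ℤ.≤ D ℤ.* M₂
    [∑m]²-≤ = ≡.subst₂ ℤ._≤_ (cong₂ ℤ._*_ total total) (cong (ℤ._* M₂) (∑-cong units (λ t → idem (not (isZero t)))))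
        (ℤ≤ (ℤO.cauchy-schwarz units (λ t → ⟦ not (isZero t) ⟧) m))
      where
      idem : ∀ c → ⟦ c ⟧ ℤ.* ⟦ c ⟧ ≡ ⟦ c ⟧
      idem true  = refl
      idem false = refl
      drop : ∀ x (p : Dec (x ≡ + 0)) → ⟦ not (does p) ⟧ ℤ.* x ≡ x
      drop x (yes refl) = refl
      drop x (no _)     = ℤP.*-identityˡ x
      total : ∑ units (λ t → ⟦ not (isZero t) ⟧ ℤ.* m t) ≡ + P ℤ.- m 0#
      total = trans (∑-cong units (λ t → drop (m t) (m t ℤ.≟ + 0))) (trans (Uℤ.∑-units m) (cong (ℤ._- m 0#) ∑m))

    2m₀≤P : 3 ℕ.≤ q → 36 ℕ.* q ℕ.^ d ℕ.≤ N₂ ℕ.* N₃ → + 2 ℤ.* m 0# ℤ.≤ + P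
    2m₀≤P 3≤q big = ≡.subst₂ ℤ._≤_ (trans (∑-*ˡ L₁ (+ 2) _) (cong (+ 2 ℤ.*_) (sym (∑-T ℤP.+-*-commutativeRing (λ s → ⟦ does ((‖ s ‖ + 0#) ≟ 0#) ⟧)))))
      (trans (∑-constℤ L₁ (+ (N₂ ℕ.* N₃))) (sym (ℤP.pos-* N₁ (N₂ ℕ.* N₃)))) (∑-monoℤ L₁ (λ x → isotropic-pairs-≤ L₂ L₃ nodup₂ nodup₃ 3≤q big x))

    module _ (k : ℕ) (W : suc k ℕ.* N₃ ≡ P ℕ.* P) (hyp : q ℕ.* q ℕ.* q ℕ.* A.momentBound n N₁ N₂ ℕ.≤ suc k ℕ.* suc k ℕ.* (suc k ℕ.* suc k))
             (3≤q : 3 ℕ.≤ q) (big : 36 ℕ.* q ℕ.^ d ℕ.≤ N₂ ℕ.* N₃) (P>0 : ℕ.NonZero P) where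

      P² : ℤ
      P² = + P ℤ.* + P

      -- By `ev-norm` and `τB-≤` the sum of squares of `b` is at most 2 q q^d W N₃ with W = `suc k`,
      -- and W N₃ = P². Cancelling q^d q² leaves 4 · 2 = 8.
      zM₂-≤8P² : z ℤ.* M₂ ℤ.≤ + 8 ℤ.* P²
      zM₂-≤8P² = ℤP.*-cancelˡ-≤-pos (z ℤ.* M₂) (+ 8 ℤ.* P²) (+ (q ℕ.^ d ℕ.* (q ℕ.* q))) {{c>0}} (≡.subst₂ ℤ._≤_ eq₁ eq₂ (ℤP.≤-trans zM₂-≤ (ℤP.*-monoˡ-≤-nonNeg (+ 4) (ℤP.*-monoˡ-≤-nonNeg (+ q) Σb²-≤))))
        where
        c>0 : ℤ.Positive (+ (q ℕ.^ d ℕ.* (q ℕ.* q)))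
        c>0 = ℤ.positive (ℤ.+<+ (ℕP.n≢0⇒n>0 (ℕ.≢-nonZero⁻¹ _ {{ℕP.m*n≢0 (q ℕ.^ d) (q ℕ.* q) {{A.q^-nonZero d}} {{ℕP.m*n≢0 q q {{A.q-nonZero}} {{A.q-nonZero}}}}}})))
        cast : + (q ℕ.^ d ℕ.* (q ℕ.* q)) ≡ qᵈ ℤ.* (+ q ℤ.* + q)
        cast = trans (ℤP.pos-* (q ℕ.^ d) (q ℕ.* q)) (cong (qᵈ ℤ.*_) (ℤP.pos-* q q))
        Σb²-≤ : Σb² ℤ.≤ + q ℤ.* (+ 2 ℤ.* (qᵈ ℤ.* P²))
        Σb²-≤ = ℤP.≤-trans (ℤP.≤-reflexive (ev-norm B)) (ℤP.*-monoˡ-≤-nonNeg (+ q) (ℤP.≤-trans (τB-≤ k hyp) (ℤP.≤-reflexive (cong (+ 2 ℤ.*_)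
          (trans (cong (+ suc k ℤ.*_) (ℤP.pos-* (q ℕ.^ d) N₃)) (trans (ℤS.solve 3 (λ w x n → w ℤS.:* (x ℤS.:* n) ℤS.:= x ℤS.:* (w ℤS.:* n)) refl (+ suc k) qᵈ (+ N₃))
            (cong (qᵈ ℤ.*_) (trans (sym (ℤP.pos-* (suc k) N₃)) (trans (cong +_ W) (ℤP.pos-* P P))))))))))
        eq₁ : z ℤ.* (qᵈ ℤ.* (+ q ℤ.* + q) ℤ.* M₂) ≡ + (q ℕ.^ d ℕ.* (q ℕ.* q)) ℤ.* (z ℤ.* M₂)
        eq₁ = trans (ℤS.solve 3 (λ z c M → z ℤS.:* (c ℤS.:* M) ℤS.:= c ℤS.:* (z ℤS.:* M)) refl z (qᵈ ℤ.* (+ q ℤ.* + q)) M₂) (cong (ℤ._* (z ℤ.* M₂)) (sym cast))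
        eq₂ : + 4 ℤ.* (+ q ℤ.* (+ q ℤ.* (+ 2 ℤ.* (qᵈ ℤ.* P²)))) ≡ + (q ℕ.^ d ℕ.* (q ℕ.* q)) ℤ.* (+ 8 ℤ.* P²)
        eq₂ = trans (ℤS.solve 3 (λ q d p → ℤS.con (+ 4) ℤS.:* (q ℤS.:* (q ℤS.:* (ℤS.con (+ 2) ℤS.:* (d ℤS.:* p)))) ℤS.:= d ℤS.:* (q ℤS.:* q) ℤS.:* (ℤS.con (+ 8) ℤS.:* p)) refl (+ q) qᵈ P²) (cong (ℤ._* (+ 8 ℤ.* P²)) (sym cast))

      -- At least half of the triples have a sum of nonzero norm, which costs a factor 4 after
      -- squaring.
      P²-≤4DM₂ : P² ℤ.≤ + 4 ℤ.* (D ℤ.* M₂)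
      P²-≤4DM₂ = ℤP.≤-trans half-≤ (ℤP.*-monoˡ-≤-nonNeg (+ 4) [∑m]²-≤)
        where
        g = + P ℤ.- + 2 ℤ.* m 0#
        0≤g : + 0 ℤ.≤ g
        0≤g = ℤP.i≤j⇒0≤j-i (2m₀≤P 3≤q big)
        -- With g = P − 2m(0) ≥ 0 one has 4 (P − m(0))² − P² = g² + 2Pg.
        half-≤ : P² ℤ.≤ + 4 ℤ.* ((+ P ℤ.- m 0#) ℤ.* (+ P ℤ.- m 0#))
        half-≤ = ℤ≤ (≡.subst (+ 0 ℤ.≤_) (ℤS.solve 2 (λ P y → (P ℤS.:- ℤS.con (+ 2) ℤS.:* y) ℤS.:* (P ℤS.:- ℤS.con (+ 2) ℤS.:* y) ℤS.:+ ℤS.con (+ 2) ℤS.:* (P ℤS.:* (P ℤS.:- ℤS.con (+ 2) ℤS.:* y))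
                   ℤS.:= ℤS.con (+ 4) ℤS.:* ((P ℤS.:- y) ℤS.:* (P ℤS.:- y)) ℤS.:- P ℤS.:* P) refl (+ P) (m 0#))
          (ℤO.NN-+ {g ℤ.* g} {+ 2 ℤ.* (+ P ℤ.* g)} (ℤO.NN-sq g) (ℤO.NN-* {+ 2} {+ P ℤ.* g} (+≤+ ℕ.z≤n) (ℤO.NN-* {+ P} {g} (+≤+ ℕ.z≤n) 0≤g))))

      P²>0 : ℤ.Positive P²
      P²>0 = ≡.subst ℤ.Positive (ℤP.pos-* P P) (ℤ.positive (ℤ.+<+ (ℕP.n≢0⇒n>0 (ℕ.≢-nonZero⁻¹ _ {{ℕP.m*n≢0 P P {{P>0}} {{P>0}}}}))))

      0≤z : + 0 ℤ.≤ z
      0≤z = ℤO.NN-∑ units (λ t → 0≤⟦⟧ (isZero t))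

      0≤D : + 0 ℤ.≤ D
      0≤D = ℤO.NN-∑ units (λ t → 0≤⟦⟧ (not (isZero t)))

      -- The unknown second moment cancels between the two bounds: z P² ≤ 4 D (z M₂) ≤ 32 D P².
      z-≤32D : z ℤ.≤ + 32 ℤ.* D
      z-≤32D = ℤP.*-cancelˡ-≤-pos z (+ 32 ℤ.* D) P² {{P²>0}} (ℤP.≤-trans (ℤP.≤-trans (ℤP.≤-reflexive (ℤP.*-comm P² z)) (mono z 0≤z P²-≤4DM₂))
          (ℤP.≤-trans (ℤP.≤-reflexive (ℤS.solve 3 (λ z D M → z ℤS.:* (ℤS.con (+ 4) ℤS.:* (D ℤS.:* M)) ℤS.:= ℤS.con (+ 4) ℤS.:* (D ℤS.:* (z ℤS.:* M))) refl z D M₂))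
          (ℤP.≤-trans (ℤP.*-monoˡ-≤-nonNeg (+ 4) (mono D 0≤D zM₂-≤8P²)) (ℤP.≤-reflexive (ℤS.solve 2 (λ D p → ℤS.con (+ 4) ℤS.:* (D ℤS.:* (ℤS.con (+ 8) ℤS.:* p)) ℤS.:= p ℤS.:* (ℤS.con (+ 32) ℤS.:* D)) refl D P²)))))
        where
        mono : ∀ c → + 0 ℤ.≤ c → ∀ {x y} → x ℤ.≤ y → c ℤ.* x ℤ.≤ c ℤ.* y
        mono c h {x} {y} h' = ℤ≤ (ℤO.*-monoˡ {c} {x} {y} h (≤ℤ h'))

      1≤D : + 1 ℤ.≤ D
      1≤D = aux D 0≤D refl
        where
        aux : ∀ D' → + 0 ℤ.≤ D' → D ≡ D' → + 1 ℤ.≤ D'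
        aux (+ suc j) _ _ = +≤+ (ℕ.s≤s ℕ.z≤n)
        aux (+ zero) _ e = ⊥-elim (ℤP.<-irrefl refl (ℤP.<-≤-trans (ℤP.positive⁻¹ P² {{P²>0}}) (ℤP.≤-trans P²-≤4DM₂ (ℤP.≤-reflexive (trans (cong (λ u → + 4 ℤ.* (u ℤ.* M₂)) e) (cong (+ 4 ℤ.*_) (ℤP.*-zeroˡ M₂)))))))

      -- The nonzero t number z + D, so q = z + D + 1 ≤ 33 D + 1, and D ≥ 1.
      q-≤34D : + q ℤ.≤ + 34 ℤ.* D
      q-≤34D = ℤ≤ (≡.subst (+ 0 ℤ.≤_) (trans (ℤS.solve 2 (λ z D → ℤS.con (+ 32) ℤS.:* D ℤS.:- z ℤS.:+ (D ℤS.:- ℤS.con (+ 1)) ℤS.:= ℤS.con (+ 34) ℤS.:* D ℤS.:- (z ℤS.:+ D ℤS.:+ ℤS.con (+ 1))) refl z D)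
          (cong (λ u → + 34 ℤ.* D ℤ.- u) (trans (cong (ℤ._+ + 1) z+D) (ℤS.solve 1 (λ q → q ℤS.:- ℤS.con (+ 1) ℤS.:+ ℤS.con (+ 1) ℤS.:= q) refl (+ q)))))
        (ℤO.NN-+ {+ 32 ℤ.* D ℤ.- z} {D ℤ.- + 1} (ℤP.i≤j⇒0≤j-i z-≤32D) (ℤP.i≤j⇒0≤j-i 1≤D)))

      module _ (p : Carrier → Bool) (values : All (λ s → p (‖ s ‖) ≡ true) T) where
        count-∑ : ∀ (r : Carrier → Bool) xs → + count r xs ≡ ∑ xs (λ t → ⟦ r t ⟧)
        count-∑ r [] = refl
        count-∑ r (x ∷ xs) with r x
        ... | true  = cong (ℤ._+_ (+ 1)) (count-∑ r xs)
        ... | false = trans (count-∑ r xs) (sym (ℤP.+-identityˡ (∑ xs (λ t → ⟦ r t ⟧))))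

        m≡0 : ∀ t → p (- t) ≡ false → m t ≡ + 0
        m≡0 t e = go T values
          where
          go : ∀ xs → All (λ s → p (‖ s ‖) ≡ true) xs → ∑ xs (λ s → ⟦ does ((‖ s ‖ + t) ≟ 0#) ⟧) ≡ + 0
          go []       []       = refl
          go (s ∷ xs) (h ∷ hs) = cong₂ ℤ._+_ (cong ⟦_⟧ (dec-false ((‖ s ‖ + t) ≟ 0#) (λ z → contra (trans (sym h) (trans (cong p (norm≡ z)) e))))) (go xs hs)
            where
            contra : true ≢ false
            contra ()
            norm≡ : ‖ s ‖ + t ≡ 0# → ‖ s ‖ ≡ - t
            norm≡ z = trans (solve 2 (λ n t → n := n :+ t :- t) refl (‖ s ‖) t) (trans (cong (_- t) z) (+-identityˡ (- t)))

        D-≤-count : D ℤ.≤ + count p elements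
        D-≤-count = ℤP.≤-trans (ℤP.≤-trans (∑-monoℤ units bound) (ℤ≤ (ℤO.∑-filter-≤ nz elements (λ t → 0≤⟦⟧ (p (- t))))))
          (ℤP.≤-reflexive (trans (Rℤ.reindex -_ -_ neg-neg neg-neg (λ t → ⟦ p t ⟧)) (sym (count-∑ p elements))))
          where
          neg-neg : ∀ x → - (- x) ≡ x
          neg-neg x = solve 1 (λ x → :- (:- x) := x) refl x
          bound : ∀ t → ⟦ not (isZero t) ⟧ ℤ.≤ ⟦ p (- t) ⟧
          bound t with p (- t) in eq
          ... | true  = ≤1 (not (isZero t))
            where
            ≤1 : ∀ c → ⟦ c ⟧ ℤ.≤ + 1
            ≤1 true  = ℤP.≤-refl
            ≤1 false = +≤+ ℕ.z≤n
          ... | false = ℤP.≤-reflexive (cong (λ c → ⟦ not c ⟧) (dec-true (m t ℤ.≟ + 0) (m≡0 t eq)))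

        q-≤-34count : q ℕ.≤ 34 ℕ.* count p elements
        q-≤-34count = ℤP.drop‿+≤+ (ℤP.≤-trans q-≤34D (ℤP.≤-trans (ℤP.*-monoˡ-≤-nonNeg (+ 34) D-≤-count) (ℤP.≤-reflexive (sym (ℤP.pos-* 34 (count p elements))))))

  -- From lists of distinct vectors to the size hypotheses.

  module Thresholds (n k : ℕ) where

    private
      d den : ℕ
      d = n ℕ.* 2
      den = 14 ℕ.+ k
      ∣_∣ᴸ : List (Vect d) → ℕ
      ∣_∣ᴸ = L.length

    3≤q : 3 ℕ.≤ q
    3≤q = aux (to 0#) (to 1#) (to (1# + 1#)) (λ e → 0≢1 (injective e)) (λ e → 2≢0 (sym (injective e)))
              (λ e → 0≢1 (sym (trans (solve 1 (λ x → x := x :+ x :- x) refl 1#) (trans (cong (_- 1#) (sym (injective e))) (-‿inverseʳ 1#)))))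
      where
      open Inverse enum using (to; from; strictlyInverseʳ)
      injective : ∀ {x y} → to x ≡ to y → x ≡ y
      injective {x} {y} e = trans (sym (strictlyInverseʳ x)) (trans (cong from e) (strictlyInverseʳ y))
      aux : ∀ {m} (i j l : Fin.Fin m) → i ≢ j → i ≢ l → j ≢ l → 3 ℕ.≤ m
      aux {1} Fin.zero Fin.zero _ a _ _ = ⊥-elim (a refl)
      aux {2} Fin.zero Fin.zero _ a _ _ = ⊥-elim (a refl)
      aux {2} Fin.zero (Fin.suc Fin.zero) Fin.zero _ b _ = ⊥-elim (b refl)
      aux {2} Fin.zero (Fin.suc Fin.zero) (Fin.suc Fin.zero) _ _ c = ⊥-elim (c refl)
      aux {2} (Fin.suc Fin.zero) Fin.zero Fin.zero _ _ c = ⊥-elim (c refl)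
      aux {2} (Fin.suc Fin.zero) Fin.zero (Fin.suc Fin.zero) _ b _ = ⊥-elim (b refl)
      aux {2} (Fin.suc Fin.zero) (Fin.suc Fin.zero) _ a _ _ = ⊥-elim (a refl)
      aux {suc (suc (suc m))} _ _ _ _ _ _ = ℕ.s≤s (ℕ.s≤s (ℕ.s≤s ℕ.z≤n))

    q≢0 : ℕ.NonZero q
    q≢0 = ℕ.>-nonZero (ℕP.≤-trans (ℕ.s≤s ℕ.z≤n) 3≤q)

    Covers : (L₁ L₂ L₃ : List (Vect d)) → (Carrier → Bool) → Set
    Covers L₁ L₂ L₃ p = ∀ {x y z} → x ∈ L₁ → y ∈ L₂ → z ∈ L₃ → p (‖ x +ᵛ (y +ᵛ z) ‖) ≡ true

    Size : (L₁ L₂ L₃ : List (Vect d)) → Set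
    Size L₁ L₂ L₃ = SizeHyp 3 d den C₃ q (∣ L₁ ∣ᴸ ℕ.* (∣ L₂ ∣ᴸ ℕ.* ∣ L₃ ∣ᴸ))

    -- The two smaller sets feed the mixed moment, the smallest one through |Ê₁|⁴ and the next as
    -- the weight v. The largest enters that argument through Plancherel.
    three-sorted : ∀ L₁ L₂ L₃ → NoDup F L₁ → NoDup F L₂ → NoDup F L₃ → ∣ L₁ ∣ᴸ ℕ.≤ ∣ L₂ ∣ᴸ → ∣ L₂ ∣ᴸ ℕ.≤ ∣ L₃ ∣ᴸ →
      Size L₁ L₂ L₃ → ∀ p → Covers L₁ L₂ L₃ p → q ℕ.≤ 34 ℕ.* count p elements
    three-sorted L₁ L₂ L₃ nodup₁ nodup₂ nodup₃ le₁₂ le₂₃ size p covers =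
      Con.q-≤-34count (ℕ.pred W) (trans (cong (ℕ._* N₃) W≡) square)
        (≡.subst (λ w → q ℕ.* q ℕ.* q ℕ.* A.momentBound n N₁ N₂ ℕ.≤ w ℕ.* w ℕ.* (w ℕ.* w)) (sym W≡) (Exponents.moment-size {n} {k} le₁₂ le₂₃ size))
        3≤q (Exponents.size-c {n} {k} le₁₂ le₂₃ size) P≢0 p
        (all-concatMap _ L₁ (λ x∈ → all-concatMap _ L₂ (λ y∈ → AllP.map⁺ (All.tabulate (λ z∈ → covers x∈ y∈ z∈)))))
      where
      instance
        _ = q≢0
      module Con = SumDistribution n L₁ L₂ L₃ nodup₁ nodup₂ nodup₃
      N₁ = L.length L₁
      N₂ = L.length L₂
      N₃ = L.length L₃
      W = N₁ ℕ.* N₁ ℕ.* (N₂ ℕ.* N₂) ℕ.* N₃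
      P≢0 : ℕ.NonZero (N₁ ℕ.* (N₂ ℕ.* N₃))
      P≢0 = Exponents.size⇒≢0 {3} {d} {den} {C₃} {q} {{C₃≢0}} size
      square : W ℕ.* N₃ ≡ N₁ ℕ.* (N₂ ℕ.* N₃) ℕ.* (N₁ ℕ.* (N₂ ℕ.* N₃))
      square = solveℕ 3 (λ a b c → a ⊠ a ⊠ (b ⊠ b) ⊠ c ⊠ c ≐ a ⊠ (b ⊠ c) ⊠ (a ⊠ (b ⊠ c))) refl N₁ N₂ N₃
        where open +-*-Solver renaming (solve to solveℕ; _:*_ to _⊠_; _:=_ to _≐_)
      W≢0 : ℕ.NonZero W
      W≢0 = ℕP.m*n≢0⇒m≢0 W {{≡.subst ℕ.NonZero (sym square) (ℕP.m*n≢0 _ _ {{P≢0}} {{P≢0}})}}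
      W≡ : suc (ℕ.pred W) ≡ W
      W≡ = ℕP.suc-pred W {{W≢0}}

    Large : (L₁ L₂ L₃ : List (Vect d)) → Set
    Large L₁ L₂ L₃ = NoDup F L₁ → NoDup F L₂ → NoDup F L₃ → Size L₁ L₂ L₃ → ∀ p → Covers L₁ L₂ L₃ p → q ℕ.≤ 34 ℕ.* count p elements

    +ᵛ-swap : ∀ (x y z : Vect d) → y +ᵛ (x +ᵛ z) ≡ x +ᵛ (y +ᵛ z)
    +ᵛ-swap x y z = trans (sym (+ᵛ-assoc y x z)) (trans (cong (_+ᵛ z) (+ᵛ-comm y x)) (+ᵛ-assoc x y z))

    *-swap : ∀ a b c → a ℕ.* (b ℕ.* c) ≡ b ℕ.* (a ℕ.* c)
    *-swap a b c = trans (sym (ℕP.*-assoc a b c)) (trans (cong (ℕ._* c) (ℕP.*-comm a b)) (ℕP.*-assoc b a c))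

    swap₁₂ : ∀ {L₁ L₂ L₃} → Large L₂ L₁ L₃ → Large L₁ L₂ L₃
    swap₁₂ {L₁} {L₂} {L₃} large n₁ n₂ n₃ size p cov = large n₂ n₁ n₃ (≡.subst (SizeHyp 3 d den C₃ q) (*-swap ∣ L₁ ∣ᴸ ∣ L₂ ∣ᴸ ∣ L₃ ∣ᴸ) size) p
      (λ {y} {x} {z} hy hx hz → trans (cong (λ s → p (‖ s ‖)) (+ᵛ-swap x y z)) (cov hx hy hz))

    swap₂₃ : ∀ {L₁ L₂ L₃} → Large L₁ L₃ L₂ → Large L₁ L₂ L₃
    swap₂₃ {L₁} {L₂} {L₃} large n₁ n₂ n₃ size p cov = large n₁ n₃ n₂ (≡.subst (SizeHyp 3 d den C₃ q) (cong (∣ L₁ ∣ᴸ ℕ.*_) (ℕP.*-comm ∣ L₂ ∣ᴸ ∣ L₃ ∣ᴸ)) size) p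
      (λ {x} {z} {y} hx hz hy → trans (cong (λ s → p (‖ x +ᵛ s ‖)) (+ᵛ-comm z y)) (cov hx hy hz))

    three : ∀ L₁ L₂ L₃ → Large L₁ L₂ L₃
    three L₁ L₂ L₃ with ℕP.≤-total ∣ L₁ ∣ᴸ ∣ L₂ ∣ᴸ | ℕP.≤-total ∣ L₂ ∣ᴸ ∣ L₃ ∣ᴸ | ℕP.≤-total ∣ L₁ ∣ᴸ ∣ L₃ ∣ᴸ
    ... | inj₁ a | inj₁ b | _      = λ n₁ n₂ n₃ → three-sorted L₁ L₂ L₃ n₁ n₂ n₃ a b
    ... | inj₁ a | inj₂ b | inj₁ c = swap₂₃ {L₁} {L₂} {L₃} (λ n₁ n₃ n₂ → three-sorted L₁ L₃ L₂ n₁ n₃ n₂ c b)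
    ... | inj₁ a | inj₂ b | inj₂ c = swap₂₃ {L₁} {L₂} {L₃} (swap₁₂ {L₁} {L₃} {L₂} (λ n₃ n₁ n₂ → three-sorted L₃ L₁ L₂ n₃ n₁ n₂ c a))
    ... | inj₂ a | inj₁ b | inj₁ c = swap₁₂ {L₁} {L₂} {L₃} (λ n₂ n₁ n₃ → three-sorted L₂ L₁ L₃ n₂ n₁ n₃ a c)
    ... | inj₂ a | inj₁ b | inj₂ c = swap₁₂ {L₁} {L₂} {L₃} (swap₂₃ {L₂} {L₁} {L₃} (λ n₂ n₃ n₁ → three-sorted L₂ L₃ L₁ n₂ n₃ n₁ b c))
    ... | inj₂ a | inj₂ b | _      = swap₂₃ {L₁} {L₂} {L₃} (swap₁₂ {L₁} {L₃} {L₂} (swap₂₃ {L₃} {L₁} {L₂} (λ n₃ n₂ n₁ → three-sorted L₃ L₂ L₁ n₃ n₂ n₁ b a)))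

    NoDup-translate : ∀ (w : Vect d) L → NoDup F L → NoDup F (L.map (w +ᵛ_) L)
    NoDup-translate w L nodup y = ≡.subst (ℤ._≤ + 1) (sym (trans (ℤT.∑-map (w +ᵛ_) L (λ x → ℤT.⟦ does (x ≟ᵛ y) ⟧))
      (ℤT.∑-cong L (λ x → cong ℤT.⟦_⟧ (does-cong ((w +ᵛ x) ≟ᵛ y) (x ≟ᵛ (y -ᵛ w))
        (λ { refl → sym (trans (cong (_-ᵛ w) (+ᵛ-comm w x)) (+ᵛ-ᵛ x w)) }) (λ { refl → trans (+ᵛ-comm w (y -ᵛ w)) (-ᵛ+ᵛ y w) })))))) (nodup (y -ᵛ w))

    Size₄ : (L₁ L₂ L₃ L₄ : List (Vect d)) → Set
    Size₄ L₁ L₂ L₃ L₄ = SizeHyp 4 d den C₄ q (∣ L₁ ∣ᴸ ℕ.* (∣ L₂ ∣ᴸ ℕ.* (∣ L₃ ∣ᴸ ℕ.* ∣ L₄ ∣ᴸ)))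

    Covers₄ : (L₁ L₂ L₃ L₄ : List (Vect d)) → (Carrier → Bool) → Set
    Covers₄ L₁ L₂ L₃ L₄ p = ∀ {x y z w} → x ∈ L₁ → y ∈ L₂ → z ∈ L₃ → w ∈ L₄ → p (‖ x +ᵛ (y +ᵛ (z +ᵛ w)) ‖) ≡ true

    Large₄ : (L₁ L₂ L₃ L₄ : List (Vect d)) → Set
    Large₄ L₁ L₂ L₃ L₄ = NoDup F L₁ → NoDup F L₂ → NoDup F L₃ → NoDup F L₄ → Size₄ L₁ L₂ L₃ L₄ → ∀ p → Covers₄ L₁ L₂ L₃ L₄ p → q ℕ.≤ 34 ℕ.* count p elements

    -- One element w of the smallest set is fixed and absorbed into the first set by translation, so
    -- the sums of three sets are among the sums of four. By `drop-one` the size hypothesis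
    -- survives.
    four-last-smallest : ∀ L₁ L₂ L₃ L₄ → ∣ L₄ ∣ᴸ ℕ.≤ ∣ L₁ ∣ᴸ → ∣ L₄ ∣ᴸ ℕ.≤ ∣ L₂ ∣ᴸ → ∣ L₄ ∣ᴸ ℕ.≤ ∣ L₃ ∣ᴸ → Large₄ L₁ L₂ L₃ L₄
    -- An empty set makes the product 0, against the size hypothesis.
    four-last-smallest L₁ L₂ L₃ [] _ _ _ _ _ _ _ size = ⊥-elim (ℕ.≢-nonZero⁻¹ _ {{Exponents.size⇒≢0 {4} {d} {den} {C₄} {q} {{C₄≢0}} {{q≢0}} size}}
      (trans (cong (∣ L₁ ∣ᴸ ℕ.*_) (trans (cong (∣ L₂ ∣ᴸ ℕ.*_) (ℕP.*-zeroʳ ∣ L₃ ∣ᴸ)) (ℕP.*-zeroʳ ∣ L₂ ∣ᴸ))) (ℕP.*-zeroʳ ∣ L₁ ∣ᴸ)))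
    four-last-smallest L₁ L₂ L₃ (w ∷ L₄) le₁ le₂ le₃ n₁ n₂ n₃ n₄ size p cov =
      three (L.map (w +ᵛ_) L₁) L₂ L₃ (NoDup-translate w L₁ n₁) n₂ n₃
        (≡.subst (λ N₁ → SizeHyp 3 d den C₃ q (N₁ ℕ.* (∣ L₂ ∣ᴸ ℕ.* ∣ L₃ ∣ᴸ))) (sym (LP.length-map (w +ᵛ_) L₁))
          (Exponents.drop-one {q} {den} {suc d ℕ.* den ℕ.∸ 2} {∣ L₁ ∣ᴸ ℕ.* (∣ L₂ ∣ᴸ ℕ.* ∣ L₃ ∣ᴸ)} {_} {∣ w ∷ L₄ ∣ᴸ} cube
            (solveℕ 4 (λ a b c e → a ⊠ (b ⊠ (c ⊠ e)) ≐ e ⊠ (a ⊠ (b ⊠ c))) refl ∣ L₁ ∣ᴸ ∣ L₂ ∣ᴸ ∣ L₃ ∣ᴸ ∣ w ∷ L₄ ∣ᴸ) size))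
        p covers
      where
      open +-*-Solver renaming (solve to solveℕ; _:*_ to _⊠_; _:=_ to _≐_)
      cube : ∣ w ∷ L₄ ∣ᴸ ℕ.^ 3 ℕ.≤ ∣ L₁ ∣ᴸ ℕ.* (∣ L₂ ∣ᴸ ℕ.* ∣ L₃ ∣ᴸ)
      cube = ℕP.*-mono-≤ le₁ (ℕP.*-mono-≤ le₂ (ℕP.≤-trans (ℕP.≤-reflexive (ℕP.*-identityʳ ∣ w ∷ L₄ ∣ᴸ)) le₃))
      covers : Covers (L.map (w +ᵛ_) L₁) L₂ L₃ p
      covers {y = y} {z} hx hy hz with ∈-map⁻ (w +ᵛ_) hx
      ... | x , x∈ , refl = trans (cong (λ s → p (‖ s ‖)) (trans (+ᵛ-assoc w x (y +ᵛ z)) (trans (+ᵛ-comm w (x +ᵛ (y +ᵛ z))) (trans (+ᵛ-assoc x (y +ᵛ z) w) (cong (x +ᵛ_) (+ᵛ-assoc y z w))))))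
                                  (cov x∈ hy hz (here refl))

    swap₁₂′ : ∀ {L₁ L₂ L₃ L₄} → Large₄ L₂ L₁ L₃ L₄ → Large₄ L₁ L₂ L₃ L₄
    swap₁₂′ {L₁} {L₂} {L₃} {L₄} large n₁ n₂ n₃ n₄ size p cov = large n₂ n₁ n₃ n₄ (≡.subst (SizeHyp 4 d den C₄ q) (*-swap ∣ L₁ ∣ᴸ ∣ L₂ ∣ᴸ (∣ L₃ ∣ᴸ ℕ.* ∣ L₄ ∣ᴸ)) size) p
      (λ {y} {x} {z} {w} hy hx hz hw → trans (cong (λ s → p (‖ s ‖)) (+ᵛ-swap x y (z +ᵛ w))) (cov hx hy hz hw))

    swap₂₃′ : ∀ {L₁ L₂ L₃ L₄} → Large₄ L₁ L₃ L₂ L₄ → Large₄ L₁ L₂ L₃ L₄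
    swap₂₃′ {L₁} {L₂} {L₃} {L₄} large n₁ n₂ n₃ n₄ size p cov = large n₁ n₃ n₂ n₄ (≡.subst (SizeHyp 4 d den C₄ q) (cong (∣ L₁ ∣ᴸ ℕ.*_) (*-swap ∣ L₂ ∣ᴸ ∣ L₃ ∣ᴸ ∣ L₄ ∣ᴸ)) size) p
      (λ {x} {z} {y} {w} hx hz hy hw → trans (cong (λ s → p (‖ x +ᵛ s ‖)) (+ᵛ-swap y z w)) (cov hx hy hz hw))

    swap₃₄′ : ∀ {L₁ L₂ L₃ L₄} → Large₄ L₁ L₂ L₄ L₃ → Large₄ L₁ L₂ L₃ L₄
    swap₃₄′ {L₁} {L₂} {L₃} {L₄} large n₁ n₂ n₃ n₄ size p cov = large n₁ n₂ n₄ n₃ (≡.subst (SizeHyp 4 d den C₄ q) (cong (λ m → ∣ L₁ ∣ᴸ ℕ.* (∣ L₂ ∣ᴸ ℕ.* m)) (ℕP.*-comm ∣ L₃ ∣ᴸ ∣ L₄ ∣ᴸ)) size) p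
      (λ {x} {y} {w} {z} hx hy hw hz → trans (cong (λ s → p (‖ x +ᵛ (y +ᵛ s) ‖)) (+ᵛ-comm w z)) (cov hx hy hz hw))

    four : ∀ L₁ L₂ L₃ L₄ → Large₄ L₁ L₂ L₃ L₄
    four L₁ L₂ L₃ L₄ with ℕP.≤-total ∣ L₁ ∣ᴸ ∣ L₂ ∣ᴸ | ℕP.≤-total ∣ L₃ ∣ᴸ ∣ L₄ ∣ᴸ
    ... | inj₁ a | inj₁ b with ℕP.≤-total ∣ L₁ ∣ᴸ ∣ L₃ ∣ᴸ
    ...   | inj₁ c = swap₁₂′ {L₁} {L₂} {L₃} {L₄} (swap₂₃′ {L₂} {L₁} {L₃} {L₄} (swap₃₄′ {L₂} {L₃} {L₁} {L₄} (four-last-smallest L₂ L₃ L₄ L₁ a c (ℕP.≤-trans c b))))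
    ...   | inj₂ c = swap₃₄′ {L₁} {L₂} {L₃} {L₄} (four-last-smallest L₁ L₂ L₄ L₃ c (ℕP.≤-trans c a) b)
    four L₁ L₂ L₃ L₄ | inj₁ a | inj₂ b with ℕP.≤-total ∣ L₁ ∣ᴸ ∣ L₄ ∣ᴸ
    ...   | inj₁ c = swap₁₂′ {L₁} {L₂} {L₃} {L₄} (swap₂₃′ {L₂} {L₁} {L₃} {L₄} (swap₃₄′ {L₂} {L₃} {L₁} {L₄} (four-last-smallest L₂ L₃ L₄ L₁ a (ℕP.≤-trans c b) c)))
    ...   | inj₂ c = four-last-smallest L₁ L₂ L₃ L₄ c (ℕP.≤-trans c a) b
    four L₁ L₂ L₃ L₄ | inj₂ a | inj₁ b with ℕP.≤-total ∣ L₂ ∣ᴸ ∣ L₃ ∣ᴸ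
    ...   | inj₁ c = swap₂₃′ {L₁} {L₂} {L₃} {L₄} (swap₃₄′ {L₁} {L₃} {L₂} {L₄} (four-last-smallest L₁ L₃ L₄ L₂ a c (ℕP.≤-trans c b)))
    ...   | inj₂ c = swap₃₄′ {L₁} {L₂} {L₃} {L₄} (four-last-smallest L₁ L₂ L₄ L₃ (ℕP.≤-trans c a) c b)
    four L₁ L₂ L₃ L₄ | inj₂ a | inj₂ b with ℕP.≤-total ∣ L₂ ∣ᴸ ∣ L₄ ∣ᴸ
    ...   | inj₁ c = swap₂₃′ {L₁} {L₂} {L₃} {L₄} (swap₃₄′ {L₁} {L₃} {L₂} {L₄} (four-last-smallest L₁ L₃ L₄ L₂ a (ℕP.≤-trans c b) c))
    ...   | inj₂ c = four-last-smallest L₁ L₂ L₃ L₄ (ℕP.≤-trans c a) c b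

    NoDup-members : ∀ (E : Subset d) → NoDup F (members E)
    NoDup-members E y = ≡.subst (ℤ._≤ + 1) (sym (trans (ℤT.∑-filter E (allVecs d) (λ x → ℤT.⟦ does (x ≟ᵛ y) ⟧))
      (trans (ℤT.∑-cong (allVecs d) (λ x → ℤP.*-comm ℤT.⟦ E x ⟧ ℤT.⟦ does (x ≟ᵛ y) ⟧)) (RV.select d ℤP.+-*-commutativeRing (λ x → ℤT.⟦ E x ⟧) y)))) (≤1 (E y))
      where
      ≤1 : ∀ b → ℤT.⟦ b ⟧ ℤ.≤ + 1
      ≤1 true  = ℤP.≤-refl
      ≤1 false = +≤+ ℕ.z≤n

    length-filter : ∀ {A : Set} (p : A → Bool) xs → L.length (filterᵇ p xs) ≡ count p xs
    length-filter p []       = refl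
    length-filter p (x ∷ xs) with p x
    ... | true  = cong suc (length-filter p xs)
    ... | false = length-filter p xs

    length-members : ∀ (E : Subset d) → L.length (members E) ≡ ∣ E ∣
    length-members E = length-filter E (allVecs d)

    -- `sums` ends with the zero vector, so the innermost term has the form z + 0.
    +ᵛ-0 : ∀ {m} (x : Vect m) → x +ᵛ 0ᵛ ≡ x
    +ᵛ-0 []      = refl
    +ᵛ-0 (a ∷ x) = cong₂ _∷_ (+-identityʳ a) (+ᵛ-0 x)

    ∈-sums : ∀ {m} {E : Subset d} {Es : Vec (Subset d) m} {x s} → x ∈ members E → s ∈ sums Es → x +ᵛ s ∈ sums (E ∷ Es)
    ∈-sums {Es = Es} {x = x} hx hs = ∈-concatMap (λ x → L.map (x +ᵛ_) (sums Es)) hx (∈-map⁺ (x +ᵛ_) hs)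

    inΔ-sums : ∀ {m} (Es : Vec (Subset d) m) {s} → s ∈ sums Es → inΔ Es (‖ s ‖) ≡ true
    inΔ-sums Es {s} hs = any-∈ (λ s' → does (‖ s' ‖ ≟ ‖ s ‖)) hs (dec-true (‖ s ‖ ≟ ‖ s ‖) refl)

    Δ₃-large : ∀ (E₁ E₂ E₃ : Subset d) → SizeHyp 3 d den C₃ q (∏∣ E₁ ∷ E₂ ∷ E₃ ∷ [] ∣) → q ℕ.≤ 34 ℕ.* ∣Δ∣ (E₁ ∷ E₂ ∷ E₃ ∷ [])
    Δ₃-large E₁ E₂ E₃ size = three (members E₁) (members E₂) (members E₃) (NoDup-members E₁) (NoDup-members E₂) (NoDup-members E₃)
      (≡.subst (SizeHyp 3 d den C₃ q) (cong₂ ℕ._*_ (sym (length-members E₁)) (cong₂ ℕ._*_ (sym (length-members E₂)) (trans (ℕP.*-identityʳ (∣ E₃ ∣)) (sym (length-members E₃))))) size)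
      (inΔ (E₁ ∷ E₂ ∷ E₃ ∷ []))
      (λ {x} {y} {z} hx hy hz → ≡.subst (λ s → inΔ (E₁ ∷ E₂ ∷ E₃ ∷ []) (‖ x +ᵛ (y +ᵛ s) ‖) ≡ true) (+ᵛ-0 z)
        (inΔ-sums (E₁ ∷ E₂ ∷ E₃ ∷ []) (∈-sums {E = E₁} {E₂ ∷ E₃ ∷ []} hx (∈-sums {E = E₂} {E₃ ∷ []} hy (∈-sums {E = E₃} {[]} hz (here refl))))))

    Δ₄-large : ∀ (E₁ E₂ E₃ E₄ : Subset d) → SizeHyp 4 d den C₄ q (∏∣ E₁ ∷ E₂ ∷ E₃ ∷ E₄ ∷ [] ∣) → q ℕ.≤ 34 ℕ.* ∣Δ∣ (E₁ ∷ E₂ ∷ E₃ ∷ E₄ ∷ [])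
    Δ₄-large E₁ E₂ E₃ E₄ size = four (members E₁) (members E₂) (members E₃) (members E₄) (NoDup-members E₁) (NoDup-members E₂) (NoDup-members E₃) (NoDup-members E₄)
      (≡.subst (SizeHyp 4 d den C₄ q) (cong₂ ℕ._*_ (sym (length-members E₁)) (cong₂ ℕ._*_ (sym (length-members E₂)) (cong₂ ℕ._*_ (sym (length-members E₃)) (trans (ℕP.*-identityʳ (∣ E₄ ∣)) (sym (length-members E₄)))))) size)
      (inΔ (E₁ ∷ E₂ ∷ E₃ ∷ E₄ ∷ []))
      (λ {x} {y} {z} {w} hx hy hz hw → ≡.subst (λ s → inΔ (E₁ ∷ E₂ ∷ E₃ ∷ E₄ ∷ []) (‖ x +ᵛ (y +ᵛ (z +ᵛ s)) ‖) ≡ true) (+ᵛ-0 w)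
        (inΔ-sums (E₁ ∷ E₂ ∷ E₃ ∷ E₄ ∷ []) (∈-sums {E = E₁} {E₂ ∷ E₃ ∷ E₄ ∷ []} hx (∈-sums {E = E₂} {E₃ ∷ E₄ ∷ []} hy (∈-sums {E = E₃} {E₄ ∷ []} hz (∈-sums {E = E₄} {[]} hw (here refl)))))))

-- The three cases of the theorem, as denominators 14 + k.

open import Data.Nat using (_+_; _*_; _∸_; _≤_)
open FiniteField using (Subset; CharGt2; ∣Δ∣; ∏∣_∣)

-- The constants are the same for all dimensions and denominators. A denominator above 14 only
-- raises the required size.
Δ₃-bound : ∀ n k → ∃₂ λ (C m : ℕ) → 1 ≤ m ×
  ((q : ℕ) (F : FiniteField q) → CharGt2 F → (E₁ E₂ E₃ : Subset F (n * 2)) →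
   SizeHyp 3 (n * 2) (14 + k) C q (∏∣_∣ F (E₁ ∷ E₂ ∷ E₃ ∷ [])) → q ≤ m * ∣Δ∣ F (E₁ ∷ E₂ ∷ E₃ ∷ []))
Δ₃-bound n k = C₃ , 34 , ℕ.s≤s ℕ.z≤n , λ q F 2≢0 → Modulus.Thresholds.Δ₃-large F 2≢0 n k

Δ₄-bound : ∀ n k → ∃₂ λ (C m : ℕ) → 1 ≤ m ×
  ((q : ℕ) (F : FiniteField q) → CharGt2 F → (E₁ E₂ E₃ E₄ : Subset F (n * 2)) →
   SizeHyp 4 (n * 2) (14 + k) C q (∏∣_∣ F (E₁ ∷ E₂ ∷ E₃ ∷ E₄ ∷ [])) → q ≤ m * ∣Δ∣ F (E₁ ∷ E₂ ∷ E₃ ∷ E₄ ∷ []))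
Δ₄-bound n k = C₄ , 34 , ℕ.s≤s ℕ.z≤n , λ q F 2≢0 → Modulus.Thresholds.Δ₄-large F 2≢0 n k

theorem1p6 : ((d : ℕ) → (d ≡ 4 ⊎ d ≡ 6) →
    ∃₂ λ (C m : ℕ) → 1 ≤ m ×
    ((q : ℕ) (F : FiniteField q) → CharGt2 F →
    (E₁ E₂ E₃ : Subset F d) →
    SizeHyp 3 d (6 * d + 2) C q (∏∣_∣ F (E₁ ∷ E₂ ∷ E₃ ∷ [])) →
    q ≤ m * ∣Δ∣ F (E₁ ∷ E₂ ∷ E₃ ∷ [])))
    ×
    ((d : ℕ) → 8 ≤ d → 2 ∣ d →
    ∃₂ λ (C m : ℕ) → 1 ≤ m ×
    ((q : ℕ) (F : FiniteField q) → CharGt2 F →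
    (E₁ E₂ E₃ E₄ : Subset F d) →
    SizeHyp 4 d (6 * d + 2) C q (∏∣_∣ F (E₁ ∷ E₂ ∷ E₃ ∷ E₄ ∷ [])) →
    q ≤ m * ∣Δ∣ F (E₁ ∷ E₂ ∷ E₃ ∷ E₄ ∷ [])))
    ×
    ((d : ℕ) → 8 ≤ d → 2 ∣ d →
    ∃₂ λ (C m : ℕ) → 1 ≤ m ×
    ((q : ℕ) (F : FiniteField q) → CharGt2 F →
    (E₁ E₂ E₃ : Subset F d) →
    SizeHyp 3 d (9 * d ∸ 18) C q (∏∣_∣ F (E₁ ∷ E₂ ∷ E₃ ∷ [])) →
    q ≤ m * ∣Δ∣ F (E₁ ∷ E₂ ∷ E₃ ∷ [])))
theorem1p6 = low-dimension , four-sets , three-sets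
  where
  low-dimension : (d : ℕ) → (d ≡ 4 ⊎ d ≡ 6) → ∃₂ λ (C m : ℕ) → 1 ≤ m ×
    ((q : ℕ) (F : FiniteField q) → CharGt2 F → (E₁ E₂ E₃ : Subset F d) →
     SizeHyp 3 d (6 * d + 2) C q (∏∣_∣ F (E₁ ∷ E₂ ∷ E₃ ∷ [])) → q ≤ m * ∣Δ∣ F (E₁ ∷ E₂ ∷ E₃ ∷ []))
  -- 6·4 + 2 = 14 + 12 and 6·6 + 2 = 14 + 24.
  low-dimension d (inj₁ refl) = Δ₃-bound 2 12
  low-dimension d (inj₂ refl) = Δ₃-bound 3 24
  four-sets : (d : ℕ) → 8 ≤ d → 2 ∣ d → ∃₂ λ (C m : ℕ) → 1 ≤ m ×
    ((q : ℕ) (F : FiniteField q) → CharGt2 F → (E₁ E₂ E₃ E₄ : Subset F d) →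
     SizeHyp 4 d (6 * d + 2) C q (∏∣_∣ F (E₁ ∷ E₂ ∷ E₃ ∷ E₄ ∷ [])) → q ≤ m * ∣Δ∣ F (E₁ ∷ E₂ ∷ E₃ ∷ E₄ ∷ []))
  four-sets d 8≤d (divides n refl) = ≡.subst (λ den → ∃₂ λ (C m : ℕ) → 1 ≤ m ×
    ((q : ℕ) (F : FiniteField q) → CharGt2 F → (E₁ E₂ E₃ E₄ : Subset F d) →
     SizeHyp 4 d den C q (∏∣_∣ F (E₁ ∷ E₂ ∷ E₃ ∷ E₄ ∷ [])) → q ≤ m * ∣Δ∣ F (E₁ ∷ E₂ ∷ E₃ ∷ E₄ ∷ [])))
    -- At the least dimension, 6·8 + 2 = 14 + 36.
    (ℕP.m+[n∸m]≡n (ℕP.≤-trans (ℕP.m≤m+n 14 36) (ℕP.+-monoˡ-≤ 2 (ℕP.*-monoʳ-≤ 6 8≤d)))) (Δ₄-bound n (6 * d + 2 ∸ 14))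
  three-sets : (d : ℕ) → 8 ≤ d → 2 ∣ d → ∃₂ λ (C m : ℕ) → 1 ≤ m ×
    ((q : ℕ) (F : FiniteField q) → CharGt2 F → (E₁ E₂ E₃ : Subset F d) →
     SizeHyp 3 d (9 * d ∸ 18) C q (∏∣_∣ F (E₁ ∷ E₂ ∷ E₃ ∷ [])) → q ≤ m * ∣Δ∣ F (E₁ ∷ E₂ ∷ E₃ ∷ []))
  three-sets d 8≤d (divides n refl) = ≡.subst (λ den → ∃₂ λ (C m : ℕ) → 1 ≤ m ×
    ((q : ℕ) (F : FiniteField q) → CharGt2 F → (E₁ E₂ E₃ : Subset F d) →
     SizeHyp 3 d den C q (∏∣_∣ F (E₁ ∷ E₂ ∷ E₃ ∷ [])) → q ≤ m * ∣Δ∣ F (E₁ ∷ E₂ ∷ E₃ ∷ [])))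
    -- At the least dimension, 9·8 - 18 = 14 + 40.
    (ℕP.m+[n∸m]≡n (ℕP.≤-trans (ℕP.m≤m+n 14 40) (ℕP.∸-monoˡ-≤ 18 (ℕP.*-monoʳ-≤ 9 8≤d)))) (Δ₃-bound n (9 * d ∸ 18 ∸ 14))
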